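{- Let $\Bbbk$ be a field, $0\ne v\in\Bbbk$, and $\delta=\pm(v+v^{ -1})$. Let $V=V(1)$ and let $\mathbf{U}=\mathbf{U}(\mathfrak{gl}_2)$ or $\mathbf{U}(\mathfrak{sl}_2)$ (Lusztig divided power forms, specialized at $v$). Then the commuting actions of $\mathbf{U}$ and $\mathrm{TL}_n(\delta)$ on $V^{\otimes n}$ satisfy Schur--Weyl duality; that is, each of the induced algebra maps $$\mathbf{U}\to\operatorname{End}_{\mathrm{TL}_n(\delta)}(V^{\otimes n}),\qquad \mathrm{TL}_n(\delta)\to\operatorname{End}_{\mathbf{U}}(V^{\otimes n})$$ is surjective. Moreover, the latter map is an isomorphism.
   Context: $\mathrm{TL}_n(\delta)$ is the unital $\Bbbk$-algebra with generators $e_1,\dots,e_{n-1}$ and relations $e_i^2=\delta e_i$; $e_ie_je_i=e_i$ if $|i-j|=1$; $e_ie_j=e_je_i$ if $|i-j|>1$. **Quantum algebras.** Let $t$ be an indeterminate, $\mathcal{A}=\mathbb{Z}[t,t^{ -1}]$, $[j]_t=\sum_{k=0}^{j-1}t^{ -(j-1)+2k}$, $[j]_t^!=[1]_t\cdots[j]_t$, $[0]^!_t=1$. $\mathbf{U}_{\mathbb{Q}(t)}(\mathfrak{gl}_2)$ is the $\mathbb{Q}(t)$-algebra generated by $E,F,K_1^{\pm1},K_2^{\pm1}$ with relations $K_1K_2=K_2K_1$, $K_iK_i^{ -1}=1=K_i^{ -1}K_i$, $K_1EK_1^{ -1}=tE$, $K_2EK_2^{ -1}=t^{ -1}E$, $K_1FK_1^{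 -1}=t^{ -1}F$, $K_2FK_2^{ -1}=tF$, $EF-FE=\frac{K-K^{ -1}}{t-t^{ -1}}$ where $K=K_1K_2^{ -1}$. It is a Hopf algebra with coproduct $\Delta(E)=E\otimes1+K\otimes E$, $\Delta(F)=F\otimes K^{ -1}+1\otimes F$, $\Delta(K_i)=K_i\otimes K_i$. $\mathbf{U}_{\mathbb{Q}(t)}(\mathfrak{sl}_2)$ is the subalgebra generated by $E,F,K^{\pm1}$. Let $\mathbf{U}_{\mathcal{A}}(\mathfrak{gl}_2)$ (resp. $\mathbf{U}_{\mathcal{A}}(\mathfrak{sl}_2)$) be the $\mathcal{A}$-subalgebra generated by the divided powers $E^{(j)}=E^j/[j]_t^!$, $F^{(j)}=F^j/[j]_t^!$ ($j\ge0$) and $K_1^{\pm1},K_2^{\pm1}$ (resp. $K^{\pm1}$). Regard $\Bbbk$ as an $\mathcal{A}$-algebra via $t^{\pm1}\mapsto v^{\pm1}$, and set $\mathbf{U}(\mathfrak{gl}_2)=\mathbf{U}_{\mathcal{A}}(\mathfrak{gl}_2)\otimes_{\mathcal{A}}\Bbbk$, $\mathbf{U}(\mathfrak{sl}_2)=\mathbf{U}_{\mathcal{A}}(\mathfrak{sl}_2)\otimes_{\mathcal{A}}\Bbbk$; these inherit Hopf algebra structures. **The module $V$.** $V=V(1)$ is the $2$-dimensional vector module, with $\Bbbk$-basis $x_0,x_1$, obtained by specializing the $\mathcal{A}$-lattice spanned by $x_0,x_1$: $Fx_0=x_1$, $Fx_1=0$, $Ex_1=x_0$, $Ex_0=0$,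 $E^{(j)}$ and $F^{(j)}$ act as $0$ for $j\ge2$, $K_1x_0=vx_0$, $K_1x_1=x_1$, $K_2x_0=x_0$, $K_2x_1=vx_1$ (so $Kx_0=vx_0$, $Kx_1=v^{ -1}x_1$). $\mathbf{U}$ acts on $V^{\otimes n}$ via the iterated coproduct. **Temperley--Lieb action.** Write $x_{i,j}=x_i\otimes x_j$ and let $\xi:V\otimes V\to V\otimes V$ be the linear map $x_{0,0}\mapsto0$, $x_{0,1}\mapsto v^{ -1}x_{0,1}-x_{1,0}$, $x_{1,0}\mapsto-x_{0,1}+vx_{1,0}$, $x_{1,1}\mapsto0$. If $\delta=\pm(v+v^{ -1})$, then $e_i$ acts on $V^{\otimes n}$ as $1^{\otimes(i-1)}\otimes(\pm\xi)\otimes1^{\otimes(n-i-1)}$ (same choice of sign), with $\pm\xi$ in tensor positions $i,i+1$. This defines an action of $\mathrm{TL}_n(\delta)$ that commutes with the action of $\mathbf{U}$. -}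

module Defs where

open import Level using (Level; _⊔_; 0ℓ) renaming (suc to lsuc)
open import Algebra.Bundles
open import Algebra.Module.Bundles using (LeftModule)
open import Algebra.Module.Morphism.Structures using (module LeftModuleMorphisms)
open import Algebra.Morphism.Structures using (module RingMorphisms)
import Algebra.Solver.Ring as RingSolver
open import Algebra.Solver.Ring.AlmostCommutativeRing using (fromCommutativeRing; _-Raw-AlmostCommutative⟶_)
open import Data.Empty using (⊥; ⊥-elim)
open import Data.Fin.Base using (Fin; zero; suc; toℕ)
open import Data.Fin.Patterns using (0F; 1F)
open import Data.Integer.Base as ℤ using (ℤ; +_; -[1+_]; _⊖_; 0ℤ; 1ℤ)
import Data.Integer.Properties as ℤ
open import Data.List.Base as List using (List; []; _∷_)
open import Data.Maybe.Base as Maybe using ()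
open import Data.Nat.Base as ℕ using (ℕ; zero; suc; _∸_; ∣_-_∣)
import Data.Nat.Properties as ℕ
open import Data.Product.Base using (Σ; _×_; _,_; proj₁; proj₂)
open import Data.Sign.Base as Sign using (Sign)
open import Data.Sum.Base using (_⊎_; inj₁; inj₂; [_,_]′)
open import Data.Vec.Base using (Vec; []; _∷_)
open import Function.Definitions using (Surjective)
open import Relation.Binary.Core using (Rel)
open import Relation.Binary.Definitions using (WeaklyDecidable)
open import Relation.Binary.PropositionalEquality.Core as ≡ using (_≡_)
open import Relation.Nullary using (¬_; Dec; yes; no)
open import Relation.Nullary.Decidable using (dec⇒maybe)

module _ {a ℓa b ℓb} (R : Ring a ℓa) (S : Ring b ℓb) where
  private
    module R = Ring R
    module S = Ring S
  open RingMorphisms R.rawRing S.rawRing using (IsRingHomomorphism)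

  mkRingHom : (f : R.Carrier → S.Carrier) →
              (∀ {x y} → x R.≈ y → f x S.≈ f y) →
              (∀ x y → f (x R.+ y) S.≈ f x S.+ f y) →
              (∀ x y → f (x R.* y) S.≈ f x S.* f y) →
              f R.1# S.≈ S.1# → IsRingHomomorphism f
  mkRingHom f f-cong f-+ f-* f-1 = record
    { isSemiringHomomorphism = record
      { isNearSemiringHomomorphism = record
        { +-isMonoidHomomorphism = record
          { isMagmaHomomorphism = record
            { isRelHomomorphism = record { cong = f-cong }
            ; homo = f-+
            }
          ; ε-homo = f-0
          }
        ; *-homo = f-*
        }
      ; 1#-homo = f-1
      }
    ; -‿homo = f-neg
    }
    where
    open import Algebra.Properties.Ring S using (x+x≈x⇒x≈0)
    open import Algebra.Properties.Group S.+-group using (inverseˡ-unique)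
    f-0 : f R.0# S.≈ S.0#
    f-0 = x+x≈x⇒x≈0 _ (S.trans (S.sym (f-+ _ _)) (f-cong (R.+-identityˡ _)))
    f-neg : ∀ x → f (R.- x) S.≈ S.- f x
    f-neg x = inverseˡ-unique _ _
      (S.trans (S.sym (f-+ _ _)) (S.trans (f-cong (R.-‿inverseˡ x)) f-0))

module FromℤR {c ℓ} (R : CommutativeRing c ℓ) where
  open CommutativeRing R
  open import Algebra.Properties.Ring ring
  open import Algebra.Properties.Semiring.Mult.TCOptimised semiring
    renaming (_×_ to _·_) using (×-homo-+; ×1-homo-*)
  open import Relation.Binary.Reasoning.Setoid setoid

  fromℤ : ℤ → Carrier
  fromℤ (+ n)    = n · 1#
  fromℤ -[1+ n ] = - (suc n · 1#)

  private
    suc· : ∀ n → suc n · 1# ≈ 1# + n · 1#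
    suc· n = ×-homo-+ 1# 1 n

    cancel : ∀ x y → (1# + x) - (1# + y) ≈ x - y
    cancel x y = begin
      (1# + x) + - (1# + y)      ≈⟨ +-cong (+-comm x 1#) (-‿+-comm 1# y) ⟨
      (x + 1#) + (- 1# + - y)    ≈⟨ +-assoc x 1# _ ⟩
      x + (1# + (- 1# + - y))    ≈⟨ +-congˡ (+-assoc _ _ _) ⟨
      x + ((1# + - 1#) + - y)    ≈⟨ +-congˡ (+-congʳ (-‿inverseʳ 1#)) ⟩
      x + (0# + - y)             ≈⟨ +-congˡ (+-identityˡ _) ⟩
      x - y                      ∎

    fromℤ-⊖ : ∀ m n → fromℤ (m ⊖ n) ≈ m · 1# - n · 1#
    fromℤ-⊖ m zero = sym (trans (+-congˡ -0#≈0#) (+-identityʳ _))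
    fromℤ-⊖ zero (suc n) = sym (+-identityˡ _)
    fromℤ-⊖ (suc m) (suc n) = begin
      fromℤ (suc m ⊖ suc n)          ≡⟨ ≡.cong fromℤ (ℤ.[1+m]⊖[1+n]≡m⊖n m n) ⟩
      fromℤ (m ⊖ n)                  ≈⟨ fromℤ-⊖ m n ⟩
      m · 1# - n · 1#                ≈⟨ cancel _ _ ⟨
      (1# + m · 1#) - (1# + n · 1#)  ≈⟨ +-cong (suc· m) (-‿cong (suc· n)) ⟨
      suc m · 1# - suc n · 1#        ∎

  fromℤ-+ : ∀ i j → fromℤ (i ℤ.+ j) ≈ fromℤ i + fromℤ j
  fromℤ-+ (+ m)    (+ n)    = ×-homo-+ 1# m n
  fromℤ-+ (+ m)    -[1+ n ] = fromℤ-⊖ m (suc n)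
  fromℤ-+ -[1+ m ] (+ n)    = trans (fromℤ-⊖ n (suc m)) (+-comm _ _)
  fromℤ-+ -[1+ m ] -[1+ n ] = begin
    - (suc (suc (m ℕ.+ n)) · 1#)    ≡⟨ ≡.cong (λ k → - (k · 1#)) (ℕ.+-suc (suc m) n) ⟨
    - ((suc m ℕ.+ suc n) · 1#)      ≈⟨ -‿cong (×-homo-+ 1# (suc m) (suc n)) ⟩
    - (suc m · 1# + suc n · 1#)     ≈⟨ -‿+-comm _ _ ⟨
    - (suc m · 1#) - (suc n · 1#)   ∎

  fromℤ-neg : ∀ i → fromℤ (ℤ.- i) ≈ - fromℤ i
  fromℤ-neg (+ zero)  = sym -0#≈0#
  fromℤ-neg (+ suc n) = refl
  fromℤ-neg -[1+ n ]  = sym (-‿involutive _)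

  private
    fromℤ-*⁺ : ∀ m j → fromℤ (+ m ℤ.* j) ≈ fromℤ (+ m) * fromℤ j
    fromℤ-*⁺ m (+ n) = begin
      fromℤ (+ m ℤ.* + n)      ≡⟨ ≡.cong fromℤ (ℤ.pos-* m n) ⟨
      fromℤ (+ (m ℕ.* n))      ≈⟨ ×1-homo-* m n ⟩
      m · 1# * n · 1#          ∎
    fromℤ-*⁺ m -[1+ n ] = begin
      fromℤ (+ m ℤ.* -[1+ n ])         ≡⟨ ≡.cong fromℤ (ℤ.neg-distribʳ-* (+ m) (+ suc n)) ⟨
      fromℤ (ℤ.- (+ m ℤ.* + suc n))    ≈⟨ fromℤ-neg (+ m ℤ.* + suc n) ⟩
      - fromℤ (+ m ℤ.* + suc n)        ≈⟨ -‿cong (fromℤ-*⁺ m (+ suc n)) ⟩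
      - (m · 1# * suc n · 1#)          ≈⟨ -‿distribʳ-* _ _ ⟩
      m · 1# * - (suc n · 1#)          ∎

  fromℤ-* : ∀ i j → fromℤ (i ℤ.* j) ≈ fromℤ i * fromℤ j
  fromℤ-* (+ m)    j = fromℤ-*⁺ m j
  fromℤ-* -[1+ m ] j = begin
    fromℤ (-[1+ m ] ℤ.* j)           ≡⟨ ≡.cong fromℤ (ℤ.neg-distribˡ-* (+ suc m) j) ⟨
    fromℤ (ℤ.- (+ suc m ℤ.* j))      ≈⟨ fromℤ-neg (+ suc m ℤ.* j) ⟩
    - fromℤ (+ suc m ℤ.* j)          ≈⟨ -‿cong (fromℤ-*⁺ (suc m) j) ⟩
    - (suc m · 1# * fromℤ j)         ≈⟨ -‿distribˡ-* _ _ ⟩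
    - (suc m · 1#) * fromℤ j         ∎

  private
    morphism : ℤ.+-*-rawRing -Raw-AlmostCommutative⟶ fromCommutativeRing R
    morphism = record
      { ⟦_⟧ = fromℤ ; +-homo = fromℤ-+ ; *-homo = fromℤ-*
      ; -‿homo = fromℤ-neg ; 0-homo = refl ; 1-homo = refl }

    fromℤ-≟ : WeaklyDecidable (λ i j → fromℤ i ≈ fromℤ j)
    fromℤ-≟ i j = Maybe.map (λ i≡j → reflexive (≡.cong fromℤ i≡j)) (dec⇒maybe (i ℤ.≟ j))

  module Solver = RingSolver ℤ.+-*-rawRing (fromCommutativeRing R) morphism fromℤ-≟

record IsIntegralDomain {c ℓ} (R : CommutativeRing c ℓ) : Set (c ⊔ ℓ) where
  open CommutativeRing R
  field
    1≉0        : ¬ 1# ≈ 0#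
    zero-product : ∀ {x y} → x * y ≈ 0# → x ≈ 0# ⊎ y ≈ 0#

-- ℤ[t]: the list a₀ ∷ a₁ ∷ … stands for Σ aᵢtⁱ; lists that differ by trailing
-- zeros are identified.
module Polynomial where

  infix  4 _≈_
  infixl 6 _+_
  infixl 7 _*_ _·_
  infix  8 -_

  coeff : List ℤ → ℕ → ℤ
  coeff []      _       = 0ℤ
  coeff (a ∷ p) zero    = a
  coeff (a ∷ p) (suc i) = coeff p i

  record _≈_ (p q : List ℤ) : Set where
    constructor coeffwise
    field at : ∀ i → coeff p i ≡ coeff q i
  open _≈_

  _+_ : List ℤ → List ℤ → List ℤ
  []      + q       = q
  (a ∷ p) + []      = a ∷ p
  (a ∷ p) + (b ∷ q) = a ℤ.+ b ∷ p + q

  -_ : List ℤ → List ℤ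
  - p = List.map (λ a → ℤ.- a) p

  _·_ : ℤ → List ℤ → List ℤ
  a · p = List.map (a ℤ.*_) p

  _*_ : List ℤ → List ℤ → List ℤ
  []      * q = []
  (a ∷ p) * q = a · q + (0ℤ ∷ p * q)

  private
    coeff-+ : ∀ p q i → coeff (p + q) i ≡ coeff p i ℤ.+ coeff q i
    coeff-+ []      q       i       = ≡.sym (ℤ.+-identityˡ _)
    coeff-+ (a ∷ p) []      i       = ≡.sym (ℤ.+-identityʳ _)
    coeff-+ (a ∷ p) (b ∷ q) zero    = ≡.refl
    coeff-+ (a ∷ p) (b ∷ q) (suc i) = coeff-+ p q i

    coeff-- : ∀ p i → coeff (- p) i ≡ ℤ.- coeff p i
    coeff-- []      i       = ≡.refl
    coeff-- (a ∷ p) zero    = ≡.refl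
    coeff-- (a ∷ p) (suc i) = coeff-- p i

    coeff-· : ∀ a p i → coeff (a · p) i ≡ a ℤ.* coeff p i
    coeff-· a []      i       = ≡.sym (ℤ.*-zeroʳ a)
    coeff-· a (b ∷ p) zero    = ≡.refl
    coeff-· a (b ∷ p) (suc i) = coeff-· a p i

    refl : ∀ {p} → p ≈ p
    refl = coeffwise (λ _ → ≡.refl)

    sym : ∀ {p q} → p ≈ q → q ≈ p
    sym e = coeffwise (λ i → ≡.sym (at e i))

    trans : ∀ {p q r} → p ≈ q → q ≈ r → p ≈ r
    trans e f = coeffwise (λ i → ≡.trans (at e i) (at f i))

    ∷-cong : ∀ {a b p q} → a ≡ b → p ≈ q → a ∷ p ≈ b ∷ q
    ∷-cong a≡b e = coeffwise λ { zero → a≡b ; (suc i) → at e i }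

    tail : ∀ {a b p q} → a ∷ p ≈ b ∷ q → p ≈ q
    tail e = coeffwise (λ i → at e (suc i))

    tail₀ : ∀ {b q} → [] ≈ b ∷ q → [] ≈ q
    tail₀ e = coeffwise (λ i → at e (suc i))

    0∷[] : 0ℤ ∷ [] ≈ []
    0∷[] = coeffwise λ { zero → ≡.refl ; (suc i) → ≡.refl }

    +-cong : ∀ {p p′ q q′} → p ≈ p′ → q ≈ q′ → p + q ≈ p′ + q′
    +-cong {p} {p′} {q} {q′} e f = coeffwise λ i →
      ≡.trans (coeff-+ p q i) (≡.trans (≡.cong₂ ℤ._+_ (at e i) (at f i)) (≡.sym (coeff-+ p′ q′ i)))

    +-comm : ∀ p q → p + q ≈ q + p
    +-comm p q = coeffwise λ i →
      ≡.trans (coeff-+ p q i) (≡.trans (ℤ.+-comm (coeff p i) _) (≡.sym (coeff-+ q p i)))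

    +-assoc : ∀ p q r → (p + q) + r ≈ p + (q + r)
    +-assoc p q r = coeffwise λ i →
      ≡.trans (coeff-+ (p + q) r i)
      (≡.trans (≡.cong (ℤ._+ coeff r i) (coeff-+ p q i))
      (≡.trans (ℤ.+-assoc (coeff p i) _ _)
      (≡.trans (≡.cong (λ a → coeff p i ℤ.+ a) (≡.sym (coeff-+ q r i)))
               (≡.sym (coeff-+ p (q + r) i)))))

    +-identityʳ : ∀ p → p + [] ≈ p
    +-identityʳ p = +-comm p []

    -‿cong : ∀ {p q} → p ≈ q → - p ≈ - q
    -‿cong {p} {q} e = coeffwise λ i →
      ≡.trans (coeff-- p i) (≡.trans (≡.cong (λ a → ℤ.- a) (at e i)) (≡.sym (coeff-- q i)))

    -‿inverseˡ : ∀ p → - p + p ≈ []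
    -‿inverseˡ p = coeffwise λ i →
      ≡.trans (coeff-+ (- p) p i)
      (≡.trans (≡.cong (ℤ._+ coeff p i) (coeff-- p i)) (ℤ.+-inverseˡ (coeff p i)))

    ·-cong : ∀ a {p q} → p ≈ q → a · p ≈ a · q
    ·-cong a {p} {q} e = coeffwise λ i →
      ≡.trans (coeff-· a p i) (≡.trans (≡.cong (a ℤ.*_) (at e i)) (≡.sym (coeff-· a q i)))

    ·-+ : ∀ a p q → a · (p + q) ≈ a · p + a · q
    ·-+ a p q = coeffwise λ i →
      ≡.trans (coeff-· a (p + q) i)
      (≡.trans (≡.cong (a ℤ.*_) (coeff-+ p q i))
      (≡.trans (ℤ.*-distribˡ-+ a (coeff p i) _)
      (≡.trans (≡.sym (≡.cong₂ ℤ._+_ (coeff-· a p i) (coeff-· a q i)))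
               (≡.sym (coeff-+ (a · p) (a · q) i)))))

    ·-· : ∀ a b p → a · (b · p) ≈ (a ℤ.* b) · p
    ·-· a b p = coeffwise λ i →
      ≡.trans (coeff-· a (b · p) i)
      (≡.trans (≡.cong (a ℤ.*_) (coeff-· b p i))
      (≡.trans (≡.sym (ℤ.*-assoc a b _)) (≡.sym (coeff-· (a ℤ.* b) p i))))

    0·≈[] : ∀ p → 0ℤ · p ≈ []
    0·≈[] p = coeffwise λ i → ≡.trans (coeff-· 0ℤ p i) (ℤ.*-zeroˡ (coeff p i))

    1· : ∀ p → 1ℤ · p ≈ p
    1· p = coeffwise λ i → ≡.trans (coeff-· 1ℤ p i) (ℤ.*-identityˡ (coeff p i))

    ·[]≈[] : ∀ {a p} → a ≡ 0ℤ → a · p ≈ []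
    ·[]≈[] {p = p} ≡.refl = 0·≈[] p

    +-congˡ : ∀ p {q q′} → q ≈ q′ → p + q ≈ p + q′
    +-congˡ p = +-cong {p = p} refl

    medial : ∀ p q r s → (p + q) + (r + s) ≈ (p + r) + (q + s)
    medial p q r s =
      trans (+-assoc p q (r + s))
      (trans (+-congˡ p (trans (sym (+-assoc q r s))
             (trans (+-cong (+-comm q r) refl) (+-assoc r q s))))
             (sym (+-assoc p r (q + s))))

    *-congˡ : ∀ p {q q′} → q ≈ q′ → p * q ≈ p * q′
    *-congˡ []      e = refl
    *-congˡ (a ∷ p) e = +-cong (·-cong a e) (∷-cong ≡.refl (*-congˡ p e))

    *-zeroˡ : ∀ p q → [] ≈ p → [] ≈ p * q
    *-zeroˡ []      q e = refl
    *-zeroˡ (a ∷ p) q e =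
      sym (+-cong (·[]≈[] {p = q} (≡.sym (at e 0)))
                  (trans (∷-cong ≡.refl (sym (*-zeroˡ p q (tail₀ e)))) 0∷[]))

    *-congʳ : ∀ {p p′} q → p ≈ p′ → p * q ≈ p′ * q
    *-congʳ {[]}    {p′}     q e = *-zeroˡ p′ q e
    *-congʳ {a ∷ p} {[]}     q e = sym (*-zeroˡ (a ∷ p) q (sym e))
    *-congʳ {a ∷ p} {b ∷ p′} q e with ≡.refl ← at e 0 =
      +-cong refl (∷-cong ≡.refl (*-congʳ q (tail e)))

    *-distribˡ : ∀ p q r → p * (q + r) ≈ p * q + p * r
    *-distribˡ []      q r = refl
    *-distribˡ (a ∷ p) q r =
      trans (+-cong (·-+ a q r) (∷-cong ≡.refl (*-distribˡ p q r)))
            (medial (a · q) (a · r) (0ℤ ∷ p * q) (0ℤ ∷ p * r))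

    *-zeroʳ : ∀ p → p * [] ≈ []
    *-zeroʳ []      = refl
    *-zeroʳ (a ∷ p) = trans (∷-cong ≡.refl (*-zeroʳ p)) 0∷[]

    *-∷ : ∀ p b q → p * (b ∷ q) ≈ b · p + (0ℤ ∷ p * q)
    *-∷ []      b q = sym 0∷[]
    *-∷ (a ∷ p) b q = ∷-cong
      (≡.cong (ℤ._+ 0ℤ) (ℤ.*-comm a b))
      (trans (+-cong refl (*-∷ p b q))
      (trans (sym (+-assoc (a · q) (b · p) (0ℤ ∷ p * q)))
      (trans (+-cong (+-comm (a · q) (b · p)) refl)
             (+-assoc (b · p) (a · q) (0ℤ ∷ p * q)))))

    *-comm : ∀ p q → p * q ≈ q * p
    *-comm p []      = *-zeroʳ p
    *-comm p (b ∷ q) = trans (*-∷ p b q) (+-cong refl (∷-cong ≡.refl (*-comm p q)))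

    ·-* : ∀ a p q → a · p * q ≈ a · (p * q)
    ·-* a []      q = refl
    ·-* a (b ∷ p) q =
      trans (+-cong (sym (·-· a b q))
                    (∷-cong (≡.sym (ℤ.*-zeroʳ a)) (·-* a p q)))
            (sym (·-+ a (b · q) (0ℤ ∷ p * q)))

    *-distribʳ : ∀ r p q → (p + q) * r ≈ p * r + q * r
    *-distribʳ r p q =
      trans (*-comm (p + q) r)
      (trans (*-distribˡ r p q) (+-cong (*-comm r p) (*-comm r q)))

    0∷-* : ∀ p q → (0ℤ ∷ p) * q ≈ 0ℤ ∷ p * q
    0∷-* p q = +-cong (0·≈[] q) refl

    *-assoc : ∀ p q r → (p * q) * r ≈ p * (q * r)
    *-assoc []      q r = refl
    *-assoc (a ∷ p) q r =
      trans (*-distribʳ r (a · q) (0ℤ ∷ p * q))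
            (+-cong (·-* a q r) (trans (0∷-* (p * q) r) (∷-cong ≡.refl (*-assoc p q r))))

    *-identityˡ : ∀ p → (1ℤ ∷ []) * p ≈ p
    *-identityˡ p = trans (+-cong (1· p) 0∷[]) (+-identityʳ p)

  commutativeRing : CommutativeRing 0ℓ 0ℓ
  commutativeRing = record
    { Carrier = List ℤ
    ; _≈_ = _≈_ ; _+_ = _+_ ; _*_ = _*_ ; -_ = -_ ; 0# = [] ; 1# = 1ℤ ∷ []
    ; isCommutativeRing = record
      { isRing = record
        { +-isAbelianGroup = record
          { isGroup = record
            { isMonoid = record
              { isSemigroup = record
                { isMagma = record
                  { isEquivalence = record { refl = refl ; sym = sym ; trans = trans }
                  ; ∙-cong = +-cong }
                ; assoc = +-assoc }
              ; identity = (λ _ → refl) , +-identityʳ }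
            ; inverse = -‿inverseˡ , (λ p → trans (+-comm p (- p)) (-‿inverseˡ p))
            ; ⁻¹-cong = -‿cong }
          ; comm = +-comm }
        ; *-cong = λ {p} {p′} {q} {q′} e f → trans (*-congʳ q e) (*-congˡ p′ f)
        ; *-assoc = *-assoc
        ; *-identity = *-identityˡ , (λ p → trans (*-comm p _) (*-identityˡ p))
        ; distrib = *-distribˡ , *-distribʳ }
      ; *-comm = *-comm } }

  private
    cons≈[] : ∀ {a p} → a ≡ 0ℤ → p ≈ [] → a ∷ p ≈ []
    cons≈[] ≡.refl e = trans (∷-cong ≡.refl e) 0∷[]

    tail-of-product : ∀ a p q → a ≡ 0ℤ → (a ∷ p) * q ≈ [] → p * q ≈ []
    tail-of-product a p q ≡.refl e = sym (tail₀ (sym (trans (sym (0∷-* p q)) e)))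

    zero-product : ∀ p q → p * q ≈ [] → p ≈ [] ⊎ q ≈ []
    zero-product []      q       e = inj₁ refl
    zero-product (a ∷ p) []      e = inj₂ refl
    zero-product (a ∷ p) (b ∷ q) e =
      step (zero-product p (b ∷ q)) (zero-product (a ∷ p) q) (a ℤ.≟ 0ℤ) (b ℤ.≟ 0ℤ)
      where
      step : (p * (b ∷ q) ≈ [] → p ≈ [] ⊎ (b ∷ q) ≈ []) →
             ((a ∷ p) * q ≈ [] → (a ∷ p) ≈ [] ⊎ q ≈ []) →
             Dec (a ≡ 0ℤ) → Dec (b ≡ 0ℤ) → (a ∷ p) ≈ [] ⊎ (b ∷ q) ≈ []
      step rec _ (yes a≡0) _ = [ (λ h → inj₁ (cons≈[] a≡0 h)) , inj₂ ]′
        (rec (tail-of-product a p (b ∷ q) a≡0 e))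
      step _ rec (no _) (yes b≡0) = [ inj₁ , (λ h → inj₂ (cons≈[] b≡0 h)) ]′
        (rec (trans (*-comm (a ∷ p) q)
          (tail-of-product b q (a ∷ p) b≡0 (trans (*-comm (b ∷ q) (a ∷ p)) e))))
      step _ _ (no a≢0) (no b≢0) = ⊥-elim
        ([ a≢0 , b≢0 ]′ (ℤ.i*j≡0⇒i≡0∨j≡0 a (≡.trans (≡.sym (ℤ.+-identityʳ _)) (at e 0))))

  isIntegralDomain : IsIntegralDomain commutativeRing
  isIntegralDomain = record
    { 1≉0 = λ e → case-⊥ (at e 0) ; zero-product = λ {p} {q} → zero-product p q }
    where
    case-⊥ : 1ℤ ≡ 0ℤ → ⊥
    case-⊥ ()

  t : List ℤ
  t = 0ℤ ∷ 1ℤ ∷ []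

  t≉0 : ¬ t ≈ []
  t≉0 e with () ← at e 1

  module Evaluation {c ℓ} (R : CommutativeRing c ℓ) (x : CommutativeRing.Carrier R) where
    private module R = CommutativeRing R
    open FromℤR R
    open Solver
    open import Relation.Binary.Reasoning.Setoid R.setoid

    eval : List ℤ → R.Carrier
    eval []      = R.0#
    eval (a ∷ p) = fromℤ a R.+ x R.* eval p

    private
      eval-0 : ∀ p → [] ≈ p → eval p R.≈ R.0#
      eval-0 []      e = R.refl
      eval-0 (a ∷ p) e with ≡.refl ← at e 0 = R.trans (R.+-identityˡ _)
        (R.trans (R.*-congˡ (eval-0 p (tail₀ e))) (R.zeroʳ x))

      eval-cong : ∀ {p q} → p ≈ q → eval p R.≈ eval q
      eval-cong {[]}    {q}     e = R.sym (eval-0 q e)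
      eval-cong {a ∷ p} {[]}    e = eval-0 (a ∷ p) (sym e)
      eval-cong {a ∷ p} {b ∷ q} e with ≡.refl ← at e 0 = R.+-congˡ (R.*-congˡ (eval-cong (tail e)))

      eval-+ : ∀ p q → eval (p + q) R.≈ eval p R.+ eval q
      eval-+ []      q       = R.sym (R.+-identityˡ _)
      eval-+ (a ∷ p) []      = R.sym (R.+-identityʳ _)
      eval-+ (a ∷ p) (b ∷ q) = R.trans
        (R.+-cong (fromℤ-+ a b) (R.*-congˡ (eval-+ p q)))
        (solve 5 (λ A B X P Q → (A :+ B) :+ X :* (P :+ Q) := (A :+ X :* P) :+ (B :+ X :* Q))
          R.refl (fromℤ a) (fromℤ b) x (eval p) (eval q))

      eval-· : ∀ a p → eval (a · p) R.≈ fromℤ a R.* eval p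
      eval-· a []      = R.sym (R.zeroʳ _)
      eval-· a (b ∷ p) = R.trans
        (R.+-cong (fromℤ-* a b) (R.*-congˡ (eval-· a p)))
        (solve 4 (λ A B X P → A :* B :+ X :* (A :* P) := A :* (B :+ X :* P))
          R.refl (fromℤ a) (fromℤ b) x (eval p))

      eval-* : ∀ p q → eval (p * q) R.≈ eval p R.* eval q
      eval-* []      q = R.sym (R.zeroˡ _)
      eval-* (a ∷ p) q = R.trans (eval-+ (a · q) (0ℤ ∷ p * q)) (R.trans
        (R.+-cong (eval-· a q) (R.+-congˡ (R.*-congˡ (eval-* p q))))
        (solve 4 (λ A X P Q → A :* Q :+ (con 0ℤ :+ X :* (P :* Q)) := (A :+ X :* P) :* Q)
          R.refl (fromℤ a) x (eval p) (eval q)))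

    open RingMorphisms (CommutativeRing.rawRing commutativeRing) R.rawRing using (IsRingHomomorphism)

    isRingHomomorphism : IsRingHomomorphism eval
    isRingHomomorphism = mkRingHom (CommutativeRing.ring commutativeRing) R.ring eval
      eval-cong eval-+ eval-* (R.trans (R.+-congˡ (R.zeroʳ x)) (R.+-identityʳ _))

    eval-t : eval t R.≈ x
    eval-t = solve 1 (λ X → con 0ℤ :+ X :* (con 1ℤ :+ X :* con 0ℤ) := X) R.refl x

-- S⁻¹R. As R is a domain and 0 ∉ S, equality of fractions is plain cross-multiplication.
module Localization
  {c ℓ s} (R : CommutativeRing c ℓ) (domain : IsIntegralDomain R)
  (S : CommutativeRing.Carrier R → Set s)
  (S-1 : S (CommutativeRing.1# R))
  (S-* : ∀ {x y} → S x → S y → S (CommutativeRing._*_ R x y))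
  (S≉0 : ∀ {x} → S x → ¬ CommutativeRing._≈_ R x (CommutativeRing.0# R))
  where

  private module R = CommutativeRing R
  open R using (_+_; _*_; -_; 0#; 1#)
  open IsIntegralDomain domain
  open FromℤR.Solver R using (solve; _:=_; _:+_; _:*_; _:-_; :-_; con)
  open import Algebra.Properties.Ring R.ring using (x≈y⇒x∙y⁻¹≈ε; x∙y⁻¹≈ε⇒x≈y)

  infixl 7 _/_[_]
  record Fraction : Set (c ⊔ s) where
    no-eta-equality
    pattern
    constructor _/_[_]
    field
      num   : R.Carrier
      den   : R.Carrier
      den∈S : S den
  open Fraction

  infix 4 _≈_
  record _≈_ (x y : Fraction) : Set ℓ where
    no-eta-equality
    pattern
    constructor cross
    field cross⁻ : num x * den y R.≈ num y * den x
  open _≈_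

  private
    S-cancel : ∀ {s x y} → S s → s * x R.≈ s * y → x R.≈ y
    S-cancel {s} {x} {y} s∈S sx≈sy = [ (λ s≈0 → ⊥-elim (S≉0 s∈S s≈0)) , x∙y⁻¹≈ε⇒x≈y x y ]′
      (zero-product (R.trans
        (solve 3 (λ s x y → s :* (x :- y) := s :* x :- s :* y) R.refl s x y)
        (x≈y⇒x∙y⁻¹≈ε sx≈sy)))

    refl : ∀ {x} → x ≈ x
    refl = cross R.refl

    sym : ∀ {x y} → x ≈ y → y ≈ x
    sym (cross e) = cross (R.sym e)

    trans : ∀ {x y z} → x ≈ y → y ≈ z → x ≈ z
    trans {a / b [ _ ]} {c / d [ d∈S ]} {e / f [ _ ]} (cross p) (cross q) =
      cross (S-cancel d∈S (begin
        d * (a * f)   ≈⟨ solve 3 (λ d a f → d :* (a :* f) := (a :* d) :* f) R.refl d a f ⟩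
        (a * d) * f   ≈⟨ R.*-congʳ p ⟩
        (c * b) * f   ≈⟨ solve 3 (λ c b f → (c :* b) :* f := (c :* f) :* b) R.refl c b f ⟩
        (c * f) * b   ≈⟨ R.*-congʳ q ⟩
        (e * d) * b   ≈⟨ solve 3 (λ e d b → (e :* d) :* b := d :* (e :* b)) R.refl e d b ⟩
        d * (e * b)   ∎))
      where open import Relation.Binary.Reasoning.Setoid R.setoid

  -- (opaque only to keep type checking fast)
  opaque
    add mul : Fraction → Fraction → Fraction
    add x y = (num x * den y + num y * den x) / (den x * den y) [ S-* (den∈S x) (den∈S y) ]
    mul x y = (num x * num y) / (den x * den y) [ S-* (den∈S x) (den∈S y) ]

    neg : Fraction → Fraction
    neg x = (- num x) / den x [ den∈S x ]

  [_] : R.Carrier → Fraction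
  [ a ] = a / 1# [ S-1 ]

  private opaque
    unfolding add

    add-cong : ∀ {x x′ y y′} → x ≈ x′ → y ≈ y′ → add x y ≈ add x′ y′
    add-cong {a / b [ _ ]} {a′ / b′ [ _ ]} {c / d [ _ ]} {c′ / d′ [ _ ]} (cross p) (cross q) =
      cross (begin
        (a * d + c * b) * (b′ * d′)              ≈⟨ solve 6 (λ a b c d b′ d′ → (a :* d :+ c :* b) :* (b′ :* d′)
                                                        := (a :* b′) :* (d :* d′) :+ (c :* d′) :* (b :* b′))
                                                        R.refl a b c d b′ d′ ⟩
        (a * b′) * (d * d′) + (c * d′) * (b * b′) ≈⟨ R.+-cong (R.*-congʳ p) (R.*-congʳ q) ⟩
        (a′ * b) * (d * d′) + (c′ * d) * (b * b′) ≈⟨ solve 6 (λ a′ b c′ d b′ d′ → (a′ :* b) :* (d :* d′) :+ (c′ :* d) :* (b :* b′)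
                                                        := (a′ :* d′ :+ c′ :* b′) :* (b :* d))
                                                        R.refl a′ b c′ d b′ d′ ⟩
        (a′ * d′ + c′ * b′) * (b * d)            ∎)
      where open import Relation.Binary.Reasoning.Setoid R.setoid

    mul-cong : ∀ {x x′ y y′} → x ≈ x′ → y ≈ y′ → mul x y ≈ mul x′ y′
    mul-cong {a / b [ _ ]} {a′ / b′ [ _ ]} {c / d [ _ ]} {c′ / d′ [ _ ]} (cross p) (cross q) =
      cross (begin
        (a * c) * (b′ * d′)    ≈⟨ solve 4 (λ a c b′ d′ → (a :* c) :* (b′ :* d′) := (a :* b′) :* (c :* d′)) R.refl a c b′ d′ ⟩
        (a * b′) * (c * d′)    ≈⟨ R.*-cong p q ⟩
        (a′ * b) * (c′ * d)    ≈⟨ solve 4 (λ a′ c′ b d → (a′ :* b) :* (c′ :* d) := (a′ :* c′) :* (b :* d)) R.refl a′ c′ b d ⟩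
        (a′ * c′) * (b * d)    ∎)
      where open import Relation.Binary.Reasoning.Setoid R.setoid

    neg-cong : ∀ {x y} → x ≈ y → neg x ≈ neg y
    neg-cong {a / b [ _ ]} {c / d [ _ ]} (cross p) = cross (begin
      (- a) * d    ≈⟨ solve 2 (λ a d → (:- a) :* d := :- (a :* d)) R.refl a d ⟩
      - (a * d)    ≈⟨ R.-‿cong p ⟩
      - (c * b)    ≈⟨ solve 2 (λ c b → :- (c :* b) := (:- c) :* b) R.refl c b ⟩
      (- c) * b    ∎)
      where open import Relation.Binary.Reasoning.Setoid R.setoid

    add-comm : ∀ x y → add x y ≈ add y x
    add-comm (a / b [ _ ]) (c / d [ _ ]) = cross
      (solve 4 (λ a b c d → (a :* d :+ c :* b) :* (d :* b) := (c :* b :+ a :* d) :* (b :* d)) R.refl a b c d)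

    mul-comm : ∀ x y → mul x y ≈ mul y x
    mul-comm (a / b [ _ ]) (c / d [ _ ]) = cross
      (solve 4 (λ a b c d → (a :* c) :* (d :* b) := (c :* a) :* (b :* d)) R.refl a b c d)

    add-assoc : ∀ x y z → add (add x y) z ≈ add x (add y z)
    add-assoc (a / b [ _ ]) (c / d [ _ ]) (e / f [ _ ]) = cross
      (solve 6 (λ a b c d e f →
        ((a :* d :+ c :* b) :* f :+ e :* (b :* d)) :* (b :* (d :* f)) :=
        (a :* (d :* f) :+ (c :* f :+ e :* d) :* b) :* ((b :* d) :* f)) R.refl a b c d e f)

    mul-assoc : ∀ x y z → mul (mul x y) z ≈ mul x (mul y z)
    mul-assoc (a / b [ _ ]) (c / d [ _ ]) (e / f [ _ ]) = cross
      (solve 6 (λ a b c d e f →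
        ((a :* c) :* e) :* (b :* (d :* f)) := (a :* (c :* e)) :* ((b :* d) :* f)) R.refl a b c d e f)

    add-identityˡ : ∀ x → add [ 0# ] x ≈ x
    add-identityˡ (a / b [ _ ]) = cross
      (solve 2 (λ a b → (con 0ℤ :* b :+ a :* con 1ℤ) :* b := a :* (con 1ℤ :* b)) R.refl a b)

    add-inverseˡ : ∀ x → add (neg x) x ≈ [ 0# ]
    add-inverseˡ (a / b [ _ ]) = cross
      (solve 2 (λ a b → ((:- a) :* b :+ a :* b) :* con 1ℤ := con 0ℤ :* (b :* b)) R.refl a b)

    mul-identityˡ : ∀ x → mul [ 1# ] x ≈ x
    mul-identityˡ (a / b [ _ ]) = cross
      (solve 2 (λ a b → (con 1ℤ :* a) :* b := a :* (con 1ℤ :* b)) R.refl a b)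

    distribˡ : ∀ x y z → mul x (add y z) ≈ add (mul x y) (mul x z)
    distribˡ (a / b [ _ ]) (c / d [ _ ]) (e / f [ _ ]) = cross
      (solve 6 (λ a b c d e f →
        (a :* (c :* f :+ e :* d)) :* ((b :* d) :* (b :* f)) :=
        ((a :* c) :* (b :* f) :+ (a :* e) :* (b :* d)) :* (b :* (d :* f))) R.refl a b c d e f)

  commutativeRing : CommutativeRing (c ⊔ s) ℓ
  commutativeRing = record
    { Carrier = Fraction
    ; _≈_ = _≈_ ; _+_ = add ; _*_ = mul ; -_ = neg ; 0# = [ 0# ] ; 1# = [ 1# ]
    ; isCommutativeRing = record
      { isRing = record
        { +-isAbelianGroup = record
          { isGroup = record
            { isMonoid = record
              { isSemigroup = record
                { isMagma = record
                  { isEquivalence = record { refl = refl ; sym = sym ; trans = trans }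
                  ; ∙-cong = add-cong }
                ; assoc = add-assoc }
              ; identity = add-identityˡ , (λ x → trans (add-comm x [ 0# ]) (add-identityˡ x)) }
            ; inverse = add-inverseˡ , (λ x → trans (add-comm x (neg x)) (add-inverseˡ x))
            ; ⁻¹-cong = neg-cong }
          ; comm = add-comm }
        ; *-cong = mul-cong
        ; *-assoc = mul-assoc
        ; *-identity = mul-identityˡ , (λ x → trans (mul-comm x [ 1# ]) (mul-identityˡ x))
        ; distrib = distribˡ , (λ z x y → trans (mul-comm (add x y) z)
            (trans (distribˡ z x y) (add-cong (mul-comm z x) (mul-comm z y)))) }
      ; *-comm = mul-comm } }

  num≈0 : ∀ {x} → x ≈ [ 0# ] → num x R.≈ 0#
  num≈0 (cross e) = R.trans (R.sym (R.*-identityʳ _)) (R.trans e (R.zeroˡ _))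

  ≈0 : ∀ {x} → num x R.≈ 0# → x ≈ [ 0# ]
  ≈0 e = cross (R.trans (R.*-congʳ e) (R.trans (R.zeroˡ _) (R.sym (R.zeroˡ _))))

  opaque
    unfolding add

    isIntegralDomain : IsIntegralDomain commutativeRing
    isIntegralDomain = record
      { 1≉0 = λ e → 1≉0 (num≈0 e)
      ; zero-product = λ e → [ (λ h → inj₁ (≈0 h)) , (λ h → inj₂ (≈0 h)) ]′ (zero-product (num≈0 e)) }

  open RingMorphisms R.rawRing (CommutativeRing.rawRing commutativeRing) using (IsRingHomomorphism)

  opaque
    unfolding add

    []-isRingHomomorphism : IsRingHomomorphism [_]
    []-isRingHomomorphism = mkRingHom R.ring (CommutativeRing.ring commutativeRing) [_]
      (λ e → cross (R.*-congʳ e))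
      (λ x y → cross (solve 2 (λ x y → (x :+ y) :* (con 1ℤ :* con 1ℤ) := (x :* con 1ℤ :+ y :* con 1ℤ) :* con 1ℤ) R.refl x y))
      (λ x y → cross (solve 2 (λ x y → (x :* y) :* (con 1ℤ :* con 1ℤ) := (x :* y) :* con 1ℤ) R.refl x y))
      refl

  []-injective : ∀ {x y} → [ x ] ≈ [ y ] → x R.≈ y
  []-injective (cross e) = R.trans (R.sym (R.*-identityʳ _)) (R.trans e (R.*-identityʳ _))

  opaque
    unfolding add

    unit-fraction : ∀ {s} (s∈S : S s) → mul [ s ] (1# / s [ s∈S ]) ≈ [ 1# ]
    unit-fraction {s} _ = cross (solve 1 (λ s → (s :* con 1ℤ) :* con 1ℤ := con 1ℤ :* (con 1ℤ :* s)) R.refl s)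

module ℤ[t] = CommutativeRing Polynomial.commutativeRing

-- 𝒜 = ℤ[t,t⁻¹], as the localization of ℤ[t] at the powers of t
module LaurentRing where
  open Polynomial using (t; t≉0; isIntegralDomain)
  open import Algebra.Properties.Semiring.Exp ℤ[t].semiring public using (_^_; ^-homo-*)

  PowerOfT : ℤ[t].Carrier → Set
  PowerOfT p = Σ ℕ λ k → p ℤ[t].≈ t ^ k

  private
    S-* : ∀ {p q} → PowerOfT p → PowerOfT q → PowerOfT (p ℤ[t].* q)
    S-* (k , e) (l , f) = k ℕ.+ l , ℤ[t].trans (ℤ[t].*-cong e f) (ℤ[t].sym (^-homo-* t k l))

    t^≉0 : ∀ k → ¬ t ^ k ℤ[t].≈ ℤ[t].0#
    t^≉0 zero    = IsIntegralDomain.1≉0 isIntegralDomain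
    t^≉0 (suc k) e = [ t≉0 , t^≉0 k ]′ (IsIntegralDomain.zero-product isIntegralDomain {t} e)

    S≉0 : ∀ {p} → PowerOfT p → ¬ p ℤ[t].≈ ℤ[t].0#
    S≉0 (k , e) e′ = t^≉0 k (ℤ[t].trans (ℤ[t].sym e) e′)

  open Localization Polynomial.commutativeRing isIntegralDomain PowerOfT
    (0 , ℤ[t].refl) S-* S≉0 public

  t∈S : PowerOfT t
  t∈S = 1 , ℤ[t].sym (ℤ[t].*-identityʳ t)

𝒜 : CommutativeRing 0ℓ 0ℓ
𝒜 = LaurentRing.commutativeRing

𝒜-isIntegralDomain : IsIntegralDomain 𝒜
𝒜-isIntegralDomain = LaurentRing.isIntegralDomain

module 𝒜 = CommutativeRing 𝒜

𝐭 𝐭⁻¹ : 𝒜.Carrier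
𝐭   = LaurentRing.[ Polynomial.t ]
𝐭⁻¹ = ℤ[t].1# LaurentRing./ Polynomial.t [ LaurentRing.t∈S ]

𝐭*𝐭⁻¹≈1 : 𝐭 𝒜.* 𝐭⁻¹ 𝒜.≈ 𝒜.1#
𝐭*𝐭⁻¹≈1 = LaurentRing.unit-fraction LaurentRing.t∈S

-- ℚ(t), as the field of fractions of 𝒜
module FractionField = Localization 𝒜 𝒜-isIntegralDomain (λ x → ¬ x 𝒜.≈ 𝒜.0#)
  (IsIntegralDomain.1≉0 𝒜-isIntegralDomain)
  (λ x≉0 y≉0 xy≈0 → [ x≉0 , y≉0 ]′ (IsIntegralDomain.zero-product 𝒜-isIntegralDomain xy≈0))
  (λ x≉0 → x≉0)

ℚ⟨t⟩ : CommutativeRing 0ℓ 0ℓ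
ℚ⟨t⟩ = FractionField.commutativeRing

module ℚ⟨t⟩ = CommutativeRing ℚ⟨t⟩

-- t^{±1} ↦ v^{±1}
module Specialization
  {c ℓ} (R : CommutativeRing c ℓ) (v v⁻¹ : CommutativeRing.Carrier R)
  (v*v⁻¹≈1 : CommutativeRing._≈_ R (CommutativeRing._*_ R v v⁻¹) (CommutativeRing.1# R))
  where

  private module R = CommutativeRing R
  open R using (_*_; _+_)
  open Polynomial.Evaluation R v
  open RingMorphisms ℤ[t].rawRing R.rawRing using (module IsRingHomomorphism)
  private module eval = IsRingHomomorphism isRingHomomorphism
  open RingMorphisms 𝒜.rawRing R.rawRing using (IsRingHomomorphism)
  open LaurentRing using (_/_[_]; PowerOfT)
  open import Algebra.Properties.CommutativeSemiring.Exp R.commutativeSemiring using (_^_; ^-homo-*; ^-distrib-*)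
  open FromℤR.Solver R using (solve; _:=_; _:+_; _:*_; _:-_; :-_; con)
  open import Relation.Binary.Reasoning.Setoid R.setoid

  private
    1^ : ∀ k → R.1# ^ k R.≈ R.1#
    1^ zero    = R.refl
    1^ (suc k) = R.trans (R.*-identityˡ _) (1^ k)

    v^*v⁻¹^ : ∀ k → v ^ k * v⁻¹ ^ k R.≈ R.1#
    v^*v⁻¹^ k = R.trans (R.sym (^-distrib-* v v⁻¹ k))
      (R.trans (Exp.^-congˡ k v*v⁻¹≈1) (1^ k))
      where import Algebra.Properties.Semiring.Exp R.semiring as Exp

    eval-t^ : ∀ k → eval (Polynomial.t LaurentRing.^ k) R.≈ v ^ k
    eval-t^ zero    = eval.1#-homo
    eval-t^ (suc k) = R.trans (eval.*-homo Polynomial.t (Polynomial.t LaurentRing.^ k)) (R.*-cong eval-t (eval-t^ k))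

    eval-den : ∀ {p} (p∈S : PowerOfT p) → eval p * v⁻¹ ^ proj₁ p∈S R.≈ R.1#
    eval-den (k , e) = R.trans (R.*-congʳ (R.trans (eval.⟦⟧-cong e) (eval-t^ k))) (v^*v⁻¹^ k)

  specialize : 𝒜.Carrier → R.Carrier
  specialize (p / _ [ k , _ ]) = eval p * v⁻¹ ^ k

  private
    specialize-cong : ∀ {x y} → x 𝒜.≈ y → specialize x R.≈ specialize y
    specialize-cong {p / a [ a∈S ]} {q / b [ b∈S ]} (LaurentRing.cross e) = begin
      P * A⁻                    ≈⟨ R.*-identityʳ _ ⟨
      (P * A⁻) * R.1#           ≈⟨ R.*-congˡ (eval-den b∈S) ⟨
      (P * A⁻) * (B * B⁻)       ≈⟨ solve 4 (λ P A⁻ B B⁻ → (P :* A⁻) :* (B :* B⁻) := (P :* B) :* (A⁻ :* B⁻)) R.refl P A⁻ B B⁻ ⟩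
      (P * B) * (A⁻ * B⁻)       ≈⟨ R.*-congʳ (eval.*-homo p b) ⟨
      eval (p ℤ[t].* b) * (A⁻ * B⁻) ≈⟨ R.*-congʳ (eval.⟦⟧-cong e) ⟩
      eval (q ℤ[t].* a) * (A⁻ * B⁻) ≈⟨ R.*-congʳ (eval.*-homo q a) ⟩
      (Q * A) * (A⁻ * B⁻)       ≈⟨ solve 4 (λ Q A A⁻ B⁻ → (Q :* A) :* (A⁻ :* B⁻) := (Q :* B⁻) :* (A :* A⁻)) R.refl Q A A⁻ B⁻ ⟩
      (Q * B⁻) * (A * A⁻)       ≈⟨ R.*-congˡ (eval-den a∈S) ⟩
      (Q * B⁻) * R.1#           ≈⟨ R.*-identityʳ _ ⟩
      Q * B⁻                    ∎
      where
      P = eval p ; Q = eval q ; A = eval a ; B = eval b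
      A⁻ = v⁻¹ ^ proj₁ a∈S
      B⁻ = v⁻¹ ^ proj₁ b∈S

    sum-of-fractions : ∀ p q {a b} (a∈S : PowerOfT a) (b∈S : PowerOfT b) →
      eval (p ℤ[t].* b ℤ[t].+ q ℤ[t].* a) * v⁻¹ ^ (proj₁ a∈S ℕ.+ proj₁ b∈S) R.≈
      eval p * v⁻¹ ^ proj₁ a∈S + eval q * v⁻¹ ^ proj₁ b∈S
    sum-of-fractions p q {a} {b} a∈S b∈S = begin
      eval (p ℤ[t].* b ℤ[t].+ q ℤ[t].* a) * v⁻¹ ^ (proj₁ a∈S ℕ.+ proj₁ b∈S)
        ≈⟨ R.*-cong (R.trans (eval.+-homo (p ℤ[t].* b) (q ℤ[t].* a)) (R.+-cong (eval.*-homo p b) (eval.*-homo q a)))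
                    (^-homo-* v⁻¹ (proj₁ a∈S) (proj₁ b∈S)) ⟩
      (P * B + Q * A) * (A⁻ * B⁻)
        ≈⟨ solve 6 (λ P Q A B A⁻ B⁻ → (P :* B :+ Q :* A) :* (A⁻ :* B⁻)
             := (P :* A⁻) :* (B :* B⁻) :+ (Q :* B⁻) :* (A :* A⁻)) R.refl P Q A B A⁻ B⁻ ⟩
      (P * A⁻) * (B * B⁻) + (Q * B⁻) * (A * A⁻)
        ≈⟨ R.+-cong (R.trans (R.*-congˡ (eval-den b∈S)) (R.*-identityʳ _))
                    (R.trans (R.*-congˡ (eval-den a∈S)) (R.*-identityʳ _)) ⟩
      P * A⁻ + Q * B⁻ ∎
      where
      P = eval p ; Q = eval q ; A = eval a ; B = eval b
      A⁻ = v⁻¹ ^ proj₁ a∈S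
      B⁻ = v⁻¹ ^ proj₁ b∈S

    product-of-fractions : ∀ p q k l →
      eval (p ℤ[t].* q) * v⁻¹ ^ (k ℕ.+ l) R.≈ (eval p * v⁻¹ ^ k) * (eval q * v⁻¹ ^ l)
    product-of-fractions p q k l = R.trans
      (R.*-cong (eval.*-homo p q) (^-homo-* v⁻¹ k l))
      (solve 4 (λ P Q A⁻ B⁻ → (P :* Q) :* (A⁻ :* B⁻) := (P :* A⁻) :* (Q :* B⁻)) R.refl
        (eval p) (eval q) (v⁻¹ ^ k) (v⁻¹ ^ l))

    opaque
      unfolding LaurentRing.add

      specialize-+ : ∀ x y → specialize (x 𝒜.+ y) R.≈ specialize x + specialize y
      specialize-+ (p / _ [ a∈S ]) (q / _ [ b∈S ]) = sum-of-fractions p q a∈S b∈S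

      specialize-* : ∀ x y → specialize (x 𝒜.* y) R.≈ specialize x * specialize y
      specialize-* (p / _ [ a∈S ]) (q / _ [ b∈S ]) = product-of-fractions p q (proj₁ a∈S) (proj₁ b∈S)

  specialize-isRingHomomorphism : IsRingHomomorphism specialize
  specialize-isRingHomomorphism = mkRingHom 𝒜.ring R.ring specialize specialize-cong specialize-+ specialize-*
    (R.trans (R.*-identityʳ _) eval.1#-homo)

  specialize-t : specialize 𝐭 R.≈ v
  specialize-t = R.trans (R.*-identityʳ _) eval-t

  specialize-t⁻¹ : specialize 𝐭⁻¹ R.≈ v⁻¹
  specialize-t⁻¹ = R.trans (R.*-cong eval.1#-homo (R.*-identityʳ _)) (R.*-identityˡ _)

record Algebra {c ℓ} (R : CommutativeRing c ℓ) a ℓa : Set (c ⊔ ℓ ⊔ lsuc (a ⊔ ℓa)) where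
  private module R = CommutativeRing R
  field
    ring : Ring a ℓa
  open Ring ring public
  open RingMorphisms R.rawRing rawRing using (IsRingHomomorphism)
  field
    ι                    : R.Carrier → Carrier
    ι-isRingHomomorphism : IsRingHomomorphism ι
    ι-central            : ∀ r x → ι r * x ≈ x * ι r

  module ι = RingMorphisms.IsRingHomomorphism ι-isRingHomomorphism

record AlgebraHom {c ℓ a ℓa b ℓb} {R : CommutativeRing c ℓ}
                  (A : Algebra R a ℓa) (B : Algebra R b ℓb) : Set (c ⊔ a ⊔ ℓa ⊔ b ⊔ ℓb) where
  private
    module A = Algebra A
    module B = Algebra B
  open RingMorphisms A.rawRing B.rawRing using (IsRingHomomorphism)
  field
    ⟦_⟧                : A.Carrier → B.Carrier
    isRingHomomorphism : IsRingHomomorphism ⟦_⟧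
    ι-homo             : ∀ r → ⟦ A.ι r ⟧ B.≈ B.ι r

  open RingMorphisms.IsRingHomomorphism isRingHomomorphism public
    using (⟦⟧-cong; +-homo; *-homo; 1#-homo)

module _ {c ℓ a ℓa b ℓb} {R : CommutativeRing c ℓ}
         {A : Algebra R a ℓa} {B : Algebra R b ℓb} (f : AlgebraHom A B) where
  private
    module A = Algebra A
    module B = Algebra B

  IsSurjective : Set (a ⊔ ℓa ⊔ b ⊔ ℓb)
  IsSurjective = Surjective A._≈_ B._≈_ (AlgebraHom.⟦_⟧ f)

  IsIsomorphism : Set (a ⊔ ℓa ⊔ b ⊔ ℓb)
  IsIsomorphism = RingMorphisms.IsRingIsomorphism A.rawRing B.rawRing (AlgebraHom.⟦_⟧ f)

module Presentation {c ℓ} (R : CommutativeRing c ℓ) where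
  private module R = CommutativeRing R

  infixl 6 _+_ _-_
  infixl 7 _*_
  infix  8 -_

  data Term {x} (X : Set x) : Set (c ⊔ x) where
    gen     : X → Term X
    con     : R.Carrier → Term X
    _+_ _*_ : Term X → Term X → Term X

  -_ : ∀ {x} {X : Set x} → Term X → Term X
  - a = con (R.- R.1#) * a

  _-_ : ∀ {x} {X : Set x} → Term X → Term X → Term X
  a - b = a + (- b)

  module _ {x r} {X : Set x} (Relation : Rel (Term X) r) where

    infix 4 _≈_
    data _≈_ : Term X → Term X → Set (c ⊔ ℓ ⊔ x ⊔ r) where
      relation    : ∀ {a b} → Relation a b → a ≈ b
      refl        : ∀ {a} → a ≈ a
      sym         : ∀ {a b} → a ≈ b → b ≈ a
      trans       : ∀ {a b d} → a ≈ b → b ≈ d → a ≈ d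
      +-cong      : ∀ {a a′ b b′} → a ≈ a′ → b ≈ b′ → a + b ≈ a′ + b′
      *-cong      : ∀ {a a′ b b′} → a ≈ a′ → b ≈ b′ → a * b ≈ a′ * b′
      con-cong    : ∀ {r s} → r R.≈ s → con r ≈ con s
      con-+       : ∀ r s → con (r R.+ s) ≈ con r + con s
      con-*       : ∀ r s → con (r R.* s) ≈ con r * con s
      con-central : ∀ r a → con r * a ≈ a * con r
      +-assoc     : ∀ a b d → (a + b) + d ≈ a + (b + d)
      +-comm      : ∀ a b → a + b ≈ b + a
      +-identityˡ : ∀ a → con R.0# + a ≈ a
      *-assoc     : ∀ a b d → (a * b) * d ≈ a * (b * d)
      *-identityˡ : ∀ a → con R.1# * a ≈ a
      distribˡ    : ∀ a b d → a * (b + d) ≈ a * b + a * d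
      distribʳ    : ∀ d a b → (a + b) * d ≈ a * d + b * d
      zeroˡ       : ∀ a → con R.0# * a ≈ con R.0#

    private
      -‿inverseˡ : ∀ a → - a + a ≈ con R.0#
      -‿inverseˡ a =
        trans (+-cong refl (sym (*-identityˡ a)))
        (trans (sym (distribʳ a _ _))
        (trans (*-cong (trans (sym (con-+ _ _)) (con-cong (R.-‿inverseˡ R.1#))) refl) (zeroˡ a)))

    algebra : Algebra R (c ⊔ x) (c ⊔ ℓ ⊔ x ⊔ r)
    algebra = record
      { ring = ring
      ; ι = con
      ; ι-isRingHomomorphism = mkRingHom R.ring ring con con-cong con-+ con-* refl
      ; ι-central = con-central }
      where
      ring = record
        { Carrier = Term X
        ; _≈_ = _≈_ ; _+_ = _+_ ; _*_ = _*_ ; -_ = -_ ; 0# = con R.0# ; 1# = con R.1#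
        ; isRing = record
          { +-isAbelianGroup = record
            { isGroup = record
              { isMonoid = record
                { isSemigroup = record
                  { isMagma = record
                    { isEquivalence = record { refl = refl ; sym = sym ; trans = trans }
                    ; ∙-cong = +-cong }
                  ; assoc = +-assoc }
                ; identity = +-identityˡ , (λ a → trans (+-comm a _) (+-identityˡ a)) }
              ; inverse = -‿inverseˡ , (λ a → trans (+-comm a _) (-‿inverseˡ a))
              ; ⁻¹-cong = *-cong refl }
            ; comm = +-comm }
          ; *-cong = *-cong
          ; *-assoc = *-assoc
          ; *-identity = *-identityˡ , (λ a → trans (sym (con-central R.1# a)) (*-identityˡ a))
          ; distrib = distribˡ , distribʳ } }

    module _ {b ℓb} (B : Algebra R b ℓb) where
      private module B = Algebra B

      evaluate : (X → B.Carrier) → Term X → B.Carrier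
      evaluate f (gen g) = f g
      evaluate f (con r) = B.ι r
      evaluate f (a + b) = evaluate f a B.+ evaluate f b
      evaluate f (a * b) = evaluate f a B.* evaluate f b

      module _ (f : X → B.Carrier)
               (f-relation : ∀ {a b} → Relation a b → evaluate f a B.≈ evaluate f b) where

        evaluate-cong : ∀ {a b} → a ≈ b → evaluate f a B.≈ evaluate f b
        evaluate-cong (relation r)      = f-relation r
        evaluate-cong refl              = B.refl
        evaluate-cong (sym e)           = B.sym (evaluate-cong e)
        evaluate-cong (trans e e′)      = B.trans (evaluate-cong e) (evaluate-cong e′)
        evaluate-cong (+-cong e e′)     = B.+-cong (evaluate-cong e) (evaluate-cong e′)
        evaluate-cong (*-cong e e′)     = B.*-cong (evaluate-cong e) (evaluate-cong e′)
        evaluate-cong (con-cong e)      = B.ι.⟦⟧-cong e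
        evaluate-cong (con-+ r s)       = B.ι.+-homo r s
        evaluate-cong (con-* r s)       = B.ι.*-homo r s
        evaluate-cong (con-central r a) = B.ι-central r _
        evaluate-cong (+-assoc a b d)   = B.+-assoc _ _ _
        evaluate-cong (+-comm a b)      = B.+-comm _ _
        evaluate-cong (+-identityˡ a)   = B.trans (B.+-congʳ B.ι.0#-homo) (B.+-identityˡ _)
        evaluate-cong (*-assoc a b d)   = B.*-assoc _ _ _
        evaluate-cong (*-identityˡ a)   = B.trans (B.*-congʳ B.ι.1#-homo) (B.*-identityˡ _)
        evaluate-cong (distribˡ a b d)  = B.distribˡ _ _ _
        evaluate-cong (distribʳ d a b)  = B.distribʳ _ _ _
        evaluate-cong (zeroˡ a)         = B.trans (B.*-congʳ B.ι.0#-homo) (B.trans (B.zeroˡ _) (B.sym B.ι.0#-homo))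

        extend : AlgebraHom algebra B
        extend = record
          { ⟦_⟧ = evaluate f
          ; isRingHomomorphism = mkRingHom (Algebra.ring algebra) B.ring (evaluate f) evaluate-cong
              (λ _ _ → B.refl) (λ _ _ → B.refl) B.ι.1#-homo
          ; ι-homo = λ _ → B.refl }

-- The R-subalgebra (R acting through ψ : R → S) of the S-algebra B generated by the g x.
-- Equality is that of B and ignores the proof of membership.
module GeneratedSubalgebra
  {c ℓ c′ ℓ′ b ℓb x} (R : CommutativeRing c ℓ) (S : CommutativeRing c′ ℓ′)
  (ψ : CommutativeRing.Carrier R → CommutativeRing.Carrier S)
  (ψ-hom : RingMorphisms.IsRingHomomorphism (CommutativeRing.rawRing R) (CommutativeRing.rawRing S) ψ)
  (B : Algebra S b ℓb) {X : Set x} (g : X → Algebra.Carrier B)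
  where
  private
    module R = CommutativeRing R
    module S = CommutativeRing S
    module B = Algebra B
    module ψ = RingMorphisms.IsRingHomomorphism ψ-hom

  data Generated : B.Carrier → Set (c ⊔ b ⊔ ℓb ⊔ x) where
    gen     : ∀ x → Generated (g x)
    scalar  : ∀ r → Generated (B.ι (ψ r))
    add     : ∀ {u w} → Generated u → Generated w → Generated (u B.+ w)
    mul     : ∀ {u w} → Generated u → Generated w → Generated (u B.* w)
    respect : ∀ {u w} → u B.≈ w → Generated u → Generated w

  private
    -1·≈- : ∀ u → B.ι (ψ (R.- R.1#)) B.* u B.≈ B.- u
    -1·≈- u = B.trans (B.*-congʳ (B.trans (B.ι.⟦⟧-cong (S.trans (ψ.-‿homo _) (S.-‿cong ψ.1#-homo)))
        (B.trans (B.ι.-‿homo _) (B.-‿cong B.ι.1#-homo)))) (-1*x≈-x u)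
      where open import Algebra.Properties.Ring B.ring using (-1*x≈-x)

  algebra : Algebra R (c ⊔ b ⊔ ℓb ⊔ x) ℓb
  algebra = record
    { ring = ring
    ; ι = λ r → B.ι (ψ r) , scalar r
    ; ι-isRingHomomorphism = mkRingHom R.ring ring _
        (λ e → B.ι.⟦⟧-cong (ψ.⟦⟧-cong e))
        (λ r s → B.trans (B.ι.⟦⟧-cong (ψ.+-homo r s)) (B.ι.+-homo _ _))
        (λ r s → B.trans (B.ι.⟦⟧-cong (ψ.*-homo r s)) (B.ι.*-homo _ _))
        (B.trans (B.ι.⟦⟧-cong ψ.1#-homo) B.ι.1#-homo)
    ; ι-central = λ r u → B.ι-central (ψ r) (proj₁ u) }
    where
    ring : Ring _ _
    ring = record
      { Carrier = Σ B.Carrier Generated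
      ; _≈_ = λ u w → proj₁ u B.≈ proj₁ w
      ; _+_ = λ { (u , p) (w , q) → u B.+ w , add p q }
      ; _*_ = λ { (u , p) (w , q) → u B.* w , mul p q }
      ; -_ = λ { (u , p) → B.- u , respect (-1·≈- u) (mul (scalar (R.- R.1#)) p) }
      ; 0# = B.0# , respect (B.trans (B.ι.⟦⟧-cong ψ.0#-homo) B.ι.0#-homo) (scalar R.0#)
      ; 1# = B.1# , respect (B.trans (B.ι.⟦⟧-cong ψ.1#-homo) B.ι.1#-homo) (scalar R.1#)
      ; isRing = record
        { +-isAbelianGroup = record
          { isGroup = record
            { isMonoid = record
              { isSemigroup = record
                { isMagma = record
                  { isEquivalence = record { refl = B.refl ; sym = B.sym ; trans = B.trans }
                  ; ∙-cong = B.+-cong }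
                ; assoc = λ _ _ _ → B.+-assoc _ _ _ }
              ; identity = (λ _ → B.+-identityˡ _) , (λ _ → B.+-identityʳ _) }
            ; inverse = (λ _ → B.-‿inverseˡ _) , (λ _ → B.-‿inverseʳ _)
            ; ⁻¹-cong = B.-‿cong }
          ; comm = λ _ _ → B.+-comm _ _ }
        ; *-cong = B.*-cong
        ; *-assoc = λ _ _ _ → B.*-assoc _ _ _
        ; *-identity = (λ _ → B.*-identityˡ _) , (λ _ → B.*-identityʳ _)
        ; distrib = (λ _ _ _ → B.distribˡ _ _ _) , (λ _ _ _ → B.distribʳ _ _ _) } }

-- The S-algebra B ⊗_R S, for S an R-algebra via φ.
module BaseChange
  {c ℓ c′ ℓ′ b ℓb} (R : CommutativeRing c ℓ) (S : CommutativeRing c′ ℓ′)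
  (φ : CommutativeRing.Carrier R → CommutativeRing.Carrier S)
  (φ-hom : RingMorphisms.IsRingHomomorphism (CommutativeRing.rawRing R) (CommutativeRing.rawRing S) φ)
  (B : Algebra R b ℓb)
  where
  private
    module R = CommutativeRing R
    module S = CommutativeRing S
    module B = Algebra B

  infixr 8 _⊗_
  infixl 7 _*_
  infixl 6 _+_
  infix  9 -_
  infix  4 _≈_

  data Tensor : Set (c′ ⊔ b) where
    _⊗_ : B.Carrier → S.Carrier → Tensor
    0#  : Tensor
    _+_ : Tensor → Tensor → Tensor
    -_  : Tensor → Tensor

  data _≈_ : Tensor → Tensor → Set (c ⊔ c′ ⊔ ℓ′ ⊔ b ⊔ ℓb) where
    refl        : ∀ {x} → x ≈ x
    sym         : ∀ {x y} → x ≈ y → y ≈ x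
    trans       : ∀ {x y z} → x ≈ y → y ≈ z → x ≈ z
    +-cong      : ∀ {x x′ y y′} → x ≈ x′ → y ≈ y′ → x + y ≈ x′ + y′
    -‿cong      : ∀ {x y} → x ≈ y → - x ≈ - y
    +-assoc     : ∀ x y z → (x + y) + z ≈ x + (y + z)
    +-comm      : ∀ x y → x + y ≈ y + x
    +-identityˡ : ∀ x → 0# + x ≈ x
    -‿inverseˡ  : ∀ x → - x + x ≈ 0#
    ⊗-cong      : ∀ {u u′ s s′} → u B.≈ u′ → s S.≈ s′ → u ⊗ s ≈ u′ ⊗ s′
    ⊗-distribʳ  : ∀ u u′ s → (u B.+ u′) ⊗ s ≈ u ⊗ s + u′ ⊗ s
    ⊗-distribˡ  : ∀ u s s′ → u ⊗ (s S.+ s′) ≈ u ⊗ s + u ⊗ s′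
    ⊗-balanced  : ∀ r u s → (B.ι r B.* u) ⊗ s ≈ u ⊗ (φ r S.* s)

  mulPure : B.Carrier → S.Carrier → Tensor → Tensor
  mulPure u s (w ⊗ r) = (u B.* w) ⊗ (s S.* r)
  mulPure u s 0#      = 0#
  mulPure u s (x + y) = mulPure u s x + mulPure u s y
  mulPure u s (- x)   = - mulPure u s x

  _*_ : Tensor → Tensor → Tensor
  (u ⊗ s) * y = mulPure u s y
  0#      * y = 0#
  (x + z) * y = x * y + z * y
  (- x)   * y = - (x * y)

  private
    +-abelianGroup : AbelianGroup _ _
    +-abelianGroup = record
      { Carrier = Tensor ; _≈_ = _≈_ ; _∙_ = _+_ ; ε = 0# ; _⁻¹ = -_
      ; isAbelianGroup = record
        { isGroup = record
          { isMonoid = record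
            { isSemigroup = record
              { isMagma = record
                { isEquivalence = record { refl = refl ; sym = sym ; trans = trans }
                ; ∙-cong = +-cong }
              ; assoc = +-assoc }
            ; identity = +-identityˡ , (λ x → trans (+-comm x _) (+-identityˡ x)) }
          ; inverse = -‿inverseˡ , (λ x → trans (+-comm x _) (-‿inverseˡ x))
          ; ⁻¹-cong = -‿cong }
        ; comm = +-comm } }

    open import Algebra.Properties.AbelianGroup +-abelianGroup using (⁻¹-∙-comm)
    open import Algebra.Properties.CommutativeSemigroup
      (CommutativeMonoid.commutativeSemigroup (AbelianGroup.commutativeMonoid +-abelianGroup)) using (interchange)

    neg-+ : ∀ x y → - (x + y) ≈ - x + - y
    neg-+ x y = sym (⁻¹-∙-comm x y)

    slide : ∀ u r w → u B.* (B.ι r B.* w) B.≈ B.ι r B.* (u B.* w)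
    slide u r w = B.trans (B.sym (B.*-assoc u _ w))
      (B.trans (B.*-congʳ (B.sym (B.ι-central r u))) (B.*-assoc _ u w))

    slideS : ∀ a s r → a S.* (s S.* r) S.≈ s S.* (a S.* r)
    slideS a s r = S.trans (S.sym (S.*-assoc a s r))
      (S.trans (S.*-congʳ (S.*-comm a s)) (S.*-assoc s a r))

    mulPure-congʳ : ∀ u s {x y} → x ≈ y → mulPure u s x ≈ mulPure u s y
    mulPure-congʳ u s refl              = refl
    mulPure-congʳ u s (sym e)           = sym (mulPure-congʳ u s e)
    mulPure-congʳ u s (trans e e′)      = trans (mulPure-congʳ u s e) (mulPure-congʳ u s e′)
    mulPure-congʳ u s (+-cong e e′)     = +-cong (mulPure-congʳ u s e) (mulPure-congʳ u s e′)
    mulPure-congʳ u s (-‿cong e)        = -‿cong (mulPure-congʳ u s e)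
    mulPure-congʳ u s (+-assoc x y z)   = +-assoc _ _ _
    mulPure-congʳ u s (+-comm x y)      = +-comm _ _
    mulPure-congʳ u s (+-identityˡ x)   = +-identityˡ _
    mulPure-congʳ u s (-‿inverseˡ x)    = -‿inverseˡ _
    mulPure-congʳ u s (⊗-cong e e′)     = ⊗-cong (B.*-congˡ e) (S.*-congˡ e′)
    mulPure-congʳ u s (⊗-distribʳ w w′ r) =
      trans (⊗-cong (B.distribˡ u w w′) S.refl) (⊗-distribʳ _ _ _)
    mulPure-congʳ u s (⊗-distribˡ w r r′) =
      trans (⊗-cong B.refl (S.distribˡ s r r′)) (⊗-distribˡ _ _ _)
    mulPure-congʳ u s (⊗-balanced a w r) =
      trans (⊗-cong (slide u a w) S.refl)
      (trans (⊗-balanced a (u B.* w) (s S.* r)) (⊗-cong B.refl (slideS (φ a) s r)))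

    mulPure-congˡ : ∀ {u u′ s s′} → u B.≈ u′ → s S.≈ s′ → ∀ y → mulPure u s y ≈ mulPure u′ s′ y
    mulPure-congˡ e e′ (w ⊗ r) = ⊗-cong (B.*-congʳ e) (S.*-congʳ e′)
    mulPure-congˡ e e′ 0#      = refl
    mulPure-congˡ e e′ (x + y) = +-cong (mulPure-congˡ e e′ x) (mulPure-congˡ e e′ y)
    mulPure-congˡ e e′ (- x)   = -‿cong (mulPure-congˡ e e′ x)

    mulPure-+ : ∀ u u′ s y → mulPure (u B.+ u′) s y ≈ mulPure u s y + mulPure u′ s y
    mulPure-+ u u′ s (w ⊗ r) = trans (⊗-cong (B.distribʳ w u u′) S.refl) (⊗-distribʳ _ _ _)
    mulPure-+ u u′ s 0#      = sym (+-identityˡ 0#)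
    mulPure-+ u u′ s (x + y) = trans (+-cong (mulPure-+ u u′ s x) (mulPure-+ u u′ s y)) (interchange _ _ _ _)
    mulPure-+ u u′ s (- x)   = trans (-‿cong (mulPure-+ u u′ s x)) (neg-+ _ _)

    mulPure-+ʳ : ∀ u s s′ y → mulPure u (s S.+ s′) y ≈ mulPure u s y + mulPure u s′ y
    mulPure-+ʳ u s s′ (w ⊗ r) = trans (⊗-cong B.refl (S.distribʳ r s s′)) (⊗-distribˡ _ _ _)
    mulPure-+ʳ u s s′ 0#      = sym (+-identityˡ 0#)
    mulPure-+ʳ u s s′ (x + y) = trans (+-cong (mulPure-+ʳ u s s′ x) (mulPure-+ʳ u s s′ y)) (interchange _ _ _ _)
    mulPure-+ʳ u s s′ (- x)   = trans (-‿cong (mulPure-+ʳ u s s′ x)) (neg-+ _ _)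

    mulPure-balanced : ∀ a u s y → mulPure (B.ι a B.* u) s y ≈ mulPure u (φ a S.* s) y
    mulPure-balanced a u s (w ⊗ r) = trans (⊗-cong (B.*-assoc _ _ _) S.refl)
      (trans (⊗-balanced a (u B.* w) (s S.* r)) (⊗-cong B.refl (S.sym (S.*-assoc _ _ _))))
    mulPure-balanced a u s 0#      = refl
    mulPure-balanced a u s (x + y) = +-cong (mulPure-balanced a u s x) (mulPure-balanced a u s y)
    mulPure-balanced a u s (- x)   = -‿cong (mulPure-balanced a u s x)

    *-congʳ : ∀ {x x′} → x ≈ x′ → ∀ y → x * y ≈ x′ * y
    *-congʳ refl                 y = refl
    *-congʳ (sym e)              y = sym (*-congʳ e y)
    *-congʳ (trans e e′)         y = trans (*-congʳ e y) (*-congʳ e′ y)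
    *-congʳ (+-cong e e′)        y = +-cong (*-congʳ e y) (*-congʳ e′ y)
    *-congʳ (-‿cong e)           y = -‿cong (*-congʳ e y)
    *-congʳ (+-assoc _ _ _)      y = +-assoc _ _ _
    *-congʳ (+-comm _ _)         y = +-comm _ _
    *-congʳ (+-identityˡ _)      y = +-identityˡ _
    *-congʳ (-‿inverseˡ _)       y = -‿inverseˡ _
    *-congʳ (⊗-cong e e′)        y = mulPure-congˡ e e′ y
    *-congʳ (⊗-distribʳ u u′ s)  y = mulPure-+ u u′ s y
    *-congʳ (⊗-distribˡ u s s′)  y = mulPure-+ʳ u s s′ y
    *-congʳ (⊗-balanced a u s)   y = mulPure-balanced a u s y

    *-congˡ : ∀ x {y y′} → y ≈ y′ → x * y ≈ x * y′
    *-congˡ (u ⊗ s) e = mulPure-congʳ u s e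
    *-congˡ 0#      e = refl
    *-congˡ (x + z) e = +-cong (*-congˡ x e) (*-congˡ z e)
    *-congˡ (- x)   e = -‿cong (*-congˡ x e)

    distribˡ : ∀ x y z → x * (y + z) ≈ x * y + x * z
    distribˡ (u ⊗ s) y z = refl
    distribˡ 0#      y z = sym (+-identityˡ 0#)
    distribˡ (x + w) y z = trans (+-cong (distribˡ x y z) (distribˡ w y z)) (interchange _ _ _ _)
    distribˡ (- x)   y z = trans (-‿cong (distribˡ x y z)) (neg-+ _ _)

    mulPure-mulPure : ∀ u s w r z → mulPure (u B.* w) (s S.* r) z ≈ mulPure u s (mulPure w r z)
    mulPure-mulPure u s w r (x ⊗ q) = ⊗-cong (B.*-assoc u w x) (S.*-assoc s r q)
    mulPure-mulPure u s w r 0#      = refl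
    mulPure-mulPure u s w r (x + y) = +-cong (mulPure-mulPure u s w r x) (mulPure-mulPure u s w r y)
    mulPure-mulPure u s w r (- x)   = -‿cong (mulPure-mulPure u s w r x)

    mulPure-* : ∀ u s y z → mulPure u s y * z ≈ mulPure u s (y * z)
    mulPure-* u s (w ⊗ r) z = mulPure-mulPure u s w r z
    mulPure-* u s 0#      z = refl
    mulPure-* u s (x + y) z = +-cong (mulPure-* u s x z) (mulPure-* u s y z)
    mulPure-* u s (- x)   z = -‿cong (mulPure-* u s x z)

    *-assoc : ∀ x y z → (x * y) * z ≈ x * (y * z)
    *-assoc (u ⊗ s) y z = mulPure-* u s y z
    *-assoc 0#      y z = refl
    *-assoc (x + w) y z = +-cong (*-assoc x y z) (*-assoc w y z)
    *-assoc (- x)   y z = -‿cong (*-assoc x y z)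

    *-identityˡ : ∀ x → mulPure B.1# S.1# x ≈ x
    *-identityˡ (u ⊗ s) = ⊗-cong (B.*-identityˡ u) (S.*-identityˡ s)
    *-identityˡ 0#      = refl
    *-identityˡ (x + y) = +-cong (*-identityˡ x) (*-identityˡ y)
    *-identityˡ (- x)   = -‿cong (*-identityˡ x)

    central : ∀ s x → mulPure B.1# s x ≈ x * (B.1# ⊗ s)
    central s (u ⊗ r) = ⊗-cong (B.trans (B.*-identityˡ u) (B.sym (B.*-identityʳ u))) (S.*-comm s r)
    central s 0#      = refl
    central s (x + y) = +-cong (central s x) (central s y)
    central s (- x)   = -‿cong (central s x)

  algebra : Algebra S (c′ ⊔ b) (c ⊔ c′ ⊔ ℓ′ ⊔ b ⊔ ℓb)
  algebra = record
    { ring = ring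
    ; ι = B.1# ⊗_
    ; ι-isRingHomomorphism = mkRingHom S.ring ring (B.1# ⊗_)
        (⊗-cong B.refl) (⊗-distribˡ B.1#)
        (λ _ _ → ⊗-cong (B.sym (B.*-identityˡ B.1#)) S.refl) refl
    ; ι-central = central }
    where
    ring : Ring _ _
    ring = record
      { Carrier = Tensor
      ; _≈_ = _≈_ ; _+_ = _+_ ; _*_ = _*_ ; -_ = -_ ; 0# = 0# ; 1# = B.1# ⊗ S.1#
      ; isRing = record
        { +-isAbelianGroup = AbelianGroup.isAbelianGroup +-abelianGroup
        ; *-cong = λ {x} {x′} {y} {y′} e e′ → trans (*-congʳ e y) (*-congˡ x′ e′)
        ; *-assoc = *-assoc
        ; *-identity = *-identityˡ , (λ x → trans (sym (central S.1# x)) (*-identityˡ x))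
        ; distrib = distribˡ , (λ _ _ _ → refl) } }

module Endomorphisms {c ℓ m ℓm} (R : CommutativeRing c ℓ)
                     (M : LeftModule (CommutativeRing.ring R) m ℓm) where
  private module R = CommutativeRing R
  open LeftModule M
  open LeftModuleMorphisms rawLeftModule rawLeftModule using (IsLeftModuleHomomorphism)

  record Endomorphism : Set (c ⊔ m ⊔ ℓm) where
    field
      ⟦_⟧                      : Carrierᴹ → Carrierᴹ
      isLeftModuleHomomorphism : IsLeftModuleHomomorphism ⟦_⟧
    open LeftModuleMorphisms.IsLeftModuleHomomorphism isLeftModuleHomomorphism public
  open Endomorphism

  mkEndomorphism : (f : Carrierᴹ → Carrierᴹ) →
                   (∀ {x y} → x ≈ᴹ y → f x ≈ᴹ f y) →
                   (∀ x y → f (x +ᴹ y) ≈ᴹ f x +ᴹ f y) →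
                   (∀ r x → f (r *ₗ x) ≈ᴹ r *ₗ f x) → Endomorphism
  mkEndomorphism f f-cong f-+ f-* = record
    { ⟦_⟧ = f
    ; isLeftModuleHomomorphism = record
      { +ᴹ-isGroupHomomorphism = record
        { isMonoidHomomorphism = record
          { isMagmaHomomorphism = record { isRelHomomorphism = record { cong = f-cong } ; homo = f-+ }
          ; ε-homo = f-0 }
        ; ⁻¹-homo = λ x → inverseˡ-unique _ _
            (≈ᴹ-trans (≈ᴹ-sym (f-+ _ x)) (≈ᴹ-trans (f-cong (-ᴹ‿inverseˡ x)) f-0)) }
      ; *ₗ-homo = f-* } }
    where
    open import Algebra.Properties.Group +ᴹ-group using (inverseˡ-unique)
    f-0 : f 0ᴹ ≈ᴹ 0ᴹ
    f-0 = ≈ᴹ-trans (f-cong (≈ᴹ-sym (*ₗ-zeroˡ 0ᴹ))) (≈ᴹ-trans (f-* R.0# 0ᴹ) (*ₗ-zeroˡ _))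

  private
    scaling : R.Carrier → Endomorphism
    scaling r = mkEndomorphism (r *ₗ_) (*ₗ-cong R.refl) (*ₗ-distribˡ r)
      (λ s x → ≈ᴹ-trans (≈ᴹ-sym (*ₗ-assoc r s x))
                 (≈ᴹ-trans (*ₗ-cong (R.*-comm r s) ≈ᴹ-refl) (*ₗ-assoc s r x)))

    open import Algebra.Properties.CommutativeSemigroup
      (CommutativeMonoid.commutativeSemigroup +ᴹ-commutativeMonoid) using (interchange)
    open import Algebra.Properties.AbelianGroup +ᴹ-abelianGroup using (⁻¹-∙-comm; inverseʳ-unique)

    -ᴹ-*ₗ : ∀ r x → -ᴹ (r *ₗ x) ≈ᴹ r *ₗ (-ᴹ x)
    -ᴹ-*ₗ r x = ≈ᴹ-sym (inverseʳ-unique _ _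
      (≈ᴹ-trans (≈ᴹ-sym (*ₗ-distribˡ r x _)) (≈ᴹ-trans (*ₗ-cong R.refl (-ᴹ‿inverseʳ x)) (*ₗ-zeroʳ r))))

  algebra : Algebra R (c ⊔ m ⊔ ℓm) (m ⊔ ℓm)
  algebra = record
    { ring = ring
    ; ι = scaling
    ; ι-isRingHomomorphism = mkRingHom R.ring ring scaling
        (λ e x → *ₗ-cong e ≈ᴹ-refl) (λ r s x → *ₗ-distribʳ x r s) (λ r s x → *ₗ-assoc r s x) *ₗ-identityˡ
    ; ι-central = λ r f x → ≈ᴹ-sym (*ₗ-homo f r x) }
    where
    ring : Ring _ _
    ring = record
      { Carrier = Endomorphism
      ; _≈_ = λ f g → ∀ x → ⟦ f ⟧ x ≈ᴹ ⟦ g ⟧ x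
      ; _+_ = λ f g → mkEndomorphism (λ x → ⟦ f ⟧ x +ᴹ ⟦ g ⟧ x)
          (λ e → +ᴹ-cong (⟦⟧-cong f e) (⟦⟧-cong g e))
          (λ x y → ≈ᴹ-trans (+ᴹ-cong (+ᴹ-homo f x y) (+ᴹ-homo g x y)) (interchange _ _ _ _))
          (λ r x → ≈ᴹ-trans (+ᴹ-cong (*ₗ-homo f r x) (*ₗ-homo g r x)) (≈ᴹ-sym (*ₗ-distribˡ r _ _)))
      ; _*_ = λ f g → mkEndomorphism (λ x → ⟦ f ⟧ (⟦ g ⟧ x))
          (λ e → ⟦⟧-cong f (⟦⟧-cong g e))
          (λ x y → ≈ᴹ-trans (⟦⟧-cong f (+ᴹ-homo g x y)) (+ᴹ-homo f _ _))
          (λ r x → ≈ᴹ-trans (⟦⟧-cong f (*ₗ-homo g r x)) (*ₗ-homo f r _))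
      ; -_ = λ f → mkEndomorphism (λ x → -ᴹ ⟦ f ⟧ x)
          (λ e → -ᴹ‿cong (⟦⟧-cong f e))
          (λ x y → ≈ᴹ-trans (-ᴹ‿cong (+ᴹ-homo f x y)) (≈ᴹ-sym (⁻¹-∙-comm _ _)))
          (λ r x → ≈ᴹ-trans (-ᴹ‿cong (*ₗ-homo f r x)) (-ᴹ-*ₗ r _))
      ; 0# = mkEndomorphism (λ _ → 0ᴹ) (λ _ → ≈ᴹ-refl)
          (λ _ _ → ≈ᴹ-sym (+ᴹ-identityˡ 0ᴹ)) (λ r _ → ≈ᴹ-sym (*ₗ-zeroʳ r))
      ; 1# = mkEndomorphism (λ x → x) (λ e → e) (λ _ _ → ≈ᴹ-refl) (λ _ _ → ≈ᴹ-refl)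
      ; isRing = record
        { +-isAbelianGroup = record
          { isGroup = record
            { isMonoid = record
              { isSemigroup = record
                { isMagma = record
                  { isEquivalence = record
                    { refl = λ _ → ≈ᴹ-refl
                    ; sym = λ e x → ≈ᴹ-sym (e x)
                    ; trans = λ e e′ x → ≈ᴹ-trans (e x) (e′ x) }
                  ; ∙-cong = λ e e′ x → +ᴹ-cong (e x) (e′ x) }
                ; assoc = λ _ _ _ _ → +ᴹ-assoc _ _ _ }
              ; identity = (λ _ _ → +ᴹ-identityˡ _) , (λ _ _ → +ᴹ-identityʳ _) }
            ; inverse = (λ _ _ → -ᴹ‿inverseˡ _) , (λ _ _ → -ᴹ‿inverseʳ _)
            ; ⁻¹-cong = λ e x → -ᴹ‿cong (e x) }
          ; comm = λ _ _ _ → +ᴹ-comm _ _ }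
        ; *-cong = λ {f} {f′} {g} {g′} e e′ x → ≈ᴹ-trans (⟦⟧-cong f (e′ x)) (e (⟦ g′ ⟧ x))
        ; *-assoc = λ _ _ _ _ → ≈ᴹ-refl
        ; *-identity = (λ _ _ → ≈ᴹ-refl) , (λ _ _ → ≈ᴹ-refl)
        ; distrib = (λ f g h x → +ᴹ-homo f _ _) , (λ _ _ _ _ → ≈ᴹ-refl) } }

-- The subalgebra of B of the elements that commute with every a x; for B = End(M)
-- and a : X → End(M) the action of an algebra X, this is End_X(M).
module Centralizer
  {c ℓ b ℓb x} {R : CommutativeRing c ℓ} (B : Algebra R b ℓb)
  {X : Set x} (a : X → Algebra.Carrier B)
  where
  private module B = Algebra B

  Commutes : B.Carrier → Set (x ⊔ ℓb)
  Commutes f = ∀ y → f B.* a y B.≈ a y B.* f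

  open import Algebra.Properties.Ring B.ring using (-‿distribˡ-*; -‿distribʳ-*)

  +-commutes : ∀ {f g} → Commutes f → Commutes g → Commutes (f B.+ g)
  +-commutes p q y = B.trans (B.distribʳ _ _ _) (B.trans (B.+-cong (p y) (q y)) (B.sym (B.distribˡ _ _ _)))

  *-commutes : ∀ {f g} → Commutes f → Commutes g → Commutes (f B.* g)
  *-commutes p q y = B.trans (B.*-assoc _ _ _) (B.trans (B.*-congˡ (q y))
    (B.trans (B.sym (B.*-assoc _ _ _)) (B.trans (B.*-congʳ (p y)) (B.*-assoc _ _ _))))

  neg-commutes : ∀ {f} → Commutes f → Commutes (B.- f)
  neg-commutes p y = B.trans (B.sym (-‿distribˡ-* _ _)) (B.trans (B.-‿cong (p y)) (-‿distribʳ-* _ _))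

  algebra : Algebra R (b ⊔ ℓb ⊔ x) ℓb
  algebra = record
    { ring = ring
    ; ι = λ r → B.ι r , (λ y → B.ι-central r (a y))
    ; ι-isRingHomomorphism = mkRingHom (CommutativeRing.ring R) ring _
        B.ι.⟦⟧-cong B.ι.+-homo B.ι.*-homo B.ι.1#-homo
    ; ι-central = λ r f → B.ι-central r (proj₁ f) }
    where
    ring : Ring _ _
    ring = record
      { Carrier = Σ B.Carrier Commutes
      ; _≈_ = λ f g → proj₁ f B.≈ proj₁ g
      ; _+_ = λ { (f , p) (g , q) → f B.+ g , +-commutes p q }
      ; _*_ = λ { (f , p) (g , q) → f B.* g , *-commutes p q }
      ; -_ = λ { (f , p) → B.- f , neg-commutes p }
      ; 0# = B.0# , (λ y → B.trans (B.zeroˡ _) (B.sym (B.zeroʳ _)))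
      ; 1# = B.1# , (λ y → B.trans (B.*-identityˡ _) (B.sym (B.*-identityʳ _)))
      ; isRing = record
        { +-isAbelianGroup = record
          { isGroup = record
            { isMonoid = record
              { isSemigroup = record
                { isMagma = record
                  { isEquivalence = record { refl = B.refl ; sym = B.sym ; trans = B.trans }
                  ; ∙-cong = B.+-cong }
                ; assoc = λ _ _ _ → B.+-assoc _ _ _ }
              ; identity = (λ _ → B.+-identityˡ _) , (λ _ → B.+-identityʳ _) }
            ; inverse = (λ _ → B.-‿inverseˡ _) , (λ _ → B.-‿inverseʳ _)
            ; ⁻¹-cong = B.-‿cong }
          ; comm = λ _ _ → B.+-comm _ _ }
        ; *-cong = B.*-cong
        ; *-assoc = λ _ _ _ → B.*-assoc _ _ _
        ; *-identity = (λ _ → B.*-identityˡ _) , (λ _ → B.*-identityʳ _)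
        ; distrib = (λ _ _ _ → B.distribˡ _ _ _) , (λ _ _ _ → B.distribʳ _ _ _) } }

-- V^{⊗n} for V = R x₀ ⊕ R x₁: a vector is the function giving its coordinates
-- with respect to the basis x_{i₁} ⊗ ⋯ ⊗ x_{iₙ}, indexed by words i₁ ∷ ⋯ ∷ iₙ.
module TensorPower {c ℓ} (R : CommutativeRing c ℓ) where
  open CommutativeRing R hiding (zero)
  open FromℤR.Solver R using (solve; _:=_; _:+_; _:*_; _:-_; :-_; con)

  Vector : ℕ → Set c
  Vector n = Vec (Fin 2) n → Carrier

  V^⊗ : ℕ → LeftModule ring c ℓ
  V^⊗ n = record
    { Carrierᴹ = Vector n
    ; _≈ᴹ_ = λ f g → ∀ w → f w ≈ g w
    ; _+ᴹ_ = λ f g w → f w + g w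
    ; _*ₗ_ = λ r f w → r * f w
    ; 0ᴹ = λ _ → 0#
    ; -ᴹ_ = λ f w → - f w
    ; isLeftModule = record
      { isLeftSemimodule = record
        { +ᴹ-isCommutativeMonoid = record
          { isMonoid = record
            { isSemigroup = record
              { isMagma = record
                { isEquivalence = record
                  { refl = λ _ → refl ; sym = λ e w → sym (e w) ; trans = λ e e′ w → trans (e w) (e′ w) }
                ; ∙-cong = λ e e′ w → +-cong (e w) (e′ w) }
              ; assoc = λ _ _ _ _ → +-assoc _ _ _ }
            ; identity = (λ _ _ → +-identityˡ _) , (λ _ _ → +-identityʳ _) }
          ; comm = λ _ _ _ → +-comm _ _ }
        ; isPreleftSemimodule = record
          { *ₗ-cong = λ e e′ w → *-cong e (e′ w)
          ; *ₗ-zeroˡ = λ _ _ → zeroˡ _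
          ; *ₗ-distribʳ = λ _ _ _ _ → distribʳ _ _ _
          ; *ₗ-identityˡ = λ _ _ → *-identityˡ _
          ; *ₗ-assoc = λ _ _ _ _ → *-assoc _ _ _
          ; *ₗ-zeroʳ = λ _ _ → zeroʳ _
          ; *ₗ-distribˡ = λ _ _ _ _ → distribˡ _ _ _ } }
      ; -ᴹ‿cong = λ e w → -‿cong (e w)
      ; -ᴹ‿inverse = (λ _ _ → -‿inverseˡ _) , (λ _ _ → -‿inverseʳ _) } }

  End : ℕ → Algebra R (c ⊔ ℓ) (c ⊔ ℓ)
  End n = Endomorphisms.algebra R (V^⊗ n)

  module End (n : ℕ) = Algebra (End n)
  open module Endo {n} = Endomorphisms R (V^⊗ n) using (Endomorphism; mkEndomorphism) public
  open module Apply {n} = Endomorphisms.Endomorphism {R = R} {M = V^⊗ n}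
    using (⟦_⟧; ⟦⟧-cong; +ᴹ-homo; *ₗ-homo) public

  infixl 6 _⊕_
  infixl 7 _∘_
  _⊕_ _∘_ : ∀ {n} (B C : Endomorphism {n}) → Endomorphism {n}
  _⊕_ {n} = End._+_ n
  _∘_ {n} = End._*_ n

  infix 4 _≋_
  _≋_ : ∀ {n} (B C : Endomorphism {n}) → Set (c ⊔ ℓ)
  _≋_ {n} = End._≈_ n

  1ᵒ 0ᵒ : ∀ n → Endomorphism {n}
  1ᵒ = End.1#
  0ᵒ = End.0#

  infixr 7 _•_
  _•_ : ∀ {n} → Carrier → Endomorphism {n} → Endomorphism {n}
  r • B = End.ι _ r ∘ B

  infixl 8 _↾_
  _↾_ : ∀ {n} → Vector (suc n) → Fin 2 → Vector n
  (f ↾ i) w = f (i ∷ w)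

  -- M i j is the coefficient of xᵢ in M xⱼ
  Matrix : Set c
  Matrix = Fin 2 → Fin 2 → Carrier

  matrix : (a b c d : Carrier) → Matrix
  matrix a b c d 0F 0F = a
  matrix a b c d 0F 1F = b
  matrix a b c d 1F 0F = c
  matrix a b c d 1F 1F = d

  linear₂ : ∀ {n} (B : Endomorphism {n}) α β x y w →
            ⟦ B ⟧ (λ w → α * x w + β * y w) w ≈ α * ⟦ B ⟧ x w + β * ⟦ B ⟧ y w
  linear₂ B α β x y w = trans (+ᴹ-homo B _ _ w) (+-cong (*ₗ-homo B α x w) (*ₗ-homo B β y w))

  linear₄ : ∀ {n} (B : Endomorphism {n}) α β γ δ x y z t w →
            ⟦ B ⟧ (λ w → (α * x w + β * y w) + (γ * z w + δ * t w)) w ≈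
            (α * ⟦ B ⟧ x w + β * ⟦ B ⟧ y w) + (γ * ⟦ B ⟧ z w + δ * ⟦ B ⟧ t w)
  linear₄ B α β γ δ x y z t w =
    trans (+ᴹ-homo B _ _ w) (+-cong (linear₂ B α β x y w) (linear₂ B γ δ z t w))

  infixr 8 _⊗ᵒ_
  _⊗ᵒ_ : ∀ {n} → Matrix → Endomorphism {n} → Endomorphism {suc n}
  M ⊗ᵒ B = mkEndomorphism
    (λ { f (i ∷ w) → M i 0F * ⟦ B ⟧ (f ↾ 0F) w + M i 1F * ⟦ B ⟧ (f ↾ 1F) w })
    (λ { e (i ∷ w) → +-cong (*-congˡ (⟦⟧-cong B (λ w → e (0F ∷ w)) w)) (*-congˡ (⟦⟧-cong B (λ w → e (1F ∷ w)) w)) })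
    (λ { f g (i ∷ w) → trans
      (+-cong (*-congˡ (+ᴹ-homo B (f ↾ 0F) (g ↾ 0F) w)) (*-congˡ (+ᴹ-homo B (f ↾ 1F) (g ↾ 1F) w)))
      (solve 6 (λ m n a b c d → m :* (a :+ b) :+ n :* (c :+ d) := (m :* a :+ n :* c) :+ (m :* b :+ n :* d)) refl
        (M i 0F) (M i 1F) _ _ _ _) })
    (λ { r f (i ∷ w) → trans
      (+-cong (*-congˡ (*ₗ-homo B r (f ↾ 0F) w)) (*-congˡ (*ₗ-homo B r (f ↾ 1F) w)))
      (solve 5 (λ m n r a b → m :* (r :* a) :+ n :* (r :* b) := r :* (m :* a :+ n :* b)) refl
        (M i 0F) (M i 1F) r _ _) })

  ⊗ᵒ-cong : ∀ {n} M {B C : Endomorphism {n}} → B ≋ C → M ⊗ᵒ B ≋ M ⊗ᵒ C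
  ⊗ᵒ-cong M e f (i ∷ w) = +-cong (*-congˡ (e _ w)) (*-congˡ (e _ w))

  -- A linear endomorphism is determined by its values on vectors whose
  -- coordinates are images under a homomorphism φ.
  module _ {a b} (S : CommutativeRing a b) (φ : CommutativeRing.Carrier S → Carrier)
           (φ-hom : RingMorphisms.IsRingHomomorphism (CommutativeRing.rawRing S) rawRing φ) where
    private
      module S = CommutativeRing S
      module φ = RingMorphisms.IsRingHomomorphism φ-hom

      record Functional (n : ℕ) : Set (c ⊔ ℓ) where
        field
          fun     : Vector n → Carrier
          fun-cong : ∀ {f g} → (∀ w → f w ≈ g w) → fun f ≈ fun g
          fun-+   : ∀ f g → fun (λ w → f w + g w) ≈ fun f + fun g
          fun-*   : ∀ r f → fun (λ w → r * f w) ≈ r * fun f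
      open Functional

      inject : ∀ {a} {A : Set a} {n} → A → Fin 2 → (Vec (Fin 2) n → A) → Vec (Fin 2) (suc n) → A
      inject 0′ 0F f (0F ∷ w) = f w
      inject 0′ 0F f (1F ∷ w) = 0′
      inject 0′ 1F f (0F ∷ w) = 0′
      inject 0′ 1F f (1F ∷ w) = f w

      restrict : ∀ {n} → Fin 2 → Functional (suc n) → Functional n
      restrict i L = record
        { fun = λ f → fun L (inject 0# i f)
        ; fun-cong = λ e → fun-cong L (inject-cong i e)
        ; fun-+ = λ f g → trans (fun-cong L (inject-+ i f g)) (fun-+ L _ _)
        ; fun-* = λ r f → trans (fun-cong L (inject-* i r f)) (fun-* L r _) }
        where
        inject-cong : ∀ {n} i {f g : Vector n} → (∀ w → f w ≈ g w) → ∀ w → inject 0# i f w ≈ inject 0# i g w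
        inject-cong 0F e (0F ∷ w) = e w
        inject-cong 0F e (1F ∷ w) = refl
        inject-cong 1F e (0F ∷ w) = refl
        inject-cong 1F e (1F ∷ w) = e w
        inject-+ : ∀ {n} i (f g : Vector n) w →
          inject 0# i (λ w → f w + g w) w ≈ inject 0# i f w + inject 0# i g w
        inject-+ 0F f g (0F ∷ w) = refl
        inject-+ 0F f g (1F ∷ w) = sym (+-identityˡ _)
        inject-+ 1F f g (0F ∷ w) = sym (+-identityˡ _)
        inject-+ 1F f g (1F ∷ w) = refl
        inject-* : ∀ {n} i r (f : Vector n) w →
          inject 0# i (λ w → r * f w) w ≈ r * inject 0# i f w
        inject-* 0F r f (0F ∷ w) = refl
        inject-* 0F r f (1F ∷ w) = sym (zeroʳ r)
        inject-* 1F r f (0F ∷ w) = sym (zeroʳ r)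
        inject-* 1F r f (1F ∷ w) = refl

      agree : ∀ {n} (L L′ : Functional n) →
              (∀ (f : Vec (Fin 2) n → S.Carrier) → fun L (λ w → φ (f w)) ≈ fun L′ (λ w → φ (f w))) →
              ∀ x → fun L x ≈ fun L′ x
      agree {zero} L L′ e x = begin
        fun L x                               ≈⟨ scalar L ⟩
        x [] * fun L (λ _ → φ S.1#)           ≈⟨ *-congˡ (e (λ _ → S.1#)) ⟩
        x [] * fun L′ (λ _ → φ S.1#)          ≈⟨ scalar L′ ⟨
        fun L′ x                              ∎
        where
        open import Relation.Binary.Reasoning.Setoid setoid
        scalar : ∀ L → fun L x ≈ x [] * fun L (λ _ → φ S.1#)
        scalar L = trans (fun-cong L (λ { [] → sym (trans (*-congˡ φ.1#-homo) (*-identityʳ _)) }))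
          (fun-* L (x []) _)
      agree {suc n} L L′ e x = begin
        fun L x     ≈⟨ split L ⟩
        _           ≈⟨ +-cong (agree (restrict 0F L) (restrict 0F L′) (e′ 0F) _)
                              (agree (restrict 1F L) (restrict 1F L′) (e′ 1F) _) ⟩
        _           ≈⟨ split L′ ⟨
        fun L′ x    ∎
        where
        open import Relation.Binary.Reasoning.Setoid setoid
        split : ∀ L → fun L x ≈ fun L (inject 0# 0F (x ↾ 0F)) + fun L (inject 0# 1F (x ↾ 1F))
        split L = trans
          (fun-cong L (λ { (0F ∷ w) → sym (+-identityʳ _) ; (1F ∷ w) → sym (+-identityˡ _) }))
          (fun-+ L _ _)
        φ-inject : ∀ i f w → inject {n = n} 0# i (λ w → φ (f w)) w ≈ φ (inject S.0# i f w)
        φ-inject 0F f (0F ∷ w) = refl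
        φ-inject 0F f (1F ∷ w) = sym φ.0#-homo
        φ-inject 1F f (0F ∷ w) = sym φ.0#-homo
        φ-inject 1F f (1F ∷ w) = refl
        e′ : ∀ i f → fun L (inject 0# i (λ w → φ (f w))) ≈ fun L′ (inject 0# i (λ w → φ (f w)))
        e′ i f = trans (fun-cong L (φ-inject i f)) (trans (e (inject S.0# i f)) (sym (fun-cong L′ (φ-inject i f))))

    ≋-from-image : ∀ {n} (B C : Endomorphism {n}) →
      (∀ (f : Vec (Fin 2) n → S.Carrier) w → ⟦ B ⟧ (λ w → φ (f w)) w ≈ ⟦ C ⟧ (λ w → φ (f w)) w) →
      B ≋ C
    ≋-from-image B C e x w = agree (at B) (at C) (λ f → e f w) x
      where
      at : Endomorphism → Functional _
      at B = record
        { fun = λ f → ⟦ B ⟧ f w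
        ; fun-cong = λ e → ⟦⟧-cong B e w
        ; fun-+ = λ f g → +ᴹ-homo B f g w
        ; fun-* = λ r f → *ₗ-homo B r f w }

module QuantumOperators
  {c ℓ} (R : CommutativeRing c ℓ) (q q⁻¹ : CommutativeRing.Carrier R)
  (q*q⁻¹≈1 : CommutativeRing._≈_ R (CommutativeRing._*_ R q q⁻¹) (CommutativeRing.1# R))
  where
  open CommutativeRing R hiding (zero)
  open FromℤR.Solver R using (solve; _:=_; _:+_; _:*_; _:-_; :-_; con)
  open TensorPower R
  open import Algebra.Properties.Semiring.Exp semiring using (_^_; ^-congˡ)
  open import Algebra.Properties.CommutativeSemiring.Exp commutativeSemiring using (^-distrib-*)
  open import Algebra.Properties.Semiring.Sum semiring using (sum; sum-cong-≋; *-distribˡ-sum)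
  open import Relation.Binary.Reasoning.Setoid setoid

  -- [j] = Σ_{k<j} q^{-(j-1)+2k}
  [_] : ℕ → Carrier
  [ j ] = sum {j} (λ k → q⁻¹ ^ (j ∸ 1) * q ^ (2 ℕ.* toℕ k))

  [_]! : ℕ → Carrier
  [ zero ]!  = 1#
  [ suc j ]! = [ j ]! * [ suc j ]

  cancel-q : ∀ x → q * (q⁻¹ * x) ≈ x
  cancel-q x = trans (sym (*-assoc q q⁻¹ x)) (trans (*-congʳ q*q⁻¹≈1) (*-identityˡ x))

  cancel-q⁻¹ : ∀ x → q⁻¹ * (q * x) ≈ x
  cancel-q⁻¹ x = trans (solve 3 (λ q p x → p :* (q :* x) := q :* (p :* x)) refl q q⁻¹ x) (cancel-q x)

  q^*q⁻¹^ : ∀ j → q ^ j * q⁻¹ ^ j ≈ 1#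
  q^*q⁻¹^ zero    = *-identityˡ 1#
  q^*q⁻¹^ (suc j) = begin
    (q * q ^ j) * (q⁻¹ * q⁻¹ ^ j)   ≈⟨ solve 4 (λ q p a b → (q :* a) :* (p :* b) := (q :* p) :* (a :* b)) refl q q⁻¹ (q ^ j) (q⁻¹ ^ j) ⟩
    (q * q⁻¹) * (q ^ j * q⁻¹ ^ j)   ≈⟨ *-cong q*q⁻¹≈1 (q^*q⁻¹^ j) ⟩
    1# * 1#                         ≈⟨ *-identityˡ 1# ⟩
    1#                              ∎

  [suc]ˡ : ∀ j → [ suc j ] ≈ q⁻¹ ^ j + q * [ j ]
  [suc]ˡ zero    = solve 1 (λ q → con 1ℤ :* con 1ℤ :+ con 0ℤ := con 1ℤ :+ q :* con 0ℤ) refl q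
  [suc]ˡ (suc j) = +-cong (*-identityʳ _) (begin
    sum {suc j} (λ k → q⁻¹ ^ suc j * q ^ (2 ℕ.* suc (toℕ k)))
      ≈⟨ sum-cong-≋ term ⟩
    sum {suc j} (λ k → q * (q⁻¹ ^ j * q ^ (2 ℕ.* toℕ k)))
      ≈⟨ *-distribˡ-sum {suc j} q (λ k → q⁻¹ ^ j * q ^ (2 ℕ.* toℕ k)) ⟨
    q * [ suc j ] ∎)
    where
    term : ∀ (k : Fin (suc j)) → q⁻¹ ^ suc j * q ^ (2 ℕ.* suc (toℕ k)) ≈ q * (q⁻¹ ^ j * q ^ (2 ℕ.* toℕ k))
    term k = begin
      q⁻¹ ^ suc j * q ^ (2 ℕ.* suc (toℕ k))
        ≡⟨ ≡.cong (λ m → q⁻¹ ^ suc j * q ^ m) (ℕ.*-suc 2 (toℕ k)) ⟩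
      (q⁻¹ * q⁻¹ ^ j) * (q * (q * q ^ (2 ℕ.* toℕ k)))
        ≈⟨ solve 4 (λ q p a b → (p :* a) :* (q :* (q :* b)) := q :* (p :* (q :* (a :* b)))) refl q q⁻¹ (q⁻¹ ^ j) (q ^ (2 ℕ.* toℕ k)) ⟩
      q * (q⁻¹ * (q * (q⁻¹ ^ j * q ^ (2 ℕ.* toℕ k))))
        ≈⟨ *-congˡ (cancel-q⁻¹ _) ⟩
      q * (q⁻¹ ^ j * q ^ (2 ℕ.* toℕ k)) ∎

  [suc]ʳ : ∀ j → [ suc j ] ≈ q ^ j + q⁻¹ * [ j ]
  [suc]ʳ zero    = solve 1 (λ q → con 1ℤ :* con 1ℤ :+ con 0ℤ := con 1ℤ :+ q :* con 0ℤ) refl q⁻¹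
  [suc]ʳ (suc j) = begin
    [ suc (suc j) ]
      ≈⟨ [suc]ˡ (suc j) ⟩
    q⁻¹ * q⁻¹ ^ j + q * [ suc j ]
      ≈⟨ +-congˡ (*-congˡ ([suc]ʳ j)) ⟩
    q⁻¹ * q⁻¹ ^ j + q * (q ^ j + q⁻¹ * [ j ])
      ≈⟨ solve 5 (λ q p a b x → p :* b :+ q :* (a :+ p :* x) := q :* a :+ (p :* b :+ q :* (p :* x))) refl q q⁻¹ (q ^ j) (q⁻¹ ^ j) [ j ] ⟩
    q * q ^ j + (q⁻¹ * q⁻¹ ^ j + q * (q⁻¹ * [ j ]))
      ≈⟨ +-congˡ (+-congˡ (trans (cancel-q _) (sym (cancel-q⁻¹ _)))) ⟩
    q * q ^ j + (q⁻¹ * q⁻¹ ^ j + q⁻¹ * (q * [ j ]))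
      ≈⟨ +-congˡ (sym (distribˡ q⁻¹ _ _)) ⟩
    q * q ^ j + q⁻¹ * (q⁻¹ ^ j + q * [ j ])
      ≈⟨ +-congˡ (*-congˡ ([suc]ˡ j)) ⟨
    q ^ suc j + q⁻¹ * [ suc j ] ∎

  E-matrix F-matrix 1-matrix : Matrix
  E-matrix = matrix 0# 1# 0# 0#
  F-matrix = matrix 0# 0# 1# 0#
  1-matrix = matrix 1# 0# 0# 1#

  -- The action on V^{⊗n} of a grouplike element that acts on V by diag(a,b).
  diagonal : Carrier → Carrier → ∀ n → Endomorphism {n}
  diagonal a b zero    = 1ᵒ 0
  diagonal a b (suc n) = matrix a 0# 0# b ⊗ᵒ diagonal a b n

  𝐊₁ 𝐊₁⁻¹ 𝐊₂ 𝐊₂⁻¹ 𝐊 𝐊⁻¹ : ∀ n → Endomorphism {n}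
  𝐊₁   = diagonal q 1#
  𝐊₁⁻¹ = diagonal q⁻¹ 1#
  𝐊₂   = diagonal 1# q
  𝐊₂⁻¹ = diagonal 1# q⁻¹
  𝐊    = diagonal q q⁻¹
  𝐊⁻¹  = diagonal q⁻¹ q

  -- From Δ(E) = E ⊗ 1 + K ⊗ E and Δ(F) = F ⊗ K⁻¹ + 1 ⊗ F; on V^{⊗0} through the counit.
  𝐄 𝐅 : ∀ n → Endomorphism {n}
  𝐄 zero    = 0ᵒ 0
  𝐄 (suc n) = E-matrix ⊗ᵒ 1ᵒ n ⊕ matrix q 0# 0# q⁻¹ ⊗ᵒ 𝐄 n
  𝐅 zero    = 0ᵒ 0
  𝐅 (suc n) = F-matrix ⊗ᵒ 𝐊⁻¹ n ⊕ 1-matrix ⊗ᵒ 𝐅 n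

  -- From Δ(E)ʲ/[j]! and Δ(F)ʲ/[j]!, with E² = F² = 0 on V:
  --   Δ(E⁽ʲ⁾) acts as Kʲ ⊗ E⁽ʲ⁾ + E ⊗ E⁽ʲ⁻¹⁾,
  --   Δ(F⁽ʲ⁾) acts as 1 ⊗ F⁽ʲ⁾ + qʲ⁻¹ F ⊗ F⁽ʲ⁻¹⁾K⁻¹;
  -- 𝐄∘𝐄⁽⁾ and 𝐅∘𝐅⁽⁾ below give 𝐄ʲ = [j]! 𝐄⁽ j ⁾ and 𝐅ʲ = [j]! 𝐅⁽ j ⁾.
  𝐄⁽_⁾ 𝐅⁽_⁾ : ℕ → ∀ n → Endomorphism {n}
  𝐄⁽ zero ⁾  n       = 1ᵒ n
  𝐄⁽ suc j ⁾ zero    = 0ᵒ 0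
  𝐄⁽ suc j ⁾ (suc n) = matrix (q ^ suc j) 0# 0# (q⁻¹ ^ suc j) ⊗ᵒ 𝐄⁽ suc j ⁾ n ⊕ E-matrix ⊗ᵒ 𝐄⁽ j ⁾ n
  𝐅⁽ zero ⁾  n       = 1ᵒ n
  𝐅⁽ suc j ⁾ zero    = 0ᵒ 0
  𝐅⁽ suc j ⁾ (suc n) = 1-matrix ⊗ᵒ 𝐅⁽ suc j ⁾ n ⊕ matrix 0# 0# (q ^ j) 0# ⊗ᵒ (𝐅⁽ j ⁾ n ∘ 𝐊⁻¹ n)

  private
    variable n : ℕ

    0ₗ : ∀ x y → x + 0# * y ≈ x
    0ₗ x y = trans (+-congˡ (zeroˡ y)) (+-identityʳ x)

  module _ (B : Endomorphism {n}) (f : Vector (suc n)) (w : Vec (Fin 2) n) where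

    diagonal-0 : ∀ a b → ⟦ B ⟧ (⟦ diagonal a b (suc n) ⟧ f ↾ 0F) w ≈ a * ⟦ B ⟧ (⟦ diagonal a b n ⟧ (f ↾ 0F)) w
    diagonal-0 a b = trans (linear₂ B a 0# _ _ w) (0ₗ _ _)

    diagonal-1 : ∀ a b → ⟦ B ⟧ (⟦ diagonal a b (suc n) ⟧ f ↾ 1F) w ≈ b * ⟦ B ⟧ (⟦ diagonal a b n ⟧ (f ↾ 1F)) w
    diagonal-1 a b = trans (linear₂ B 0# b _ _ w) (trans (+-comm _ _) (0ₗ _ _))

    𝐄-0 : ⟦ B ⟧ (⟦ 𝐄 (suc n) ⟧ f ↾ 0F) w ≈ q * ⟦ B ⟧ (⟦ 𝐄 n ⟧ (f ↾ 0F)) w + ⟦ B ⟧ (f ↾ 1F) w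
    𝐄-0 = trans (linear₄ B 0# 1# q 0# _ _ _ _ w)
      (solve 5 (λ q a b c d → (con 0ℤ :* a :+ con 1ℤ :* b) :+ (q :* c :+ con 0ℤ :* d) := q :* c :+ b) refl q _ _ _ _)

    𝐄-1 : ⟦ B ⟧ (⟦ 𝐄 (suc n) ⟧ f ↾ 1F) w ≈ q⁻¹ * ⟦ B ⟧ (⟦ 𝐄 n ⟧ (f ↾ 1F)) w
    𝐄-1 = trans (linear₄ B 0# 0# 0# q⁻¹ _ _ _ _ w)
      (solve 5 (λ q a b c d → (con 0ℤ :* a :+ con 0ℤ :* b) :+ (con 0ℤ :* c :+ q :* d) := q :* d) refl q⁻¹ _ _ _ _)

    𝐅-0 : ⟦ B ⟧ (⟦ 𝐅 (suc n) ⟧ f ↾ 0F) w ≈ ⟦ B ⟧ (⟦ 𝐅 n ⟧ (f ↾ 0F)) w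
    𝐅-0 = trans (linear₄ B 0# 0# 1# 0# _ _ _ _ w)
      (solve 4 (λ a b c d → (con 0ℤ :* a :+ con 0ℤ :* b) :+ (con 1ℤ :* c :+ con 0ℤ :* d) := c) refl _ _ _ _)

    𝐅-1 : ⟦ B ⟧ (⟦ 𝐅 (suc n) ⟧ f ↾ 1F) w ≈ ⟦ B ⟧ (⟦ 𝐊⁻¹ n ⟧ (f ↾ 0F)) w + ⟦ B ⟧ (⟦ 𝐅 n ⟧ (f ↾ 1F)) w
    𝐅-1 = trans (linear₄ B 1# 0# 0# 1# _ _ _ _ w)
      (solve 4 (λ a b c d → (con 1ℤ :* a :+ con 0ℤ :* b) :+ (con 0ℤ :* c :+ con 1ℤ :* d) := a :+ d) refl _ _ _ _)

    𝐄⁽⁾-0 : ∀ j → ⟦ B ⟧ (⟦ 𝐄⁽ suc j ⁾ (suc n) ⟧ f ↾ 0F) w ≈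
                  q ^ suc j * ⟦ B ⟧ (⟦ 𝐄⁽ suc j ⁾ n ⟧ (f ↾ 0F)) w + ⟦ B ⟧ (⟦ 𝐄⁽ j ⁾ n ⟧ (f ↾ 1F)) w
    𝐄⁽⁾-0 j = trans (linear₄ B (q ^ suc j) 0# 0# 1# _ _ _ _ w)
      (solve 5 (λ q a b c d → (q :* a :+ con 0ℤ :* b) :+ (con 0ℤ :* c :+ con 1ℤ :* d) := q :* a :+ d) refl (q ^ suc j) _ _ _ _)

    𝐄⁽⁾-1 : ∀ j → ⟦ B ⟧ (⟦ 𝐄⁽ suc j ⁾ (suc n) ⟧ f ↾ 1F) w ≈ q⁻¹ ^ suc j * ⟦ B ⟧ (⟦ 𝐄⁽ suc j ⁾ n ⟧ (f ↾ 1F)) w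
    𝐄⁽⁾-1 j = trans (linear₄ B 0# (q⁻¹ ^ suc j) 0# 0# _ _ _ _ w)
      (solve 5 (λ q a b c d → (con 0ℤ :* a :+ q :* b) :+ (con 0ℤ :* c :+ con 0ℤ :* d) := q :* b) refl (q⁻¹ ^ suc j) _ _ _ _)

    𝐅⁽⁾-0 : ∀ j → ⟦ B ⟧ (⟦ 𝐅⁽ suc j ⁾ (suc n) ⟧ f ↾ 0F) w ≈ ⟦ B ⟧ (⟦ 𝐅⁽ suc j ⁾ n ⟧ (f ↾ 0F)) w
    𝐅⁽⁾-0 j = trans (linear₄ B 1# 0# 0# 0# _ _ _ _ w)
      (solve 4 (λ a b c d → (con 1ℤ :* a :+ con 0ℤ :* b) :+ (con 0ℤ :* c :+ con 0ℤ :* d) := a) refl _ _ _ _)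

    𝐅⁽⁾-1 : ∀ j → ⟦ B ⟧ (⟦ 𝐅⁽ suc j ⁾ (suc n) ⟧ f ↾ 1F) w ≈
                  ⟦ B ⟧ (⟦ 𝐅⁽ suc j ⁾ n ⟧ (f ↾ 1F)) w + q ^ j * ⟦ B ⟧ (⟦ 𝐅⁽ j ⁾ n ⟧ (⟦ 𝐊⁻¹ n ⟧ (f ↾ 0F))) w
    𝐅⁽⁾-1 j = trans (linear₄ B 0# 1# (q ^ j) 0# _ _ _ _ w)
      (solve 5 (λ q a b c d → (con 0ℤ :* a :+ con 1ℤ :* b) :+ (q :* c :+ con 0ℤ :* d) := b :+ q :* c) refl (q ^ j) _ _ _ _)

  diagonal-cong : ∀ {a a′ b b′} → a ≈ a′ → b ≈ b′ → ∀ n → diagonal a b n ≋ diagonal a′ b′ n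
  diagonal-cong e e′ zero    f w        = refl
  diagonal-cong e e′ (suc n) f (0F ∷ w) = +-cong (*-cong e (diagonal-cong e e′ n _ w)) (trans (zeroˡ _) (sym (zeroˡ _)))
  diagonal-cong e e′ (suc n) f (1F ∷ w) = +-cong (trans (zeroˡ _) (sym (zeroˡ _))) (*-cong e′ (diagonal-cong e e′ n _ w))

  diagonal-∘ : ∀ a b a′ b′ n → diagonal a b n ∘ diagonal a′ b′ n ≋ diagonal (a * a′) (b * b′) n
  diagonal-∘ a b a′ b′ zero    f w        = refl
  diagonal-∘ a b a′ b′ (suc n) f (0F ∷ w) = begin
    _ ≈⟨ diagonal-0 (1ᵒ n) (⟦ diagonal a′ b′ (suc n) ⟧ f) w a b ⟩
    _ ≈⟨ *-congˡ (diagonal-0 (diagonal a b n) f w a′ b′) ⟩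
    _ ≈⟨ *-congˡ (*-congˡ (diagonal-∘ a b a′ b′ n _ w)) ⟩
    _ ≈⟨ *-assoc a a′ _ ⟨
    _ ≈⟨ diagonal-0 (1ᵒ n) f w (a * a′) (b * b′) ⟨
    _ ∎
  diagonal-∘ a b a′ b′ (suc n) f (1F ∷ w) = begin
    _ ≈⟨ diagonal-1 (1ᵒ n) (⟦ diagonal a′ b′ (suc n) ⟧ f) w a b ⟩
    _ ≈⟨ *-congˡ (diagonal-1 (diagonal a b n) f w a′ b′) ⟩
    _ ≈⟨ *-congˡ (*-congˡ (diagonal-∘ a b a′ b′ n _ w)) ⟩
    _ ≈⟨ *-assoc b b′ _ ⟨
    _ ≈⟨ diagonal-1 (1ᵒ n) f w (a * a′) (b * b′) ⟨
    _ ∎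

  diagonal-comm : ∀ a b a′ b′ n → diagonal a b n ∘ diagonal a′ b′ n ≋ diagonal a′ b′ n ∘ diagonal a b n
  diagonal-comm a b a′ b′ n f w = trans (diagonal-∘ a b a′ b′ n f w)
    (trans (diagonal-cong (*-comm a a′) (*-comm b b′) n f w) (sym (diagonal-∘ a′ b′ a b n f w)))

  diagonal-1-1 : ∀ n → diagonal 1# 1# n ≋ 1ᵒ n
  diagonal-1-1 zero    f w        = refl
  diagonal-1-1 (suc n) f (0F ∷ w) = trans (diagonal-0 (1ᵒ n) f w 1# 1#) (trans (*-identityˡ _) (diagonal-1-1 n _ w))
  diagonal-1-1 (suc n) f (1F ∷ w) = trans (diagonal-1 (1ᵒ n) f w 1# 1#) (trans (*-identityˡ _) (diagonal-1-1 n _ w))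

  diagonal-inverse : ∀ {a b a′ b′} → a * a′ ≈ 1# → b * b′ ≈ 1# → ∀ n → diagonal a b n ∘ diagonal a′ b′ n ≋ 1ᵒ n
  diagonal-inverse e e′ n f w = trans (diagonal-∘ _ _ _ _ n f w)
    (trans (diagonal-cong e e′ n f w) (diagonal-1-1 n f w))

  -- diag(a,b) E⁽ʲ⁾ = sʲ E⁽ʲ⁾ diag(a,b) for s = a/b, and diag(a,b) F⁽ʲ⁾ = sʲ F⁽ʲ⁾ diag(a,b) for s = b/a
  module _ {a b s : Carrier} where
    private D = diagonal a b

    diagonal-𝐄⁽⁾ : a ≈ s * b → ∀ j n → D n ∘ 𝐄⁽ j ⁾ n ≋ s ^ j • (𝐄⁽ j ⁾ n ∘ D n)
    diagonal-𝐄⁽⁾ e zero    n       f w        = sym (*-identityˡ _)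
    diagonal-𝐄⁽⁾ e (suc j) zero    f w        = sym (zeroʳ _)
    diagonal-𝐄⁽⁾ e (suc j) (suc n) f (0F ∷ w) = begin
      _ ≈⟨ diagonal-0 (1ᵒ n) (⟦ 𝐄⁽ suc j ⁾ (suc n) ⟧ f) w a b ⟩
      _ ≈⟨ *-congˡ (𝐄⁽⁾-0 (D n) f w j) ⟩
      a * (q ^ suc j * ⟦ D n ∘ 𝐄⁽ suc j ⁾ n ⟧ (f ↾ 0F) w + ⟦ D n ∘ 𝐄⁽ j ⁾ n ⟧ (f ↾ 1F) w)
        ≈⟨ *-congˡ (+-cong (*-congˡ (diagonal-𝐄⁽⁾ e (suc j) n _ w)) (diagonal-𝐄⁽⁾ e j n _ w)) ⟩
      a * (q ^ suc j * (s ^ suc j * X) + s ^ j * Y)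
        ≈⟨ solve 6 (λ a Q S S′ x y → a :* (Q :* (S :* x) :+ S′ :* y) := S :* (Q :* (a :* x)) :+ a :* (S′ :* y)) refl a (q ^ suc j) (s ^ suc j) (s ^ j) X Y ⟩
      s ^ suc j * (q ^ suc j * (a * X)) + a * (s ^ j * Y)
        ≈⟨ +-congˡ (*-congʳ e) ⟩
      s ^ suc j * (q ^ suc j * (a * X)) + (s * b) * (s ^ j * Y)
        ≈⟨ solve 7 (λ a b s Q S x y → (s :* S) :* (Q :* (a :* x)) :+ (s :* b) :* (S :* y) := (s :* S) :* (Q :* (a :* x) :+ b :* y)) refl a b s (q ^ suc j) (s ^ j) X Y ⟩
      s ^ suc j * (q ^ suc j * (a * X) + b * Y)
        ≈⟨ *-congˡ (+-cong (*-congˡ (diagonal-0 (𝐄⁽ suc j ⁾ n) f w a b)) (diagonal-1 (𝐄⁽ j ⁾ n) f w a b)) ⟨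
      _ ≈⟨ *-congˡ (𝐄⁽⁾-0 (1ᵒ n) (⟦ D (suc n) ⟧ f) w j) ⟨
      _ ∎
      where
      X = ⟦ 𝐄⁽ suc j ⁾ n ∘ D n ⟧ (f ↾ 0F) w
      Y = ⟦ 𝐄⁽ j ⁾ n ∘ D n ⟧ (f ↾ 1F) w
    diagonal-𝐄⁽⁾ e (suc j) (suc n) f (1F ∷ w) = begin
      _ ≈⟨ diagonal-1 (1ᵒ n) (⟦ 𝐄⁽ suc j ⁾ (suc n) ⟧ f) w a b ⟩
      _ ≈⟨ *-congˡ (𝐄⁽⁾-1 (D n) f w j) ⟩
      _ ≈⟨ *-congˡ (*-congˡ (diagonal-𝐄⁽⁾ e (suc j) n _ w)) ⟩
      _ ≈⟨ solve 4 (λ b Q S x → b :* (Q :* (S :* x)) := S :* (Q :* (b :* x))) refl b (q⁻¹ ^ suc j) (s ^ suc j) _ ⟩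
      _ ≈⟨ *-congˡ (*-congˡ (diagonal-1 (𝐄⁽ suc j ⁾ n) f w a b)) ⟨
      _ ≈⟨ *-congˡ (𝐄⁽⁾-1 (1ᵒ n) (⟦ D (suc n) ⟧ f) w j) ⟨
      _ ∎

    diagonal-𝐅⁽⁾ : b ≈ s * a → ∀ j n → D n ∘ 𝐅⁽ j ⁾ n ≋ s ^ j • (𝐅⁽ j ⁾ n ∘ D n)
    diagonal-𝐅⁽⁾ e zero    n       f w        = sym (*-identityˡ _)
    diagonal-𝐅⁽⁾ e (suc j) zero    f w        = sym (zeroʳ _)
    diagonal-𝐅⁽⁾ e (suc j) (suc n) f (0F ∷ w) = begin
      _ ≈⟨ diagonal-0 (1ᵒ n) (⟦ 𝐅⁽ suc j ⁾ (suc n) ⟧ f) w a b ⟩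
      _ ≈⟨ *-congˡ (𝐅⁽⁾-0 (D n) f w j) ⟩
      _ ≈⟨ *-congˡ (diagonal-𝐅⁽⁾ e (suc j) n _ w) ⟩
      _ ≈⟨ solve 3 (λ a S x → a :* (S :* x) := S :* (a :* x)) refl a (s ^ suc j) _ ⟩
      _ ≈⟨ *-congˡ (diagonal-0 (𝐅⁽ suc j ⁾ n) f w a b) ⟨
      _ ≈⟨ *-congˡ (𝐅⁽⁾-0 (1ᵒ n) (⟦ D (suc n) ⟧ f) w j) ⟨
      _ ∎
    diagonal-𝐅⁽⁾ e (suc j) (suc n) f (1F ∷ w) = begin
      _ ≈⟨ diagonal-1 (1ᵒ n) (⟦ 𝐅⁽ suc j ⁾ (suc n) ⟧ f) w a b ⟩
      _ ≈⟨ *-congˡ (𝐅⁽⁾-1 (D n) f w j) ⟩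
      b * (⟦ D n ∘ 𝐅⁽ suc j ⁾ n ⟧ (f ↾ 1F) w + q ^ j * ⟦ D n ∘ 𝐅⁽ j ⁾ n ⟧ (⟦ 𝐊⁻¹ n ⟧ (f ↾ 0F)) w)
        ≈⟨ *-congˡ (+-cong (diagonal-𝐅⁽⁾ e (suc j) n _ w) (*-congˡ (trans (diagonal-𝐅⁽⁾ e j n _ w)
             (*-congˡ (⟦⟧-cong (𝐅⁽ j ⁾ n) (diagonal-comm a b q⁻¹ q n (f ↾ 0F)) w))))) ⟩
      b * (s ^ suc j * X + q ^ j * (s ^ j * Y))
        ≈⟨ solve 6 (λ b Q S S′ x y → b :* (S :* x :+ Q :* (S′ :* y)) := S :* (b :* x) :+ b :* (Q :* (S′ :* y))) refl b (q ^ j) (s ^ suc j) (s ^ j) X Y ⟩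
      s ^ suc j * (b * X) + b * (q ^ j * (s ^ j * Y))
        ≈⟨ +-congˡ (*-congʳ e) ⟩
      s ^ suc j * (b * X) + (s * a) * (q ^ j * (s ^ j * Y))
        ≈⟨ solve 7 (λ a b s Q S x y → (s :* S) :* (b :* x) :+ (s :* a) :* (Q :* (S :* y)) := (s :* S) :* (b :* x :+ Q :* (a :* y))) refl a b s (q ^ j) (s ^ j) X Y ⟩
      s ^ suc j * (b * X + q ^ j * (a * Y))
        ≈⟨ *-congˡ (+-cong (diagonal-1 (𝐅⁽ suc j ⁾ n) f w a b) (*-congˡ (diagonal-0 (𝐅⁽ j ⁾ n ∘ 𝐊⁻¹ n) f w a b))) ⟨
      _ ≈⟨ *-congˡ (𝐅⁽⁾-1 (1ᵒ n) (⟦ D (suc n) ⟧ f) w j) ⟨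
      _ ∎
      where
      X = ⟦ 𝐅⁽ suc j ⁾ n ∘ D n ⟧ (f ↾ 1F) w
      Y = ⟦ 𝐅⁽ j ⁾ n ∘ (𝐊⁻¹ n ∘ D n) ⟧ (f ↾ 0F) w

  𝐄∘𝐄⁽⁾ : ∀ j n → 𝐄 n ∘ 𝐄⁽ j ⁾ n ≋ [ suc j ] • 𝐄⁽ suc j ⁾ n
  𝐄∘𝐄⁽⁾ j zero f w = sym (zeroʳ _)
  𝐄∘𝐄⁽⁾ zero (suc n) f (0F ∷ w) = begin
    _ ≈⟨ 𝐄-0 (1ᵒ n) f w ⟩
    q * ⟦ 𝐄 n ⟧ (f ↾ 0F) w + f (1F ∷ w)
      ≈⟨ +-congʳ (*-congˡ (𝐄∘𝐄⁽⁾ zero n _ w)) ⟩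
    q * ([ 1 ] * X) + f (1F ∷ w)
      ≈⟨ solve 3 (λ q x y → q :* ((con 1ℤ :* con 1ℤ :+ con 0ℤ) :* x) :+ y
           := (con 1ℤ :* con 1ℤ :+ con 0ℤ) :* ((q :* con 1ℤ) :* x :+ y)) refl q X (f (1F ∷ w)) ⟩
    [ 1 ] * (q ^ 1 * X + f (1F ∷ w))
      ≈⟨ *-congˡ (𝐄⁽⁾-0 (1ᵒ n) f w 0) ⟨
    _ ∎
    where X = ⟦ 𝐄⁽ 1 ⁾ n ⟧ (f ↾ 0F) w
  𝐄∘𝐄⁽⁾ zero (suc n) f (1F ∷ w) = begin
    _ ≈⟨ 𝐄-1 (1ᵒ n) f w ⟩
    _ ≈⟨ *-congˡ (𝐄∘𝐄⁽⁾ zero n _ w) ⟩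
    _ ≈⟨ solve 2 (λ q x → q :* ((con 1ℤ :* con 1ℤ :+ con 0ℤ) :* x)
           := (con 1ℤ :* con 1ℤ :+ con 0ℤ) :* ((q :* con 1ℤ) :* x)) refl q⁻¹ _ ⟩
    _ ≈⟨ *-congˡ (𝐄⁽⁾-1 (1ᵒ n) f w 0) ⟨
    _ ∎
  𝐄∘𝐄⁽⁾ (suc j) (suc n) f (0F ∷ w) = begin
    _ ≈⟨ 𝐄-0 (1ᵒ n) (⟦ 𝐄⁽ suc j ⁾ (suc n) ⟧ f) w ⟩
    _ ≈⟨ +-cong (*-congˡ (trans (𝐄⁽⁾-0 (𝐄 n) f w j)
           (+-cong (*-congˡ (𝐄∘𝐄⁽⁾ (suc j) n _ w)) (𝐄∘𝐄⁽⁾ j n _ w))))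
         (𝐄⁽⁾-1 (1ᵒ n) f w j) ⟩
    q * (q ^ suc j * ([ suc (suc j) ] * X) + [ suc j ] * Y) + q⁻¹ ^ suc j * Y
      ≈⟨ solve 7 (λ q Q J J′ N x y → q :* (Q :* (J′ :* x) :+ J :* y) :+ N :* y
           := J′ :* ((q :* Q) :* x) :+ (N :+ q :* J) :* y) refl q (q ^ suc j) [ suc j ] [ suc (suc j) ] (q⁻¹ ^ suc j) X Y ⟩
    [ suc (suc j) ] * (q ^ suc (suc j) * X) + (q⁻¹ ^ suc j + q * [ suc j ]) * Y
      ≈⟨ +-congˡ (*-congʳ ([suc]ˡ (suc j))) ⟨
    [ suc (suc j) ] * (q ^ suc (suc j) * X) + [ suc (suc j) ] * Y
      ≈⟨ distribˡ _ _ _ ⟨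
    [ suc (suc j) ] * (q ^ suc (suc j) * X + Y)
      ≈⟨ *-congˡ (𝐄⁽⁾-0 (1ᵒ n) f w (suc j)) ⟨
    _ ∎
    where
    X = ⟦ 𝐄⁽ suc (suc j) ⁾ n ⟧ (f ↾ 0F) w
    Y = ⟦ 𝐄⁽ suc j ⁾ n ⟧ (f ↾ 1F) w
  𝐄∘𝐄⁽⁾ (suc j) (suc n) f (1F ∷ w) = begin
    _ ≈⟨ 𝐄-1 (1ᵒ n) (⟦ 𝐄⁽ suc j ⁾ (suc n) ⟧ f) w ⟩
    _ ≈⟨ *-congˡ (trans (𝐄⁽⁾-1 (𝐄 n) f w j) (*-congˡ (𝐄∘𝐄⁽⁾ (suc j) n _ w))) ⟩
    _ ≈⟨ solve 4 (λ q N J x → q :* (N :* (J :* x)) := J :* ((q :* N) :* x)) refl q⁻¹ (q⁻¹ ^ suc j) [ suc (suc j) ] _ ⟩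
    _ ≈⟨ *-congˡ (𝐄⁽⁾-1 (1ᵒ n) f w (suc j)) ⟨
    _ ∎

  private
    q² = q * q

    𝐊⁻¹-𝐅⁽⁾ : ∀ j n → 𝐊⁻¹ n ∘ 𝐅⁽ j ⁾ n ≋ q² ^ j • (𝐅⁽ j ⁾ n ∘ 𝐊⁻¹ n)
    𝐊⁻¹-𝐅⁽⁾ = diagonal-𝐅⁽⁾ {q⁻¹} {q} {q²} (sym (trans (*-assoc q q q⁻¹) (trans (*-congˡ q*q⁻¹≈1) (*-identityʳ q))))

  𝐅∘𝐅⁽⁾ : ∀ j n → 𝐅 n ∘ 𝐅⁽ j ⁾ n ≋ [ suc j ] • 𝐅⁽ suc j ⁾ n
  𝐅∘𝐅⁽⁾ j zero f w = sym (zeroʳ _)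
  𝐅∘𝐅⁽⁾ zero (suc n) f (0F ∷ w) = begin
    _ ≈⟨ 𝐅-0 (1ᵒ n) f w ⟩
    _ ≈⟨ 𝐅∘𝐅⁽⁾ zero n _ w ⟩
    _ ≈⟨ *-congˡ (𝐅⁽⁾-0 (1ᵒ n) f w 0) ⟨
    _ ∎
  𝐅∘𝐅⁽⁾ zero (suc n) f (1F ∷ w) = begin
    _ ≈⟨ 𝐅-1 (1ᵒ n) f w ⟩
    _ ≈⟨ +-congˡ (𝐅∘𝐅⁽⁾ zero n _ w) ⟩
    _ ≈⟨ solve 2 (λ x y → x :+ (con 1ℤ :* con 1ℤ :+ con 0ℤ) :* y
           := (con 1ℤ :* con 1ℤ :+ con 0ℤ) :* (y :+ con 1ℤ :* x)) refl _ _ ⟩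
    _ ≈⟨ *-congˡ (𝐅⁽⁾-1 (1ᵒ n) f w 0) ⟨
    _ ∎
  𝐅∘𝐅⁽⁾ (suc j) (suc n) f (0F ∷ w) = begin
    _ ≈⟨ 𝐅-0 (1ᵒ n) (⟦ 𝐅⁽ suc j ⁾ (suc n) ⟧ f) w ⟩
    _ ≈⟨ 𝐅⁽⁾-0 (𝐅 n) f w j ⟩
    _ ≈⟨ 𝐅∘𝐅⁽⁾ (suc j) n _ w ⟩
    _ ≈⟨ *-congˡ (𝐅⁽⁾-0 (1ᵒ n) f w (suc j)) ⟨
    _ ∎
  𝐅∘𝐅⁽⁾ (suc j) (suc n) f (1F ∷ w) = begin
    _ ≈⟨ 𝐅-1 (1ᵒ n) (⟦ 𝐅⁽ suc j ⁾ (suc n) ⟧ f) w ⟩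
    _ ≈⟨ +-cong (trans (𝐅⁽⁾-0 (𝐊⁻¹ n) f w j) (𝐊⁻¹-𝐅⁽⁾ (suc j) n _ w))
                (trans (𝐅⁽⁾-1 (𝐅 n) f w j) (+-cong (𝐅∘𝐅⁽⁾ (suc j) n _ w) (*-congˡ (𝐅∘𝐅⁽⁾ j n _ w)))) ⟩
    q² ^ suc j * Y + ([ suc (suc j) ] * X + q ^ j * ([ suc j ] * Y))
      ≈⟨ +-cong (*-congʳ (^-distrib-* q q (suc j))) (+-congˡ (*-congʳ (sym (cancel-q⁻¹ (q ^ j))))) ⟩
    (q ^ suc j * q ^ suc j) * Y + ([ suc (suc j) ] * X + (q⁻¹ * q ^ suc j) * ([ suc j ] * Y))
      ≈⟨ solve 6 (λ p Q J J′ x y → (Q :* Q) :* y :+ (J′ :* x :+ (p :* Q) :* (J :* y))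
           := J′ :* x :+ (Q :+ p :* J) :* (Q :* y)) refl q⁻¹ (q ^ suc j) [ suc j ] [ suc (suc j) ] X Y ⟩
    [ suc (suc j) ] * X + (q ^ suc j + q⁻¹ * [ suc j ]) * (q ^ suc j * Y)
      ≈⟨ +-congˡ (*-congʳ ([suc]ʳ (suc j))) ⟨
    [ suc (suc j) ] * X + [ suc (suc j) ] * (q ^ suc j * Y)
      ≈⟨ distribˡ _ _ _ ⟨
    [ suc (suc j) ] * (X + q ^ suc j * Y)
      ≈⟨ *-congˡ (𝐅⁽⁾-1 (1ᵒ n) f w (suc j)) ⟨
    _ ∎
    where
    X = ⟦ 𝐅⁽ suc (suc j) ⁾ n ⟧ (f ↾ 1F) w
    Y = ⟦ 𝐅⁽ suc j ⁾ n ⟧ (⟦ 𝐊⁻¹ n ⟧ (f ↾ 0F)) w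

  -- If P j = 𝐄ʲ (or 𝐅ʲ) and c = 1/[j]!, then c • P j is the divided power.
  private
    divide : ∀ {n} (X : Endomorphism {n}) (D : ℕ → Endomorphism {n}) → D 0 ≋ 1ᵒ n →
             (∀ j → X ∘ D j ≋ [ suc j ] • D (suc j)) →
             (P : ℕ → Endomorphism {n}) → P 0 ≋ 1ᵒ n → (∀ j → P (suc j) ≋ X ∘ P j) →
             ∀ j c → c * [ j ]! ≈ 1# → D j ≋ c • P j
    divide X D D-0 D-suc P P-0 P-suc j c e f w = sym (begin
      c * ⟦ P j ⟧ f w                ≈⟨ *-congˡ (power j f w) ⟩
      c * ([ j ]! * ⟦ D j ⟧ f w)     ≈⟨ *-assoc c _ _ ⟨
      (c * [ j ]!) * ⟦ D j ⟧ f w     ≈⟨ trans (*-congʳ e) (*-identityˡ _) ⟩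
      ⟦ D j ⟧ f w                    ∎)
      where
      power : ∀ j → P j ≋ [ j ]! • D j
      power zero    f w = trans (P-0 f w) (trans (sym (D-0 f w)) (sym (*-identityˡ _)))
      power (suc j) f w = begin
        ⟦ P (suc j) ⟧ f w                         ≈⟨ P-suc j f w ⟩
        ⟦ X ⟧ (⟦ P j ⟧ f) w                       ≈⟨ ⟦⟧-cong X (power j f) w ⟩
        ⟦ X ⟧ (λ w → [ j ]! * ⟦ D j ⟧ f w) w      ≈⟨ *ₗ-homo X [ j ]! (⟦ D j ⟧ f) w ⟩
        [ j ]! * ⟦ X ∘ D j ⟧ f w                  ≈⟨ *-congˡ (D-suc j f w) ⟩
        [ j ]! * ([ suc j ] * ⟦ D (suc j) ⟧ f w)  ≈⟨ *-assoc _ _ _ ⟨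
        [ suc j ]! * ⟦ D (suc j) ⟧ f w            ∎

  𝐄-divide : ∀ n (P : ℕ → Endomorphism {n}) → P 0 ≋ 1ᵒ n → (∀ j → P (suc j) ≋ 𝐄 n ∘ P j) →
             ∀ j c → c * [ j ]! ≈ 1# → 𝐄⁽ j ⁾ n ≋ c • P j
  𝐄-divide n = divide (𝐄 n) (λ j → 𝐄⁽ j ⁾ n) (λ _ _ → refl) (λ j → 𝐄∘𝐄⁽⁾ j n)

  𝐅-divide : ∀ n (P : ℕ → Endomorphism {n}) → P 0 ≋ 1ᵒ n → (∀ j → P (suc j) ≋ 𝐅 n ∘ P j) →
             ∀ j c → c * [ j ]! ≈ 1# → 𝐅⁽ j ⁾ n ≋ c • P j
  𝐅-divide n = divide (𝐅 n) (λ j → 𝐅⁽ j ⁾ n) (λ _ _ → refl) (λ j → 𝐅∘𝐅⁽⁾ j n)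

  private
    [1]≈1 : [ 1 ] ≈ 1#
    [1]≈1 = solve 0 (con 1ℤ :* con 1ℤ :+ con 0ℤ := con 1ℤ) refl

  𝐄≋𝐄⁽1⁾ : ∀ n → 𝐄 n ≋ 𝐄⁽ 1 ⁾ n
  𝐄≋𝐄⁽1⁾ n f w = trans (𝐄∘𝐄⁽⁾ 0 n f w) (trans (*-congʳ [1]≈1) (*-identityˡ _))

  𝐅≋𝐅⁽1⁾ : ∀ n → 𝐅 n ≋ 𝐅⁽ 1 ⁾ n
  𝐅≋𝐅⁽1⁾ n f w = trans (𝐅∘𝐅⁽⁾ 0 n f w) (trans (*-congʳ [1]≈1) (*-identityˡ _))

  diagonal-𝐄 : ∀ {a b s} → a ≈ s * b → ∀ n → diagonal a b n ∘ 𝐄 n ≋ s • (𝐄 n ∘ diagonal a b n)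
  diagonal-𝐄 {a} {b} {s} e n f w = begin
    _ ≈⟨ ⟦⟧-cong (diagonal a b n) (𝐄≋𝐄⁽1⁾ n f) w ⟩
    _ ≈⟨ diagonal-𝐄⁽⁾ e 1 n f w ⟩
    _ ≈⟨ *-cong (*-identityʳ s) (sym (𝐄≋𝐄⁽1⁾ n _ w)) ⟩
    _ ∎

  diagonal-𝐅 : ∀ {a b s} → b ≈ s * a → ∀ n → diagonal a b n ∘ 𝐅 n ≋ s • (𝐅 n ∘ diagonal a b n)
  diagonal-𝐅 {a} {b} {s} e n f w = begin
    _ ≈⟨ ⟦⟧-cong (diagonal a b n) (𝐅≋𝐅⁽1⁾ n f) w ⟩
    _ ≈⟨ diagonal-𝐅⁽⁾ e 1 n f w ⟩
    _ ≈⟨ *-cong (*-identityʳ s) (sym (𝐅≋𝐅⁽1⁾ n _ w)) ⟩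
    _ ∎

  module _ (d : Carrier) (d-inverse : (q - q⁻¹) * d ≈ 1#) where

    𝐄𝐅-𝐅𝐄 : ∀ n f w → ⟦ 𝐄 n ∘ 𝐅 n ⟧ f w ≈ ⟦ 𝐅 n ∘ 𝐄 n ⟧ f w + d * (⟦ 𝐊 n ⟧ f w - ⟦ 𝐊⁻¹ n ⟧ f w)
    𝐄𝐅-𝐅𝐄 zero f w = solve 2 (λ d x → con 0ℤ := con 0ℤ :+ d :* (x :- x)) refl d (f w)
    𝐄𝐅-𝐅𝐄 (suc n) f (0F ∷ w) = begin
      _ ≈⟨ 𝐄-0 (1ᵒ n) (⟦ 𝐅 (suc n) ⟧ f) w ⟩
      _ ≈⟨ +-cong (*-congˡ (trans (𝐅-0 (𝐄 n) f w) (𝐄𝐅-𝐅𝐄 n _ w))) (𝐅-1 (1ᵒ n) f w) ⟩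
      q * (X + d * (k - k⁻)) + (k⁻ + Y)
        ≈⟨ +-congˡ (+-congʳ (trans (sym (*-identityˡ k⁻)) (*-congʳ (sym d-inverse)))) ⟩
      q * (X + d * (k - k⁻)) + ((q - q⁻¹) * d * k⁻ + Y)
        ≈⟨ solve 7 (λ q p d X Y k k⁻ → q :* (X :+ d :* (k :- k⁻)) :+ ((q :- p) :* d :* k⁻ :+ Y)
             := (q :* X :+ Y) :+ d :* (q :* k :- p :* k⁻)) refl q q⁻¹ d X Y k k⁻ ⟩
      (q * X + Y) + d * (q * k - q⁻¹ * k⁻)
        ≈⟨ +-cong (trans (𝐅-0 (1ᵒ n) (⟦ 𝐄 (suc n) ⟧ f) w) (𝐄-0 (𝐅 n) f w))
                  (*-congˡ (+-cong (diagonal-0 (1ᵒ n) f w q q⁻¹) (-‿cong (diagonal-0 (1ᵒ n) f w q⁻¹ q)))) ⟨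
      _ ∎
      where
      X = ⟦ 𝐅 n ∘ 𝐄 n ⟧ (f ↾ 0F) w
      Y = ⟦ 𝐅 n ⟧ (f ↾ 1F) w
      k = ⟦ 𝐊 n ⟧ (f ↾ 0F) w
      k⁻ = ⟦ 𝐊⁻¹ n ⟧ (f ↾ 0F) w
    𝐄𝐅-𝐅𝐄 (suc n) f (1F ∷ w) = begin
      _ ≈⟨ 𝐄-1 (1ᵒ n) (⟦ 𝐅 (suc n) ⟧ f) w ⟩
      _ ≈⟨ *-congˡ (trans (𝐅-1 (𝐄 n) f w) (+-congˡ (𝐄𝐅-𝐅𝐄 n _ w))) ⟩
      q⁻¹ * (A + (X + d * (k - k⁻)))
        ≈⟨ solve 6 (λ p d X A k k⁻ → p :* (A :+ (X :+ d :* (k :- k⁻))) := p :* A :+ p :* X :+ d :* (p :* k :- p :* k⁻)) refl q⁻¹ d X A k k⁻ ⟩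
      q⁻¹ * A + q⁻¹ * X + d * (q⁻¹ * k - q⁻¹ * k⁻)
        ≈⟨ solve 7 (λ q p d Z X k k⁻ → Z :+ p :* X :+ d :* (p :* k :- p :* k⁻)
             := Z :+ (q :- p) :* d :* k⁻ :+ p :* X :+ d :* (p :* k :- q :* k⁻)) refl q q⁻¹ d (q⁻¹ * A) X k k⁻ ⟩
      q⁻¹ * A + (q - q⁻¹) * d * k⁻ + q⁻¹ * X + d * (q⁻¹ * k - q * k⁻)
        ≈⟨ +-congʳ (+-congʳ (+-cong (sym qC) (trans (*-congʳ d-inverse) (*-identityˡ k⁻)))) ⟩
      q * C + k⁻ + q⁻¹ * X + d * (q⁻¹ * k - q * k⁻)
        ≈⟨ +-cong (trans (𝐅-1 (1ᵒ n) (⟦ 𝐄 (suc n) ⟧ f) w) (+-cong (𝐄-0 (𝐊⁻¹ n) f w) (𝐄-1 (𝐅 n) f w)))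
                  (*-congˡ (+-cong (diagonal-1 (1ᵒ n) f w q q⁻¹) (-‿cong (diagonal-1 (1ᵒ n) f w q⁻¹ q)))) ⟨
      _ ∎
      where
      A = ⟦ 𝐄 n ∘ 𝐊⁻¹ n ⟧ (f ↾ 0F) w
      C = ⟦ 𝐊⁻¹ n ∘ 𝐄 n ⟧ (f ↾ 0F) w
      X = ⟦ 𝐅 n ∘ 𝐄 n ⟧ (f ↾ 1F) w
      k = ⟦ 𝐊 n ⟧ (f ↾ 1F) w
      k⁻ = ⟦ 𝐊⁻¹ n ⟧ (f ↾ 1F) w
      qC : q * C ≈ q⁻¹ * A
      qC = begin
        q * C               ≈⟨ *-congˡ (diagonal-𝐄 {s = q⁻¹ * q⁻¹} (sym (trans (*-assoc _ _ _)
                                 (trans (*-congˡ (trans (*-comm _ _) q*q⁻¹≈1)) (*-identityʳ _)))) n _ w) ⟩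
        q * (q⁻¹ * q⁻¹ * A) ≈⟨ trans (*-congˡ (*-assoc _ _ _)) (cancel-q _) ⟩
        q⁻¹ * A             ∎

module Naturality
  {c ℓ c′ ℓ′} (R : CommutativeRing c ℓ) (S : CommutativeRing c′ ℓ′)
  (φ : CommutativeRing.Carrier R → CommutativeRing.Carrier S)
  (φ-hom : RingMorphisms.IsRingHomomorphism (CommutativeRing.rawRing R) (CommutativeRing.rawRing S) φ)
  (q q⁻¹ : CommutativeRing.Carrier R)
  (q*q⁻¹≈1 : CommutativeRing._≈_ R (CommutativeRing._*_ R q q⁻¹) (CommutativeRing.1# R))
  (r r⁻¹ : CommutativeRing.Carrier S)
  (r*r⁻¹≈1 : CommutativeRing._≈_ S (CommutativeRing._*_ S r r⁻¹) (CommutativeRing.1# S))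
  (φq≈r : CommutativeRing._≈_ S (φ q) r) (φq⁻¹≈r⁻¹ : CommutativeRing._≈_ S (φ q⁻¹) r⁻¹)
  where
  private
    module R = CommutativeRing R
    module S = CommutativeRing S
    module φ = RingMorphisms.IsRingHomomorphism φ-hom
    module TR = TensorPower R
    module TS = TensorPower S
    module QR = QuantumOperators R q q⁻¹ q*q⁻¹≈1
    module QS = QuantumOperators S r r⁻¹ r*r⁻¹≈1
    open import Algebra.Properties.Semiring.Exp R.semiring using () renaming (_^_ to _^R_)
    open import Algebra.Properties.Semiring.Exp S.semiring using () renaming (_^_ to _^S_)

  φ-^ : ∀ {x y} → φ x S.≈ y → ∀ j → φ (x ^R j) S.≈ y ^S j
  φ-^ e zero    = φ.1#-homo
  φ-^ e (suc j) = S.trans (φ.*-homo _ _) (S.*-cong e (φ-^ e j))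

  φ-[_] : ∀ j → φ QR.[ j ] S.≈ QS.[ j ]
  φ-[ zero ]  = φ.0#-homo
  φ-[ suc j ] = S.trans (φ.⟦⟧-cong (QR.[suc]ˡ j)) (S.trans (φ.+-homo _ _)
    (S.trans (S.+-cong (φ-^ φq⁻¹≈r⁻¹ j) (S.trans (φ.*-homo _ _) (S.*-cong φq≈r φ-[ j ])))
      (S.sym (QS.[suc]ˡ j))))

  φ-[_]! : ∀ j → φ QR.[ j ]! S.≈ QS.[ j ]!
  φ-[ zero ]!  = φ.1#-homo
  φ-[ suc j ]! = S.trans (φ.*-homo _ _) (S.*-cong φ-[ j ]! φ-[ suc j ])

  Natural : ∀ {n} → TR.Endomorphism {n} → TS.Endomorphism {n} → Set _
  Natural B C = ∀ f w → φ (TR.⟦ B ⟧ f w) S.≈ TS.⟦ C ⟧ (λ w → φ (f w)) w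

  natural-∘ : ∀ {n} {B B′ : TR.Endomorphism {n}} {C C′ : TS.Endomorphism {n}} →
              Natural B C → Natural B′ C′ → Natural (B TR.∘ B′) (C TS.∘ C′)
  natural-∘ {C = C} N N′ f w = S.trans (N _ w) (TS.⟦⟧-cong C (N′ f) w)

  natural-⊕ : ∀ {n} {B B′ : TR.Endomorphism {n}} {C C′ : TS.Endomorphism {n}} →
              Natural B C → Natural B′ C′ → Natural (B TR.⊕ B′) (C TS.⊕ C′)
  natural-⊕ N N′ f w = S.trans (φ.+-homo _ _) (S.+-cong (N f w) (N′ f w))

  natural-1 : ∀ {n} → Natural (TR.1ᵒ n) (TS.1ᵒ n)
  natural-1 f w = S.refl

  natural-0 : ∀ {n} → Natural (TR.0ᵒ n) (TS.0ᵒ n)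
  natural-0 f w = φ.0#-homo

  natural-⊗ : ∀ {n} (M : TR.Matrix) (N : TS.Matrix) {B : TR.Endomorphism {n}} {C : TS.Endomorphism {n}} →
              (∀ i j → φ (M i j) S.≈ N i j) → Natural B C → Natural (M TR.⊗ᵒ B) (N TS.⊗ᵒ C)
  natural-⊗ M N e N′ f (i ∷ w) = S.trans (φ.+-homo _ _) (S.+-cong
    (S.trans (φ.*-homo _ _) (S.*-cong (e i 0F) (N′ _ w)))
    (S.trans (φ.*-homo _ _) (S.*-cong (e i 1F) (N′ _ w))))

  natural-matrix : ∀ {a b c d a′ b′ c′ d′} → φ a S.≈ a′ → φ b S.≈ b′ → φ c S.≈ c′ → φ d S.≈ d′ →
                   ∀ i j → φ (TR.matrix a b c d i j) S.≈ TS.matrix a′ b′ c′ d′ i j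
  natural-matrix e₁ e₂ e₃ e₄ 0F 0F = e₁
  natural-matrix e₁ e₂ e₃ e₄ 0F 1F = e₂
  natural-matrix e₁ e₂ e₃ e₄ 1F 0F = e₃
  natural-matrix e₁ e₂ e₃ e₄ 1F 1F = e₄

  private
    0≈ = φ.0#-homo
    1≈ = φ.1#-homo

  natural-diagonal : ∀ {a b a′ b′} → φ a S.≈ a′ → φ b S.≈ b′ → ∀ n →
                     Natural (QR.diagonal a b n) (QS.diagonal a′ b′ n)
  natural-diagonal e e′ zero    = natural-1
  natural-diagonal e e′ (suc n) = natural-⊗ _ _ {QR.diagonal _ _ n} {QS.diagonal _ _ n}
    (natural-matrix e 0≈ 0≈ e′) (natural-diagonal e e′ n)

  natural-𝐄⁽⁾ : ∀ j n → Natural (QR.𝐄⁽ j ⁾ n) (QS.𝐄⁽ j ⁾ n)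
  natural-𝐄⁽⁾ zero    n       = natural-1
  natural-𝐄⁽⁾ (suc j) zero    = natural-0 {0}
  natural-𝐄⁽⁾ (suc j) (suc n) = natural-⊕
    {B = TR.matrix (q ^R suc j) R.0# R.0# (q⁻¹ ^R suc j) TR.⊗ᵒ QR.𝐄⁽ suc j ⁾ n} {QR.E-matrix TR.⊗ᵒ QR.𝐄⁽ j ⁾ n}
    {TS.matrix (r ^S suc j) S.0# S.0# (r⁻¹ ^S suc j) TS.⊗ᵒ QS.𝐄⁽ suc j ⁾ n} {QS.E-matrix TS.⊗ᵒ QS.𝐄⁽ j ⁾ n}
    (natural-⊗ _ _ {QR.𝐄⁽ suc j ⁾ n} {QS.𝐄⁽ suc j ⁾ n}
      (natural-matrix (φ-^ φq≈r (suc j)) 0≈ 0≈ (φ-^ φq⁻¹≈r⁻¹ (suc j))) (natural-𝐄⁽⁾ (suc j) n))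
    (natural-⊗ _ _ {QR.𝐄⁽ j ⁾ n} {QS.𝐄⁽ j ⁾ n} (natural-matrix 0≈ 1≈ 0≈ 0≈) (natural-𝐄⁽⁾ j n))

  natural-𝐅⁽⁾ : ∀ j n → Natural (QR.𝐅⁽ j ⁾ n) (QS.𝐅⁽ j ⁾ n)
  natural-𝐅⁽⁾ zero    n       = natural-1
  natural-𝐅⁽⁾ (suc j) zero    = natural-0 {0}
  natural-𝐅⁽⁾ (suc j) (suc n) = natural-⊕
    {B = QR.1-matrix TR.⊗ᵒ QR.𝐅⁽ suc j ⁾ n} {TR.matrix R.0# R.0# (q ^R j) R.0# TR.⊗ᵒ (QR.𝐅⁽ j ⁾ n TR.∘ QR.𝐊⁻¹ n)}
    {QS.1-matrix TS.⊗ᵒ QS.𝐅⁽ suc j ⁾ n} {TS.matrix S.0# S.0# (r ^S j) S.0# TS.⊗ᵒ (QS.𝐅⁽ j ⁾ n TS.∘ QS.𝐊⁻¹ n)}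
    (natural-⊗ _ _ {QR.𝐅⁽ suc j ⁾ n} {QS.𝐅⁽ suc j ⁾ n} (natural-matrix 1≈ 0≈ 0≈ 1≈) (natural-𝐅⁽⁾ (suc j) n))
    (natural-⊗ _ _ {QR.𝐅⁽ j ⁾ n TR.∘ QR.𝐊⁻¹ n} {QS.𝐅⁽ j ⁾ n TS.∘ QS.𝐊⁻¹ n} (natural-matrix 0≈ 0≈ (φ-^ φq≈r j) 0≈)
      (natural-∘ {B = QR.𝐅⁽ j ⁾ n} {QR.𝐊⁻¹ n} {QS.𝐅⁽ j ⁾ n} {QS.𝐊⁻¹ n}
        (natural-𝐅⁽⁾ j n) (natural-diagonal φq⁻¹≈r⁻¹ φq≈r n)))

data LieAlgebra : Set where
  gl₂ sl₂ : LieAlgebra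

module 𝒜-Quantum = QuantumOperators 𝒜 𝐭 𝐭⁻¹ 𝐭*𝐭⁻¹≈1
open 𝒜-Quantum public using () renaming ([_]! to [_]ₜ!)

-- At t = 1 the quantum factorial becomes a nonzero integer.
[_]ₜ!≉0 : ∀ j → ¬ [ j ]ₜ! 𝒜.≈ 𝒜.0#
[ j ]ₜ!≉0 e = nonzero j (≡.trans (≡.sym φ-[ j ]!) (≡.trans (φ.⟦⟧-cong e) φ.0#-homo))
  where
  open Specialization ℤ.+-*-commutativeRing 1ℤ 1ℤ ≡.refl
  module φ = RingMorphisms.IsRingHomomorphism specialize-isRingHomomorphism
  open Naturality 𝒜 ℤ.+-*-commutativeRing specialize specialize-isRingHomomorphism
    𝐭 𝐭⁻¹ 𝐭*𝐭⁻¹≈1 1ℤ 1ℤ ≡.refl specialize-t specialize-t⁻¹ using (φ-[_]!)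
  module Q = QuantumOperators ℤ.+-*-commutativeRing 1ℤ 1ℤ ≡.refl
  open import Algebra.Properties.Semiring.Exp ℤ.+-*-semiring using (_^_)
  1^ : ∀ j → 1ℤ ^ j ≡ 1ℤ
  1^ zero    = ≡.refl
  1^ (suc j) = ≡.trans (ℤ.*-identityˡ _) (1^ j)
  [_]≡ : ∀ j → Q.[ j ] ≡ + j
  [ zero ]≡  = ≡.refl
  [ suc j ]≡ = ≡.trans (Q.[suc]ˡ j) (≡.cong₂ ℤ._+_ (1^ j) (≡.trans (ℤ.*-identityˡ _) [ j ]≡))
  nonzero : ∀ j → ¬ Q.[ j ]! ≡ 0ℤ
  nonzero zero    ()
  nonzero (suc j) e = [ nonzero j , (λ h → suc≢0 (≡.trans (≡.sym [ suc j ]≡) h)) ]′ (ℤ.i*j≡0⇒i≡0∨j≡0 Q.[ j ]! e)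
    where
    suc≢0 : ¬ + suc j ≡ 0ℤ
    suc≢0 ()

opaque
  unfolding LaurentRing.add

  t-t⁻¹≉0 : ¬ 𝐭 𝒜.- 𝐭⁻¹ 𝒜.≈ 𝒜.0#
  t-t⁻¹≉0 e with () ← Polynomial._≈_.at (LaurentRing.num≈0 {𝐭 𝒜.- 𝐭⁻¹} e) 0

module OperatorRelations
  {c ℓ} (R : CommutativeRing c ℓ) (q q⁻¹ : CommutativeRing.Carrier R)
  (q*q⁻¹≈1 : CommutativeRing._≈_ R (CommutativeRing._*_ R q q⁻¹) (CommutativeRing.1# R))
  (n : ℕ)
  where
  open CommutativeRing R hiding (zero)
  open TensorPower R
  open QuantumOperators R q q⁻¹ q*q⁻¹≈1
  open import Algebra.Properties.Ring ring using (-1*x≈-x)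
  open import Relation.Binary.Reasoning.Setoid setoid

  private
    q⁻¹*q≈1 : q⁻¹ * q ≈ 1#
    q⁻¹*q≈1 = trans (*-comm q⁻¹ q) q*q⁻¹≈1

    1*1 = *-identityˡ 1#

    conjugate : ∀ (B C D : Endomorphism {n}) s → D ∘ B ≋ s • (B ∘ D) → D ∘ C ≋ 1ᵒ n → (D ∘ B) ∘ C ≋ s • B
    conjugate B C D s e e′ f w = trans (e (⟦ C ⟧ f) w) (*-congˡ (⟦⟧-cong B (e′ f) w))

  𝐊₁𝐊₂⁻¹ : 𝐊₁ n ∘ 𝐊₂⁻¹ n ≋ 𝐊 n
  𝐊₁𝐊₂⁻¹ f w = trans (diagonal-∘ q 1# 1# q⁻¹ n f w)
    (diagonal-cong (*-identityʳ q) (*-identityˡ q⁻¹) n f w)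

  𝐊₂𝐊₁⁻¹ : 𝐊₂ n ∘ 𝐊₁⁻¹ n ≋ 𝐊⁻¹ n
  𝐊₂𝐊₁⁻¹ f w = trans (diagonal-∘ 1# q q⁻¹ 1# n f w)
    (diagonal-cong (*-identityˡ q⁻¹) (*-identityʳ q) n f w)

  K₁K₂ : 𝐊₁ n ∘ 𝐊₂ n ≋ 𝐊₂ n ∘ 𝐊₁ n
  K₁K₂ = diagonal-comm q 1# 1# q n

  K₁K₁⁻¹ : 𝐊₁ n ∘ 𝐊₁⁻¹ n ≋ 1# • 1ᵒ n
  K₁K₁⁻¹ f w = trans (diagonal-inverse q*q⁻¹≈1 1*1 n f w) (sym (*-identityˡ _))

  K₁⁻¹K₁ : 𝐊₁⁻¹ n ∘ 𝐊₁ n ≋ 1# • 1ᵒ n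
  K₁⁻¹K₁ f w = trans (diagonal-inverse q⁻¹*q≈1 1*1 n f w) (sym (*-identityˡ _))

  K₂K₂⁻¹ : 𝐊₂ n ∘ 𝐊₂⁻¹ n ≋ 1# • 1ᵒ n
  K₂K₂⁻¹ f w = trans (diagonal-inverse 1*1 q*q⁻¹≈1 n f w) (sym (*-identityˡ _))

  K₂⁻¹K₂ : 𝐊₂⁻¹ n ∘ 𝐊₂ n ≋ 1# • 1ᵒ n
  K₂⁻¹K₂ f w = trans (diagonal-inverse 1*1 q⁻¹*q≈1 n f w) (sym (*-identityˡ _))

  K₁EK₁⁻¹ : (𝐊₁ n ∘ 𝐄 n) ∘ 𝐊₁⁻¹ n ≋ q • 𝐄 n
  K₁EK₁⁻¹ = conjugate (𝐄 n) (𝐊₁⁻¹ n) (𝐊₁ n) q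
    (diagonal-𝐄 (sym (*-identityʳ q)) n) (diagonal-inverse q*q⁻¹≈1 1*1 n)

  K₂EK₂⁻¹ : (𝐊₂ n ∘ 𝐄 n) ∘ 𝐊₂⁻¹ n ≋ q⁻¹ • 𝐄 n
  K₂EK₂⁻¹ = conjugate (𝐄 n) (𝐊₂⁻¹ n) (𝐊₂ n) q⁻¹
    (diagonal-𝐄 (sym q⁻¹*q≈1) n) (diagonal-inverse 1*1 q*q⁻¹≈1 n)

  K₁FK₁⁻¹ : (𝐊₁ n ∘ 𝐅 n) ∘ 𝐊₁⁻¹ n ≋ q⁻¹ • 𝐅 n
  K₁FK₁⁻¹ = conjugate (𝐅 n) (𝐊₁⁻¹ n) (𝐊₁ n) q⁻¹
    (diagonal-𝐅 (sym q⁻¹*q≈1) n) (diagonal-inverse q*q⁻¹≈1 1*1 n)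

  K₂FK₂⁻¹ : (𝐊₂ n ∘ 𝐅 n) ∘ 𝐊₂⁻¹ n ≋ q • 𝐅 n
  K₂FK₂⁻¹ = conjugate (𝐅 n) (𝐊₂⁻¹ n) (𝐊₂ n) q
    (diagonal-𝐅 (sym (*-identityʳ q)) n) (diagonal-inverse 1*1 q*q⁻¹≈1 n)

  module _ (d : Carrier) (d-inverse : (q - q⁻¹) * d ≈ 1#) where

    EF-FE : 𝐄 n ∘ 𝐅 n ⊕ (- 1#) • (𝐅 n ∘ 𝐄 n) ≋ d • (𝐊₁ n ∘ 𝐊₂⁻¹ n ⊕ (- 1#) • (𝐊₂ n ∘ 𝐊₁⁻¹ n))
    EF-FE f w = begin
      _ ≈⟨ +-congˡ (-1*x≈-x _) ⟩
      x - y
        ≈⟨ +-congʳ (𝐄𝐅-𝐅𝐄 d d-inverse n f w) ⟩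
      (y + z) - y
        ≈⟨ trans (+-congʳ (+-comm y z)) (trans (+-assoc z y (- y)) (trans (+-congˡ (-‿inverseʳ y)) (+-identityʳ z))) ⟩
      z
        ≈⟨ *-congˡ (+-cong (𝐊₁𝐊₂⁻¹ f w) (trans (-1*x≈-x _) (-‿cong (𝐊₂𝐊₁⁻¹ f w)))) ⟨
      _ ∎
      where
      x = ⟦ 𝐄 n ∘ 𝐅 n ⟧ f w
      y = ⟦ 𝐅 n ∘ 𝐄 n ⟧ f w
      z = d * (⟦ 𝐊 n ⟧ f w - ⟦ 𝐊⁻¹ n ⟧ f w)

module QuantumGL₂ where
  open Presentation ℚ⟨t⟩ public using (Term; gen; con; _+_; _*_; _-_)
  open FractionField using (_/_[_]) renaming ([_] to ⌊_⌋)

  data Generator : Set where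
    E F K₁ K₁⁻¹ K₂ K₂⁻¹ : Generator

  K̂ K̂⁻¹ : Term Generator
  K̂   = gen K₁ * gen K₂⁻¹
  K̂⁻¹ = gen K₂ * gen K₁⁻¹

  1/[t-t⁻¹] : ℚ⟨t⟩.Carrier
  1/[t-t⁻¹] = 𝒜.1# / (𝐭 𝒜.- 𝐭⁻¹) [ t-t⁻¹≉0 ]

  data Relation : Rel (Term Generator) 0ℓ where
    K₁K₂=K₂K₁  : Relation (gen K₁ * gen K₂) (gen K₂ * gen K₁)
    K₁K₁⁻¹=1   : Relation (gen K₁ * gen K₁⁻¹) (con ℚ⟨t⟩.1#)
    K₁⁻¹K₁=1   : Relation (gen K₁⁻¹ * gen K₁) (con ℚ⟨t⟩.1#)
    K₂K₂⁻¹=1   : Relation (gen K₂ * gen K₂⁻¹) (con ℚ⟨t⟩.1#)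
    K₂⁻¹K₂=1   : Relation (gen K₂⁻¹ * gen K₂) (con ℚ⟨t⟩.1#)
    K₁EK₁⁻¹=tE   : Relation (gen K₁ * gen E * gen K₁⁻¹) (con ⌊ 𝐭 ⌋ * gen E)
    K₂EK₂⁻¹=t⁻¹E : Relation (gen K₂ * gen E * gen K₂⁻¹) (con ⌊ 𝐭⁻¹ ⌋ * gen E)
    K₁FK₁⁻¹=t⁻¹F : Relation (gen K₁ * gen F * gen K₁⁻¹) (con ⌊ 𝐭⁻¹ ⌋ * gen F)
    K₂FK₂⁻¹=tF   : Relation (gen K₂ * gen F * gen K₂⁻¹) (con ⌊ 𝐭 ⌋ * gen F)
    EF-FE      : Relation (gen E * gen F - gen F * gen E) (con 1/[t-t⁻¹] * (K̂ - K̂⁻¹))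

  U : Algebra ℚ⟨t⟩ 0ℓ 0ℓ
  U = Presentation.algebra ℚ⟨t⟩ Relation

  open import Algebra.Properties.Semiring.Exp (Algebra.semiring U) using (_^_)

  -- (opaque only to keep type checking fast)
  opaque
    1/[_]! : ℕ → ℚ⟨t⟩.Carrier
    1/[ j ]! = 𝒜.1# / [ j ]ₜ! [ [ j ]ₜ!≉0 ]

    1/[_]!-inverse : ∀ j → ⌊ [ j ]ₜ! ⌋ ℚ⟨t⟩.* 1/[ j ]! ℚ⟨t⟩.≈ ℚ⟨t⟩.1#
    1/[ j ]!-inverse = FractionField.unit-fraction [ j ]ₜ!≉0

  data LusztigGenerator : LieAlgebra → Set where
    E⁽_⁾ F⁽_⁾       : ∀ {𝔤} → ℕ → LusztigGenerator 𝔤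
    K₁ K₁⁻¹ K₂ K₂⁻¹ : LusztigGenerator gl₂
    K K⁻¹           : LusztigGenerator sl₂

  element : ∀ {𝔤} → LusztigGenerator 𝔤 → Term Generator
  element E⁽ j ⁾ = con 1/[ j ]! * gen E ^ j
  element F⁽ j ⁾ = con 1/[ j ]! * gen F ^ j
  element K₁     = gen K₁
  element K₁⁻¹   = gen K₁⁻¹
  element K₂     = gen K₂
  element K₂⁻¹   = gen K₂⁻¹
  element K      = K̂
  element K⁻¹    = K̂⁻¹

  module Integral (𝔤 : LieAlgebra) = GeneratedSubalgebra 𝒜 ℚ⟨t⟩
    FractionField.[_] FractionField.[]-isRingHomomorphism U (element {𝔤})

  private module ⌊⌋ = RingMorphisms.IsRingHomomorphism FractionField.[]-isRingHomomorphism

  q*q⁻¹≈1 : ⌊ 𝐭 ⌋ ℚ⟨t⟩.* ⌊ 𝐭⁻¹ ⌋ ℚ⟨t⟩.≈ ℚ⟨t⟩.1#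
  q*q⁻¹≈1 = ℚ⟨t⟩.trans (ℚ⟨t⟩.sym (⌊⌋.*-homo 𝐭 𝐭⁻¹)) (⌊⌋.⟦⟧-cong 𝐭*𝐭⁻¹≈1)

  private
    d-inverse : (⌊ 𝐭 ⌋ ℚ⟨t⟩.- ⌊ 𝐭⁻¹ ⌋) ℚ⟨t⟩.* 1/[t-t⁻¹] ℚ⟨t⟩.≈ ℚ⟨t⟩.1#
    d-inverse = ℚ⟨t⟩.trans
      (ℚ⟨t⟩.*-congʳ {1/[t-t⁻¹]} (ℚ⟨t⟩.sym (ℚ⟨t⟩.trans (⌊⌋.+-homo 𝐭 (𝒜.- 𝐭⁻¹)) (ℚ⟨t⟩.+-congˡ {⌊ 𝐭 ⌋} (⌊⌋.-‿homo 𝐭⁻¹)))))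
      (FractionField.unit-fraction t-t⁻¹≉0)

  module ℚ⟨t⟩-Quantum = QuantumOperators ℚ⟨t⟩ ⌊ 𝐭 ⌋ ⌊ 𝐭⁻¹ ⌋ q*q⁻¹≈1

  module Representation (n : ℕ) where
    open TensorPower ℚ⟨t⟩
    open ℚ⟨t⟩-Quantum

    operator : Generator → Endomorphism {n}
    operator E    = 𝐄 n
    operator F    = 𝐅 n
    operator K₁   = 𝐊₁ n
    operator K₁⁻¹ = 𝐊₁⁻¹ n
    operator K₂   = 𝐊₂ n
    operator K₂⁻¹ = 𝐊₂⁻¹ n

    act : Term Generator → Endomorphism {n}
    act = Presentation.evaluate ℚ⟨t⟩ Relation (End n) operator

    private
      module Check = OperatorRelations ℚ⟨t⟩ ⌊ 𝐭 ⌋ ⌊ 𝐭⁻¹ ⌋ q*q⁻¹≈1 n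

      relations : ∀ {a b} → Relation a b → act a ≋ act b
      relations K₁K₂=K₂K₁    = Check.K₁K₂
      relations K₁K₁⁻¹=1     = Check.K₁K₁⁻¹
      relations K₁⁻¹K₁=1     = Check.K₁⁻¹K₁
      relations K₂K₂⁻¹=1     = Check.K₂K₂⁻¹
      relations K₂⁻¹K₂=1     = Check.K₂⁻¹K₂
      relations K₁EK₁⁻¹=tE   = Check.K₁EK₁⁻¹
      relations K₂EK₂⁻¹=t⁻¹E = Check.K₂EK₂⁻¹
      relations K₁FK₁⁻¹=t⁻¹F = Check.K₁FK₁⁻¹
      relations K₂FK₂⁻¹=tF   = Check.K₂FK₂⁻¹
      relations EF-FE        = Check.EF-FE 1/[t-t⁻¹] d-inverse

    act-cong : ∀ {a b} → Algebra._≈_ U a b → act a ≋ act b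
    act-cong = Presentation.evaluate-cong ℚ⟨t⟩ Relation (End n) operator relations

-- For an 𝒜-algebra R with t ↦ q, the generators of 𝐔_𝒜 act on the 𝒜-lattice of
-- V^{⊗n} and hence on its base change to R.
module LatticeAction
  (𝔤 : LieAlgebra) (n : ℕ)
  {c ℓ} (R : CommutativeRing c ℓ) (q q⁻¹ : CommutativeRing.Carrier R)
  (q*q⁻¹≈1 : CommutativeRing._≈_ R (CommutativeRing._*_ R q q⁻¹) (CommutativeRing.1# R))
  (φ : 𝒜.Carrier → CommutativeRing.Carrier R)
  where
  open TensorPower R
  open QuantumOperators R q q⁻¹ q*q⁻¹≈1
  open QuantumGL₂ using (module Integral; E⁽_⁾; F⁽_⁾; K₁; K₁⁻¹; K₂; K₂⁻¹; K; K⁻¹; LusztigGenerator)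
  open Integral 𝔤 using (Generated; gen; scalar; add; mul; respect)

  operator : LusztigGenerator 𝔤 → Endomorphism {n}
  operator E⁽ j ⁾ = 𝐄⁽ j ⁾ n
  operator F⁽ j ⁾ = 𝐅⁽ j ⁾ n
  operator K₁     = 𝐊₁ n
  operator K₁⁻¹   = 𝐊₁⁻¹ n
  operator K₂     = 𝐊₂ n
  operator K₂⁻¹   = 𝐊₂⁻¹ n
  operator K      = 𝐊 n
  operator K⁻¹    = 𝐊⁻¹ n

  act : ∀ {u} → Generated u → Endomorphism {n}
  act (gen x)       = operator x
  act (scalar r)    = End.ι n (φ r)
  act (add p p′)    = act p ⊕ act p′
  act (mul p p′)    = act p ∘ act p′
  act (respect e p) = act p

private
  ι-hom = FractionField.[]-isRingHomomorphism

  id-hom : RingMorphisms.IsRingHomomorphism 𝒜.rawRing 𝒜.rawRing (λ x → x)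
  id-hom = mkRingHom 𝒜.ring 𝒜.ring (λ x → x) (λ e → e) (λ _ _ → 𝒜.refl) (λ _ _ → 𝒜.refl) 𝒜.refl

module LatticeNaturality
  (𝔤 : LieAlgebra) (n : ℕ)
  {c ℓ} (R : CommutativeRing c ℓ) (q q⁻¹ : CommutativeRing.Carrier R)
  (q*q⁻¹≈1 : CommutativeRing._≈_ R (CommutativeRing._*_ R q q⁻¹) (CommutativeRing.1# R))
  (φ : 𝒜.Carrier → CommutativeRing.Carrier R)
  (φ-hom : RingMorphisms.IsRingHomomorphism 𝒜.rawRing (CommutativeRing.rawRing R) φ)
  (φt≈q : CommutativeRing._≈_ R (φ 𝐭) q) (φt⁻¹≈q⁻¹ : CommutativeRing._≈_ R (φ 𝐭⁻¹) q⁻¹)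
  where
  private
    module R = CommutativeRing R
    module φ = RingMorphisms.IsRingHomomorphism φ-hom
    module L = LatticeAction 𝔤 n 𝒜 𝐭 𝐭⁻¹ 𝐭*𝐭⁻¹≈1 (λ x → x)
    module LR = LatticeAction 𝔤 n R q q⁻¹ q*q⁻¹≈1 φ
  open QuantumGL₂ using (module Integral; E⁽_⁾; F⁽_⁾; K₁; K₁⁻¹; K₂; K₂⁻¹; K; K⁻¹; LusztigGenerator)
  open Integral 𝔤 using (Generated; gen; scalar; add; mul; respect)
  open Naturality 𝒜 R φ φ-hom 𝐭 𝐭⁻¹ 𝐭*𝐭⁻¹≈1 q q⁻¹ q*q⁻¹≈1 φt≈q φt⁻¹≈q⁻¹

  natural-act : ∀ {u} (p : Generated u) → Natural (L.act p) (LR.act p)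
  natural-act (gen E⁽ j ⁾) = natural-𝐄⁽⁾ j n
  natural-act (gen F⁽ j ⁾) = natural-𝐅⁽⁾ j n
  natural-act (gen K₁)     = natural-diagonal φt≈q φ.1#-homo n
  natural-act (gen K₁⁻¹)   = natural-diagonal φt⁻¹≈q⁻¹ φ.1#-homo n
  natural-act (gen K₂)     = natural-diagonal φ.1#-homo φt≈q n
  natural-act (gen K₂⁻¹)   = natural-diagonal φ.1#-homo φt⁻¹≈q⁻¹ n
  natural-act (gen K)      = natural-diagonal φt≈q φt⁻¹≈q⁻¹ n
  natural-act (gen K⁻¹)    = natural-diagonal φt⁻¹≈q⁻¹ φt≈q n
  natural-act (scalar r)   = λ f w → φ.*-homo r (f w)
  natural-act (add p p′)   = natural-⊕ {B = L.act p} {L.act p′} {LR.act p} {LR.act p′} (natural-act p) (natural-act p′)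
  natural-act (mul p p′)   = natural-∘ {B = L.act p} {L.act p′} {LR.act p} {LR.act p′} (natural-act p) (natural-act p′)
  natural-act (respect e p) = natural-act p

-- Over ℚ(t), the lattice action is the restriction of the action of 𝐔_{ℚ(t)}(gl₂).
module GenericAction (𝔤 : LieAlgebra) (n : ℕ) where
  open QuantumGL₂ hiding (_+_; _*_; _-_)
  open Integral 𝔤 using (Generated; gen; scalar; add; mul; respect)
  open FractionField using () renaming ([_] to ⌊_⌋)
  private module ρ = Representation n
  private module L = LatticeAction 𝔤 n ℚ⟨t⟩ ⌊ 𝐭 ⌋ ⌊ 𝐭⁻¹ ⌋ q*q⁻¹≈1 ⌊_⌋
  open TensorPower ℚ⟨t⟩
  open ℚ⟨t⟩-Quantum
  open import Algebra.Properties.Semiring.Exp (Algebra.semiring U) using (_^_)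

  private
    module Q = CommutativeRing ℚ⟨t⟩
    module E = Algebra (End n)

    open Naturality 𝒜 ℚ⟨t⟩ ⌊_⌋ ι-hom 𝐭 𝐭⁻¹ 𝐭*𝐭⁻¹≈1 ⌊ 𝐭 ⌋ ⌊ 𝐭⁻¹ ⌋ q*q⁻¹≈1 Q.refl Q.refl using (φ-[_]!)

    inverse : ∀ j → 1/[ j ]! Q.* [ j ]! Q.≈ Q.1#
    inverse j = Q.trans (Q.*-congˡ {1/[ j ]!} (Q.sym φ-[ j ]!))
      (Q.trans (Q.*-comm 1/[ j ]! ⌊ 𝒜-Quantum.[ j ]! ⌋) 1/[ j ]!-inverse)

  private
    act-con-* : ∀ c a → c • ρ.act a ≋ ρ.act (con c QuantumGL₂.* a)
    act-con-* c a = E.refl {c • ρ.act a}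

  agrees : ∀ {u} (p : Generated u) → L.act p ≋ ρ.act u
  agrees (gen E⁽ j ⁾) = E.trans {𝐄⁽ j ⁾ n} {1/[ j ]! • ρ.act (gen E ^ j)} {ρ.act (con 1/[ j ]! QuantumGL₂.* gen E ^ j)}
    (𝐄-divide n (λ j → ρ.act (gen E ^ j)) E.ι.1#-homo (λ j → E.refl {𝐄 n ∘ ρ.act (gen E ^ j)}) j 1/[ j ]! (inverse j))
    (act-con-* 1/[ j ]! (gen E ^ j))
  agrees (gen F⁽ j ⁾) = E.trans {𝐅⁽ j ⁾ n} {1/[ j ]! • ρ.act (gen F ^ j)} {ρ.act (con 1/[ j ]! QuantumGL₂.* gen F ^ j)}
    (𝐅-divide n (λ j → ρ.act (gen F ^ j)) E.ι.1#-homo (λ j → E.refl {𝐅 n ∘ ρ.act (gen F ^ j)}) j 1/[ j ]! (inverse j))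
    (act-con-* 1/[ j ]! (gen F ^ j))
  agrees (gen K₁)    = E.refl {𝐊₁ n}
  agrees (gen K₁⁻¹)  = E.refl {𝐊₁⁻¹ n}
  agrees (gen K₂)    = E.refl {𝐊₂ n}
  agrees (gen K₂⁻¹)  = E.refl {𝐊₂⁻¹ n}
  agrees (gen K)     = E.sym {𝐊₁ n ∘ 𝐊₂⁻¹ n} {𝐊 n} (OperatorRelations.𝐊₁𝐊₂⁻¹ ℚ⟨t⟩ ⌊ 𝐭 ⌋ ⌊ 𝐭⁻¹ ⌋ q*q⁻¹≈1 n)
  agrees (gen K⁻¹)   = E.sym {𝐊₂ n ∘ 𝐊₁⁻¹ n} {𝐊⁻¹ n} (OperatorRelations.𝐊₂𝐊₁⁻¹ ℚ⟨t⟩ ⌊ 𝐭 ⌋ ⌊ 𝐭⁻¹ ⌋ q*q⁻¹≈1 n)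
  agrees (scalar r)  = E.refl {End.ι n ⌊ r ⌋}
  agrees (add {u} {u′} p p′) = E.+-cong {L.act p} {ρ.act u} {L.act p′} {ρ.act u′} (agrees p) (agrees p′)
  agrees (mul {u} {u′} p p′) = E.*-cong {L.act p} {ρ.act u} {L.act p′} {ρ.act u′} (agrees p) (agrees p′)
  agrees (respect {u} {u′} e p) = E.trans {L.act p} {ρ.act u} {ρ.act u′} (agrees p) (ρ.act-cong e)

  private
    module L𝒜 = LatticeAction 𝔤 n 𝒜 𝐭 𝐭⁻¹ 𝐭*𝐭⁻¹≈1 (λ x → x)
    open TensorPower 𝒜 using () renaming (⟦_⟧ to ⟦_⟧𝒜; _≋_ to _≋𝒜_)
    open LatticeNaturality 𝔤 n ℚ⟨t⟩ ⌊ 𝐭 ⌋ ⌊ 𝐭⁻¹ ⌋ q*q⁻¹≈1 ⌊_⌋ ι-hom Q.refl Q.refl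

  -- Elements that are equal in 𝐔_{ℚ(t)}(gl₂) act equally on the lattice.
  lattice-cong : ∀ {u u′} (p : Generated u) (p′ : Generated u′) → Algebra._≈_ U u u′ →
                 L𝒜.act p ≋𝒜 L𝒜.act p′
  lattice-cong {u} {u′} p p′ e f w = FractionField.[]-injective (begin
    ⌊ ⟦ L𝒜.act p ⟧𝒜 f w ⌋   ≈⟨ natural-act p f w ⟩
    ⟦ L.act p ⟧ ⌊f⌋ w                       ≈⟨ agrees p ⌊f⌋ w ⟩
    ⟦ ρ.act u ⟧ ⌊f⌋ w                       ≈⟨ ρ.act-cong e ⌊f⌋ w ⟩
    ⟦ ρ.act u′ ⟧ ⌊f⌋ w                      ≈⟨ agrees p′ ⌊f⌋ w ⟨
    ⟦ L.act p′ ⟧ ⌊f⌋ w                      ≈⟨ natural-act p′ f w ⟨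
    ⌊ ⟦ L𝒜.act p′ ⟧𝒜 f w ⌋   ∎)
    where
    ⌊f⌋ = λ w → ⌊ f w ⌋
    open import Relation.Binary.Reasoning.Setoid Q.setoid

-- 𝐔(𝔤) = 𝐔_𝒜(𝔤) ⊗_𝒜 𝕜. Its action on V^{⊗n} is well defined because elements of 𝐔_𝒜
-- that are equal in 𝐔_{ℚ(t)}(gl₂) act equally on the 𝒜-lattice (lattice-cong).
module QuantumGroup
  {c ℓ} (𝕜 : CommutativeRing c ℓ) (v v⁻¹ : CommutativeRing.Carrier 𝕜)
  (v*v⁻¹≈1 : CommutativeRing._≈_ 𝕜 (CommutativeRing._*_ 𝕜 v v⁻¹) (CommutativeRing.1# 𝕜))
  (𝔤 : LieAlgebra)
  where
  private
    module 𝕜 = CommutativeRing 𝕜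
  open QuantumGL₂ using (module Integral)
  open Specialization 𝕜 v v⁻¹ v*v⁻¹≈1
  open RingMorphisms.IsRingHomomorphism specialize-isRingHomomorphism using () renaming (*-homo to specialize-*)

  module Base = BaseChange 𝒜 𝕜 specialize specialize-isRingHomomorphism (Integral.algebra 𝔤)

  𝐔 : Algebra 𝕜 c (c ⊔ ℓ)
  𝐔 = Base.algebra

  module _ (n : ℕ) where
    open TensorPower 𝕜
    open LatticeAction 𝔤 n 𝕜 v v⁻¹ v*v⁻¹≈1 specialize
    private
      module L𝒜 = LatticeAction 𝔤 n 𝒜 𝐭 𝐭⁻¹ 𝐭*𝐭⁻¹≈1 (λ x → x)
      open LatticeNaturality 𝔤 n 𝕜 v v⁻¹ v*v⁻¹≈1 specialize specialize-isRingHomomorphism specialize-t specialize-t⁻¹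

      act-cong : ∀ {u u′} (p : Integral.Generated 𝔤 u) (p′ : Integral.Generated 𝔤 u′) →
                 Algebra._≈_ QuantumGL₂.U u u′ → act p ≋ act p′
      act-cong p p′ e = ≋-from-image 𝒜 specialize specialize-isRingHomomorphism (act p) (act p′)
        (λ f w → 𝕜.trans (𝕜.sym (natural-act p f w))
          (𝕜.trans (specialize-cong (GenericAction.lattice-cong 𝔤 n p p′ e f w)) (natural-act p′ f w)))
        where open RingMorphisms.IsRingHomomorphism specialize-isRingHomomorphism renaming (⟦⟧-cong to specialize-cong)

    action : Base.Tensor → Endomorphism {n}
    action ((_ , p) Base.⊗ c) = c • act p
    action Base.0#            = 0ᵒ n
    action (x Base.+ y)       = action x ⊕ action y
    action (Base.- x)         = End.-_ n (action x)

    private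
      module E = Algebra (End n)
      open import Relation.Binary.Reasoning.Setoid 𝕜.setoid

      action-cong : ∀ {x y} → x Base.≈ y → action x ≋ action y
      action-cong Base.refl = λ f w → 𝕜.refl
      action-cong (Base.sym {x} {y} e) = E.sym {action x} {action y} (action-cong e)
      action-cong (Base.trans {x} {y} {z} e e′) = E.trans {action x} {action y} {action z} (action-cong e) (action-cong e′)
      action-cong (Base.+-cong e e′) f w = 𝕜.+-cong (action-cong e f w) (action-cong e′ f w)
      action-cong (Base.-‿cong e) f w = 𝕜.-‿cong (action-cong e f w)
      action-cong (Base.+-assoc x y z) f w = 𝕜.+-assoc _ _ _
      action-cong (Base.+-comm x y) f w = 𝕜.+-comm _ _
      action-cong (Base.+-identityˡ x) f w = 𝕜.+-identityˡ _
      action-cong (Base.-‿inverseˡ x) f w = 𝕜.-‿inverseˡ _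
      action-cong (Base.⊗-cong {_ , p} {_ , p′} e e′) f w = 𝕜.*-cong e′ (act-cong p p′ e f w)
      action-cong (Base.⊗-distribʳ u u′ c) f w = 𝕜.distribˡ _ _ _
      action-cong (Base.⊗-distribˡ u c c′) f w = 𝕜.distribʳ _ _ _
      action-cong (Base.⊗-balanced a (_ , p) c) f w =
        𝕜.trans (𝕜.sym (𝕜.*-assoc c (specialize a) _)) (𝕜.*-congʳ (𝕜.*-comm c (specialize a)))

      action-pure-* : ∀ u c y → action (Base.mulPure u c y) ≋ action (u Base.⊗ c) ∘ action y
      action-pure-* (_ , p) c ((_ , p′) Base.⊗ c′) f w = begin
        (c 𝕜.* c′) 𝕜.* ⟦ act p ∘ act p′ ⟧ f w        ≈⟨ 𝕜.*-assoc _ _ _ ⟩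
        c 𝕜.* (c′ 𝕜.* ⟦ act p ∘ act p′ ⟧ f w)        ≈⟨ 𝕜.*-congˡ (*ₗ-homo (act p) c′ (⟦ act p′ ⟧ f) w) ⟨
        c 𝕜.* ⟦ act p ⟧ (λ w → c′ 𝕜.* ⟦ act p′ ⟧ f w) w ∎
      action-pure-* u c Base.0# f w = E.sym {action (u Base.⊗ c) ∘ 0ᵒ n} {0ᵒ n} (E.zeroʳ (action (u Base.⊗ c))) f w
      action-pure-* u c (x Base.+ y) f w = 𝕜.trans
        (𝕜.+-cong (action-pure-* u c x f w) (action-pure-* u c y f w))
        (𝕜.sym (E.distribˡ (action (u Base.⊗ c)) (action x) (action y) f w))
      action-pure-* u c (Base.- x) f w = 𝕜.trans
        (𝕜.-‿cong (action-pure-* u c x f w))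
        (-‿distribʳ-* (action (u Base.⊗ c)) (action x) f w)
        where open import Algebra.Properties.Ring E.ring using (-‿distribʳ-*)

      action-* : ∀ x y → action (x Base.* y) ≋ action x ∘ action y
      action-* (u Base.⊗ c) y f w = action-pure-* u c y f w
      action-* Base.0#      y f w = 𝕜.refl
      action-* (x Base.+ z) y f w = 𝕜.+-cong (action-* x y f w) (action-* z y f w)
      action-* (Base.- x)   y f w = 𝕜.-‿cong (action-* x y f w)

      act-1 : ∀ c f w → ⟦ action (Algebra.ι 𝐔 c) ⟧ f w 𝕜.≈ c 𝕜.* f w
      act-1 c f w = 𝕜.*-congˡ (𝕜.trans (𝕜.*-congʳ 1#-homo) (𝕜.*-identityˡ (f w)))
        where open RingMorphisms.IsRingHomomorphism specialize-isRingHomomorphism using (1#-homo)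

    representation : AlgebraHom 𝐔 (End n)
    representation = record
      { ⟦_⟧ = action
      ; isRingHomomorphism = mkRingHom (Algebra.ring 𝐔) (Algebra.ring (End n)) action
          (λ {x} {y} → action-cong {x} {y}) (λ _ _ _ _ → 𝕜.refl) action-* (λ f w → 𝕜.trans (act-1 𝕜.1# f w) (𝕜.*-identityˡ _))
      ; ι-homo = act-1 }

-- TL_n(δ); the index i : Fin (n ∸ 1), counted from 0, stands for e_{i+1}.
module TemperleyLieb {c ℓ} (R : CommutativeRing c ℓ) (δ : CommutativeRing.Carrier R) (n : ℕ) where
  open Presentation R public using (Term; gen; con; _+_; _*_)

  e : Fin (n ∸ 1) → Term (Fin (n ∸ 1))
  e = gen

  data Relation : Rel (Term (Fin (n ∸ 1))) c where
    square   : ∀ i → Relation (e i * e i) (con δ * e i)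
    adjacent : ∀ i j → ∣ toℕ i - toℕ j ∣ ≡ 1 → Relation (e i * e j * e i) (e i)
    distant  : ∀ i j → 1 ℕ.< ∣ toℕ i - toℕ j ∣ → Relation (e i * e j) (e j * e i)

  TL : Algebra R c (c ⊔ ℓ)
  TL = Presentation.algebra R Relation

module TemperleyLiebOperators
  {c ℓ} (R : CommutativeRing c ℓ) (q q⁻¹ : CommutativeRing.Carrier R)
  (q*q⁻¹≈1 : CommutativeRing._≈_ R (CommutativeRing._*_ R q q⁻¹) (CommutativeRing.1# R))
  where
  open CommutativeRing R hiding (zero)
  open FromℤR.Solver R using (solve; _:=_; _:+_; _:*_; _:-_; :-_; con)
  open TensorPower R
  open QuantumOperators R q q⁻¹ q*q⁻¹≈1
  open import Algebra.Properties.Semiring.Exp semiring using (_^_)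
  open import Relation.Binary.Reasoning.Setoid setoid

  ± : Sign → Carrier → Carrier
  ± Sign.+ x = x
  ± Sign.- x = - x

  ±ᵒ : ∀ {n} → Sign → Endomorphism {n} → Endomorphism {n}
  ±ᵒ     Sign.+ B = B
  ±ᵒ {n} Sign.- B = End.-_ n B

  private
    ξ-fun : ∀ {n} → Vector (2 ℕ.+ n) → Vector (2 ℕ.+ n)
    ξ-fun f (0F ∷ 0F ∷ w) = 0#
    ξ-fun f (0F ∷ 1F ∷ w) = q⁻¹ * f (0F ∷ 1F ∷ w) - f (1F ∷ 0F ∷ w)
    ξ-fun f (1F ∷ 0F ∷ w) = - f (0F ∷ 1F ∷ w) + q * f (1F ∷ 0F ∷ w)
    ξ-fun f (1F ∷ 1F ∷ w) = 0#

  -- ξ ⊗ 1 on V ⊗ V ⊗ V^{⊗n}, in coordinates; the matrix of ξ is symmetric.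
  ξ : ∀ n → Endomorphism {2 ℕ.+ n}
  ξ n = mkEndomorphism ξ-fun
    (λ { e (0F ∷ 0F ∷ w) → refl
       ; e (0F ∷ 1F ∷ w) → +-cong (*-congˡ (e _)) (-‿cong (e _))
       ; e (1F ∷ 0F ∷ w) → +-cong (-‿cong (e _)) (*-congˡ (e _))
       ; e (1F ∷ 1F ∷ w) → refl })
    (λ { f g (0F ∷ 0F ∷ w) → sym (+-identityˡ 0#)
       ; f g (0F ∷ 1F ∷ w) → solve 5 (λ p a b c d → p :* (a :+ b) :- (c :+ d) := (p :* a :- c) :+ (p :* b :- d)) refl q⁻¹ _ _ _ _
       ; f g (1F ∷ 0F ∷ w) → solve 5 (λ q a b c d → :- (a :+ b) :+ q :* (c :+ d) := (:- a :+ q :* c) :+ (:- b :+ q :* d)) refl q _ _ _ _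
       ; f g (1F ∷ 1F ∷ w) → sym (+-identityˡ 0#) })
    (λ { r f (0F ∷ 0F ∷ w) → sym (zeroʳ r)
       ; r f (0F ∷ 1F ∷ w) → solve 4 (λ p r a c → p :* (r :* a) :- r :* c := r :* (p :* a :- c)) refl q⁻¹ r _ _
       ; r f (1F ∷ 0F ∷ w) → solve 4 (λ q r a c → :- (r :* a) :+ q :* (r :* c) := r :* (:- a :+ q :* c)) refl q r _ _
       ; r f (1F ∷ 1F ∷ w) → sym (zeroʳ r) })

  -- e_{i+1} acts as 1^{⊗i} ⊗ (±ξ) ⊗ 1^{⊗(n-i-2)}.
  𝐞 : Sign → ∀ n → Fin (n ∸ 1) → Endomorphism {n}
  𝐞 s (suc (suc n)) zero    = ±ᵒ s (ξ n)
  𝐞 s (suc (suc n)) (suc i) = 1-matrix ⊗ᵒ 𝐞 s (suc n) i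

  private
    by-relation : ∀ {x y} z → x ≈ y + (q * q⁻¹ - 1#) * z → x ≈ y
    by-relation {x} {y} z e = begin
      x                          ≈⟨ e ⟩
      y + (q * q⁻¹ - 1#) * z     ≈⟨ +-congˡ (*-congʳ (+-congʳ q*q⁻¹≈1)) ⟩
      y + (1# - 1#) * z          ≈⟨ solve 2 (λ y z → y :+ (con 1ℤ :- con 1ℤ) :* z := y) refl y z ⟩
      y                          ∎

    1⊗ : ∀ {n} → Endomorphism {n} → Endomorphism {suc n}
    1⊗ B = 1-matrix ⊗ᵒ B

    1⊗-at : ∀ {n} (B : Endomorphism {n}) f i w → ⟦ 1⊗ B ⟧ f (i ∷ w) ≈ ⟦ B ⟧ (f ↾ i) w
    1⊗-at B f 0F w = solve 2 (λ a b → con 1ℤ :* a :+ con 0ℤ :* b := a) refl _ _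
    1⊗-at B f 1F w = solve 2 (λ a b → con 0ℤ :* a :+ con 1ℤ :* b := b) refl _ _

    slicewise : ∀ {n} → Endomorphism {n} → Vector (suc n) → Vector (suc n)
    slicewise B f (i ∷ w) = ⟦ B ⟧ (f ↾ i) w

    apply-1⊗ : ∀ {n} (C : Endomorphism {suc n}) (B : Endomorphism {n}) f u →
               ⟦ C ⟧ (⟦ 1⊗ B ⟧ f) u ≈ ⟦ C ⟧ (slicewise B f) u
    apply-1⊗ C B f u = ⟦⟧-cong C (λ { (i ∷ w) → 1⊗-at B f i w }) u

    1⊗-apply : ∀ {n} (C : Endomorphism {n}) (B : Endomorphism {n}) f i w →
               ⟦ C ⟧ (⟦ 1⊗ B ⟧ f ↾ i) w ≈ ⟦ C ⟧ (⟦ B ⟧ (f ↾ i)) w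
    1⊗-apply C B f i w = ⟦⟧-cong C (1⊗-at B f i) w

    variable n : ℕ

    Commute : Endomorphism {n} → Endomorphism {n} → Set _
    Commute B C = B ∘ C ≋ C ∘ B

    commute-∘ : (B C D : Endomorphism {n}) → Commute B C → Commute B D → Commute B (C ∘ D)
    commute-∘ B C D e e′ f w = trans (e (⟦ D ⟧ f) w) (⟦⟧-cong C (e′ f) w)

    commute-⊕ : (B C D : Endomorphism {n}) → Commute B C → Commute B D → Commute B (C ⊕ D)
    commute-⊕ B C D e e′ f w = trans (+ᴹ-homo B (⟦ C ⟧ f) (⟦ D ⟧ f) w) (+-cong (e f w) (e′ f w))

    commute-⊗ : (M : Matrix) (B C : Endomorphism {n}) → Commute B C → Commute (1⊗ B) (M ⊗ᵒ C)
    commute-⊗ M B C e f (i ∷ w) = begin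
      ⟦ 1⊗ B ⟧ (⟦ M ⊗ᵒ C ⟧ f) (i ∷ w)
        ≈⟨ 1⊗-at B (⟦ M ⊗ᵒ C ⟧ f) i w ⟩
      ⟦ B ⟧ (λ w → M i 0F * ⟦ C ⟧ (f ↾ 0F) w + M i 1F * ⟦ C ⟧ (f ↾ 1F) w) w
        ≈⟨ linear₂ B (M i 0F) (M i 1F) (⟦ C ⟧ (f ↾ 0F)) (⟦ C ⟧ (f ↾ 1F)) w ⟩
      M i 0F * ⟦ B ∘ C ⟧ (f ↾ 0F) w + M i 1F * ⟦ B ∘ C ⟧ (f ↾ 1F) w
        ≈⟨ +-cong (*-congˡ (e (f ↾ 0F) w)) (*-congˡ (e (f ↾ 1F) w)) ⟩
      M i 0F * ⟦ C ∘ B ⟧ (f ↾ 0F) w + M i 1F * ⟦ C ∘ B ⟧ (f ↾ 1F) w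
        ≈⟨ +-cong (*-congˡ (1⊗-apply C B f 0F w)) (*-congˡ (1⊗-apply C B f 1F w)) ⟨
      ⟦ M ⊗ᵒ C ⟧ (⟦ 1⊗ B ⟧ f) (i ∷ w) ∎

    module _ (B : Endomorphism {n}) (f : Vector (2 ℕ.+ n)) (w : Vec (Fin 2) n) where
      ξ-zero : ⟦ B ⟧ (λ _ → 0#) w ≈ 0#
      ξ-zero = Endo.Endomorphism.0ᴹ-homo B w

      ξ-01 : ⟦ B ⟧ (⟦ ξ n ⟧ f ↾ 0F ↾ 1F) w ≈ q⁻¹ * ⟦ B ⟧ (f ↾ 0F ↾ 1F) w - ⟦ B ⟧ (f ↾ 1F ↾ 0F) w
      ξ-01 = trans (+ᴹ-homo B _ _ w) (+-cong (*ₗ-homo B q⁻¹ (f ↾ 0F ↾ 1F) w) (Endo.Endomorphism.-ᴹ-homo B (f ↾ 1F ↾ 0F) w))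

      ξ-10 : ⟦ B ⟧ (⟦ ξ n ⟧ f ↾ 1F ↾ 0F) w ≈ - ⟦ B ⟧ (f ↾ 0F ↾ 1F) w + q * ⟦ B ⟧ (f ↾ 1F ↾ 0F) w
      ξ-10 = trans (+ᴹ-homo B _ _ w) (+-cong (Endo.Endomorphism.-ᴹ-homo B (f ↾ 0F ↾ 1F) w) (*ₗ-homo B q (f ↾ 1F ↾ 0F) w))

  private
    ξ∘ξ : ∀ n → ξ n ∘ ξ n ≋ (q + q⁻¹) • ξ n
    ξ∘ξ n f (0F ∷ 0F ∷ w) = sym (zeroʳ _)
    ξ∘ξ n f (0F ∷ 1F ∷ w) = by-relation (- f (0F ∷ 1F ∷ w)) (solve 4 (λ q p a b →
      p :* (p :* a :- b) :- (:- a :+ q :* b) := (q :+ p) :* (p :* a :- b) :+ (q :* p :- con 1ℤ) :* (:- a))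
      refl q q⁻¹ (f (0F ∷ 1F ∷ w)) (f (1F ∷ 0F ∷ w)))
    ξ∘ξ n f (1F ∷ 0F ∷ w) = by-relation (- f (1F ∷ 0F ∷ w)) (solve 4 (λ q p a b →
      :- (p :* a :- b) :+ q :* (:- a :+ q :* b) := (q :+ p) :* (:- a :+ q :* b) :+ (q :* p :- con 1ℤ) :* (:- b))
      refl q q⁻¹ (f (0F ∷ 1F ∷ w)) (f (1F ∷ 0F ∷ w)))
    ξ∘ξ n f (1F ∷ 1F ∷ w) = sym (zeroʳ _)

    -- The four nonzero coordinates in ξ₁₂ξ₂₃ξ₁₂ = ξ₁₂ and in ξ₂₃ξ₁₂ξ₂₃ = ξ₂₃.
    case₁ : ∀ a b → q⁻¹ * (- 0# + q * (q⁻¹ * a - b)) - 0# ≈ q⁻¹ * a - b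
    case₁ a b = by-relation (q⁻¹ * a - b) (solve 4 (λ q p a b →
      p :* (:- con 0ℤ :+ q :* (p :* a :- b)) :- con 0ℤ := (p :* a :- b) :+ (q :* p :- con 1ℤ) :* (p :* a :- b)) refl q q⁻¹ a b)

    case₂ : ∀ a b → q⁻¹ * 0# - (q⁻¹ * (- a + q * b) - 0#) ≈ q⁻¹ * a - b
    case₂ a b = by-relation (- b) (solve 4 (λ q p a b →
      p :* con 0ℤ :- (p :* (:- a :+ q :* b) :- con 0ℤ) := (p :* a :- b) :+ (q :* p :- con 1ℤ) :* (:- b)) refl q q⁻¹ a b)

    case₃ : ∀ a b → - (- 0# + q * (q⁻¹ * a - b)) + q * 0# ≈ - a + q * b
    case₃ a b = by-relation (- a) (solve 4 (λ q p a b →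
      :- (:- con 0ℤ :+ q :* (p :* a :- b)) :+ q :* con 0ℤ := (:- a :+ q :* b) :+ (q :* p :- con 1ℤ) :* (:- a)) refl q q⁻¹ a b)

    case₄ : ∀ a b → - 0# + q * (q⁻¹ * (- a + q * b) - 0#) ≈ - a + q * b
    case₄ a b = by-relation (- a + q * b) (solve 4 (λ q p a b →
      :- con 0ℤ :+ q :* (p :* (:- a :+ q :* b) :- con 0ℤ) := (:- a :+ q :* b) :+ (q :* p :- con 1ℤ) :* (:- a :+ q :* b)) refl q q⁻¹ a b)

    ξ₁ξ₂ξ₁ : ∀ n → (ξ (suc n) ∘ 1⊗ (ξ n)) ∘ ξ (suc n) ≋ ξ (suc n)
    ξ₁ξ₂ξ₁ n f u = trans (apply-1⊗ (ξ (suc n)) (ξ n) (⟦ ξ (suc n) ⟧ f) u) (at u)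
      where
      at : ∀ u → ⟦ ξ (suc n) ⟧ (slicewise (ξ n) (⟦ ξ (suc n) ⟧ f)) u ≈ ⟦ ξ (suc n) ⟧ f u
      at (0F ∷ 0F ∷ w)      = refl
      at (0F ∷ 1F ∷ 0F ∷ w) = case₁ _ _
      at (0F ∷ 1F ∷ 1F ∷ w) = case₂ _ _
      at (1F ∷ 0F ∷ 0F ∷ w) = case₃ _ _
      at (1F ∷ 0F ∷ 1F ∷ w) = case₄ _ _
      at (1F ∷ 1F ∷ w)      = refl

    ξ₂ξ₁ξ₂ : ∀ n → (1⊗ (ξ n) ∘ ξ (suc n)) ∘ 1⊗ (ξ n) ≋ 1⊗ (ξ n)
    ξ₂ξ₁ξ₂ n f u = trans (apply-1⊗ (1⊗ (ξ n) ∘ ξ (suc n)) (ξ n) f u) (at u)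
      where
      g = slicewise (ξ n) f
      inner : ∀ i w → ⟦ ξ n ⟧ (⟦ ξ (suc n) ⟧ g ↾ i) w ≈ ⟦ ξ n ⟧ (f ↾ i) w
      inner 0F (0F ∷ 0F ∷ w) = refl
      inner 0F (0F ∷ 1F ∷ w) = case₂ _ _
      inner 0F (1F ∷ 0F ∷ w) = case₄ _ _
      inner 0F (1F ∷ 1F ∷ w) = refl
      inner 1F (0F ∷ 0F ∷ w) = refl
      inner 1F (0F ∷ 1F ∷ w) = case₁ _ _
      inner 1F (1F ∷ 0F ∷ w) = case₃ _ _
      inner 1F (1F ∷ 1F ∷ w) = refl
      at : ∀ u → ⟦ 1⊗ (ξ n) ∘ ξ (suc n) ⟧ g u ≈ ⟦ 1⊗ (ξ n) ⟧ f u
      at (i ∷ w) = begin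
        ⟦ 1⊗ (ξ n) ⟧ (⟦ ξ (suc n) ⟧ g) (i ∷ w)      ≈⟨ 1⊗-at (ξ n) (⟦ ξ (suc n) ⟧ g) i w ⟩
        ⟦ ξ n ⟧ (⟦ ξ (suc n) ⟧ g ↾ i) w             ≈⟨ inner i w ⟩
        ⟦ ξ n ⟧ (f ↾ i) w                           ≈⟨ 1⊗-at (ξ n) f i w ⟨
        ⟦ 1⊗ (ξ n) ⟧ f (i ∷ w)                      ∎

    ξ-distant : ∀ n (B : Endomorphism {n}) → Commute (ξ n) (1⊗ (1⊗ B))
    ξ-distant n B f u = begin
      _ ≈⟨ ⟦⟧-cong (ξ n) (twice f) u ⟩
      _ ≈⟨ at u ⟩
      _ ≈⟨ twice (⟦ ξ n ⟧ f) u ⟨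
      _ ∎
      where
      slice : Vector (2 ℕ.+ n) → Vector (2 ℕ.+ n)
      slice f (i ∷ j ∷ w) = ⟦ B ⟧ (f ↾ i ↾ j) w
      twice : ∀ f u → ⟦ 1⊗ (1⊗ B) ⟧ f u ≈ slice f u
      twice f (i ∷ j ∷ w) = trans (1⊗-at (1⊗ B) f i (j ∷ w)) (1⊗-at B (f ↾ i) j w)
      at : ∀ u → ⟦ ξ n ⟧ (slice f) u ≈ slice (⟦ ξ n ⟧ f) u
      at (0F ∷ 0F ∷ w) = sym (ξ-zero B f w)
      at (0F ∷ 1F ∷ w) = sym (ξ-01 B f w)
      at (1F ∷ 0F ∷ w) = sym (ξ-10 B f w)
      at (1F ∷ 1F ∷ w) = sym (ξ-zero B f w)

    ξ-diagonal : ∀ a b n → Commute (ξ n) (diagonal a b (2 ℕ.+ n))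
    ξ-diagonal a b n f u = begin
      _ ≈⟨ ⟦⟧-cong (ξ n) (expand f) u ⟩
      _ ≈⟨ at u ⟩
      _ ≈⟨ expand (⟦ ξ n ⟧ f) u ⟨
      _ ∎
      where
      D = diagonal a b n
      expansion : Vector (2 ℕ.+ n) → Vector (2 ℕ.+ n)
      expansion f (0F ∷ 0F ∷ w) = a * (a * ⟦ D ⟧ (f ↾ 0F ↾ 0F) w)
      expansion f (0F ∷ 1F ∷ w) = a * (b * ⟦ D ⟧ (f ↾ 0F ↾ 1F) w)
      expansion f (1F ∷ 0F ∷ w) = b * (a * ⟦ D ⟧ (f ↾ 1F ↾ 0F) w)
      expansion f (1F ∷ 1F ∷ w) = b * (b * ⟦ D ⟧ (f ↾ 1F ↾ 1F) w)
      expand : ∀ f u → ⟦ diagonal a b (2 ℕ.+ n) ⟧ f u ≈ expansion f u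
      expand f (0F ∷ 0F ∷ w) = trans (diagonal-0 (1ᵒ _) f (0F ∷ w) a b) (*-congˡ (diagonal-0 (1ᵒ _) (f ↾ 0F) w a b))
      expand f (0F ∷ 1F ∷ w) = trans (diagonal-0 (1ᵒ _) f (1F ∷ w) a b) (*-congˡ (diagonal-1 (1ᵒ _) (f ↾ 0F) w a b))
      expand f (1F ∷ 0F ∷ w) = trans (diagonal-1 (1ᵒ _) f (0F ∷ w) a b) (*-congˡ (diagonal-0 (1ᵒ _) (f ↾ 1F) w a b))
      expand f (1F ∷ 1F ∷ w) = trans (diagonal-1 (1ᵒ _) f (1F ∷ w) a b) (*-congˡ (diagonal-1 (1ᵒ _) (f ↾ 1F) w a b))
      at : ∀ u → ⟦ ξ n ⟧ (expansion f) u ≈ expansion (⟦ ξ n ⟧ f) u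
      at (0F ∷ 0F ∷ w) = sym (trans (*-congˡ (*-congˡ (ξ-zero D f w))) (solve 1 (λ a → a :* (a :* con 0ℤ) := con 0ℤ) refl a))
      at (0F ∷ 1F ∷ w) = trans
        (solve 5 (λ a b p x y → p :* (a :* (b :* x)) :- b :* (a :* y) := a :* (b :* (p :* x :- y))) refl a b q⁻¹ _ _)
        (*-congˡ (*-congˡ (sym (ξ-01 D f w))))
      at (1F ∷ 0F ∷ w) = trans
        (solve 5 (λ a b q x y → :- (a :* (b :* x)) :+ q :* (b :* (a :* y)) := b :* (a :* (:- x :+ q :* y))) refl a b q _ _)
        (*-congˡ (*-congˡ (sym (ξ-10 D f w))))
      at (1F ∷ 1F ∷ w) = sym (trans (*-congˡ (*-congˡ (ξ-zero D f w))) (solve 1 (λ a → a :* (a :* con 0ℤ) := con 0ℤ) refl b))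

    𝐄↓ 𝐅↓ : ℕ → ∀ n → Endomorphism {n}
    𝐄↓ zero    n = 0ᵒ n
    𝐄↓ (suc k) n = 𝐄⁽ k ⁾ n
    𝐅↓ zero    n = 0ᵒ n
    𝐅↓ (suc k) n = q ^ k • (𝐅⁽ k ⁾ n ∘ 𝐊⁻¹ n)

    𝐄⁽⁾-at0 : ∀ k (g : Vector (suc n)) w → ⟦ 𝐄⁽ k ⁾ (suc n) ⟧ g (0F ∷ w) ≈ q ^ k * ⟦ 𝐄⁽ k ⁾ n ⟧ (g ↾ 0F) w + ⟦ 𝐄↓ k n ⟧ (g ↾ 1F) w
    𝐄⁽⁾-at0 zero    g w = solve 1 (λ x → x := con 1ℤ :* x :+ con 0ℤ) refl (g (0F ∷ w))
    𝐄⁽⁾-at0 (suc k) g w = 𝐄⁽⁾-0 (1ᵒ _) g w k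

    𝐄⁽⁾-at1 : ∀ k (g : Vector (suc n)) w → ⟦ 𝐄⁽ k ⁾ (suc n) ⟧ g (1F ∷ w) ≈ q⁻¹ ^ k * ⟦ 𝐄⁽ k ⁾ n ⟧ (g ↾ 1F) w
    𝐄⁽⁾-at1 zero    g w = sym (*-identityˡ _)
    𝐄⁽⁾-at1 (suc k) g w = 𝐄⁽⁾-1 (1ᵒ _) g w k

    𝐅⁽⁾-at0 : ∀ k (g : Vector (suc n)) w → ⟦ 𝐅⁽ k ⁾ (suc n) ⟧ g (0F ∷ w) ≈ ⟦ 𝐅⁽ k ⁾ n ⟧ (g ↾ 0F) w
    𝐅⁽⁾-at0 zero    g w = refl
    𝐅⁽⁾-at0 (suc k) g w = 𝐅⁽⁾-0 (1ᵒ _) g w k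

    𝐅⁽⁾-at1 : ∀ k (g : Vector (suc n)) w → ⟦ 𝐅⁽ k ⁾ (suc n) ⟧ g (1F ∷ w) ≈ ⟦ 𝐅⁽ k ⁾ n ⟧ (g ↾ 1F) w + ⟦ 𝐅↓ k n ⟧ (g ↾ 0F) w
    𝐅⁽⁾-at1 zero    g w = sym (+-identityʳ _)
    𝐅⁽⁾-at1 (suc k) g w = 𝐅⁽⁾-1 (1ᵒ _) g w k

    ξ-𝐄⁽⁾ : ∀ j n → Commute (ξ n) (𝐄⁽ j ⁾ (2 ℕ.+ n))
    ξ-𝐄⁽⁾ zero    n f u = refl
    ξ-𝐄⁽⁾ (suc k) n f u = begin
      _ ≈⟨ ⟦⟧-cong (ξ n) (expand f) u ⟩
      _ ≈⟨ at u ⟩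
      _ ≈⟨ expand (⟦ ξ n ⟧ f) u ⟨
      _ ∎
      where
      E = 𝐄⁽ suc k ⁾ n ; D = 𝐄⁽ k ⁾ n ; D′ = 𝐄↓ k n
      P = q ^ k ; Q = q ^ suc k ; M = q⁻¹ ^ k ; N = q⁻¹ ^ suc k
      expansion : Vector (2 ℕ.+ n) → Vector (2 ℕ.+ n)
      expansion f (0F ∷ 0F ∷ w) = Q * (Q * ⟦ E ⟧ (f ↾ 0F ↾ 0F) w + ⟦ D ⟧ (f ↾ 0F ↾ 1F) w)
                                + (P * ⟦ D ⟧ (f ↾ 1F ↾ 0F) w + ⟦ D′ ⟧ (f ↾ 1F ↾ 1F) w)
      expansion f (0F ∷ 1F ∷ w) = Q * (N * ⟦ E ⟧ (f ↾ 0F ↾ 1F) w) + M * ⟦ D ⟧ (f ↾ 1F ↾ 1F) w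
      expansion f (1F ∷ 0F ∷ w) = N * (Q * ⟦ E ⟧ (f ↾ 1F ↾ 0F) w + ⟦ D ⟧ (f ↾ 1F ↾ 1F) w)
      expansion f (1F ∷ 1F ∷ w) = N * (N * ⟦ E ⟧ (f ↾ 1F ↾ 1F) w)
      expand : ∀ f u → ⟦ 𝐄⁽ suc k ⁾ (2 ℕ.+ n) ⟧ f u ≈ expansion f u
      expand f (0F ∷ 0F ∷ w) = trans (𝐄⁽⁾-0 (1ᵒ _) f (0F ∷ w) k)
        (+-cong (*-congˡ (𝐄⁽⁾-at0 (suc k) (f ↾ 0F) w)) (𝐄⁽⁾-at0 k (f ↾ 1F) w))
      expand f (0F ∷ 1F ∷ w) = trans (𝐄⁽⁾-0 (1ᵒ _) f (1F ∷ w) k)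
        (+-cong (*-congˡ (𝐄⁽⁾-at1 (suc k) (f ↾ 0F) w)) (𝐄⁽⁾-at1 k (f ↾ 1F) w))
      expand f (1F ∷ 0F ∷ w) = trans (𝐄⁽⁾-1 (1ᵒ _) f (0F ∷ w) k) (*-congˡ (𝐄⁽⁾-at0 (suc k) (f ↾ 1F) w))
      expand f (1F ∷ 1F ∷ w) = trans (𝐄⁽⁾-1 (1ᵒ _) f (1F ∷ w) k) (*-congˡ (𝐄⁽⁾-at1 (suc k) (f ↾ 1F) w))
      at : ∀ u → ⟦ ξ n ⟧ (expansion f) u ≈ expansion (⟦ ξ n ⟧ f) u
      at (0F ∷ 0F ∷ w) = sym (trans
        (+-cong (*-congˡ (+-cong (*-congˡ (ξ-zero E f w)) (ξ-01 D f w))) (+-cong (*-congˡ (ξ-10 D f w)) (ξ-zero D′ f w)))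
        (by-relation (P * x) (solve 5 (λ q p P x y →
          (q :* P) :* ((q :* P) :* con 0ℤ :+ (p :* x :- y)) :+ (P :* (:- x :+ q :* y) :+ con 0ℤ)
          := con 0ℤ :+ (q :* p :- con 1ℤ) :* (P :* x)) refl q q⁻¹ P x y)))
        where
        x = ⟦ D ⟧ (f ↾ 0F ↾ 1F) w
        y = ⟦ D ⟧ (f ↾ 1F ↾ 0F) w
      at (0F ∷ 1F ∷ w) = trans
        (solve 6 (λ p Q M x y z → p :* (Q :* ((p :* M) :* x) :+ M :* z) :- (p :* M) :* (Q :* y :+ z)
          := Q :* ((p :* M) :* (p :* x :- y)) :+ M :* con 0ℤ) refl q⁻¹ Q M _ _ _)
        (sym (+-cong (*-congˡ (*-congˡ (ξ-01 E f w))) (*-congˡ (ξ-zero D f w))))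
      at (1F ∷ 0F ∷ w) = trans
        (by-relation (M * z) (solve 7 (λ q p Q M x y z →
          :- (Q :* ((p :* M) :* x) :+ M :* z) :+ q :* ((p :* M) :* (Q :* y :+ z))
          := (p :* M) :* (Q :* (:- x :+ q :* y) :+ con 0ℤ) :+ (q :* p :- con 1ℤ) :* (M :* z)) refl q q⁻¹ Q M _ _ z))
        (sym (*-congˡ (+-cong (*-congˡ (ξ-10 E f w)) (ξ-zero D f w))))
        where z = ⟦ D ⟧ (f ↾ 1F ↾ 1F) w
      at (1F ∷ 1F ∷ w) = sym (trans (*-congˡ (*-congˡ (ξ-zero E f w))) (solve 1 (λ a → a :* (a :* con 0ℤ) := con 0ℤ) refl N))

    ξ-𝐅⁽⁾ : ∀ j n → Commute (ξ n) (𝐅⁽ j ⁾ (2 ℕ.+ n))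
    ξ-𝐅⁽⁾ zero    n f u = refl
    ξ-𝐅⁽⁾ (suc k) n f u = begin
      _ ≈⟨ ⟦⟧-cong (ξ n) (expand f) u ⟩
      _ ≈⟨ at u ⟩
      _ ≈⟨ expand (⟦ ξ n ⟧ f) u ⟨
      _ ∎
      where
      F = 𝐅⁽ suc k ⁾ n
      C = 𝐅⁽ k ⁾ n ∘ 𝐊⁻¹ n
      X = 𝐅↓ k n ∘ 𝐊⁻¹ n
      P = q ^ k
      expansion : Vector (2 ℕ.+ n) → Vector (2 ℕ.+ n)
      expansion f (0F ∷ 0F ∷ w) = ⟦ F ⟧ (f ↾ 0F ↾ 0F) w
      expansion f (0F ∷ 1F ∷ w) = ⟦ F ⟧ (f ↾ 0F ↾ 1F) w + P * ⟦ C ⟧ (f ↾ 0F ↾ 0F) w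
      expansion f (1F ∷ 0F ∷ w) = ⟦ F ⟧ (f ↾ 1F ↾ 0F) w + P * (q⁻¹ * ⟦ C ⟧ (f ↾ 0F ↾ 0F) w)
      expansion f (1F ∷ 1F ∷ w) = (⟦ F ⟧ (f ↾ 1F ↾ 1F) w + P * ⟦ C ⟧ (f ↾ 1F ↾ 0F) w)
                                + P * (q * ⟦ C ⟧ (f ↾ 0F ↾ 1F) w + q⁻¹ * ⟦ X ⟧ (f ↾ 0F ↾ 0F) w)
      expand : ∀ f u → ⟦ 𝐅⁽ suc k ⁾ (2 ℕ.+ n) ⟧ f u ≈ expansion f u
      expand f (0F ∷ 0F ∷ w) = trans (𝐅⁽⁾-0 (1ᵒ _) f (0F ∷ w) k) (𝐅⁽⁾-0 (1ᵒ _) (f ↾ 0F) w k)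
      expand f (0F ∷ 1F ∷ w) = trans (𝐅⁽⁾-0 (1ᵒ _) f (1F ∷ w) k) (𝐅⁽⁾-1 (1ᵒ _) (f ↾ 0F) w k)
      expand f (1F ∷ 0F ∷ w) = trans (𝐅⁽⁾-1 (1ᵒ _) f (0F ∷ w) k)
        (+-cong (𝐅⁽⁾-0 (1ᵒ _) (f ↾ 1F) w k) (*-congˡ (trans (𝐅⁽⁾-at0 k (⟦ 𝐊⁻¹ (suc n) ⟧ (f ↾ 0F)) w)
          (diagonal-0 (𝐅⁽ k ⁾ n) (f ↾ 0F) w q⁻¹ q))))
      expand f (1F ∷ 1F ∷ w) = trans (𝐅⁽⁾-1 (1ᵒ _) f (1F ∷ w) k)
        (+-cong (𝐅⁽⁾-1 (1ᵒ _) (f ↾ 1F) w k) (*-congˡ (trans (𝐅⁽⁾-at1 k (⟦ 𝐊⁻¹ (suc n) ⟧ (f ↾ 0F)) w)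
          (+-cong (diagonal-1 (𝐅⁽ k ⁾ n) (f ↾ 0F) w q⁻¹ q) (diagonal-0 (𝐅↓ k n) (f ↾ 0F) w q⁻¹ q)))))
      at : ∀ u → ⟦ ξ n ⟧ (expansion f) u ≈ expansion (⟦ ξ n ⟧ f) u
      at (0F ∷ 0F ∷ w) = sym (ξ-zero F f w)
      at (0F ∷ 1F ∷ w) = trans
        (solve 5 (λ p P x y z → p :* (x :+ P :* z) :- (y :+ P :* (p :* z)) := (p :* x :- y) :+ P :* con 0ℤ) refl q⁻¹ P _ _ _)
        (sym (+-cong (ξ-01 F f w) (*-congˡ (ξ-zero C f w))))
      at (1F ∷ 0F ∷ w) = trans
        (by-relation (P * z) (solve 6 (λ q p P x y z →
          :- (x :+ P :* z) :+ q :* (y :+ P :* (p :* z))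
          := ((:- x :+ q :* y) :+ P :* (p :* con 0ℤ)) :+ (q :* p :- con 1ℤ) :* (P :* z)) refl q q⁻¹ P _ _ z))
        (sym (+-cong (ξ-10 F f w) (*-congˡ (*-congˡ (ξ-zero C f w)))))
        where z = ⟦ C ⟧ (f ↾ 0F ↾ 0F) w
      at (1F ∷ 1F ∷ w) = sym (trans
        (+-cong (+-cong (ξ-zero F f w) (*-congˡ (ξ-10 C f w)))
                (*-congˡ (+-cong (*-congˡ (ξ-01 C f w)) (*-congˡ (ξ-zero X f w)))))
        (by-relation (P * x) (solve 5 (λ q p P x y →
          (con 0ℤ :+ P :* (:- x :+ q :* y)) :+ P :* (q :* (p :* x :- y) :+ p :* con 0ℤ)
          := con 0ℤ :+ (q :* p :- con 1ℤ) :* (P :* x)) refl q q⁻¹ P x y)))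
        where
        x = ⟦ C ⟧ (f ↾ 0F ↾ 1F) w
        y = ⟦ C ⟧ (f ↾ 1F ↾ 0F) w

    module _ {n : ℕ} where
      open import Algebra.Properties.Ring (Algebra.ring (End n)) public
        using (-‿distribˡ-*; -‿distribʳ-*)
      module E = Algebra (End n)

    ±-commute : ∀ s (B C : Endomorphism {n}) → Commute B C → Commute (±ᵒ s B) C
    ±-commute Sign.+ B C e = e
    ±-commute Sign.- B C e f w = trans (sym (-‿distribˡ-* B C f w)) (trans (-‿cong (e f w)) (-‿distribʳ-* C B f w))

    neg∘neg : (B C : Endomorphism {n}) → E.- B ∘ E.- C ≋ B ∘ C
    neg∘neg B C f w = trans (-‿cong (Endo.Endomorphism.-ᴹ-homo B (⟦ C ⟧ f) w))
      (solve 1 (λ x → :- (:- x) := x) refl _)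

    commute-sym : (B C : Endomorphism {n}) → Commute B C → Commute C B
    commute-sym B C e f w = sym (e f w)

  𝐞-diagonal : ∀ s n i a b → 𝐞 s n i ∘ diagonal a b n ≋ diagonal a b n ∘ 𝐞 s n i
  𝐞-diagonal s (suc (suc n)) zero    a b = ±-commute s (ξ n) (diagonal a b (2 ℕ.+ n)) (ξ-diagonal a b n)
  𝐞-diagonal s (suc (suc n)) (suc i) a b =
    commute-⊗ (matrix a 0# 0# b) (𝐞 s (suc n) i) (diagonal a b (suc n)) (𝐞-diagonal s (suc n) i a b)

  𝐞-𝐄⁽⁾ : ∀ s n i j → 𝐞 s n i ∘ 𝐄⁽ j ⁾ n ≋ 𝐄⁽ j ⁾ n ∘ 𝐞 s n i
  𝐞-𝐄⁽⁾ s n i zero f w = refl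
  𝐞-𝐄⁽⁾ s (suc (suc n)) zero    (suc j) = ±-commute s (ξ n) (𝐄⁽ suc j ⁾ (2 ℕ.+ n)) (ξ-𝐄⁽⁾ (suc j) n)
  𝐞-𝐄⁽⁾ s (suc (suc n)) (suc i) (suc j) = commute-⊕ (1⊗ e)
    (matrix (q ^ suc j) 0# 0# (q⁻¹ ^ suc j) ⊗ᵒ 𝐄⁽ suc j ⁾ (suc n)) (E-matrix ⊗ᵒ 𝐄⁽ j ⁾ (suc n))
    (commute-⊗ _ e (𝐄⁽ suc j ⁾ (suc n)) (𝐞-𝐄⁽⁾ s (suc n) i (suc j)))
    (commute-⊗ _ e (𝐄⁽ j ⁾ (suc n)) (𝐞-𝐄⁽⁾ s (suc n) i j))
    where e = 𝐞 s (suc n) i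

  𝐞-𝐅⁽⁾ : ∀ s n i j → 𝐞 s n i ∘ 𝐅⁽ j ⁾ n ≋ 𝐅⁽ j ⁾ n ∘ 𝐞 s n i
  𝐞-𝐅⁽⁾ s n i zero f w = refl
  𝐞-𝐅⁽⁾ s (suc (suc n)) zero    (suc j) = ±-commute s (ξ n) (𝐅⁽ suc j ⁾ (2 ℕ.+ n)) (ξ-𝐅⁽⁾ (suc j) n)
  𝐞-𝐅⁽⁾ s (suc (suc n)) (suc i) (suc j) = commute-⊕ (1⊗ e)
    (1-matrix ⊗ᵒ 𝐅⁽ suc j ⁾ (suc n)) (matrix 0# 0# (q ^ j) 0# ⊗ᵒ (𝐅⁽ j ⁾ (suc n) ∘ 𝐊⁻¹ (suc n)))
    (commute-⊗ _ e (𝐅⁽ suc j ⁾ (suc n)) (𝐞-𝐅⁽⁾ s (suc n) i (suc j)))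
    (commute-⊗ _ e (𝐅⁽ j ⁾ (suc n) ∘ 𝐊⁻¹ (suc n)) (commute-∘ e (𝐅⁽ j ⁾ (suc n)) (𝐊⁻¹ (suc n))
      (𝐞-𝐅⁽⁾ s (suc n) i j) (𝐞-diagonal s (suc n) i q⁻¹ q)))
    where e = 𝐞 s (suc n) i

  private
    1⊗-∘ : (B C : Endomorphism {n}) → 1⊗ B ∘ 1⊗ C ≋ 1⊗ (B ∘ C)
    1⊗-∘ B C f (i ∷ w) = trans (1⊗-at B (⟦ 1⊗ C ⟧ f) i w) (trans (1⊗-apply B C f i w) (sym (1⊗-at (B ∘ C) f i w)))

    1⊗-• : ∀ r (B : Endomorphism {n}) → 1⊗ (r • B) ≋ r • 1⊗ B
    1⊗-• r B f (i ∷ w) = trans (1⊗-at (r • B) f i w) (*-congˡ (sym (1⊗-at B f i w)))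

    ±-square : ∀ s (B : Endomorphism {n}) δ → B ∘ B ≋ δ • B → ±ᵒ s B ∘ ±ᵒ s B ≋ ± s δ • ±ᵒ s B
    ±-square Sign.+ B δ e = e
    ±-square Sign.- B δ e f w = trans (neg∘neg B B f w) (trans (e f w)
      (solve 2 (λ δ x → δ :* x := (:- δ) :* (:- x)) refl δ _))

    ±-triple : ∀ s (B C : Endomorphism {n}) → (B ∘ C) ∘ B ≋ B → (±ᵒ s B ∘ ±ᵒ s C) ∘ ±ᵒ s B ≋ ±ᵒ s B
    ±-triple Sign.+ B C e = e
    ±-triple Sign.- B C e f w = trans (neg∘neg B C (⟦ E.- B ⟧ f) w)
      (trans (sym (-‿distribʳ-* (B ∘ C) B f w)) (-‿cong (e f w)))

    1⊗-± : ∀ s (B : Endomorphism {n}) → 1⊗ (±ᵒ s B) ≋ ±ᵒ s (1⊗ B)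
    1⊗-± Sign.+ B f w       = refl
    1⊗-± Sign.- B f (i ∷ w) = trans (1⊗-at (E.- B) f i w) (-‿cong (sym (1⊗-at B f i w)))

    triple-cong : {B B′ C C′ : Endomorphism {n}} → B ≋ B′ → C ≋ C′ → (B ∘ C) ∘ B ≋ (B′ ∘ C′) ∘ B′
    triple-cong {B = B} {B′} {C} {C′} e e′ f w =
      trans (⟦⟧-cong B (⟦⟧-cong C (e f)) w) (trans (⟦⟧-cong B (e′ (⟦ B′ ⟧ f)) w) (e (⟦ C′ ⟧ (⟦ B′ ⟧ f)) w))

  𝐞-square : ∀ s n i → 𝐞 s n i ∘ 𝐞 s n i ≋ ± s (q + q⁻¹) • 𝐞 s n i
  𝐞-square s (suc (suc n)) zero    = ±-square s (ξ n) (q + q⁻¹) (ξ∘ξ n)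
  𝐞-square s (suc (suc n)) (suc i) f w = trans (1⊗-∘ e e f w)
    (trans (⊗ᵒ-cong 1-matrix {e ∘ e} {± s (q + q⁻¹) • e} (𝐞-square s (suc n) i) f w) (1⊗-• (± s (q + q⁻¹)) e f w))
    where e = 𝐞 s (suc n) i

  𝐞-adjacent : ∀ s n i j → ∣ toℕ i - toℕ j ∣ ≡ 1 → (𝐞 s n i ∘ 𝐞 s n j) ∘ 𝐞 s n i ≋ 𝐞 s n i
  𝐞-adjacent s (suc (suc n)) zero zero ()
  𝐞-adjacent s (suc (suc zero)) (suc ()) _ _
  𝐞-adjacent s (suc (suc (suc n))) zero (suc zero) _ f w =
    trans (triple-cong {B = ±ᵒ s (ξ (suc n))} {±ᵒ s (ξ (suc n))} {1⊗ (±ᵒ s (ξ n))} {±ᵒ s (1⊗ (ξ n))}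
            (λ _ _ → refl) (1⊗-± s (ξ n)) f w)
          (±-triple s (ξ (suc n)) (1⊗ (ξ n)) (ξ₁ξ₂ξ₁ n) f w)
  𝐞-adjacent s (suc (suc (suc n))) (suc zero) zero _ f w =
    trans (triple-cong {B = 1⊗ (±ᵒ s (ξ n))} {±ᵒ s (1⊗ (ξ n))} {±ᵒ s (ξ (suc n))} {±ᵒ s (ξ (suc n))}
            (1⊗-± s (ξ n)) (λ _ _ → refl) f w)
    (trans (±-triple s (1⊗ (ξ n)) (ξ (suc n)) (ξ₂ξ₁ξ₂ n) f w) (sym (1⊗-± s (ξ n) f w)))
  𝐞-adjacent s (suc (suc n)) (suc i) (suc j) d f w =
    trans (1⊗-∘ e e′ (⟦ 1⊗ e ⟧ f) w)
    (trans (1⊗-∘ (e ∘ e′) e f w) (⊗ᵒ-cong 1-matrix {(e ∘ e′) ∘ e} {e} (𝐞-adjacent s (suc n) i j d) f w))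
    where
    e = 𝐞 s (suc n) i
    e′ = 𝐞 s (suc n) j

  𝐞-distant : ∀ s n i j → 1 ℕ.< ∣ toℕ i - toℕ j ∣ → 𝐞 s n i ∘ 𝐞 s n j ≋ 𝐞 s n j ∘ 𝐞 s n i
  𝐞-distant s (suc (suc n)) zero zero ()
  𝐞-distant s (suc (suc zero)) (suc ()) _ _
  𝐞-distant s (suc (suc n)) zero (suc zero) (ℕ.s≤s ())
  𝐞-distant s (suc (suc (suc n))) zero (suc (suc j)) _ =
    ±-commute s (ξ (suc n)) (1⊗ (1⊗ (𝐞 s _ j))) (ξ-distant (suc n) (𝐞 s _ j))
  𝐞-distant s (suc (suc n)) (suc zero) zero (ℕ.s≤s ())
  𝐞-distant s (suc (suc (suc n))) (suc (suc i)) zero _ =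
    commute-sym (±ᵒ s (ξ (suc n))) (1⊗ (1⊗ (𝐞 s _ i)))
      (±-commute s (ξ (suc n)) (1⊗ (1⊗ (𝐞 s _ i))) (ξ-distant (suc n) (𝐞 s _ i)))
  𝐞-distant s (suc (suc n)) (suc i) (suc j) d =
    commute-⊗ 1-matrix (𝐞 s (suc n) i) (𝐞 s (suc n) j) (𝐞-distant s (suc n) i j d)

record Field c ℓ : Set (lsuc (c ⊔ ℓ)) where
  field
    commutativeRing : CommutativeRing c ℓ
  open CommutativeRing commutativeRing public
  field
    1≉0     : ¬ 1# ≈ 0#
    inverse : ∀ x → ¬ x ≈ 0# → Σ Carrier λ y → x * y ≈ 1#

module SchurWeyl
  {c ℓ} (𝕜 : Field c ℓ) (v : Field.Carrier 𝕜)
  (v≉0 : ¬ Field._≈_ 𝕜 v (Field.0# 𝕜))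
  (s : Sign) (𝔤 : LieAlgebra) (n : ℕ)
  where
  private
    module 𝕜 = Field 𝕜

  v⁻¹ : 𝕜.Carrier
  v⁻¹ = proj₁ (𝕜.inverse v v≉0)

  private
    v*v⁻¹≈1 : v 𝕜.* v⁻¹ 𝕜.≈ 𝕜.1#
    v*v⁻¹≈1 = proj₂ (𝕜.inverse v v≉0)

  open TemperleyLiebOperators 𝕜.commutativeRing v v⁻¹ v*v⁻¹≈1

  δ : 𝕜.Carrier
  δ = ± s (v 𝕜.+ v⁻¹)

  open TemperleyLieb 𝕜.commutativeRing δ n
  open QuantumGroup 𝕜.commutativeRing v v⁻¹ v*v⁻¹≈1 𝔤
  open TensorPower 𝕜.commutativeRing
  private
    module 𝐔 = Algebra 𝐔
    module TL = Algebra TL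
    module E = Algebra (End n)

  representationTL : AlgebraHom TL (End n)
  representationTL = Presentation.extend 𝕜.commutativeRing Relation (End n) (𝐞 s n)
    (λ { (square i) → 𝐞-square s n i
       ; (adjacent i j d) → 𝐞-adjacent s n i j d
       ; (distant i j d) → 𝐞-distant s n i j d })

  ρ : 𝐔.Carrier → E.Carrier
  ρ = AlgebraHom.⟦_⟧ (representation n)

  τ : TL.Carrier → E.Carrier
  τ = AlgebraHom.⟦_⟧ representationTL

  module End-TL = Centralizer (End n) τ
  module End-𝐔 = Centralizer (End n) ρ

  private
    open LatticeAction 𝔤 n 𝕜.commutativeRing v v⁻¹ v*v⁻¹≈1
      (Specialization.specialize 𝕜.commutativeRing v v⁻¹ v*v⁻¹≈1)
    module Int = QuantumGL₂.Integral 𝔤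
    module C𝐞 = Centralizer (End n) (𝐞 s n)

    operator-commutes : ∀ x → C𝐞.Commutes (operator x)
    operator-commutes QuantumGL₂.E⁽ j ⁾ i f w = 𝕜.sym (𝐞-𝐄⁽⁾ s n i j f w)
    operator-commutes QuantumGL₂.F⁽ j ⁾ i f w = 𝕜.sym (𝐞-𝐅⁽⁾ s n i j f w)
    operator-commutes QuantumGL₂.K₁ i f w = 𝕜.sym (𝐞-diagonal s n i _ _ f w)
    operator-commutes QuantumGL₂.K₁⁻¹ i f w = 𝕜.sym (𝐞-diagonal s n i _ _ f w)
    operator-commutes QuantumGL₂.K₂ i f w = 𝕜.sym (𝐞-diagonal s n i _ _ f w)
    operator-commutes QuantumGL₂.K₂⁻¹ i f w = 𝕜.sym (𝐞-diagonal s n i _ _ f w)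
    operator-commutes QuantumGL₂.K i f w = 𝕜.sym (𝐞-diagonal s n i _ _ f w)
    operator-commutes QuantumGL₂.K⁻¹ i f w = 𝕜.sym (𝐞-diagonal s n i _ _ f w)

    act-commutes : ∀ {u} (p : Int.Generated u) → C𝐞.Commutes (act p)
    act-commutes (Int.gen x)       = operator-commutes x
    act-commutes (Int.scalar r)    = λ i → E.ι-central _ (𝐞 s n i)
    act-commutes (Int.add p p′)    = C𝐞.+-commutes {act p} {act p′} (act-commutes p) (act-commutes p′)
    act-commutes (Int.mul p p′)    = C𝐞.*-commutes {act p} {act p′} (act-commutes p) (act-commutes p′)
    act-commutes (Int.respect e p) = act-commutes p

    ρ-commutes-𝐞 : ∀ u → C𝐞.Commutes (ρ u)
    ρ-commutes-𝐞 ((_ , p) Base.⊗ r) = C𝐞.*-commutes {E.ι r} {act p} (λ i → E.ι-central r (𝐞 s n i)) (act-commutes p)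
    ρ-commutes-𝐞 Base.0#      i = E.trans {E.0# E.* 𝐞 s n i} {E.0#} {𝐞 s n i E.* E.0#} (E.zeroˡ (𝐞 s n i)) (E.sym {𝐞 s n i E.* E.0#} {E.0#} (E.zeroʳ (𝐞 s n i)))
    ρ-commutes-𝐞 (x Base.+ y)   = C𝐞.+-commutes {ρ x} {ρ y} (ρ-commutes-𝐞 x) (ρ-commutes-𝐞 y)
    ρ-commutes-𝐞 (Base.- x)     = C𝐞.neg-commutes {ρ x} (ρ-commutes-𝐞 x)

    τ-commutes : ∀ a → End-𝐔.Commutes (τ a)
    τ-commutes (gen i) u = E.sym {ρ u E.* 𝐞 s n i} {𝐞 s n i E.* ρ u} (ρ-commutes-𝐞 u i)
    τ-commutes (con r) u = E.ι-central r (ρ u)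
    τ-commutes (a + b)   = End-𝐔.+-commutes {τ a} {τ b} (τ-commutes a) (τ-commutes b)
    τ-commutes (a * b)   = End-𝐔.*-commutes {τ a} {τ b} (τ-commutes a) (τ-commutes b)

    ρ-commutes : ∀ u → End-TL.Commutes (ρ u)
    ρ-commutes u a = E.sym {τ a E.* ρ u} {ρ u E.* τ a} (τ-commutes a u)

  𝐔→End-TL : AlgebraHom 𝐔 End-TL.algebra
  𝐔→End-TL = record
    { ⟦_⟧ = λ u → ρ u , ρ-commutes u
    ; isRingHomomorphism = mkRingHom 𝐔.ring (Algebra.ring End-TL.algebra) _
        (λ {x} {y} → R.⟦⟧-cong {x} {y}) R.+-homo R.*-homo R.1#-homo
    ; ι-homo = R.ι-homo }
    where module R = AlgebraHom (representation n)

  TL→End-𝐔 : AlgebraHom TL End-𝐔.algebra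
  TL→End-𝐔 = record
    { ⟦_⟧ = λ a → τ a , τ-commutes a
    ; isRingHomomorphism = mkRingHom TL.ring (Algebra.ring End-𝐔.algebra) _
        T.⟦⟧-cong T.+-homo T.*-homo T.1#-homo
    ; ι-homo = T.ι-homo }
    where module T = AlgebraHom representationTL

{-# OPTIONS --safe #-}
{- Everything holds over a commutative ring in which q = v is invertible; as equality in 𝕜
   need not be decidable, all coefficients are produced by explicit triangular systems.

   U → End_TL.  The weight space of V^{⊗n} with a ones and b zeros is generated over TL by
   x₁^a ⊗ x₀^b, so a map f commuting with TL is determined there by the image of this vector.
   The image is q-symmetric in the first a and in the last b letters, and the vectors
   E⁽ᵐ⁾F⁽ᵏ⁾(x₁^a ⊗ x₀^b) form a triangular system with unit diagonal; so on each weight space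
   f is a combination of the E⁽ᵐ⁾F⁽ᵏ⁾. It remains to find the weight projections in the image
   of U, by induction from the outer weights inwards. For weight -h, F⁽ʰ⁾E⁽ʰ⁾ cut off by the
   outer projections is supported on one weight space, where it is Σ κₘ E⁽ᵐ⁾F⁽ᵐ⁾; the vector
   cup^r ⊗ x₁^h is killed by the F⁽ᵐ⁾ with m ≥ 1 and shows that κ₀ is a unit, while the terms
   with m ≥ 1 factor through outer weights.

   TL → End_U.  Bending the inputs around turns f ∈ End_U(V^{⊗n}) into an invariant vector of
   V^{⊗2n}. Reading an invariant vector from the left, its restriction to the words 1^k… has
   weight k and is killed by the E⁽ʲ⁾; if it vanishes on 1^{k+1}…, then its restriction to
   1^k 0… has the same property for k - 1, and is zero for k = 0. This follows the recursion of
   Dyck paths, the second case being the insertion of a cup at positions k, k + 1, so invariant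
   vectors are expanded in noncrossing diagrams with uniquely determined coefficients. On the
   other hand, TL_n is spanned by products of words eᵢeᵢ₊₁⋯e_j that follow the same recursion;
   hence the expansion is inverse to the action. -}
module Submission where

open import Defs
open import Algebra.Bundles using (CommutativeRing; Monoid; module CommutativeMonoid)
import Algebra.Solver.Monoid as MonoidSolver
open import Data.Bool.Base as Bool using (Bool; true; false; if_then_else_; not; _∧_)
open import Data.Fin.Base using (Fin; zero; suc; toℕ)
open import Data.Fin.Patterns using (0F; 1F)
open import Data.Integer.Base using (0ℤ; 1ℤ)
open import Data.List.Base as List using (List; []; _∷_; length)
open import Data.Nat.Base as ℕ using (ℕ; zero; suc; _∸_; z≤n; s≤s)
import Data.Nat.Properties as ℕ
open import Data.Product.Base using (Σ; _×_; _,_; proj₁; proj₂)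
open import Data.Sign.Base as Sign using (Sign)
open import Data.Sum.Base using (_⊎_; inj₁; inj₂)
open import Data.Vec.Base using (Vec; []; _∷_; _++_; last; map; replicate; splitAt; toList)
open import Level using (Level; _⊔_)
open import Relation.Binary.Definitions using (tri<; tri≈; tri>)
import Relation.Binary.PropositionalEquality as ≡
open ≡ using (_≡_; _≢_)
open import Relation.Nullary using (¬_; yes; no; contradiction)

-- When v is a root of unity, distinct weights can have the same K-eigenvalue, so the weight
-- projections need not be polynomials in K. This is the obstacle on the side of U and the reason
-- why the projections are built from divided powers. The step for one weight needs the weights
-- further out at both ends of the range. One end is the mirror image of the other under x₀ ↔ x₁, q
-- ↔ q⁻¹; for this reason the ladder operators are normalised so as to be exchanged by the symmetry,
-- and reachability is proved for q and q⁻¹ together.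
--
-- On the side of TL no dimensions are counted. A single recursion, `lift`, turns any function on
-- words into an element of TL. It is evaluated twice: on the vector of a spanning element it gives
-- back this element, whence injectivity; on the vector of an equivariant map it gives an element
-- that acts as this map, whence surjectivity.

private variable n : ℕ

-- Words in the letters 0 and 1

opp : Fin 2 → Fin 2
opp 0F = 1F
opp 1F = 0F

opp-involutive : ∀ i → opp (opp i) ≡ i
opp-involutive 0F = ≡.refl
opp-involutive 1F = ≡.refl

opps : ∀ {n} → Vec (Fin 2) n → Vec (Fin 2) n
opps = map opp

opps-involutive : ∀ {n} (w : Vec (Fin 2) n) → opps (opps w) ≡ w
opps-involutive []      = ≡.refl
opps-involutive (i ∷ w) = ≡.cong₂ _∷_ (opp-involutive i) (opps-involutive w)

ones zeros : ∀ {n} → Vec (Fin 2) n → ℕ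
ones []       = 0
ones (0F ∷ w) = ones w
ones (1F ∷ w) = suc (ones w)
zeros []       = 0
zeros (0F ∷ w) = suc (zeros w)
zeros (1F ∷ w) = zeros w

ones-opps : ∀ {n} (w : Vec (Fin 2) n) → ones (opps w) ≡ zeros w
ones-opps []       = ≡.refl
ones-opps (0F ∷ w) = ≡.cong suc (ones-opps w)
ones-opps (1F ∷ w) = ones-opps w

zeros-opps : ∀ {n} (w : Vec (Fin 2) n) → zeros (opps w) ≡ ones w
zeros-opps []       = ≡.refl
zeros-opps (0F ∷ w) = zeros-opps w
zeros-opps (1F ∷ w) = ≡.cong suc (zeros-opps w)

zeros+ones : ∀ {n} (w : Vec (Fin 2) n) → zeros w ℕ.+ ones w ≡ n
zeros+ones []       = ≡.refl
zeros+ones (0F ∷ w) = ≡.cong suc (zeros+ones w)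
zeros+ones (1F ∷ w) = ≡.trans (ℕ.+-suc (zeros w) (ones w)) (≡.cong suc (zeros+ones w))

<ᵇ-true : ∀ {m n} → m ℕ.< n → (m ℕ.<ᵇ n) ≡ true
<ᵇ-true {m} {n} p with m ℕ.<ᵇ n | ℕ.<⇒<ᵇ p
... | true | _ = ≡.refl

<ᵇ-false : ∀ {m n} → n ℕ.≤ m → (m ℕ.<ᵇ n) ≡ false
<ᵇ-false {m} {n} p with m ℕ.<ᵇ n in eq
... | false = ≡.refl
... | true  = contradiction (ℕ.<ᵇ⇒< m n (≡.subst Bool.T (≡.sym eq) _)) (ℕ.≤⇒≯ p)

≡ᵇ-true : ∀ {m n} → m ≡ n → (m ℕ.≡ᵇ n) ≡ true
≡ᵇ-true {m} {n} p with m ℕ.≡ᵇ n | ℕ.≡⇒≡ᵇ m n p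
... | true | _ = ≡.refl

≡ᵇ-false : ∀ {m n} → m ≢ n → (m ℕ.≡ᵇ n) ≡ false
≡ᵇ-false {m} {n} p with m ℕ.≡ᵇ n in eq
... | false = ≡.refl
... | true  = contradiction (ℕ.≡ᵇ⇒≡ m n (≡.subst Bool.T (≡.sym eq) _)) p

-- Coordinates, the exchange of x₀ and x₁, and coordinate projections

module Coordinates {c ℓ} (R : CommutativeRing c ℓ) where
  open CommutativeRing R hiding (zero)
  open FromℤR.Solver R using (solve; _:=_; _:*_)
  open TensorPower R
  open import Relation.Binary.Reasoning.Setoid setoid

  infixr 9 _◁_
  _◁_ : Fin 2 → Vector n → Vector (suc n)
  (0F ◁ f) (0F ∷ w) = f w
  (0F ◁ f) (1F ∷ w) = 0#
  (1F ◁ f) (0F ∷ w) = 0#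
  (1F ◁ f) (1F ∷ w) = f w

  ◁-cong : ∀ i {f g : Vector n} → (∀ w → f w ≈ g w) → ∀ w → (i ◁ f) w ≈ (i ◁ g) w
  ◁-cong 0F e (0F ∷ w) = e w
  ◁-cong 0F e (1F ∷ w) = refl
  ◁-cong 1F e (0F ∷ w) = refl
  ◁-cong 1F e (1F ∷ w) = e w

  ◁-* : ∀ i r (f : Vector n) w → (i ◁ (λ w → r * f w)) w ≈ r * (i ◁ f) w
  ◁-* 0F r f (0F ∷ w) = refl
  ◁-* 0F r f (1F ∷ w) = sym (zeroʳ r)
  ◁-* 1F r f (0F ∷ w) = sym (zeroʳ r)
  ◁-* 1F r f (1F ∷ w) = refl

  ◁-0 : ∀ i (w : Vec (Fin 2) (suc n)) → (i ◁ (λ _ → 0#)) w ≈ 0#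
  ◁-0 0F (0F ∷ w) = refl
  ◁-0 0F (1F ∷ w) = refl
  ◁-0 1F (0F ∷ w) = refl
  ◁-0 1F (1F ∷ w) = refl

  basis : Vec (Fin 2) n → Vector n
  basis []      [] = 1#
  basis (i ∷ u)    = i ◁ basis u

  dot : ∀ n → Vector n → Vector n → Carrier
  dot zero    f g = f [] * g []
  dot (suc n) f g = dot n (f ↾ 0F) (g ↾ 0F) + dot n (f ↾ 1F) (g ↾ 1F)

  dot-cong : ∀ n {f f′ g g′ : Vector n} → (∀ w → f w ≈ f′ w) → (∀ w → g w ≈ g′ w) → dot n f g ≈ dot n f′ g′
  dot-cong zero    e e′ = *-cong (e []) (e′ [])
  dot-cong (suc n) e e′ =
    +-cong (dot-cong n (λ w → e (0F ∷ w)) (λ w → e′ (0F ∷ w)))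
           (dot-cong n (λ w → e (1F ∷ w)) (λ w → e′ (1F ∷ w)))

  dot-comm : ∀ n (f g : Vector n) → dot n f g ≈ dot n g f
  dot-comm zero    f g = *-comm _ _
  dot-comm (suc n) f g = +-cong (dot-comm n _ _) (dot-comm n _ _)

  dot-*ʳ : ∀ n r (f g : Vector n) → dot n f (λ w → r * g w) ≈ r * dot n f g
  dot-*ʳ zero    r f g = solve 3 (λ r a b → a :* (r :* b) := r :* (a :* b)) refl r _ _
  dot-*ʳ (suc n) r f g = trans (+-cong (dot-*ʳ n r _ _) (dot-*ʳ n r _ _)) (sym (distribˡ _ _ _))

  dot-0ʳ : ∀ n (f : Vector n) → dot n f (λ _ → 0#) ≈ 0#
  dot-0ʳ zero    f = zeroʳ _
  dot-0ʳ (suc n) f = trans (+-cong (dot-0ʳ n _) (dot-0ʳ n _)) (+-identityˡ 0#)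

  dot-*ˡ : ∀ n r (f g : Vector n) → dot n (λ w → r * f w) g ≈ r * dot n f g
  dot-*ˡ n r f g = trans (dot-comm n _ g) (trans (dot-*ʳ n r g f) (*-congˡ (dot-comm n g f)))

  dot-0ˡ : ∀ n (g : Vector n) → dot n (λ _ → 0#) g ≈ 0#
  dot-0ˡ n g = trans (dot-comm n _ g) (dot-0ʳ n g)

  record Functional (n : ℕ) : Set (c ⊔ ℓ) where
    field
      fun      : Vector n → Carrier
      fun-cong : ∀ {f g} → (∀ w → f w ≈ g w) → fun f ≈ fun g
      fun-+    : ∀ f g → fun (λ w → f w + g w) ≈ fun f + fun g
      fun-*    : ∀ r f → fun (λ w → r * f w) ≈ r * fun f
  open Functional

  coordinate : Endomorphism {n} → Vec (Fin 2) n → Functional n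
  coordinate B u = record
    { fun = λ f → ⟦ B ⟧ f u
    ; fun-cong = λ e → ⟦⟧-cong B e u
    ; fun-+ = λ f g → +ᴹ-homo B f g u
    ; fun-* = λ r f → *ₗ-homo B r f u }

  split : ∀ (f : Vector (suc n)) w → f w ≈ (0F ◁ (f ↾ 0F)) w + (1F ◁ (f ↾ 1F)) w
  split f (0F ∷ w) = sym (+-identityʳ _)
  split f (1F ∷ w) = sym (+-identityˡ _)

  private
    restrict : Fin 2 → Functional (suc n) → Functional n
    restrict i L = record
      { fun = λ f → fun L (i ◁ f)
      ; fun-cong = λ e → fun-cong L (◁-cong i e)
      ; fun-+ = λ f g → trans (fun-cong L (◁-+ i f g)) (fun-+ L _ _)
      ; fun-* = λ r f → trans (fun-cong L (◁-* i r f)) (fun-* L r _) }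
      where
      ◁-+ : ∀ i (f g : Vector n) w → (i ◁ (λ w → f w + g w)) w ≈ (i ◁ f) w + (i ◁ g) w
      ◁-+ 0F f g (0F ∷ w) = refl
      ◁-+ 0F f g (1F ∷ w) = sym (+-identityˡ _)
      ◁-+ 1F f g (0F ∷ w) = sym (+-identityˡ _)
      ◁-+ 1F f g (1F ∷ w) = refl

  functional-expand : ∀ n (L : Functional n) f → fun L f ≈ dot n f (λ u → fun L (basis u))
  functional-expand zero    L f = trans
    (fun-cong L (λ { [] → sym (*-identityʳ _) })) (fun-* L (f []) (basis []))
  functional-expand (suc n) L f = begin
    fun L f                                              ≈⟨ fun-cong L (split f) ⟩
    fun L (λ w → (0F ◁ (f ↾ 0F)) w + (1F ◁ (f ↾ 1F)) w)  ≈⟨ fun-+ L _ _ ⟩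
    fun L (0F ◁ (f ↾ 0F)) + fun L (1F ◁ (f ↾ 1F))        ≈⟨ +-cong (functional-expand n (restrict 0F L) (f ↾ 0F))
                                                                  (functional-expand n (restrict 1F L) (f ↾ 1F)) ⟩
    _                                                    ∎

  expand : (B : Endomorphism {n}) (f : Vector n) → ∀ w → ⟦ B ⟧ f w ≈ dot n f (λ u → ⟦ B ⟧ (basis u) w)
  expand B f w = functional-expand _ (coordinate B w) f

  ≋-from-basis : (B C : Endomorphism {n}) → (∀ u w → ⟦ B ⟧ (basis u) w ≈ ⟦ C ⟧ (basis u) w) → B ≋ C
  ≋-from-basis {n} B C e f w = trans (expand B f w)
    (trans (dot-cong n {f} (λ _ → refl) (λ u → e u w)) (sym (expand C f w)))

  ⟦⟧-0 : (B : Endomorphism {n}) → ∀ w → ⟦ B ⟧ (λ _ → 0#) w ≈ 0#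
  ⟦⟧-0 B w = Endo.Endomorphism.0ᴹ-homo B w

  ⟦⟧-zero : (B : Endomorphism {n}) {f : Vector n} → (∀ w → f w ≈ 0#) → ∀ w → ⟦ B ⟧ f w ≈ 0#
  ⟦⟧-zero B e w = trans (⟦⟧-cong B e w) (⟦⟧-0 B w)

  ⟦⟧-neg : (B : Endomorphism {n}) (f : Vector n) → ∀ w → ⟦ B ⟧ (λ w → - f w) w ≈ - ⟦ B ⟧ f w
  ⟦⟧-neg B f w = Endo.Endomorphism.-ᴹ-homo B f w

  ⟦⟧-minus : (B : Endomorphism {n}) (f g : Vector n) → ∀ w → ⟦ B ⟧ (λ w → f w - g w) w ≈ ⟦ B ⟧ f w - ⟦ B ⟧ g w
  ⟦⟧-minus B f g w = trans (+ᴹ-homo B f _ w) (+-congˡ (⟦⟧-neg B g w))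

  flip : Vector n → Vector n
  flip f w = f (opps w)

  flip-involutive : (f : Vector n) → ∀ w → flip (flip f) w ≈ f w
  flip-involutive f w = reflexive (≡.cong f (opps-involutive w))

  flipᵒ : Endomorphism {n} → Endomorphism {n}
  flipᵒ B = mkEndomorphism (λ f → flip (⟦ B ⟧ (flip f)))
    (λ e w → ⟦⟧-cong B (λ w → e (opps w)) (opps w))
    (λ f g w → +ᴹ-homo B (flip f) (flip g) (opps w))
    (λ r f w → *ₗ-homo B r (flip f) (opps w))

  flipᵒ-∘ : (B C : Endomorphism {n}) → flipᵒ (B ∘ C) ≋ flipᵒ B ∘ flipᵒ C
  flipᵒ-∘ B C f w = ⟦⟧-cong B (λ w → sym (flip-involutive (⟦ C ⟧ (flip f)) w)) (opps w)

  flipᵒ-involutive : (B : Endomorphism {n}) → flipᵒ (flipᵒ B) ≋ B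
  flipᵒ-involutive B f w = trans (flip-involutive (⟦ B ⟧ (flip (flip f))) w) (⟦⟧-cong B (flip-involutive f) w)

  flipᵒ-cong : {B C : Endomorphism {n}} → B ≋ C → flipᵒ B ≋ flipᵒ C
  flipᵒ-cong e f w = e (flip f) (opps w)

  -- Conditions are Booleans so that successive cuts combine by `∧` and can be compared by equations
  -- between Booleans (`window-D`, `window-E`).
  mask : Bool → Carrier → Carrier
  mask b x = if b then x else 0#

  mask-cong : ∀ b {x y} → x ≈ y → mask b x ≈ mask b y
  mask-cong false e = refl
  mask-cong true  e = e

  mask-+ : ∀ b x y → mask b (x + y) ≈ mask b x + mask b y
  mask-+ false x y = sym (+-identityˡ 0#)
  mask-+ true  x y = refl

  mask-* : ∀ b r x → mask b (r * x) ≈ r * mask b x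
  mask-* false r x = sym (zeroʳ r)
  mask-* true  r x = refl

  mask-0 : ∀ b → mask b 0# ≈ 0#
  mask-0 false = refl
  mask-0 true  = refl

  select : (Vec (Fin 2) n → Bool) → Endomorphism {n}
  select P = mkEndomorphism (λ f w → mask (P w) (f w))
    (λ e w → mask-cong (P w) (e w))
    (λ f g w → mask-+ (P w) (f w) (g w))
    (λ r f w → mask-* (P w) r (f w))

  IsUnit : Carrier → Set (c ⊔ ℓ)
  IsUnit x = Σ Carrier λ y → x * y ≈ 1#

  unit-1 : IsUnit 1#
  unit-1 = 1# , *-identityˡ 1#

  unit-* : ∀ {x y} → IsUnit x → IsUnit y → IsUnit (x * y)
  unit-* {x} {y} (x′ , e) (y′ , e′) = x′ * y′ , (begin
    (x * y) * (x′ * y′)  ≈⟨ solve 4 (λ x y x′ y′ → (x :* y) :* (x′ :* y′) := (x :* x′) :* (y :* y′)) refl x y x′ y′ ⟩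
    (x * x′) * (y * y′)  ≈⟨ *-cong e e′ ⟩
    1# * 1#              ≈⟨ *-identityˡ 1# ⟩
    1#                   ∎)

  unit-resp : ∀ {x y} → x ≈ y → IsUnit x → IsUnit y
  unit-resp e (x′ , e′) = x′ , trans (*-congʳ (sym e)) e′

-- Raising and lowering operators and the algebra they generate

module Raising {c ℓ} (R : CommutativeRing c ℓ) (q q⁻¹ : CommutativeRing.Carrier R)
  (q*q⁻¹≈1 : CommutativeRing._≈_ R (CommutativeRing._*_ R q q⁻¹) (CommutativeRing.1# R))
  where
  open CommutativeRing R hiding (zero)
  open TensorPower R
  open Coordinates R
  open QuantumOperators R q q⁻¹ q*q⁻¹≈1
  open import Algebra.Properties.Semiring.Exp semiring using (_^_)
  open import Relation.Binary.Reasoning.Setoid setoid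

  -- E⁽ʲ⁻¹⁾ with the convention E⁽⁻¹⁾ = 0, so that `E-0` covers j = 0 as well.
  E↓ : ℕ → ∀ n → Endomorphism {n}
  E↓ zero    n = 0ᵒ n
  E↓ (suc j) n = 𝐄⁽ j ⁾ n

  E-0 : ∀ j (f : Vector (suc n)) w → ⟦ 𝐄⁽ j ⁾ (suc n) ⟧ f (0F ∷ w) ≈ q ^ j * ⟦ 𝐄⁽ j ⁾ n ⟧ (f ↾ 0F) w + ⟦ E↓ j n ⟧ (f ↾ 1F) w
  E-0 zero    f w = sym (trans (+-identityʳ _) (*-identityˡ _))
  E-0 (suc j) f w = 𝐄⁽⁾-0 (1ᵒ _) f w j

  E-1 : ∀ j (f : Vector (suc n)) w → ⟦ 𝐄⁽ j ⁾ (suc n) ⟧ f (1F ∷ w) ≈ q⁻¹ ^ j * ⟦ 𝐄⁽ j ⁾ n ⟧ (f ↾ 1F) w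
  E-1 zero    f w = sym (*-identityˡ _)
  E-1 (suc j) f w = 𝐄⁽⁾-1 (1ᵒ _) f w j

  -- E⁽ʲ⁾ turns j letters 1 into 0, so a coordinate with o ones is fed by words with o + j ones, and
  -- a cut passes through with this shift. `χ` is arbitrary because the induction replaces it by its
  -- shift whenever a letter 1 is split off.
  E-mask : ∀ (χ : ℕ → Bool) j (f : Vector n) w →
           ⟦ 𝐄⁽ j ⁾ n ⟧ (λ w → mask (χ (ones w)) (f w)) w ≈ mask (χ (ones w ℕ.+ j)) (⟦ 𝐄⁽ j ⁾ n ⟧ f w)
  E-mask χ zero f w = reflexive (≡.cong (λ k → mask (χ k) (f w)) (≡.sym (ℕ.+-identityʳ (ones w))))
  E-mask χ (suc j) f [] = sym (mask-0 (χ (suc j)))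
  E-mask {suc n} χ (suc j) f (0F ∷ w) = begin
    _ ≈⟨ E-0 (suc j) (λ w → mask (χ (ones w)) (f w)) w ⟩
    _ ≈⟨ +-cong (*-congˡ (E-mask χ (suc j) (f ↾ 0F) w)) (E-mask (λ k → χ (suc k)) j (f ↾ 1F) w) ⟩
    _ ≈⟨ +-congˡ (reflexive (≡.cong (λ k → mask (χ k) (⟦ 𝐄⁽ j ⁾ n ⟧ (f ↾ 1F) w)) (≡.sym (ℕ.+-suc (ones w) j)))) ⟩
    _ ≈⟨ +-congʳ (mask-* b _ _) ⟨
    _ ≈⟨ mask-+ b _ _ ⟨
    _ ≈⟨ mask-cong b (E-0 (suc j) f w) ⟨
    _ ∎
    where b = χ (ones w ℕ.+ suc j)
  E-mask {suc n} χ (suc j) f (1F ∷ w) = begin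
    _ ≈⟨ E-1 (suc j) (λ w → mask (χ (ones w)) (f w)) w ⟩
    _ ≈⟨ *-congˡ (E-mask (λ k → χ (suc k)) (suc j) (f ↾ 1F) w) ⟩
    _ ≈⟨ mask-* b _ _ ⟨
    _ ≈⟨ mask-cong b (E-1 (suc j) f w) ⟨
    _ ∎
    where b = χ (suc (ones w ℕ.+ suc j))

module Ladder {c ℓ} (R : CommutativeRing c ℓ) (q q⁻¹ : CommutativeRing.Carrier R)
  (q*q⁻¹≈1 : CommutativeRing._≈_ R (CommutativeRing._*_ R q q⁻¹) (CommutativeRing.1# R))
  (q⁻¹*q≈1 : CommutativeRing._≈_ R (CommutativeRing._*_ R q⁻¹ q) (CommutativeRing.1# R))
  where
  open CommutativeRing R hiding (zero)
  open FromℤR.Solver R using (solve; _:=_; _:+_; _:*_)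
  open TensorPower R
  open Coordinates R
  open QuantumOperators R q q⁻¹ q*q⁻¹≈1 public
  open Raising R q q⁻¹ q*q⁻¹≈1 public
  open TemperleyLiebOperators R q q⁻¹ q*q⁻¹≈1 using (𝐞; 𝐞-diagonal; 𝐞-𝐄⁽⁾; 𝐞-𝐅⁽⁾)
  open import Algebra.Properties.Semiring.Exp semiring using (_^_)
  open import Relation.Binary.Reasoning.Setoid setoid
  private
    module Q⁻ = QuantumOperators R q⁻¹ q q⁻¹*q≈1
    module R⁻ = Raising R q⁻¹ q q⁻¹*q≈1

  -- Up to a power of q, D⁽ʲ⁾ is F⁽ʲ⁾Kʲ (D≋F∘K). Unlike F⁽ʲ⁾, it is exchanged with E⁽ʲ⁾ by the
  -- symmetry x₀ ↔ x₁, q ↔ q⁻¹, which fixes ξ.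
  D⁽_⁾ : ℕ → ∀ n → Endomorphism {n}
  D⁽ j ⁾ n = flipᵒ (Q⁻.𝐄⁽ j ⁾ n)

  D↓ : ℕ → ∀ n → Endomorphism {n}
  D↓ j n = flipᵒ (R⁻.E↓ j n)

  D-1 : ∀ j (f : Vector (suc n)) w → ⟦ D⁽ j ⁾ (suc n) ⟧ f (1F ∷ w) ≈ q⁻¹ ^ j * ⟦ D⁽ j ⁾ n ⟧ (f ↾ 1F) w + ⟦ D↓ j n ⟧ (f ↾ 0F) w
  D-1 j f w = R⁻.E-0 j (flip f) (opps w)

  D-0 : ∀ j (f : Vector (suc n)) w → ⟦ D⁽ j ⁾ (suc n) ⟧ f (0F ∷ w) ≈ q ^ j * ⟦ D⁽ j ⁾ n ⟧ (f ↾ 0F) w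
  D-0 j f w = R⁻.E-1 j (flip f) (opps w)

  D-mask : ∀ (χ : ℕ → Bool) j (f : Vector n) w →
           ⟦ D⁽ j ⁾ n ⟧ (λ w → mask (χ (zeros w)) (f w)) w ≈ mask (χ (zeros w ℕ.+ j)) (⟦ D⁽ j ⁾ n ⟧ f w)
  D-mask {n} χ j f w = begin
    _ ≈⟨ ⟦⟧-cong (Q⁻.𝐄⁽ j ⁾ n) (λ w → reflexive (≡.cong (λ k → mask (χ k) (f (opps w))) (zeros-opps w))) (opps w) ⟩
    _ ≈⟨ R⁻.E-mask χ j (flip f) (opps w) ⟩
    _ ≡⟨ ≡.cong (λ k → mask (χ (k ℕ.+ j)) (⟦ D⁽ j ⁾ n ⟧ f w)) (ones-opps w) ⟩
    _ ∎

  unit-q^ : ∀ j → IsUnit (q ^ j)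
  unit-q^ j = q⁻¹ ^ j , q^*q⁻¹^ j

  unit-q⁻¹^ : ∀ j → IsUnit (q⁻¹ ^ j)
  unit-q⁻¹^ j = q ^ j , Q⁻.q^*q⁻¹^ j

  -- θ j = q^(-j²)
  θ : ℕ → Carrier
  θ zero    = 1#
  θ (suc j) = θ j * (q⁻¹ ^ suc j * q⁻¹ ^ j)

  K^ : ℕ → ∀ n → Endomorphism {n}
  K^ j n = diagonal (q ^ j) (q⁻¹ ^ j) n

  K⁻¹K^ : ∀ j n → 𝐊⁻¹ n ∘ K^ (suc j) n ≋ K^ j n
  K⁻¹K^ j n f w = trans (diagonal-∘ q⁻¹ q (q ^ suc j) (q⁻¹ ^ suc j) n f w)
    (diagonal-cong (cancel-q⁻¹ (q ^ j)) (cancel-q (q⁻¹ ^ j)) n f w)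

  -- Both sides obey the same recursion in the first letter. In the mixed term, F⁽ʲ⁺¹⁾ contributes
  -- qʲ, the power Kʲ⁺¹ contributes qʲ⁺¹ on x₀, and one K cancels the K⁻¹ of the coproduct; q²ʲ⁺¹ is
  -- the ratio of consecutive values of `θ`.
  D≋F∘K : ∀ j n → D⁽ j ⁾ n ≋ θ j • (𝐅⁽ j ⁾ n ∘ K^ j n)
  D≋F∘K zero    n f w = trans (flip-involutive f w) (sym (trans (*-identityˡ _) (diagonal-1-1 n f w)))
  D≋F∘K (suc j) zero f w = sym (zeroʳ _)
  D≋F∘K (suc j) (suc n) f (0F ∷ w) = begin
    ⟦ D⁽ suc j ⁾ (suc n) ⟧ f (0F ∷ w)
      ≈⟨ D-0 (suc j) f w ⟩
    q ^ suc j * ⟦ D⁽ suc j ⁾ n ⟧ (f ↾ 0F) w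
      ≈⟨ *-congˡ (D≋F∘K (suc j) n (f ↾ 0F) w) ⟩
    q ^ suc j * (θ (suc j) * X)
      ≈⟨ solve 3 (λ a t x → a :* (t :* x) := t :* (a :* x)) refl (q ^ suc j) (θ (suc j)) X ⟩
    θ (suc j) * (q ^ suc j * X)
      ≈⟨ *-congˡ (trans (𝐅⁽⁾-0 (1ᵒ _) (⟦ K^ (suc j) (suc n) ⟧ f) w j)
                        (diagonal-0 (𝐅⁽ suc j ⁾ n) f w (q ^ suc j) (q⁻¹ ^ suc j))) ⟨
    _ ∎
    where X = ⟦ 𝐅⁽ suc j ⁾ n ∘ K^ (suc j) n ⟧ (f ↾ 0F) w
  D≋F∘K (suc j) (suc n) f (1F ∷ w) = begin
    ⟦ D⁽ suc j ⁾ (suc n) ⟧ f (1F ∷ w)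
      ≈⟨ D-1 (suc j) f w ⟩
    M * ⟦ D⁽ suc j ⁾ n ⟧ (f ↾ 1F) w + ⟦ D⁽ j ⁾ n ⟧ (f ↾ 0F) w
      ≈⟨ +-cong (*-congˡ (D≋F∘K (suc j) n (f ↾ 1F) w)) (D≋F∘K j n (f ↾ 0F) w) ⟩
    M * (θ (suc j) * X) + θ j * Y
      ≈⟨ +-congˡ (*-congˡ (trans (sym (*-identityˡ Y)) (*-congʳ (sym MQ)))) ⟩
    M * (θ (suc j) * X) + θ j * (((Q * M) * (P * N)) * Y)
      ≈⟨ solve 8 (λ M N P Q t s x y → M :* (s :* x) :+ t :* (((Q :* M) :* (P :* N)) :* y)
           := M :* (s :* x) :+ (t :* (M :* N)) :* (P :* (Q :* y))) refl M N P Q (θ j) (θ (suc j)) X Y ⟩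
    M * (θ (suc j) * X) + θ (suc j) * (P * (Q * Y))
      ≈⟨ solve 4 (λ a t x y → a :* (t :* x) :+ t :* y := t :* (a :* x :+ y)) refl M (θ (suc j)) X (P * (Q * Y)) ⟩
    θ (suc j) * (M * X + P * (Q * Y))
      ≈⟨ *-congˡ (+-cong (diagonal-1 (𝐅⁽ suc j ⁾ n) f w Q M)
           (*-congˡ (trans (diagonal-0 (𝐅⁽ j ⁾ n ∘ 𝐊⁻¹ n) f w Q M)
             (*-congˡ (⟦⟧-cong (𝐅⁽ j ⁾ n) (K⁻¹K^ j n (f ↾ 0F)) w))))) ⟨
    _ ≈⟨ *-congˡ (𝐅⁽⁾-1 (1ᵒ _) (⟦ K^ (suc j) (suc n) ⟧ f) w j) ⟨
    _ ∎
    where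
    P = q ^ j ; Q = q ^ suc j ; M = q⁻¹ ^ suc j ; N = q⁻¹ ^ j
    X = ⟦ 𝐅⁽ suc j ⁾ n ∘ K^ (suc j) n ⟧ (f ↾ 1F) w
    Y = ⟦ 𝐅⁽ j ⁾ n ∘ K^ j n ⟧ (f ↾ 0F) w
    MQ : (Q * M) * (P * N) ≈ 1#
    MQ = trans (*-cong (q^*q⁻¹^ (suc j)) (q^*q⁻¹^ j)) (*-identityˡ 1#)

  infixl 6 _⊞_
  infixl 7 _⊡_
  -- A description of the operators coming from U that does not mention gl₂ or sl₂ and is stable
  -- under the exchange of x₀ and x₁ (`flip-reach`).
  data Reach {n} : Endomorphism {n} → Set (c ⊔ ℓ) where
    raise  : ∀ j → Reach (𝐄⁽ j ⁾ n)
    lower  : ∀ j → Reach (D⁽ j ⁾ n)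
    scalar : ∀ r → Reach (End.ι n r)
    _⊞_    : ∀ {B C} → Reach B → Reach C → Reach (B ⊕ C)
    _⊡_    : ∀ {B C} → Reach B → Reach C → Reach (B ∘ C)
    resp   : ∀ {B C} → B ≋ C → Reach B → Reach C

  reach-minus : ∀ {B C : Endomorphism {n}} → Reach B → Reach C → Reach (B ⊕ End.-_ n C)
  reach-minus {n} {B} {C} p p′ = p ⊞ resp {B = End.ι n (- 1#) ∘ C} {End.-_ n C} (λ f w → -1*x≈-x _) (scalar (- 1#) ⊡ p′)
    where open import Algebra.Properties.Ring ring using (-1*x≈-x)

  -- One sign suffices: for the other one the generators act by the negatives, which have the same
  -- centralizer.
  Commutes-TL : Endomorphism {n} → Set (c ⊔ ℓ)
  Commutes-TL {n} B = ∀ i → B ∘ 𝐞 Sign.- n i ≋ 𝐞 Sign.- n i ∘ B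

  private
    module C {n} = Centralizer (End n) (𝐞 Sign.- n)

  commutes-resp : {B C : Endomorphism {n}} → B ≋ C → Commutes-TL B → Commutes-TL C
  commutes-resp {n} e p i f w = trans (sym (e (⟦ 𝐞 Sign.- n i ⟧ f) w)) (trans (p i f w) (⟦⟧-cong (𝐞 Sign.- n i) (e f) w))

  commutes-∘ : {B C : Endomorphism {n}} → Commutes-TL B → Commutes-TL C → Commutes-TL (B ∘ C)
  commutes-∘ {n} {B} {C} p p′ = C.*-commutes {n} {B} {C} p p′

  reach-commutes : {B : Endomorphism {n}} → Reach B → Commutes-TL B
  reach-commutes {n} (raise j) i f w = sym (𝐞-𝐄⁽⁾ Sign.- n i j f w)
  reach-commutes {n} (lower j) = commutes-resp {B = θ j • (𝐅⁽ j ⁾ n ∘ K^ j n)} {D⁽ j ⁾ n}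
    (λ f w → sym (D≋F∘K j n f w))
    (commutes-∘ {B = End.ι n (θ j)} {𝐅⁽ j ⁾ n ∘ K^ j n} (λ i → End.ι-central n (θ j) (𝐞 Sign.- n i))
      (commutes-∘ {B = 𝐅⁽ j ⁾ n} {K^ j n} (λ i f w → sym (𝐞-𝐅⁽⁾ Sign.- n i j f w)) (λ i f w → sym (𝐞-diagonal Sign.- n i _ _ f w))))
  reach-commutes {n} (scalar r) i = End.ι-central n r (𝐞 Sign.- n i)
  reach-commutes {n} (_⊞_ {B} {C} p p′) = C.+-commutes {n} {B} {C} (reach-commutes p) (reach-commutes p′)
  reach-commutes {n} (_⊡_ {B} {C} p p′) = commutes-∘ {B = B} {C} (reach-commutes p) (reach-commutes p′)
  reach-commutes {n} (resp {B} {C} e p) = commutes-resp {B = B} {C} e (reach-commutes p)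

module FlipReach {c ℓ} (R : CommutativeRing c ℓ) (q q⁻¹ : CommutativeRing.Carrier R)
  (q*q⁻¹≈1 : CommutativeRing._≈_ R (CommutativeRing._*_ R q q⁻¹) (CommutativeRing.1# R))
  (q⁻¹*q≈1 : CommutativeRing._≈_ R (CommutativeRing._*_ R q⁻¹ q) (CommutativeRing.1# R))
  where
  open CommutativeRing R hiding (zero)
  open TensorPower R
  open Coordinates R
  private
    module L  = Ladder R q q⁻¹ q*q⁻¹≈1 q⁻¹*q≈1
    module L⁻ = Ladder R q⁻¹ q q⁻¹*q≈1 q*q⁻¹≈1

  flip-reach : ∀ {n} {B : Endomorphism {n}} → L.Reach B → L⁻.Reach (flipᵒ B)
  flip-reach (L.raise j)  = L⁻.lower j
  flip-reach {n} (L.lower j) = L⁻.resp {B = L⁻.𝐄⁽ j ⁾ n} (λ f w → sym (flipᵒ-involutive (L⁻.𝐄⁽ j ⁾ n) f w)) (L⁻.raise j)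
  flip-reach {n} (L.scalar r) = L⁻.resp {B = End.ι n r} (λ f w → *-congˡ (sym (flip-involutive f w))) (L⁻.scalar r)
  flip-reach (L._⊞_ {B} {C} p p′) = L⁻.resp {B = flipᵒ B ⊕ flipᵒ C} {flipᵒ (B ⊕ C)} (λ f w → refl) (flip-reach p L⁻.⊞ flip-reach p′)
  flip-reach (L._⊡_ {B} {C} p p′) = L⁻.resp {B = flipᵒ B ∘ flipᵒ C} {flipᵒ (B ∘ C)} (λ f w → sym (flipᵒ-∘ B C f w)) (flip-reach p L⁻.⊡ flip-reach p′)
  flip-reach (L.resp {B} {C} e p) = L⁻.resp {B = flipᵒ B} {flipᵒ C} (flipᵒ-cong {B = B} {C} e) (flip-reach p)

-- Sorting words by adjacent transpositions

desc : ∀ n → ℕ → Vec (Fin 2) n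
desc zero    m       = []
desc (suc n) zero    = 0F ∷ desc n zero
desc (suc n) (suc m) = 1F ∷ desc n m

ones-desc : ∀ n m → m ℕ.≤ n → ones (desc n m) ≡ m
ones-desc zero    zero    _       = ≡.refl
ones-desc (suc n) zero    _       = ones-desc n zero z≤n
ones-desc (suc n) (suc m) (s≤s p) = ≡.cong suc (ones-desc n m p)

ones≤n : (w : Vec (Fin 2) n) → ones w ℕ.≤ n
ones≤n []       = z≤n
ones≤n (0F ∷ w) = ℕ.m≤n⇒m≤1+n (ones≤n w)
ones≤n (1F ∷ w) = s≤s (ones≤n w)

zeros≤n : (w : Vec (Fin 2) n) → zeros w ℕ.≤ n
zeros≤n []       = z≤n
zeros≤n (0F ∷ w) = s≤s (zeros≤n w)
zeros≤n (1F ∷ w) = ℕ.m≤n⇒m≤1+n (zeros≤n w)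

ones≡n∸zeros : (w : Vec (Fin 2) n) → ones w ≡ n ∸ zeros w
ones≡n∸zeros w = ≡.trans (≡.sym (ℕ.m+n∸m≡n (zeros w) (ones w))) (≡.cong (_∸ zeros w) (zeros+ones w))

zeros≡n∸ones : (w : Vec (Fin 2) n) → zeros w ≡ n ∸ ones w
zeros≡n∸ones w = ≡.trans (≡.sym (ℕ.m+n∸n≡m (zeros w) (ones w))) (≡.cong (_∸ ones w) (zeros+ones w))

zeros-++ : ∀ {m n} (u : Vec (Fin 2) m) (w : Vec (Fin 2) n) → zeros (u ++ w) ≡ zeros u ℕ.+ zeros w
zeros-++ []       w = ≡.refl
zeros-++ (0F ∷ u) w = ≡.cong suc (zeros-++ u w)
zeros-++ (1F ∷ u) w = zeros-++ u w

module Counting where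
  open ≡.≡-Reasoning

  -- Here z and o count the zeros and ones of a word of length a + b, and k and m are the degrees of
  -- a lowering and a raising operator. The first two lemmas follow the weight through E⁽ᵐ⁾D⁽ᵏ⁾
  -- without subtraction.
  solve-ones : ∀ a b {z o k} → z ℕ.+ o ≡ a ℕ.+ b → z ℕ.+ k ≡ b → o ≡ a ℕ.+ k
  solve-ones a b {z} {o} {k} e e′ = ℕ.+-cancelˡ-≡ z o (a ℕ.+ k) (begin
    z ℕ.+ o          ≡⟨ e ⟩
    a ℕ.+ b          ≡⟨ ≡.cong (a ℕ.+_) e′ ⟨
    a ℕ.+ (z ℕ.+ k)  ≡⟨ ℕ.+-assoc a z k ⟨
    (a ℕ.+ z) ℕ.+ k  ≡⟨ ≡.cong (ℕ._+ k) (ℕ.+-comm a z) ⟩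
    (z ℕ.+ a) ℕ.+ k  ≡⟨ ℕ.+-assoc z a k ⟩
    z ℕ.+ (a ℕ.+ k)  ∎)

  solve-zeros : ∀ a b {z o k s m} → z ℕ.+ o ≡ a ℕ.+ b → o ℕ.+ m ≡ a ℕ.+ k → k ℕ.+ s ≡ b ℕ.+ m → z ≡ s
  solve-zeros a b {z} {o} {k} {s} {m} e e′ e″ = ℕ.+-cancelʳ-≡ (o ℕ.+ m) z s (begin
    z ℕ.+ (o ℕ.+ m)  ≡⟨ ℕ.+-assoc z o m ⟨
    (z ℕ.+ o) ℕ.+ m  ≡⟨ ≡.cong (ℕ._+ m) e ⟩
    (a ℕ.+ b) ℕ.+ m  ≡⟨ ℕ.+-assoc a b m ⟩
    a ℕ.+ (b ℕ.+ m)  ≡⟨ ≡.cong (a ℕ.+_) e″ ⟨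
    a ℕ.+ (k ℕ.+ s)  ≡⟨ ℕ.+-assoc a k s ⟨
    (a ℕ.+ k) ℕ.+ s  ≡⟨ ≡.cong (ℕ._+ s) e′ ⟨
    (o ℕ.+ m) ℕ.+ s  ≡⟨ ℕ.+-comm (o ℕ.+ m) s ⟩
    s ℕ.+ (o ℕ.+ m)  ∎)

  solve-count : ∀ b m {z o s} → z ℕ.+ o ≡ b → m ℕ.+ z ≡ s → o ≡ (b ℕ.+ m) ∸ s
  solve-count b m {z} {o} {s} e e′ = begin
    o                                    ≡⟨ ℕ.m+n∸m≡n (m ℕ.+ z) o ⟨
    ((m ℕ.+ z) ℕ.+ o) ∸ (m ℕ.+ z)        ≡⟨ ≡.cong (_∸ (m ℕ.+ z)) (ℕ.+-assoc m z o) ⟩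
    (m ℕ.+ (z ℕ.+ o)) ∸ (m ℕ.+ z)        ≡⟨ ≡.cong (_∸ (m ℕ.+ z)) (ℕ.+-comm m (z ℕ.+ o)) ⟩
    ((z ℕ.+ o) ℕ.+ m) ∸ (m ℕ.+ z)        ≡⟨ ≡.cong₂ (λ x y → (x ℕ.+ m) ∸ y) e e′ ⟩
    (b ℕ.+ m) ∸ s                        ∎

infix 4 _⟶_
-- `there` asks for a visibly nonempty tail so that `position` lands in `Fin (n ∸ 1)` by
-- computation; `_∷ˢ_` recovers the rule for arbitrary length.
data _⟶_ : ∀ {n} → Vec (Fin 2) n → Vec (Fin 2) n → Set where
  here  : ∀ {n} {w : Vec (Fin 2) n} → 1F ∷ 0F ∷ w ⟶ 0F ∷ 1F ∷ w
  there : ∀ {n i} {w w′ : Vec (Fin 2) (suc n)} → w ⟶ w′ → i ∷ w ⟶ i ∷ w′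

position : {w w′ : Vec (Fin 2) n} → w ⟶ w′ → Fin (n ∸ 1)
position here      = zero
position (there σ) = suc (position σ)

infixr 5 _∷ˢ_
_∷ˢ_ : ∀ i {w w′ : Vec (Fin 2) n} → w ⟶ w′ → i ∷ w ⟶ i ∷ w′
i ∷ˢ here      = there here
i ∷ˢ (there σ) = there (there σ)

_++ˢ_ : ∀ {m} {u u′ : Vec (Fin 2) m} → u ⟶ u′ → (w : Vec (Fin 2) n) → u ++ w ⟶ u′ ++ w
here    ++ˢ w = here
there σ ++ˢ w = there (σ ++ˢ w)

_ˢ++_ : ∀ {m} (u : Vec (Fin 2) m) {w w′ : Vec (Fin 2) n} → w ⟶ w′ → u ++ w ⟶ u ++ w′
[]      ˢ++ σ = σ
(i ∷ u) ˢ++ σ = i ∷ˢ (u ˢ++ σ)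

module _ {p : Level} where

  Closed : (Vec (Fin 2) n → Set p) → Set p
  Closed P = ∀ {w w′} → w ⟶ w′ → P w → P w′

  private
    insert : (P : Vec (Fin 2) (suc n) → Set p) → Closed P → ∀ m → m ℕ.≤ n → P (desc (suc n) m) → P (0F ∷ desc n m)
    insert P closed zero    _       x = x
    insert P closed (suc m) (s≤s m≤n) x =
      closed here (insert (λ w → P (1F ∷ w)) (λ σ → closed (1F ∷ˢ σ)) m m≤n x)

  -- The first letter is settled before the others: if it should be 0, `insert` carries the first 0
  -- of the decreasing word to the front through the ones, and the tail is again decreasing.
  sort : (P : Vec (Fin 2) n → Set p) → Closed P → ∀ w → P (desc n (ones w)) → P w
  sort P closed []       x = x
  sort P closed (0F ∷ w) x = sort (λ w → P (0F ∷ w)) (λ σ → closed (0F ∷ˢ σ)) w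
    (insert P closed (ones w) (ones≤n w) x)
  sort P closed (1F ∷ w) x = sort (λ w → P (1F ∷ w)) (λ σ → closed (1F ∷ˢ σ)) w x

-- Maps between weight spaces that commute with Temperley-Lieb

module WeightSpaces {c ℓ} (R : CommutativeRing c ℓ) (q q⁻¹ : CommutativeRing.Carrier R)
  (q*q⁻¹≈1 : CommutativeRing._≈_ R (CommutativeRing._*_ R q q⁻¹) (CommutativeRing.1# R))
  (q⁻¹*q≈1 : CommutativeRing._≈_ R (CommutativeRing._*_ R q⁻¹ q) (CommutativeRing.1# R))
  where
  open CommutativeRing R hiding (zero)
  open FromℤR.Solver R using (solve; _:=_; _:+_; _:*_; _:-_; :-_; con)
  open import Algebra.Properties.Ring ring using (-0#≈0#)
  open TensorPower R
  open Coordinates R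
  open Ladder R q q⁻¹ q*q⁻¹≈1 q⁻¹*q≈1
  open TemperleyLiebOperators R q q⁻¹ q*q⁻¹≈1 using (𝐞)
  open import Algebra.Properties.Semiring.Exp semiring using (_^_)
  open import Relation.Binary.Reasoning.Setoid setoid

  𝐮 : ∀ n → Fin (n ∸ 1) → Endomorphism {n}
  𝐮 = 𝐞 Sign.-

  1⊗-at : (B : Endomorphism {n}) (f : Vector (suc n)) → ∀ i w → ⟦ 1-matrix ⊗ᵒ B ⟧ f (i ∷ w) ≈ ⟦ B ⟧ (f ↾ i) w
  1⊗-at B f 0F w = solve 2 (λ a b → con 1ℤ :* a :+ con 0ℤ :* b := a) refl _ _
  1⊗-at B f 1F w = solve 2 (λ a b → con 0ℤ :* a :+ con 1ℤ :* b := b) refl _ _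

  -- With this coordinate, 𝐮 f = 0 becomes the rule f w′ = q f w of `QSymmetric`.
  𝐮-coordinate : {w w′ : Vec (Fin 2) n} (σ : w ⟶ w′) (f : Vector n) →
                 ⟦ 𝐮 n (position σ) ⟧ f w ≈ f w′ - q * f w
  𝐮-coordinate here f = solve 3 (λ q x y → :- (:- x :+ q :* y) := x :- q :* y) refl q _ _
  𝐮-coordinate {suc (suc n)} {i ∷ w} (there σ) f = trans (1⊗-at (𝐮 (suc n) (position σ)) f i w) (𝐮-coordinate σ (f ↾ i))

  𝐮-◁ : (i : Fin n) (f : Vector (suc n)) → ∀ j u → ⟦ 𝐮 (2 ℕ.+ n) (suc i) ⟧ (j ◁ f) u ≈ (j ◁ ⟦ 𝐮 (suc n) i ⟧ f) u
  𝐮-◁ i f 0F (0F ∷ u) = 1⊗-at (𝐮 _ i) (0F ◁ f) 0F u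
  𝐮-◁ i f 0F (1F ∷ u) = trans (1⊗-at (𝐮 _ i) (0F ◁ f) 1F u) (⟦⟧-0 (𝐮 _ i) u)
  𝐮-◁ i f 1F (0F ∷ u) = trans (1⊗-at (𝐮 _ i) (1F ◁ f) 0F u) (⟦⟧-0 (𝐮 _ i) u)
  𝐮-◁ i f 1F (1F ∷ u) = 1⊗-at (𝐮 _ i) (1F ◁ f) 1F u

  𝐮-basis : {w w′ : Vec (Fin 2) n} (σ : w ⟶ w′) → ∀ u → ⟦ 𝐮 n (position σ) ⟧ (basis w) u ≈ basis w′ u - q * basis w u
  𝐮-basis here (0F ∷ 0F ∷ u) = solve 1 (λ q → :- (con 0ℤ) := con 0ℤ :- q :* con 0ℤ) refl q
  𝐮-basis here (0F ∷ 1F ∷ u) = solve 3 (λ q p x → :- (p :* con 0ℤ :- x) := x :- q :* con 0ℤ) refl q q⁻¹ _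
  𝐮-basis here (1F ∷ 0F ∷ u) = solve 2 (λ q x → :- (:- con 0ℤ :+ q :* x) := con 0ℤ :- q :* x) refl q _
  𝐮-basis here (1F ∷ 1F ∷ u) = solve 1 (λ q → :- (con 0ℤ) := con 0ℤ :- q :* con 0ℤ) refl q
  𝐮-basis {suc (suc n)} (there {i = i} {w} {w′} σ) u = begin
    _ ≈⟨ 𝐮-◁ (position σ) (basis w) i u ⟩
    _ ≈⟨ ◁-cong i (𝐮-basis σ) u ⟩
    _ ≈⟨ at i u ⟩
    _ ∎
    where
    zero′ : 0# ≈ 0# - q * 0#
    zero′ = solve 1 (λ q → con 0ℤ := con 0ℤ :- q :* con 0ℤ) refl q
    at : ∀ i u → (i ◁ (λ u → basis w′ u - q * basis w u)) u ≈ (i ◁ basis w′) u - q * (i ◁ basis w) u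
    at 0F (0F ∷ u) = refl
    at 0F (1F ∷ u) = zero′
    at 1F (0F ∷ u) = zero′
    at 1F (1F ∷ u) = refl

  -- As x₀₁ = (𝐮 + q) x₁₀, the decreasing word generates its weight space over TL.
  agree : (B C : Endomorphism {n}) → Commutes-TL B → Commutes-TL C → ∀ m →
          (∀ u → ⟦ B ⟧ (basis (desc n m)) u ≈ ⟦ C ⟧ (basis (desc n m)) u) →
          ∀ w → ones w ≡ m → ∀ u → ⟦ B ⟧ (basis w) u ≈ ⟦ C ⟧ (basis w) u
  agree {n} B C B-commutes C-commutes m e w ≡.refl = sort (λ w → ∀ u → ⟦ B ⟧ (basis w) u ≈ ⟦ C ⟧ (basis w) u) closed w e
    where
    image : (B : Endomorphism {n}) → Commutes-TL B → ∀ {w w′} (σ : w ⟶ w′) u →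
            ⟦ B ⟧ (basis w′) u ≈ ⟦ 𝐮 n (position σ) ⟧ (⟦ B ⟧ (basis w)) u + q * ⟦ B ⟧ (basis w) u
    image B commutes {w} {w′} σ u = begin
      ⟦ B ⟧ (basis w′) u
        ≈⟨ ⟦⟧-cong B (λ u → solve 3 (λ q x y → y := (y :- q :* x) :+ q :* x) refl q (basis w u) (basis w′ u)) u ⟩
      ⟦ B ⟧ (λ u → (basis w′ u - q * basis w u) + q * basis w u) u
        ≈⟨ +ᴹ-homo B _ _ u ⟩
      ⟦ B ⟧ (λ u → basis w′ u - q * basis w u) u + ⟦ B ⟧ (λ u → q * basis w u) u
        ≈⟨ +-cong (⟦⟧-cong B (λ u → sym (𝐮-basis σ u)) u) (*ₗ-homo B q (basis w) u) ⟩
      ⟦ B ∘ 𝐮 n (position σ) ⟧ (basis w) u + q * ⟦ B ⟧ (basis w) u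
        ≈⟨ +-congʳ (commutes (position σ) (basis w) u) ⟩
      _ ∎
    closed : Closed (λ w → ∀ u → ⟦ B ⟧ (basis w) u ≈ ⟦ C ⟧ (basis w) u)
    closed σ e u = trans (image B B-commutes σ u)
      (trans (+-cong (⟦⟧-cong (𝐮 n (position σ)) e u) (*-congˡ (e u))) (sym (image C C-commutes σ u)))

  Killed : Fin (n ∸ 1) → Vector n → Set ℓ
  Killed {n} i f = ∀ u → ⟦ 𝐮 n i ⟧ f u ≈ 0#

  killed-◁ : ∀ j {w w′ : Vec (Fin 2) n} (σ : w ⟶ w′) {f : Vector n} → Killed (position σ) f → Killed (position (j ∷ˢ σ)) (j ◁ f)
  killed-◁ j here {f} e u = trans (𝐮-◁ zero f j u) (trans (◁-cong j e u) (◁-0 j u))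
  killed-◁ j (there σ) {f} e u = trans (𝐮-◁ (suc (position σ)) f j u) (trans (◁-cong j e u) (◁-0 j u))

  private
    x-x : ∀ p → - (p * 0# - 0#) ≈ 0#
    x-x p = solve 1 (λ p → :- (p :* con 0ℤ :- con 0ℤ) := con 0ℤ) refl p

    killed-00 : (f : Vector n) → Killed {suc (suc n)} zero (0F ◁ 0F ◁ f)
    killed-00 f (0F ∷ 0F ∷ u) = -0#≈0#
    killed-00 f (0F ∷ 1F ∷ u) = x-x q⁻¹
    killed-00 f (1F ∷ 0F ∷ u) = solve 1 (λ p → :- (:- con 0ℤ :+ p :* con 0ℤ) := con 0ℤ) refl q
    killed-00 f (1F ∷ 1F ∷ u) = -0#≈0#

    killed-11 : (f : Vector n) → Killed {suc (suc n)} zero (1F ◁ 1F ◁ f)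
    killed-11 f (0F ∷ 0F ∷ u) = -0#≈0#
    killed-11 f (0F ∷ 1F ∷ u) = x-x q⁻¹
    killed-11 f (1F ∷ 0F ∷ u) = solve 1 (λ p → :- (:- con 0ℤ :+ p :* con 0ℤ) := con 0ℤ) refl q
    killed-11 f (1F ∷ 1F ∷ u) = -0#≈0#

  1^_⊗_ : ∀ a {b} → Vector b → Vector (a ℕ.+ b)
  1^ zero  ⊗ f = f
  1^ suc a ⊗ f = 1F ◁ (1^ a ⊗ f)

  generator : ∀ a b → Vector (a ℕ.+ b)
  generator a b = 1^ a ⊗ basis (desc b 0)

  generator≡basis : ∀ a b u → generator a b u ≡ basis (desc (a ℕ.+ b) a) u
  generator≡basis zero    b u        = ≡.refl
  generator≡basis (suc a) b (0F ∷ u) = ≡.refl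
  generator≡basis (suc a) b (1F ∷ u) = generator≡basis a b u

  record QSymmetric a b (f : Vector (a ℕ.+ b)) : Set ℓ where
    field
      left  : ∀ {u u′ : Vec (Fin 2) a} → u ⟶ u′ → ∀ (w : Vec (Fin 2) b) → f (u′ ++ w) ≈ q * f (u ++ w)
      right : ∀ (u : Vec (Fin 2) a) {w w′ : Vec (Fin 2) b} → w ⟶ w′ → f (u ++ w′) ≈ q * f (u ++ w)
  open QSymmetric

  private
    killed-left : ∀ a b {u u′ : Vec (Fin 2) a} (σ : u ⟶ u′) (w : Vec (Fin 2) b) → Killed (position (σ ++ˢ w)) (generator a b)
    killed-left (suc (suc a)) b here      w = killed-11 (generator a b)
    killed-left (suc (suc a)) b (there σ) w = λ u → trans (𝐮-◁ (position (σ ++ˢ w)) (generator (suc a) b) 1F u)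
      (trans (◁-cong 1F (killed-left (suc a) b σ w) u) (◁-0 1F u))

    killed-zeros : ∀ b {w w′ : Vec (Fin 2) b} (σ : w ⟶ w′) → Killed (position σ) (basis (desc b 0))
    killed-zeros (suc (suc b)) here      = killed-00 (basis (desc b 0))
    killed-zeros (suc (suc b)) (there σ) u = trans (𝐮-◁ (position σ) (basis (desc (suc b) 0)) 0F u)
      (trans (◁-cong 0F (killed-zeros (suc b) σ) u) (◁-0 0F u))

    killed-right : ∀ a b (u : Vec (Fin 2) a) {w w′ : Vec (Fin 2) b} (σ : w ⟶ w′) → Killed (position (u ˢ++ σ)) (generator a b)
    killed-right zero    b []      σ = killed-zeros b σ
    -- The generator starts with 1 whatever the letter i is. Only the position of the transposition
    -- matters, and it does not depend on the letter put in front.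
    killed-right (suc a) b (i ∷ u) σ v = trans (reflexive (≡.cong (λ k → ⟦ 𝐮 (suc a ℕ.+ b) k ⟧ (generator (suc a) b) v) (same (u ˢ++ σ))))
      (killed-◁ 1F (u ˢ++ σ) (killed-right a b u σ) v)
      where
      same : ∀ {i j n} {w w′ : Vec (Fin 2) n} (σ : w ⟶ w′) → position (i ∷ˢ σ) ≡ position (j ∷ˢ σ)
      same here      = ≡.refl
      same (there σ) = ≡.refl

  -- ξ kills x₀₀ and x₁₁, so it kills the generator at each position inside one of its two constant
  -- blocks; B commutes with it and passes this on to the image.
  qsymmetric : ∀ a b (B : Endomorphism {a ℕ.+ b}) → Commutes-TL B → QSymmetric a b (⟦ B ⟧ (generator a b))
  qsymmetric a b B commutes = record
    { left  = λ {u} {u′} σ w → from-killed {u ++ w} {u′ ++ w} (σ ++ˢ w) (killed-left a b σ w)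
    ; right = λ u {w} {w′} σ → from-killed {u ++ w} {u ++ w′} (u ˢ++ σ) (killed-right a b u σ) }
    where
    from-killed : ∀ {w w′} (σ : w ⟶ w′) → Killed (position σ) (generator a b) →
                  ⟦ B ⟧ (generator a b) w′ ≈ q * ⟦ B ⟧ (generator a b) w
    from-killed {w} {w′} σ e = x∙y⁻¹≈ε⇒x≈y _ _ (begin
      _ ≈⟨ 𝐮-coordinate σ (⟦ B ⟧ (generator a b)) ⟨
      _ ≈⟨ commutes (position σ) (generator a b) w ⟨
      _ ≈⟨ ⟦⟧-zero B e w ⟩
      0# ∎)
      where open import Algebra.Properties.Ring ring using (x∙y⁻¹≈ε⇒x≈y)

  private
    -- To reach the prefix u from 1^a, all `zeros u` raisings must act on the first a letters.
    -- Nothing is left for f, and only a power of q⁻¹ remains. With fewer raisings u cannot be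
    -- reached (`E-1^-vanish`).
    E-1^ : ∀ {a b} (u : Vec (Fin 2) a) → Σ Carrier λ κ → IsUnit κ ×
           (∀ (f : Vector b) w → ⟦ 𝐄⁽ zeros u ⁾ (a ℕ.+ b) ⟧ (1^ a ⊗ f) (u ++ w) ≈ κ * f w)
    E-1^ []       = 1# , unit-1 , λ f w → sym (*-identityˡ _)
    E-1^ {suc a} {b} (0F ∷ u) = let κ , κ-unit , e = E-1^ {a} {b} u in κ , κ-unit , λ f w → begin
      _ ≈⟨ E-0 (suc (zeros u)) (1F ◁ (1^ a ⊗ f)) (u ++ w) ⟩
      _ ≈⟨ +-cong (trans (*-congˡ (⟦⟧-0 (𝐄⁽ suc (zeros u) ⁾ _) (u ++ w))) (zeroʳ _)) (e f w) ⟩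
      _ ≈⟨ +-identityˡ _ ⟩
      _ ∎
    E-1^ {suc a} {b} (1F ∷ u) = let κ , κ-unit , e = E-1^ {a} {b} u in
      q⁻¹ ^ zeros u * κ , unit-* (unit-q⁻¹^ (zeros u)) κ-unit , λ f w → begin
      _ ≈⟨ E-1 (zeros u) (1F ◁ (1^ a ⊗ f)) (u ++ w) ⟩
      _ ≈⟨ *-congˡ (e f w) ⟩
      _ ≈⟨ *-assoc _ _ _ ⟨
      _ ∎

    E-1^-vanish : ∀ {a b} m (u : Vec (Fin 2) a) → m ℕ.< zeros u → (f : Vector b) → ∀ w →
                  ⟦ 𝐄⁽ m ⁾ (a ℕ.+ b) ⟧ (1^ a ⊗ f) (u ++ w) ≈ 0#
    E-1^-vanish {suc a} m (0F ∷ u) m< f w = begin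
      _ ≈⟨ E-0 m (1F ◁ (1^ a ⊗ f)) (u ++ w) ⟩
      _ ≈⟨ +-cong (trans (*-congˡ (⟦⟧-0 (𝐄⁽ m ⁾ _) (u ++ w))) (zeroʳ _)) (at m m<) ⟩
      _ ≈⟨ +-identityˡ _ ⟩
      _ ∎
      where
      at : ∀ m → m ℕ.< suc (zeros u) → ⟦ E↓ m _ ⟧ (1^ a ⊗ f) (u ++ w) ≈ 0#
      at zero    _        = refl
      at (suc m) (s≤s m<) = E-1^-vanish m u m< f w
    E-1^-vanish {suc a} m (1F ∷ u) m< f w = trans (E-1 m (1F ◁ (1^ a ⊗ f)) (u ++ w))
      (trans (*-congˡ (E-1^-vanish m u m< f w)) (zeroʳ _))

    -- A lowering operator finds no 0 in the block 1^a and picks up only its diagonal factor there.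
    D-1^ : ∀ a b c (f : Vector b) u → ⟦ D⁽ c ⁾ (a ℕ.+ b) ⟧ (1^ a ⊗ f) u ≈ (q⁻¹ ^ c) ^ a * (1^ a ⊗ ⟦ D⁽ c ⁾ b ⟧ f) u
    D-1^ zero    b c f u        = sym (*-identityˡ _)
    D-1^ (suc a) b c f (0F ∷ u) = trans (D-0 c (1F ◁ (1^ a ⊗ f)) u)
      (trans (trans (*-congˡ (⟦⟧-0 (D⁽ c ⁾ _) u)) (zeroʳ _)) (sym (zeroʳ _)))
    D-1^ (suc a) b c f (1F ∷ u) = begin
      _ ≈⟨ D-1 c (1F ◁ (1^ a ⊗ f)) u ⟩
      _ ≈⟨ +-cong (*-congˡ (D-1^ a b c f u)) (⟦⟧-0 (D↓ c _) u) ⟩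
      _ ≈⟨ +-identityʳ _ ⟩
      _ ≈⟨ *-assoc _ _ _ ⟨
      _ ∎

    D-zeros : ∀ {b} (w : Vec (Fin 2) b) → IsUnit (⟦ D⁽ ones w ⁾ b ⟧ (basis (desc b 0)) w)
    D-zeros []       = unit-1
    D-zeros {suc b} (0F ∷ w) = unit-resp (sym (D-0 (ones w) (0F ◁ basis (desc b 0)) w))
      (unit-* (unit-q^ (ones w)) (D-zeros w))
    D-zeros {suc b} (1F ∷ w) = unit-resp (sym (begin
      _ ≈⟨ D-1 (suc (ones w)) (0F ◁ basis (desc b 0)) w ⟩
      _ ≈⟨ +-congʳ (trans (*-congˡ (⟦⟧-0 (D⁽ suc (ones w) ⁾ b) w)) (zeroʳ _)) ⟩
      _ ≈⟨ +-identityˡ _ ⟩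
      _ ∎)) (D-zeros w)

  Homogeneous : ℕ → Vector n → Set ℓ
  Homogeneous s f = ∀ u → zeros u ≢ s → f u ≈ 0#

  private
    masked : (weight : Vec (Fin 2) n → ℕ) → ∀ {s} {f : Vector n} → (∀ u → weight u ≢ s → f u ≈ 0#) →
             ∀ u → f u ≈ mask (weight u ℕ.≡ᵇ s) (f u)
    masked weight {s} {f} e u with weight u ℕ.≟ s
    ... | yes p = reflexive (≡.cong (λ b → mask b (f u)) (≡.sym (≡ᵇ-true p)))
    ... | no p  = trans (e u p) (sym (reflexive (≡.cong (λ b → mask b (f u)) (≡ᵇ-false p))))

  E-homogeneous : ∀ j {s} {f : Vector n} → (∀ u → ones u ≢ s → f u ≈ 0#) →
                  ∀ u → ones u ℕ.+ j ≢ s → ⟦ 𝐄⁽ j ⁾ n ⟧ f u ≈ 0#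
  E-homogeneous {n} j {s} {f} e u p = begin
    _ ≈⟨ ⟦⟧-cong (𝐄⁽ j ⁾ n) (masked ones e) u ⟩
    _ ≈⟨ E-mask (ℕ._≡ᵇ s) j f u ⟩
    _ ≡⟨ ≡.cong (λ b → mask b (⟦ 𝐄⁽ j ⁾ n ⟧ f u)) (≡ᵇ-false p) ⟩
    0# ∎

  D-homogeneous : ∀ j {s} {f : Vector n} → (∀ u → zeros u ≢ s → f u ≈ 0#) →
                  ∀ u → zeros u ℕ.+ j ≢ s → ⟦ D⁽ j ⁾ n ⟧ f u ≈ 0#
  D-homogeneous {n} j {s} {f} e u p = begin
    _ ≈⟨ ⟦⟧-cong (D⁽ j ⁾ n) (masked zeros e) u ⟩
    _ ≈⟨ D-mask (ℕ._≡ᵇ s) j f u ⟩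
    _ ≡⟨ ≡.cong (λ b → mask b (⟦ D⁽ j ⁾ n ⟧ f u)) (≡ᵇ-false p) ⟩
    0# ∎

  generator-homogeneous : ∀ a b → Homogeneous b (generator a b)
  generator-homogeneous zero zero    []       p = contradiction ≡.refl p
  generator-homogeneous zero (suc b) (0F ∷ u) p = generator-homogeneous zero b u (λ e → p (≡.cong suc e))
  generator-homogeneous zero (suc b) (1F ∷ u) p = refl
  generator-homogeneous (suc a) b    (0F ∷ u) p = refl
  generator-homogeneous (suc a) b    (1F ∷ u) p = generator-homogeneous a b u p

  module _ (a b s : ℕ) where

    private
      v = generator a b
      -- From b zeros, D⁽ᵏ⁾ leads to b - k and E⁽ᵐ⁾ to b - k + m zeros, which is s for k = b + m -
      -- s. Where the subtraction is truncated, `decompose` uses the coefficient 0.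
      t : ℕ → Endomorphism {a ℕ.+ b}
      t m = 𝐄⁽ m ⁾ _ ∘ D⁽ (b ℕ.+ m) ∸ s ⁾ _

    -- The head belongs to the largest m: elimination from the top adds coefficients in front, and
    -- `last` is the coefficient κ₀ of m = 0.
    combination : ∀ {m} → Vec Carrier m → Endomorphism {a ℕ.+ b}
    combination []                = 0ᵒ _
    combination {suc m} (κ ∷ κs) = combination κs ⊕ κ • t m

    combination-reach : ∀ {m} (κs : Vec Carrier m) → Reach (combination κs)
    combination-reach [] = resp {B = End.ι _ 0#} {0ᵒ _} (λ f w → zeroˡ _) (scalar 0#)
    combination-reach {suc m} (κ ∷ κs) = combination-reach κs ⊞ (scalar κ ⊡ (raise m ⊡ lower ((b ℕ.+ m) ∸ s)))

    private
      leading-zero : ∀ m (u : Vec (Fin 2) a) (w : Vec (Fin 2) b) → m ℕ.< zeros u → ⟦ t m ⟧ v (u ++ w) ≈ 0#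
      leading-zero m u w m< = begin
        _ ≈⟨ ⟦⟧-cong (𝐄⁽ m ⁾ _) (D-1^ a b ((b ℕ.+ m) ∸ s) (basis (desc b 0))) (u ++ w) ⟩
        _ ≈⟨ *ₗ-homo (𝐄⁽ m ⁾ _) _ _ (u ++ w) ⟩
        _ ≈⟨ *-congˡ (E-1^-vanish m u m< (⟦ D⁽ (b ℕ.+ m) ∸ s ⁾ b ⟧ (basis (desc b 0))) w) ⟩
        _ ≈⟨ zeroʳ _ ⟩
        0# ∎

      leading : ∀ m (u : Vec (Fin 2) a) → zeros u ≡ m → Σ Carrier λ κ → IsUnit κ ×
                (∀ w → ⟦ t m ⟧ v (u ++ w) ≈ κ * ⟦ D⁽ (b ℕ.+ m) ∸ s ⁾ b ⟧ (basis (desc b 0)) w)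
      leading m u ≡.refl = let κ , κ-unit , e = E-1^ {a} {b} u in
        (q⁻¹ ^ k) ^ a * κ , unit-* (unit-^ a) κ-unit , λ w → begin
        _ ≈⟨ ⟦⟧-cong (𝐄⁽ m ⁾ _) (D-1^ a b k (basis (desc b 0))) (u ++ w) ⟩
        _ ≈⟨ *ₗ-homo (𝐄⁽ m ⁾ _) _ _ (u ++ w) ⟩
        _ ≈⟨ *-congˡ (e (⟦ D⁽ k ⁾ b ⟧ (basis (desc b 0))) w) ⟩
        _ ≈⟨ *-assoc _ _ _ ⟨
        _ ∎
        where
        k = (b ℕ.+ m) ∸ s
        unit-^ : ∀ a → IsUnit ((q⁻¹ ^ k) ^ a)
        unit-^ zero    = unit-1
        unit-^ (suc a) = unit-* (unit-q⁻¹^ k) (unit-^ a)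

      t-homogeneous : ∀ m → m ℕ.≤ s → s ℕ.≤ b ℕ.+ m → Homogeneous s (⟦ t m ⟧ v)
      t-homogeneous m m≤s s≤b+m u p = E-homogeneous m {a ℕ.+ k} {⟦ D⁽ k ⁾ _ ⟧ v} after-D u
        (λ e → p (Counting.solve-zeros a b (zeros+ones u) e (ℕ.m∸n+n≡m s≤b+m)))
        where
        k = (b ℕ.+ m) ∸ s
        after-D : ∀ u → ones u ≢ a ℕ.+ k → ⟦ D⁽ k ⁾ _ ⟧ v u ≈ 0#
        after-D u p = D-homogeneous k {b} {v} (generator-homogeneous a b) u
          (λ e → p (Counting.solve-ones a b (zeros+ones u) e))

      pad : ∀ m (f : Vector (a ℕ.+ b)) → (Σ (Vec Carrier m) λ κs → ∀ x → f x ≈ ⟦ combination κs ⟧ v x) →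
            Σ (Vec Carrier (suc m)) λ κs → ∀ x → f x ≈ ⟦ combination κs ⟧ v x
      pad m f (κs , e) = 0# ∷ κs , λ x → trans (e x) (sym (trans (+-congˡ (zeroˡ _)) (+-identityʳ _)))

      vanish-at : ∀ m (f : Vector (a ℕ.+ b)) → Homogeneous s f → (∀ u w → suc m ℕ.≤ zeros u → f (u ++ w) ≈ 0#) →
                  (∀ (u : Vec (Fin 2) a) (w : Vec (Fin 2) b) → zeros u ≡ m → zeros (u ++ w) ≢ s) →
                  ∀ u w → m ℕ.≤ zeros u → f (u ++ w) ≈ 0#
      vanish-at m f f-hom e p u w m≤ with ℕ.m≤n⇒m<n∨m≡n m≤
      ... | inj₁ m< = e u w m<
      ... | inj₂ m≡ = f-hom (u ++ w) (p u w (≡.sym m≡))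

    -- E⁽ᵐ⁾D⁽ᵏ⁾ applied to the generator has no coordinates with more than m zeros among the
    -- first a letters, and unit coordinates for exactly m: the system is triangular.
    decompose : ∀ m → m ℕ.≤ suc a → (f : Vector (a ℕ.+ b)) → QSymmetric a b f → Homogeneous s f →
                (∀ u w → m ℕ.≤ zeros u → f (u ++ w) ≈ 0#) →
                Σ (Vec Carrier m) λ κs → ∀ x → f x ≈ ⟦ combination κs ⟧ v x
    decompose zero _ f f-sym f-hom e = [] , at
      where
      at : ∀ x → f x ≈ 0#
      at x with u , w , ≡.refl ← splitAt a x = e u w z≤n
    decompose (suc m) (s≤s m≤a) f f-sym f-hom e with m ℕ.≤? s | s ℕ.≤? b ℕ.+ m
    ... | yes m≤s | yes s≤b+m = κ′ ∷ proj₁ rec , λ x → begin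
      f x                                              ≈⟨ solve 2 (λ y z → y := (y :- z) :+ z) refl (f x) (κ′ * ⟦ t m ⟧ v x) ⟩
      f′ x + κ′ * ⟦ t m ⟧ v x                          ≈⟨ +-congʳ (proj₂ rec x) ⟩
      _                                                ∎
      where
      k = (b ℕ.+ m) ∸ s
      -- The pivot word has m zeros in its first block and k ones in its second. By q-symmetry in
      -- both blocks, its coordinate determines all coordinates of weight s with m zeros in the
      -- first block.
      U = desc a (a ∸ m)
      W = desc b k
      k≤b : k ℕ.≤ b
      k≤b = ℕ.m≤n+o⇒m∸n≤o (b ℕ.+ m) s (≡.subst (b ℕ.+ m ℕ.≤_) (ℕ.+-comm b s) (ℕ.+-monoʳ-≤ b m≤s))
      zeros-U : zeros U ≡ m
      zeros-U = ≡.trans (zeros≡n∸ones U) (≡.trans (≡.cong (a ∸_) (ones-desc a (a ∸ m) (ℕ.m∸n≤m a m))) (ℕ.m∸[m∸n]≡n m≤a))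
      t-unit : IsUnit (⟦ t m ⟧ v (U ++ W))
      t-unit = let κ , κ-unit , e = leading m U zeros-U in unit-resp (sym (e W))
        (unit-* κ-unit (≡.subst (λ k → IsUnit (⟦ D⁽ k ⁾ b ⟧ (basis (desc b 0)) W)) (ones-desc b k k≤b) (D-zeros W)))
      κ⁻¹ = proj₁ t-unit
      κ′ = f (U ++ W) * κ⁻¹
      f′ : Vector (a ℕ.+ b)
      f′ x = f x - κ′ * ⟦ t m ⟧ v x
      t-sym : QSymmetric a b (⟦ t m ⟧ v)
      t-sym = qsymmetric a b (t m) (reach-commutes (raise m ⊡ lower k))
      scale : ∀ {x x′ y y′} → x′ ≈ q * x → y′ ≈ q * y → x′ - κ′ * y′ ≈ q * (x - κ′ * y)
      scale {x} {x′} {y} {y′} e e′ = trans (+-cong e (-‿cong (*-congˡ e′)))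
        (solve 4 (λ q κ x y → q :* x :- κ :* (q :* y) := q :* (x :- κ :* y)) refl q κ′ x y)
      f′-sym : QSymmetric a b f′
      f′-sym = record { left  = λ σ w → scale (left f-sym σ w) (left t-sym σ w)
                      ; right = λ u σ → scale (right f-sym u σ) (right t-sym u σ) }
      f′-hom : Homogeneous s f′
      f′-hom x p = trans (+-cong (f-hom x p) (-‿cong (*-congˡ (t-homogeneous m m≤s s≤b+m x p))))
        (solve 1 (λ κ → con 0ℤ :- κ :* con 0ℤ := con 0ℤ) refl κ′)
      f′-UW : f′ (U ++ W) ≈ 0#
      f′-UW = begin
        y - (y * κ⁻¹) * z   ≈⟨ solve 3 (λ y i z → y :- (y :* i) :* z := y :- y :* (z :* i)) refl y κ⁻¹ z ⟩
        y - y * (z * κ⁻¹)   ≈⟨ +-congˡ (-‿cong (*-congˡ (proj₂ t-unit))) ⟩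
        y - y * 1#          ≈⟨ solve 1 (λ y → y :- y :* con 1ℤ := con 0ℤ) refl y ⟩
        0#                  ∎
        where
        y = f (U ++ W)
        z = ⟦ t m ⟧ v (U ++ W)
      f′-U : ∀ w → f′ (U ++ w) ≈ 0#
      f′-U w with ones w ℕ.≟ k
      ... | yes p = sort (λ w → f′ (U ++ w) ≈ 0#)
              (λ σ e → trans (right f′-sym U σ) (trans (*-congˡ e) (zeroʳ q))) w
              (≡.subst (λ k → f′ (U ++ desc b k) ≈ 0#) (≡.sym p) f′-UW)
      ... | no p = f′-hom (U ++ w) λ e → p (Counting.solve-count b m (zeros+ones w)
              (≡.trans (≡.cong (ℕ._+ zeros w) (≡.sym zeros-U)) (≡.trans (≡.sym (zeros-++ U w)) e)))
      f′-vanish : ∀ u w → m ℕ.≤ zeros u → f′ (u ++ w) ≈ 0#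
      f′-vanish u w m≤ with ℕ.m≤n⇒m<n∨m≡n m≤
      ... | inj₁ m< = trans (+-cong (e u w m<) (-‿cong (*-congˡ (leading-zero m u w m<))))
              (solve 1 (λ κ → con 0ℤ :- κ :* con 0ℤ := con 0ℤ) refl κ′)
      ... | inj₂ p = sort (λ u → ∀ w → f′ (u ++ w) ≈ 0#)
              (λ σ e w → trans (left f′-sym σ w) (trans (*-congˡ (e w)) (zeroʳ q))) u
              (≡.subst (λ k → ∀ w → f′ (desc a k ++ w) ≈ 0#)
                (≡.trans (≡.cong (a ∸_) p) (≡.sym (ones≡n∸zeros u))) f′-U) w
      rec = decompose m (ℕ.m≤n⇒m≤1+n m≤a) f′ f′-sym f′-hom f′-vanish
    -- In this case and the next one, no word with s zeros has m of them in its first block. These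
    -- coordinates vanish for free and the coefficient is 0.
    ... | yes _  | no s≰ = pad m f (decompose m (ℕ.m≤n⇒m≤1+n m≤a) f f-sym f-hom (vanish-at m f f-hom e λ u w p e′ →
      s≰ (≡.subst₂ ℕ._≤_ (≡.trans (≡.sym (zeros-++ u w)) e′) (ℕ.+-comm m b) (ℕ.+-mono-≤ (ℕ.≤-reflexive p) (zeros≤n w)))))
    ... | no m≰s | _     = pad m f (decompose m (ℕ.m≤n⇒m≤1+n m≤a) f f-sym f-hom (vanish-at m f f-hom e λ u w p e′ →
      m≰s (≡.subst₂ ℕ._≤_ p (≡.trans (≡.sym (zeros-++ u w)) e′) (ℕ.m≤m+n (zeros u) (zeros w)))))

-- Weight projections from divided powers

private
  ∧-cases : ∀ {x y z b c d} → x ≡ b → y ≡ c → z ≡ d → (b ∧ not c) ≡ d → (x ∧ not y) ≡ z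
  ∧-cases ≡.refl ≡.refl ≡.refl e = e

  ∧-cases′ : ∀ {x y z b c d} → x ≡ b → y ≡ c → z ≡ d → (not b ∧ not c) ≡ d → (not x ∧ not y) ≡ z
  ∧-cases′ ≡.refl ≡.refl ≡.refl e = e

-- Cutting off before and after a raising or lowering operator isolates a single weight.
window-D : ∀ r m z → m ℕ.≤ r → ((z ℕ.<ᵇ suc (r ∸ m)) ∧ not (z ℕ.+ m ℕ.<ᵇ r)) ≡ (z ℕ.+ m ℕ.≡ᵇ r)
window-D r m z m≤r with ℕ.<-cmp (z ℕ.+ m) r
... | tri< p ≢r _ = ∧-cases (<ᵇ-true (s≤s (ℕ.m+n≤o⇒m≤o∸n z (ℕ.<⇒≤ p)))) (<ᵇ-true p) (≡ᵇ-false ≢r) ≡.refl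
... | tri≈ _ p _  = ∧-cases (<ᵇ-true (s≤s (ℕ.m+n≤o⇒m≤o∸n z (ℕ.≤-reflexive p)))) (<ᵇ-false (ℕ.≤-reflexive (≡.sym p))) (≡ᵇ-true p) ≡.refl
... | tri> _ ≢r p = ∧-cases (<ᵇ-false (ℕ.+-cancelʳ-≤ m (suc (r ∸ m)) z (≡.subst (ℕ._≤ z ℕ.+ m) (≡.cong suc (≡.sym (ℕ.m∸n+n≡m m≤r))) p)))
                            (<ᵇ-false (ℕ.<⇒≤ p)) (≡ᵇ-false ≢r) ≡.refl

private
  difference : ∀ r h o → ((r ℕ.+ h) ℕ.+ r) ∸ (o ℕ.+ h) ≡ (r ℕ.+ r) ∸ o
  difference r h o = ≡.trans (≡.cong (_∸ (o ℕ.+ h)) (≡.trans (ℕ.+-assoc r h r)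
      (≡.trans (≡.cong (r ℕ.+_) (ℕ.+-comm h r)) (≡.sym (ℕ.+-assoc r r h)))))
    (≡.trans (≡.cong ((r ℕ.+ r ℕ.+ h) ∸_) (ℕ.+-comm o h))
    (≡.trans (≡.sym (ℕ.∸-+-assoc (r ℕ.+ r ℕ.+ h) h o)) (≡.cong (_∸ o) (ℕ.m+n∸n≡m (r ℕ.+ r) h))))

-- In length 2r + h, a word with o ones after E⁽ʰ⁾ comes from one with 2r - o zeros. The cuts o ≥ r
-- and 2r - o ≥ r leave only o = r. For r = 0 both are vacuous, and truncation makes the right side
-- true for every o.
window-E : ∀ r h o → (not (o ℕ.<ᵇ r) ∧ not (((r ℕ.+ h) ℕ.+ r) ∸ (o ℕ.+ h) ℕ.<ᵇ r)) ≡ (((r ℕ.+ h) ℕ.+ r) ∸ (o ℕ.+ h) ℕ.≡ᵇ r)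
window-E r h o = ≡.subst (λ d → (not (o ℕ.<ᵇ r) ∧ not (d ℕ.<ᵇ r)) ≡ (d ℕ.≡ᵇ r)) (≡.sym (difference r h o)) (at r)
  where
  at : ∀ r → (not (o ℕ.<ᵇ r) ∧ not ((r ℕ.+ r) ∸ o ℕ.<ᵇ r)) ≡ ((r ℕ.+ r) ∸ o ℕ.≡ᵇ r)
  at zero    = ≡.cong (ℕ._≡ᵇ 0) (≡.sym (ℕ.0∸n≡0 o))
  at r@(suc _) with ℕ.<-cmp o r
  ... | tri< p ≢r _ = ∧-cases′ {c = (r ℕ.+ r) ∸ o ℕ.<ᵇ r} (<ᵇ-true p) ≡.refl (≡ᵇ-false λ e → ≢r (≡.sym (ℕ.+-cancelˡ-≡ r r o
          (≡.trans (≡.sym (ℕ.m∸n+n≡m (ℕ.≤-trans (ℕ.<⇒≤ p) (ℕ.m≤m+n r r)))) (≡.cong (ℕ._+ o) e))))) ≡.refl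
  ... | tri≈ _ ≡.refl _ = ∧-cases′ (<ᵇ-false (ℕ.≤-refl {r})) (<ᵇ-false (ℕ.≤-reflexive (≡.sym (ℕ.m+n∸n≡m r r)))) (≡ᵇ-true (ℕ.m+n∸n≡m r r)) ≡.refl
  ... | tri> _ _ p = ∧-cases′ (<ᵇ-false (ℕ.<⇒≤ p)) (<ᵇ-true d<r) (≡ᵇ-false (ℕ.<⇒≢ d<r)) ≡.refl
    where
    d<r : (r ℕ.+ r) ∸ o ℕ.< r
    d<r = ℕ.m<n+o⇒m∸n<o (r ℕ.+ r) o (ℕ.+-monoˡ-< r p)

module Highest {c ℓ} (R : CommutativeRing c ℓ) (q q⁻¹ : CommutativeRing.Carrier R)
  (q*q⁻¹≈1 : CommutativeRing._≈_ R (CommutativeRing._*_ R q q⁻¹) (CommutativeRing.1# R))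
  where
  open CommutativeRing R hiding (zero)
  open TensorPower R
  open Coordinates R
  open QuantumOperators R q q⁻¹ q*q⁻¹≈1
  open Raising R q q⁻¹ q*q⁻¹≈1
  open import Relation.Binary.Reasoning.Setoid setoid

  E-0◁ : ∀ j {f : Vector n} → (∀ w → ⟦ 𝐄⁽ j ⁾ n ⟧ f w ≈ 0#) → ∀ w → ⟦ 𝐄⁽ j ⁾ (suc n) ⟧ (0F ◁ f) w ≈ 0#
  E-0◁ j {f} e (0F ∷ w) = trans (E-0 j (0F ◁ f) w) (trans (+-cong (trans (*-congˡ (e w)) (zeroʳ _)) (⟦⟧-0 (E↓ j _) w)) (+-identityˡ 0#))
  E-0◁ j {f} e (1F ∷ w) = trans (E-1 j (0F ◁ f) w) (trans (*-congˡ (⟦⟧-0 (𝐄⁽ j ⁾ _) w)) (zeroʳ _))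

  E-zeros : ∀ j n w → ⟦ 𝐄⁽ suc j ⁾ n ⟧ (basis (replicate n 0F)) w ≈ 0#
  E-zeros j zero    w = refl
  E-zeros j (suc n) w = E-0◁ (suc j) (E-zeros j n) w

  E-ones-vanish : ∀ j n → n ℕ.< j → ∀ w → ⟦ 𝐄⁽ j ⁾ n ⟧ (basis (replicate n 1F)) w ≈ 0#
  E-ones-vanish (suc j) zero    p w = refl
  E-ones-vanish (suc j) (suc n) (s≤s p) (0F ∷ w) = trans (E-0 (suc j) (1F ◁ basis (replicate n 1F)) w)
    (trans (+-cong (trans (*-congˡ (⟦⟧-0 (𝐄⁽ suc j ⁾ n) w)) (zeroʳ _)) (E-ones-vanish j n p w)) (+-identityˡ 0#))
  E-ones-vanish (suc j) (suc n) (s≤s p) (1F ∷ w) = trans (E-1 (suc j) (1F ◁ basis (replicate n 1F)) w)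
    (trans (*-congˡ (E-ones-vanish (suc j) n (ℕ.m≤n⇒m≤1+n p) w)) (zeroʳ _))

  -- Each letter has to be raised once, so only the summands E ⊗ E⁽ʲ⁾ of the coproduct contribute;
  -- they carry no power of q, hence the coefficient 1.
  E-ones : ∀ n w → ⟦ 𝐄⁽ n ⁾ n ⟧ (basis (replicate n 1F)) w ≈ basis (replicate n 0F) w
  E-ones zero    [] = refl
  E-ones (suc n) (0F ∷ w) = trans (E-0 (suc n) (1F ◁ basis (replicate n 1F)) w)
    (trans (+-cong (trans (*-congˡ (⟦⟧-0 (𝐄⁽ suc n ⁾ n) w)) (zeroʳ _)) (E-ones n w)) (+-identityˡ _))
  E-ones (suc n) (1F ∷ w) = trans (E-1 (suc n) (1F ◁ basis (replicate n 1F)) w)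
    (trans (*-congˡ (E-ones-vanish (suc n) n ℕ.≤-refl w)) (zeroʳ _))

module WeightProjections {c ℓ} (R : CommutativeRing c ℓ) (q q⁻¹ : CommutativeRing.Carrier R)
  (q*q⁻¹≈1 : CommutativeRing._≈_ R (CommutativeRing._*_ R q q⁻¹) (CommutativeRing.1# R))
  (q⁻¹*q≈1 : CommutativeRing._≈_ R (CommutativeRing._*_ R q⁻¹ q) (CommutativeRing.1# R))
  where
  open CommutativeRing R hiding (zero)
  open FromℤR.Solver R using (solve; _:=_; _:+_; _:*_; _:-_; :-_; con)
  open import Algebra.Properties.Ring ring using (-0#≈0#)
  open TensorPower R
  open Coordinates R
  open Ladder R q q⁻¹ q*q⁻¹≈1 q⁻¹*q≈1
  open WeightSpaces R q q⁻¹ q*q⁻¹≈1 q⁻¹*q≈1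
  open import Relation.Binary.Reasoning.Setoid setoid
  private
    module H  = Highest R q q⁻¹ q*q⁻¹≈1
    module H⁻ = Highest R q⁻¹ q q⁻¹*q≈1
    module Q⁻ = QuantumOperators R q⁻¹ q q⁻¹*q≈1

  -- (x₁₀ - q⁻¹ x₀₁) ⊗ f
  cup : Vector n → Vector (2 ℕ.+ n)
  cup f (0F ∷ 0F ∷ w) = 0#
  cup f (0F ∷ 1F ∷ w) = - q⁻¹ * f w
  cup f (1F ∷ 0F ∷ w) = f w
  cup f (1F ∷ 1F ∷ w) = 0#

  cup-cong : {f g : Vector n} → (∀ w → f w ≈ g w) → ∀ w → cup f w ≈ cup g w
  cup-cong e (0F ∷ 0F ∷ w) = refl
  cup-cong e (0F ∷ 1F ∷ w) = *-congˡ (e w)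
  cup-cong e (1F ∷ 0F ∷ w) = e w
  cup-cong e (1F ∷ 1F ∷ w) = refl

  cup-0 : {f : Vector n} → (∀ w → f w ≈ 0#) → ∀ w → cup f w ≈ 0#
  cup-0 e (0F ∷ 0F ∷ w) = refl
  cup-0 e (0F ∷ 1F ∷ w) = trans (*-congˡ (e w)) (zeroʳ _)
  cup-0 e (1F ∷ 0F ∷ w) = e w
  cup-0 e (1F ∷ 1F ∷ w) = refl

  private
    𝐮-cup : (f : Vector (2 ℕ.+ n)) {g : Vector n} → (∀ w → f (0F ∷ 1F ∷ w) ≈ g w) → (∀ w → f (1F ∷ 0F ∷ w) ≈ 0#) →
            ∀ w → ⟦ 𝐮 (2 ℕ.+ n) zero ⟧ f w ≈ cup g w
    𝐮-cup f e e′ (0F ∷ 0F ∷ w) = -0#≈0#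
    𝐮-cup f e e′ (0F ∷ 1F ∷ w) = trans (-‿cong (+-cong (*-congˡ (e w)) (-‿cong (e′ w))))
      (solve 2 (λ p x → :- (p :* x :- con 0ℤ) := (:- p) :* x) refl q⁻¹ _)
    𝐮-cup f e e′ (1F ∷ 0F ∷ w) = trans (-‿cong (+-cong (-‿cong (e w)) (*-congˡ (e′ w))))
      (solve 2 (λ p x → :- (:- x :+ p :* con 0ℤ) := x) refl q _)
    𝐮-cup f e e′ (1F ∷ 1F ∷ w) = -0#≈0#

    -- As cup f = 𝐮(x₀₁ ⊗ f) and 𝐮 reads only the coordinates 01 and 10, it is enough to know these
    -- two coordinates of B(x₀₁ ⊗ f).
    intertwine-cup : (B : Endomorphism {2 ℕ.+ n}) (C : Endomorphism {n}) → Commutes-TL B → (f : Vector n) →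
                     (∀ w → ⟦ B ⟧ (0F ◁ 1F ◁ f) (0F ∷ 1F ∷ w) ≈ ⟦ C ⟧ f w) →
                     (∀ w → ⟦ B ⟧ (0F ◁ 1F ◁ f) (1F ∷ 0F ∷ w) ≈ 0#) →
                     ∀ w → ⟦ B ⟧ (cup f) w ≈ cup (⟦ C ⟧ f) w
    intertwine-cup B C commutes f e e′ w = begin
      _ ≈⟨ ⟦⟧-cong B (𝐮-cup (0F ◁ 1F ◁ f) (λ _ → refl) (λ _ → refl)) w ⟨
      _ ≈⟨ commutes zero (0F ◁ 1F ◁ f) w ⟩
      _ ≈⟨ 𝐮-cup (⟦ B ⟧ (0F ◁ 1F ◁ f)) e e′ w ⟩
      _ ∎

  E-cup : ∀ j (f : Vector n) w → ⟦ 𝐄⁽ j ⁾ (2 ℕ.+ n) ⟧ (cup f) w ≈ cup (⟦ 𝐄⁽ j ⁾ n ⟧ f) w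
  E-cup {n} j f = intertwine-cup (𝐄⁽ j ⁾ _) (𝐄⁽ j ⁾ n) (reach-commutes (raise j)) f
    (λ w → begin
      _ ≈⟨ E-0 j (0F ◁ 1F ◁ f) (1F ∷ w) ⟩
      _ ≈⟨ +-cong (*-congˡ (E-1 j (1F ◁ f) w)) (⟦⟧-0 (E↓ j _) (1F ∷ w)) ⟩
      _ ≈⟨ +-identityʳ _ ⟩
      _ ≈⟨ *-assoc _ _ _ ⟨
      _ ≈⟨ *-congʳ (q^*q⁻¹^ j) ⟩
      _ ≈⟨ *-identityˡ _ ⟩
      _ ∎)
    (λ w → trans (E-1 j (0F ◁ 1F ◁ f) (0F ∷ w)) (trans (*-congˡ (⟦⟧-0 (𝐄⁽ j ⁾ _) (0F ∷ w))) (zeroʳ _)))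

  D-cup : ∀ j (f : Vector n) w → ⟦ D⁽ j ⁾ (2 ℕ.+ n) ⟧ (cup f) w ≈ cup (⟦ D⁽ j ⁾ n ⟧ f) w
  D-cup {n} j f = intertwine-cup (D⁽ j ⁾ _) (D⁽ j ⁾ n) (reach-commutes (lower j)) f
    (λ w → begin
      _ ≈⟨ D-0 j (0F ◁ 1F ◁ f) (1F ∷ w) ⟩
      _ ≈⟨ *-congˡ (D-1 j (1F ◁ f) w) ⟩
      _ ≈⟨ *-congˡ (+-congˡ (⟦⟧-0 (D↓ j _) w)) ⟩
      _ ≈⟨ *-congˡ (+-identityʳ _) ⟩
      _ ≈⟨ *-assoc _ _ _ ⟨
      _ ≈⟨ *-congʳ (q^*q⁻¹^ j) ⟩
      _ ≈⟨ *-identityˡ _ ⟩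
      _ ∎)
    (λ w → begin
      _ ≈⟨ D-1 j (0F ◁ 1F ◁ f) (0F ∷ w) ⟩
      _ ≈⟨ +-cong (trans (*-congˡ (⟦⟧-0 (D⁽ j ⁾ _) (0F ∷ w))) (zeroʳ _)) (at j w) ⟩
      _ ≈⟨ +-identityˡ 0# ⟩
      0# ∎)
    where
    at : ∀ j w → ⟦ D↓ j _ ⟧ (1F ◁ f) (0F ∷ w) ≈ 0#
    at zero    w = refl
    at (suc j) w = trans (D-0 j (1F ◁ f) w) (trans (*-congˡ (⟦⟧-0 (D⁽ j ⁾ _) w)) (zeroʳ _))

  -- The vectors killed by all D⁽ʲ⁾, j ≥ 1, detect the coefficient of the identity in Σₘ κₘ E⁽ᵐ⁾D⁽ᵐ⁾.
  record Lowest (n r h : ℕ) : Set (c ⊔ ℓ) where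
    field
      vector      : Vector n
      homogeneous : Homogeneous r vector
      D-kills     : ∀ j w → ⟦ D⁽ suc j ⁾ n ⟧ vector w ≈ 0#
      D-E         : ∀ w → ⟦ D⁽ h ⁾ n ∘ 𝐄⁽ h ⁾ n ⟧ vector w ≈ vector w
      word        : Vec (Fin 2) n
      at-word     : vector word ≈ 1#

  private
    flip-basis : ∀ (w : Vec (Fin 2) n) u → flip (basis w) u ≈ basis (opps w) u
    flip-basis []       []       = refl
    flip-basis (0F ∷ w) (0F ∷ u) = refl
    flip-basis (0F ∷ w) (1F ∷ u) = flip-basis w u
    flip-basis (1F ∷ w) (0F ∷ u) = flip-basis w u
    flip-basis (1F ∷ w) (1F ∷ u) = refl

    opps-replicate : ∀ n i → opps (replicate n i) ≡ replicate n (opp i)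
    opps-replicate zero    i = ≡.refl
    opps-replicate (suc n) i = ≡.cong (opp i ∷_) (opps-replicate n i)

    flip-replicate : ∀ n i u → flip (basis (replicate n i)) u ≈ basis (replicate n (opp i)) u
    flip-replicate n i u = trans (flip-basis (replicate n i) u) (reflexive (≡.cong (λ w → basis w u) (opps-replicate n i)))

    basis-self : ∀ (w : Vec (Fin 2) n) → basis w w ≈ 1#
    basis-self []       = refl
    basis-self (0F ∷ w) = basis-self w
    basis-self (1F ∷ w) = basis-self w

    ones-homogeneous : ∀ n u → zeros u ≢ 0 → basis (replicate n 1F) u ≈ 0#
    ones-homogeneous zero    []       p = contradiction ≡.refl p
    ones-homogeneous (suc n) (0F ∷ u) p = refl
    ones-homogeneous (suc n) (1F ∷ u) p = ones-homogeneous n u p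

  -- For r = 0 the vector is x₁^h, which E⁽ʰ⁾ sends to x₀^h and D⁽ʰ⁾ sends back, both with
  -- coefficient 1. The operators pass through a cup unchanged, so all properties persist when one
  -- is added.
  lowest : ∀ r h {n} → n ≡ (r ℕ.+ h) ℕ.+ r → Lowest n r h
  lowest zero    h e rewrite ≡.trans e (ℕ.+-identityʳ h) = record
    { vector = basis (replicate h 1F)
    ; homogeneous = λ u → ones-homogeneous h u
    ; D-kills = λ j w → trans (⟦⟧-cong (Q⁻.𝐄⁽ suc j ⁾ h) (flip-replicate h 1F) (opps w)) (H⁻.E-zeros j h (opps w))
    ; D-E = λ w → begin
        _ ≈⟨ ⟦⟧-cong (D⁽ h ⁾ h) (H.E-ones h) w ⟩
        _ ≈⟨ ⟦⟧-cong (Q⁻.𝐄⁽ h ⁾ h) (flip-replicate h 0F) (opps w) ⟩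
        _ ≈⟨ H⁻.E-ones h (opps w) ⟩
        _ ≈⟨ flip-replicate h 0F w ⟩
        _ ∎
    ; word = replicate h 1F
    ; at-word = basis-self (replicate h 1F) }
  lowest (suc r) h {suc zero} e with () ← ≡.trans (ℕ.suc-injective e) (ℕ.+-suc (r ℕ.+ h) r)
  lowest (suc r) h {suc (suc n)} e = record
    { vector = cup Z.vector
    ; homogeneous = at
    ; D-kills = λ j w → trans (D-cup (suc j) Z.vector w) (cup-0 (Z.D-kills j) w)
    ; D-E = λ w → trans (⟦⟧-cong (D⁽ h ⁾ _) (E-cup h Z.vector) w) (trans (D-cup h (⟦ 𝐄⁽ h ⁾ n ⟧ Z.vector) w) (cup-cong Z.D-E w))
    ; word = 1F ∷ 0F ∷ Z.word
    ; at-word = Z.at-word }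
    where
    module Z = Lowest (lowest r h {n} (ℕ.suc-injective (≡.trans (ℕ.suc-injective e) (ℕ.+-suc (r ℕ.+ h) r))))
    at : Homogeneous (suc r) (cup Z.vector)
    at (0F ∷ 0F ∷ w) p = refl
    at (0F ∷ 1F ∷ w) p = trans (*-congˡ (Z.homogeneous w (λ e → p (≡.cong suc e)))) (zeroʳ _)
    at (1F ∷ 0F ∷ w) p = Z.homogeneous w (λ e → p (≡.cong suc e))
    at (1F ∷ 1F ∷ w) p = refl

  -- `below` and `belowᵒ` cut out the two ends of the range of weights.
  at below belowᵒ : ℕ → Endomorphism {n}
  at r     = select (λ w → zeros w ℕ.≡ᵇ r)
  below r  = select (λ w → zeros w ℕ.<ᵇ r)
  belowᵒ r = select (λ w → ones w ℕ.<ᵇ r)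

  module _ (P : Vec (Fin 2) n → Bool) where

    not-select : ∀ f w → ⟦ select (λ w → not (P w)) ⟧ f w ≈ f w - ⟦ select P ⟧ f w
    not-select f w with P w
    ... | true  = sym (-‿inverseʳ _)
    ... | false = sym (trans (+-congˡ -0#≈0#) (+-identityʳ _))

    reach-not : Reach (select P) → Reach (select (λ w → not (P w)))
    reach-not p = resp {B = 1ᵒ n ⊕ End.-_ n (select P)} {select (λ w → not (P w))} (λ f w → sym (not-select f w))
      (reach-minus (resp {B = End.ι n 1#} {1ᵒ n} (λ f w → *-identityˡ _) (scalar 1#)) p)

  mask-∧ : ∀ b b′ x → mask b (mask b′ x) ≡ mask (b ∧ b′) x
  mask-∧ false b′ x = ≡.refl
  mask-∧ true  b′ x = ≡.refl

  homogeneous-agree : ∀ (B C : Endomorphism {n}) r → (∀ w → zeros w ≡ r → ∀ u → ⟦ B ⟧ (basis w) u ≈ ⟦ C ⟧ (basis w) u) →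
                      ∀ {f : Vector n} → Homogeneous r f → ∀ u → ⟦ B ⟧ f u ≈ ⟦ C ⟧ f u
  homogeneous-agree {n} B C r e {f} f-hom u = trans (expand B f u) (trans (dot-agree n cases) (sym (expand C f u)))
    where
    dot-agree : ∀ n {f g h : Vector n} → (∀ w → f w ≈ 0# ⊎ g w ≈ h w) → dot n f g ≈ dot n f h
    dot-agree zero e with e []
    ... | inj₁ p = trans (*-congʳ p) (trans (zeroˡ _) (sym (trans (*-congʳ p) (zeroˡ _))))
    ... | inj₂ p = *-congˡ p
    dot-agree (suc n) e = +-cong (dot-agree n (λ w → e (0F ∷ w))) (dot-agree n (λ w → e (1F ∷ w)))
    cases : ∀ w → f w ≈ 0# ⊎ ⟦ B ⟧ (basis w) u ≈ ⟦ C ⟧ (basis w) u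
    cases w with zeros w ℕ.≟ r
    ... | yes p = inj₂ (e w p u)
    ... | no  p = inj₁ (f-hom w p)

  at-homogeneous : ∀ r (f : Vector n) → Homogeneous r (⟦ at r ⟧ f)
  at-homogeneous r f w p = reflexive (≡.cong (λ b → mask b (f w)) (≡ᵇ-false p))

  at-fixes : ∀ r {f : Vector n} → Homogeneous r f → ∀ w → ⟦ at r ⟧ f w ≈ f w
  at-fixes r {f} f-hom w with zeros w ℕ.≟ r
  ... | yes p = reflexive (≡.cong (λ b → mask b (f w)) (≡ᵇ-true p))
  ... | no p  = trans (at-homogeneous r f w p) (sym (f-hom w p))

  E-mask-zeros : ∀ (χ : ℕ → Bool) j (f : Vector n) u →
    ⟦ 𝐄⁽ j ⁾ n ⟧ (λ w → mask (χ (zeros w)) (f w)) u ≈ mask (χ (n ∸ (ones u ℕ.+ j))) (⟦ 𝐄⁽ j ⁾ n ⟧ f u)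
  E-mask-zeros {n} χ j f u = trans
    (⟦⟧-cong (𝐄⁽ j ⁾ n) (λ w → reflexive (≡.cong (λ k → mask (χ k) (f w)) (zeros≡n∸ones w))) u)
    (E-mask (λ k → χ (n ∸ k)) j f u)

  module _ (r h : ℕ) where
    private
      a = r ℕ.+ h
      N = a ℕ.+ r
      v = generator a r
      -- On words with r zeros and r + h ones, E⁽ʰ⁾ goes to the opposite weight and D⁽ʰ⁾ returns. On
      -- this weight space f can therefore be decomposed with a, b, s equal to r + h, r, r.
      f = D⁽ h ⁾ N ∘ 𝐄⁽ h ⁾ N

      v-ones : ∀ u → ones u ≢ a → v u ≈ 0#
      v-ones u p = generator-homogeneous a r u λ e → p (ℕ.+-cancelˡ-≡ (zeros u) (ones u) a
        (≡.trans (zeros+ones u) (≡.trans (ℕ.+-comm a r) (≡.cong (ℕ._+ a) (≡.sym e)))))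

      fv-homogeneous : Homogeneous r (⟦ f ⟧ v)
      fv-homogeneous u p = D-homogeneous h {a} {⟦ 𝐄⁽ h ⁾ N ⟧ v} after-E u (λ e → p (ℕ.+-cancelʳ-≡ h (zeros u) r e))
        where
        after-E : ∀ u → zeros u ≢ a → ⟦ 𝐄⁽ h ⁾ N ⟧ v u ≈ 0#
        after-E u p = E-homogeneous h {a} {v} v-ones u λ e → p (ℕ.+-cancelʳ-≡ (ones u) (zeros u) a
          (≡.trans (zeros+ones u) (≡.cong (a ℕ.+_) (≡.sym (ℕ.+-cancelʳ-≡ h (ones u) r e)))))

      decomposition : Σ (Vec Carrier (suc a)) λ κs → ∀ x → ⟦ f ⟧ v x ≈ ⟦ combination a r r κs ⟧ v x
      decomposition = decompose a r r (suc a) ℕ.≤-refl (⟦ f ⟧ v) (qsymmetric a r f (reach-commutes (lower h ⊡ raise h)))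
        fv-homogeneous (λ u w p → contradiction p (ℕ.<⇒≱ (s≤s (zeros≤n u))))

      κs = proj₁ decomposition
      g = combination a r r κs

      f≈g : ∀ {x : Vector N} → Homogeneous r x → ∀ u → ⟦ f ⟧ x u ≈ ⟦ g ⟧ x u
      f≈g = homogeneous-agree f g r λ w p u → agree f g (reach-commutes (lower h ⊡ raise h)) (reach-commutes (combination-reach a r r κs)) a
        (λ u → trans (⟦⟧-cong f (λ u → sym (reflexive (generator≡basis a r u))) u)
          (trans (proj₂ decomposition u) (⟦⟧-cong g (λ u → reflexive (generator≡basis a r u)) u)))
        w (≡.trans (ones≡n∸zeros w) (≡.trans (≡.cong (N ∸_) p) (ℕ.m+n∸n≡m a r))) u

      D0 : ∀ {n} (x : Vector n) → ∀ w → ⟦ D⁽ (r ℕ.+ 0) ∸ r ⁾ n ⟧ x w ≈ x w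
      D0 {n} x w = trans (reflexive (≡.cong (λ k → ⟦ D⁽ k ⁾ n ⟧ x w) (ℕ.m+n∸m≡n r 0))) (flip-involutive x w)

      module Z = Lowest (lowest r h {N} ≡.refl)

      combination-lowest : ∀ {m} (κs : Vec Carrier (suc m)) → ∀ w → ⟦ combination a r r κs ⟧ Z.vector w ≈ last κs * Z.vector w
      combination-lowest {zero} (κ ∷ []) w = trans (+-identityˡ _) (*-congˡ (D0 Z.vector w))
      combination-lowest {suc m} (κ ∷ κs@(_ ∷ _)) w = trans (+-cong (combination-lowest κs w)
        (trans (*-congˡ (⟦⟧-zero (𝐄⁽ suc m ⁾ N) killed w)) (zeroʳ κ))) (+-identityʳ _)
        where
        killed : ∀ w → ⟦ D⁽ (r ℕ.+ suc m) ∸ r ⁾ N ⟧ Z.vector w ≈ 0#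
        killed w = trans (reflexive (≡.cong (λ k → ⟦ D⁽ k ⁾ N ⟧ Z.vector w) (ℕ.m+n∸m≡n r (suc m)))) (Z.D-kills m w)

      -- On the lowest vector all terms with m ≥ 1 vanish and f is the identity. The coordinate at
      -- `Z.word` is 1, so the coefficient can be read off there.
      last≈1 : last κs ≈ 1#
      last≈1 = begin
        last κs                      ≈⟨ *-identityʳ _ ⟨
        last κs * 1#                 ≈⟨ *-congˡ Z.at-word ⟨
        last κs * Z.vector Z.word    ≈⟨ combination-lowest κs Z.word ⟨
        ⟦ g ⟧ Z.vector Z.word        ≈⟨ f≈g Z.homogeneous Z.word ⟨
        ⟦ f ⟧ Z.vector Z.word        ≈⟨ Z.D-E Z.word ⟩
        Z.vector Z.word              ≈⟨ Z.at-word ⟩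
        1#                           ∎

    module _ (below-reach : ∀ t → t ℕ.≤ r → Reach {N} (below t)) (belowᵒ-reach : Reach {N} (belowᵒ r)) where
      private
        notbelow = select {N} (λ w → not (zeros w ℕ.<ᵇ r))
        notbelowᵒ = select {N} (λ w → not (ones w ℕ.<ᵇ r))

        notbelow-reach : Reach notbelow
        notbelow-reach = reach-not (λ w → zeros w ℕ.<ᵇ r) (below-reach r ℕ.≤-refl)

        -- Fewer than r zeros are excluded before E⁽ʰ⁾ and fewer than r ones after it; by `window-E`
        -- only inputs with exactly r zeros survive.
        f∘at : D⁽ h ⁾ N ∘ (notbelowᵒ ∘ (𝐄⁽ h ⁾ N ∘ notbelow)) ≋ f ∘ at r
        f∘at x = ⟦⟧-cong (D⁽ h ⁾ N) λ u → begin
          _ ≈⟨ mask-cong (not (ones u ℕ.<ᵇ r)) (E-mask-zeros (λ z → not (z ℕ.<ᵇ r)) h x u) ⟩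
          _ ≡⟨ mask-∧ (not (ones u ℕ.<ᵇ r)) _ _ ⟩
          _ ≡⟨ ≡.cong (λ b → mask b (⟦ 𝐄⁽ h ⁾ N ⟧ x u)) (window-E r h (ones u)) ⟩
          _ ≈⟨ E-mask-zeros (ℕ._≡ᵇ r) h x u ⟨
          _ ∎

        -- For m ≤ r, D⁽ᵐ⁾ leads from r zeros to r - m, a weight whose cut `below (suc (r ∸ m))` is
        -- already available; together with `notbelow` in front it isolates r. For m > r there is
        -- nothing to lower and the product is 0.
        E∘D∘at : ∀ m → Reach (𝐄⁽ suc m ⁾ N ∘ (D⁽ suc m ⁾ N ∘ at r))
        E∘D∘at m-1 with suc m-1 ℕ.≤? r
        ... | yes m≤r = resp {B = 𝐄⁽ m ⁾ N ∘ (below (suc (r ∸ m)) ∘ (D⁽ m ⁾ N ∘ notbelow))} {𝐄⁽ m ⁾ N ∘ (D⁽ m ⁾ N ∘ at r)}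
          (λ x → ⟦⟧-cong (𝐄⁽ m ⁾ N) λ u → begin
            _ ≈⟨ mask-cong (zeros u ℕ.<ᵇ suc (r ∸ m)) (D-mask (λ z → not (z ℕ.<ᵇ r)) m x u) ⟩
            _ ≡⟨ mask-∧ (zeros u ℕ.<ᵇ suc (r ∸ m)) _ _ ⟩
            _ ≡⟨ ≡.cong (λ b → mask b (⟦ D⁽ m ⁾ N ⟧ x u)) (window-D r m (zeros u) m≤r) ⟩
            _ ≈⟨ D-mask (ℕ._≡ᵇ r) m x u ⟨
            _ ∎)
          (raise m ⊡ (below-reach (suc (r ∸ m)) (ℕ.∸-monoʳ-< {r} {m} {0} (s≤s z≤n) m≤r) ⊡ (lower m ⊡ notbelow-reach)))
          where m = suc m-1
        ... | no m≰r = resp {B = End.ι N 0#} {𝐄⁽ m ⁾ N ∘ (D⁽ m ⁾ N ∘ at r)}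
          (λ x u → trans (zeroˡ _) (sym (⟦⟧-zero (𝐄⁽ m ⁾ N) (λ u → D-homogeneous m (at-homogeneous r x) u
            (λ e → m≰r (≡.subst (m ℕ.≤_) e (ℕ.m≤n+m m (zeros u))))) u))) (scalar 0#)
          where m = suc m-1

        combination∘at : ∀ {m} (κs : Vec Carrier (suc m)) → Σ (Endomorphism {N}) λ B → Reach B ×
          (∀ x u → ⟦ combination a r r κs ⟧ (⟦ at r ⟧ x) u ≈ ⟦ B ⟧ x u + last κs * ⟦ at r ⟧ x u)
        combination∘at {zero} (κ ∷ []) = End.ι N 0# , scalar 0# , λ x u →
          +-cong (sym (zeroˡ _)) (*-congˡ (D0 (⟦ at r ⟧ x) u))
        combination∘at {suc m} (κ ∷ κs@(_ ∷ _)) with B , B-reach , e ← combination∘at κs =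
          B ⊕ κ • (𝐄⁽ suc m ⁾ N ∘ (D⁽ suc m ⁾ N ∘ at r)) , (B-reach ⊞ (scalar κ ⊡ E∘D∘at m)) , λ x u → trans
            (+-cong (e x u) (*-congˡ (⟦⟧-cong (𝐄⁽ suc m ⁾ N) (λ u → reflexive (≡.cong (λ k → ⟦ D⁽ k ⁾ N ⟧ (⟦ at r ⟧ x) u) (ℕ.m+n∸m≡n r (suc m)))) u)))
            (solve 3 (λ x y z → (x :+ y) :+ z := (x :+ z) :+ y) refl _ _ _)

      -- On this weight space f is B plus the identity, where B collects the terms with m ≥ 1. Both
      -- the cut-off f and B are reachable, hence so is their difference.
      at-reach : Reach {N} (at r)
      at-reach with B , B-reach , e ← combination∘at κs =
        resp {B = D⁽ h ⁾ N ∘ (notbelowᵒ ∘ (𝐄⁽ h ⁾ N ∘ notbelow)) ⊕ End.-_ N B} {at r} (λ x u → begin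
          _ ≈⟨ +-congʳ (f∘at x u) ⟩
          ⟦ f ⟧ (⟦ at r ⟧ x) u - ⟦ B ⟧ x u
            ≈⟨ +-congʳ (trans (f≈g (at-homogeneous r x) u) (e x u)) ⟩
          (⟦ B ⟧ x u + last κs * ⟦ at r ⟧ x u) - ⟦ B ⟧ x u
            ≈⟨ +-congʳ (+-congˡ (*-congʳ last≈1)) ⟩
          (⟦ B ⟧ x u + 1# * ⟦ at r ⟧ x u) - ⟦ B ⟧ x u
            ≈⟨ solve 2 (λ b y → (b :+ con 1ℤ :* y) :- b := y) refl _ _ ⟩
          _ ∎)
          (reach-minus (lower h ⊡ (reach-not (λ w → ones w ℕ.<ᵇ r) belowᵒ-reach ⊡ (raise h ⊡ notbelow-reach))) B-reach)

  below-zero : below {n} 0 ≋ End.ι n 0#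
  below-zero x u = sym (zeroˡ _)

  below-suc : ∀ r → below {n} r ⊕ at r ≋ below (suc r)
  below-suc r x u with ℕ.<-cmp (zeros u) r
  ... | tri< p ≢r _ rewrite <ᵇ-true p | ≡ᵇ-false ≢r | <ᵇ-true (ℕ.m<n⇒m<1+n p) = +-identityʳ _
  ... | tri≈ ≮r p _ rewrite <ᵇ-false (ℕ.≮⇒≥ ≮r) | ≡ᵇ-true p | <ᵇ-true (s≤s (ℕ.≤-reflexive p)) = +-identityˡ _
  ... | tri> _ ≢r p rewrite <ᵇ-false (ℕ.<⇒≤ p) | ≡ᵇ-false ≢r | <ᵇ-false p = +-identityˡ _

module ProjectionsReachable {c ℓ} (R : CommutativeRing c ℓ) where
  open CommutativeRing R hiding (zero)
  open TensorPower R
  open Coordinates R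
  private
    module L = Ladder R
    module W = WeightProjections R

  private
    flip-select : ∀ (q q⁻¹ : Carrier) (e : q * q⁻¹ ≈ 1#) (e′ : q⁻¹ * q ≈ 1#) (χ : ℕ → Bool) →
      L.Reach q q⁻¹ e e′ {n} (select (λ w → χ (zeros w))) → L.Reach q⁻¹ q e′ e {n} (select (λ w → χ (ones w)))
    flip-select q q⁻¹ e e′ χ p = L.resp {B = flipᵒ (select (λ w → χ (zeros w)))} {select (λ w → χ (ones w))}
      (λ f w → trans (reflexive (≡.cong (λ k → mask (χ k) (f (opps (opps w)))) (zeros-opps w)))
                     (mask-cong (χ (ones w)) (flip-involutive f w)))
      (FlipReach.flip-reach R q q⁻¹ e e′ p)

    -- Quantified over q because a step for q also uses `belowᵒ`, which is the flip of `below` for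
    -- q⁻¹.
    BelowReach : ℕ → ℕ → Set (c ⊔ ℓ)
    BelowReach n r = ∀ q q⁻¹ (e : q * q⁻¹ ≈ 1#) (e′ : q⁻¹ * q ≈ 1#) t → t ℕ.≤ r → L.Reach q q⁻¹ e e′ {n} (W.below q q⁻¹ e e′ t)

    AtReach : ℕ → ℕ → Set (c ⊔ ℓ)
    AtReach n r = ∀ q q⁻¹ (e : q * q⁻¹ ≈ 1#) (e′ : q⁻¹ * q ≈ 1#) → L.Reach q q⁻¹ e e′ {n} (W.at q q⁻¹ e e′ r)

    at-step : ∀ n r → r ℕ.+ r ℕ.≤ n → BelowReach n r → AtReach n r
    at-step n r p below-reach q q⁻¹ e e′ = go (n ∸ (r ℕ.+ r)) (≡.trans (≡.sym (ℕ.m+[n∸m]≡n p))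
        (≡.trans (ℕ.+-assoc r r _) (≡.trans (≡.cong (r ℕ.+_) (ℕ.+-comm r _)) (≡.sym (ℕ.+-assoc r _ r)))))
      where
      go : ∀ h → n ≡ (r ℕ.+ h) ℕ.+ r → L.Reach q q⁻¹ e e′ {n} (W.at q q⁻¹ e e′ r)
      go h ≡.refl = W.at-reach q q⁻¹ e e′ r h (below-reach q q⁻¹ e e′)
        (flip-select q⁻¹ q e′ e (ℕ._<ᵇ r) (below-reach q⁻¹ q e′ e r ℕ.≤-refl))

    half : ∀ r n → suc r ℕ.+ suc r ℕ.≤ 2 ℕ.+ n → r ℕ.+ r ℕ.≤ n
    half r n p = ℕ.s≤s⁻¹ (≡.subst (ℕ._≤ suc n) (ℕ.+-suc r r) (ℕ.s≤s⁻¹ p))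

    -- `below r` is the sum of the projections `at t` with t < r, and `at-step` needs 2t ≤ n for
    -- these; this is the bound 2r ≤ n + 2.
    below-all : ∀ n r → r ℕ.+ r ℕ.≤ 2 ℕ.+ n → BelowReach n r
    below-all n r p q q⁻¹ e e′ zero t≤ = L.resp {B = End.ι n 0#} {W.below q q⁻¹ e e′ 0}
      (λ x u → sym (W.below-zero q q⁻¹ e e′ x u)) (L.scalar 0#)
    below-all n (suc r) p q q⁻¹ e e′ (suc t) (s≤s t≤) with ℕ.m≤n⇒m<n∨m≡n t≤
    ... | inj₁ t< = below-all n r (ℕ.m≤n⇒m≤1+n (ℕ.m≤n⇒m≤1+n (half r n p))) q q⁻¹ e e′ (suc t) t<
    ... | inj₂ ≡.refl = L.resp {B = W.below q q⁻¹ e e′ r ⊕ W.at q q⁻¹ e e′ r} {W.below q q⁻¹ e e′ (suc r)}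
      (W.below-suc q q⁻¹ e e′ r)
      (L._⊞_ (rec q q⁻¹ e e′ r ℕ.≤-refl) (at-step n r (half r n p) rec q q⁻¹ e e′))
      where rec = below-all n r (ℕ.m≤n⇒m≤1+n (ℕ.m≤n⇒m≤1+n (half r n p)))

  at-all : ∀ n r → r ℕ.≤ n → ∀ q q⁻¹ (e : q * q⁻¹ ≈ 1#) (e′ : q⁻¹ * q ≈ 1#) → L.Reach q q⁻¹ e e′ {n} (W.at q q⁻¹ e e′ r)
  at-all n r r≤n q q⁻¹ e e′ with r ℕ.+ r ℕ.≤? n
  ... | yes p = at-step n r p (below-all n r (ℕ.m≤n⇒m≤1+n (ℕ.m≤n⇒m≤1+n p))) q q⁻¹ e e′
  -- Having r zeros means having k = n - r ones. Now 2k ≤ n, so the flip of the projection for k and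
  -- q⁻¹ does it.
  ... | no p  = L.resp {B = select (λ w → ones w ℕ.≡ᵇ k)} {W.at q q⁻¹ e e′ r}
      (λ f w → reflexive (≡.cong (λ b → mask b (f w)) (same w)))
      (flip-select q⁻¹ q e′ e (ℕ._≡ᵇ k) (at-step n k k+k≤n (below-all n k (ℕ.m≤n⇒m≤1+n (ℕ.m≤n⇒m≤1+n k+k≤n))) q⁻¹ q e′ e))
    where
    k = n ∸ r
    r+k≡n : r ℕ.+ k ≡ n
    r+k≡n = ℕ.m+[n∸m]≡n r≤n
    k+k≤n : k ℕ.+ k ℕ.≤ n
    k+k≤n = ≡.subst (k ℕ.+ k ℕ.≤_) r+k≡n (ℕ.+-monoˡ-≤ k (ℕ.<⇒≤ (ℕ.+-cancelˡ-< r k r (≡.subst (ℕ._< r ℕ.+ r) (≡.sym r+k≡n) (ℕ.≰⇒> p)))))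
    same : ∀ w → (ones w ℕ.≡ᵇ k) ≡ (zeros w ℕ.≡ᵇ r)
    same w with zeros w ℕ.≟ r
    ... | yes z≡r = ≡.trans (≡ᵇ-true (≡.trans (ones≡n∸zeros w) (≡.cong (n ∸_) z≡r))) (≡.sym (≡ᵇ-true z≡r))
    ... | no z≢r  = ≡.trans (≡ᵇ-false {ones w} {k} λ o≡k → z≢r (≡.trans (zeros≡n∸ones w) (≡.trans (≡.cong (n ∸_) o≡k) (ℕ.m∸[m∸n]≡n r≤n)))) (≡.sym (≡ᵇ-false z≢r))

-- The centralizer of Temperley-Lieb is the image of U

module DoubleCentralizer {c ℓ} (R : CommutativeRing c ℓ) (q q⁻¹ : CommutativeRing.Carrier R)
  (q*q⁻¹≈1 : CommutativeRing._≈_ R (CommutativeRing._*_ R q q⁻¹) (CommutativeRing.1# R))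
  (q⁻¹*q≈1 : CommutativeRing._≈_ R (CommutativeRing._*_ R q⁻¹ q) (CommutativeRing.1# R))
  where
  open CommutativeRing R hiding (zero)
  open TensorPower R
  open Coordinates R
  open Ladder R q q⁻¹ q*q⁻¹≈1 q⁻¹*q≈1
  open WeightSpaces R q q⁻¹ q*q⁻¹≈1 q⁻¹*q≈1
  open WeightProjections R q q⁻¹ q*q⁻¹≈1 q⁻¹*q≈1
  open import Relation.Binary.Reasoning.Setoid setoid

  at-reachable : ∀ n r → r ℕ.≤ n → Reach {n} (at r)
  at-reachable n r r≤n = ProjectionsReachable.at-all R n r r≤n q q⁻¹ q*q⁻¹≈1 q⁻¹*q≈1

  private
    -- `decompose` gives a combination with the same value as at s ∘ B on the generator; as both
    -- maps commute with TL, they agree on the whole weight space. That `at s` commutes with TL is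
    -- read off from its reachability.
    component : ∀ a b s → s ℕ.≤ a ℕ.+ b → (B : Endomorphism {a ℕ.+ b}) → Commutes-TL B → Reach (at s ∘ (B ∘ at b))
    component a b s s≤n B B-commutes with κs , e ← decompose a b s (suc a) ℕ.≤-refl (⟦ at s ∘ B ⟧ (generator a b))
        (qsymmetric a b (at s ∘ B) (commutes-∘ {B = at s} {B} (reach-commutes (at-reachable _ s s≤n)) B-commutes))
        (at-homogeneous s (⟦ B ⟧ (generator a b))) (λ u w p → contradiction p (ℕ.<⇒≱ (s≤s (zeros≤n u)))) =
      resp {B = C ∘ at b} {at s ∘ (B ∘ at b)}
        (λ x → homogeneous-agree C (at s ∘ B) b (λ w p u → agree C (at s ∘ B) (reach-commutes C-reach)
            (commutes-∘ {B = at s} {B} (reach-commutes (at-reachable _ s s≤n)) B-commutes) a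
            (λ u → trans (⟦⟧-cong C (λ u → sym (reflexive (generator≡basis a b u))) u)
              (trans (sym (e u)) (⟦⟧-cong (at s ∘ B) (λ u → reflexive (generator≡basis a b u)) u)))
            w (≡.trans (ones≡n∸zeros w) (≡.trans (≡.cong (a ℕ.+ b ∸_) p) (ℕ.m+n∸n≡m a b))) u)
          (at-homogeneous b x))
        (C-reach ⊡ at-reachable _ b (ℕ.m≤n+m b a))
      where
      C = combination a b s κs
      C-reach = combination-reach a b s κs

    component′ : ∀ n b s → b ℕ.≤ n → s ℕ.≤ n → (B : Endomorphism {n}) → Commutes-TL B → Reach (at s ∘ (B ∘ at b))
    component′ n b s b≤n s≤n = go (n ∸ b) (ℕ.m∸n+n≡m b≤n)
      where
      go : ∀ a → a ℕ.+ b ≡ n → (B : Endomorphism {n}) → Commutes-TL B → Reach (at s ∘ (B ∘ at b))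
      go a ≡.refl = component a b s s≤n

    reach-0 : {B : Endomorphism {n}} → (∀ f w → ⟦ B ⟧ f w ≈ 0#) → Reach B
    reach-0 {n} {B} e = resp {B = End.ι n 0#} {B} (λ f w → trans (zeroˡ _) (sym (e f w))) (scalar 0#)

    below-full : below {n} (suc n) ≋ 1ᵒ n
    below-full {n} f w = reflexive (≡.cong (λ b → mask b (f w)) (<ᵇ-true (s≤s (zeros≤n w))))

  module _ (B : Endomorphism {n}) (B-commutes : Commutes-TL B) where
    private
      -- The matrix of weight blocks is summed up first over target weights and then over source
      -- weights, `below` being the partial sums of `at`.
      rows : ∀ b → b ℕ.≤ n → ∀ s → s ℕ.≤ suc n → Reach (below s ∘ (B ∘ at b))
      rows b b≤n zero    _ = reach-0 {B = below 0 ∘ (B ∘ at b)} λ f w → refl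
      rows b b≤n (suc s) (s≤s s≤n) = resp {B = below s ∘ (B ∘ at b) ⊕ at s ∘ (B ∘ at b)} {below (suc s) ∘ (B ∘ at b)}
        (λ f → below-suc s (⟦ B ∘ at b ⟧ f))
        (rows b b≤n s (ℕ.m≤n⇒m≤1+n s≤n) ⊞ component′ n b s b≤n s≤n B B-commutes)

      columns : ∀ b → b ℕ.≤ suc n → Reach (B ∘ below b)
      columns zero    _ = reach-0 {B = B ∘ below 0} λ f w → ⟦⟧-0 B w
      columns (suc b) (s≤s b≤n) = resp {B = B ∘ below b ⊕ below (suc n) ∘ (B ∘ at b)} {B ∘ below (suc b)}
        (λ f w → begin
          _ ≈⟨ +-congˡ (below-full (⟦ B ∘ at b ⟧ f) w) ⟩
          _ ≈⟨ +ᴹ-homo B (⟦ below b ⟧ f) (⟦ at b ⟧ f) w ⟨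
          _ ≈⟨ ⟦⟧-cong B (below-suc b f) w ⟩
          _ ∎)
        (columns b (ℕ.m≤n⇒m≤1+n b≤n) ⊞ rows b b≤n (suc n) ℕ.≤-refl)

    reachable : Reach B
    reachable = resp {B = B ∘ below (suc n)} {B} (λ f → ⟦⟧-cong B (below-full f)) (columns (suc n) ℕ.≤-refl)

module Image {c ℓ} (R : CommutativeRing c ℓ) (q q⁻¹ : CommutativeRing.Carrier R)
  (q*q⁻¹≈1 : CommutativeRing._≈_ R (CommutativeRing._*_ R q q⁻¹) (CommutativeRing.1# R))
  (q⁻¹*q≈1 : CommutativeRing._≈_ R (CommutativeRing._*_ R q⁻¹ q) (CommutativeRing.1# R))
  (𝔤 : LieAlgebra) (n : ℕ)
  where
  open CommutativeRing R hiding (zero)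
  open TensorPower R
  open Ladder R q q⁻¹ q*q⁻¹≈1 q⁻¹*q≈1
  open QuantumGroup R q q⁻¹ q*q⁻¹≈1 𝔤
  private
    module ρ = AlgebraHom (representation n)
    module 𝐔 = Algebra 𝐔
    module Int = QuantumGL₂.Integral 𝔤
    module L = LatticeAction 𝔤 n R q q⁻¹ q*q⁻¹≈1 (Specialization.specialize R q q⁻¹ q*q⁻¹≈1)

  InImage : Endomorphism {n} → Set _
  InImage B = Σ 𝐔.Carrier λ u → ρ.⟦ u ⟧ ≋ B

  image-resp : {B C : Endomorphism {n}} → B ≋ C → InImage B → InImage C
  image-resp e (u , p) = u , λ f w → trans (p f w) (e f w)

  image-∘ : {B C : Endomorphism {n}} → InImage B → InImage C → InImage (B ∘ C)
  image-∘ {B} {C} (u , p) (u′ , p′) = u 𝐔.* u′ , λ f w →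
    trans (ρ.*-homo u u′ f w) (trans (p (⟦ ρ.⟦ u′ ⟧ ⟧ f) w) (⟦⟧-cong B (p′ f) w))

  image-⊕ : {B C : Endomorphism {n}} → InImage B → InImage C → InImage (B ⊕ C)
  image-⊕ (u , p) (u′ , p′) = u 𝐔.+ u′ , λ f w → +-cong (p f w) (p′ f w)

  image-ι : ∀ r → InImage (End.ι n r)
  image-ι r = 𝐔.ι r , ρ.ι-homo r

  image-gen : (x : QuantumGL₂.LusztigGenerator 𝔤) → InImage (L.operator x)
  image-gen x = (_ , Int.gen x) Base.⊗ 1# , λ f w → *-identityˡ _

image-K : ∀ {c ℓ} (R : CommutativeRing c ℓ) q q⁻¹ e e′ 𝔤 n → Image.InImage R q q⁻¹ e e′ 𝔤 n (QuantumOperators.𝐊 R q q⁻¹ e n)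
image-K R q q⁻¹ e e′ sl₂ n = Image.image-gen R q q⁻¹ e e′ sl₂ n QuantumGL₂.K
image-K R q q⁻¹ e e′ gl₂ n = image-resp {𝐊₁ n ∘ 𝐊₂⁻¹ n} {𝐊 n} (OperatorRelations.𝐊₁𝐊₂⁻¹ R q q⁻¹ e n)
  (image-∘ {𝐊₁ n} {𝐊₂⁻¹ n} (image-gen QuantumGL₂.K₁) (image-gen QuantumGL₂.K₂⁻¹))
  where
  open Image R q q⁻¹ e e′ gl₂ n
  open QuantumOperators R q q⁻¹ e
  open TensorPower R

module ReachImage {c ℓ} (R : CommutativeRing c ℓ) (q q⁻¹ : CommutativeRing.Carrier R)
  (q*q⁻¹≈1 : CommutativeRing._≈_ R (CommutativeRing._*_ R q q⁻¹) (CommutativeRing.1# R))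
  (q⁻¹*q≈1 : CommutativeRing._≈_ R (CommutativeRing._*_ R q⁻¹ q) (CommutativeRing.1# R))
  (𝔤 : LieAlgebra) (n : ℕ)
  where
  open CommutativeRing R hiding (zero)
  open TensorPower R
  open Ladder R q q⁻¹ q*q⁻¹≈1 q⁻¹*q≈1
  open Image R q q⁻¹ q*q⁻¹≈1 q⁻¹*q≈1 𝔤 n public

  private
    image-K^ : ∀ j → InImage (K^ j n)
    image-K^ zero    = image-resp {End.ι n 1#} {K^ 0 n}
      (λ f w → trans (*-identityˡ _) (sym (diagonal-1-1 n f w))) (image-ι 1#)
    image-K^ (suc j) = image-resp {𝐊 n ∘ K^ j n} {K^ (suc j) n} (diagonal-∘ _ _ _ _ n)
      (image-∘ {𝐊 n} {K^ j n} (image-K R q q⁻¹ q*q⁻¹≈1 q⁻¹*q≈1 𝔤 n) (image-K^ j))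

  reach-image : {B : Endomorphism {n}} → Reach B → InImage B
  reach-image (raise j)  = image-gen QuantumGL₂.E⁽ j ⁾
  reach-image (lower j)  = image-resp {θ j • (𝐅⁽ j ⁾ n ∘ K^ j n)} {D⁽ j ⁾ n} (λ f w → sym (D≋F∘K j n f w))
    (image-∘ {End.ι n (θ j)} {𝐅⁽ j ⁾ n ∘ K^ j n} (image-ι (θ j)) (image-∘ {𝐅⁽ j ⁾ n} {K^ j n} (image-gen QuantumGL₂.F⁽ j ⁾) (image-K^ j)))
  reach-image (scalar r) = image-ι r
  reach-image (_⊞_ {B} {C} p p′) = image-⊕ {B} {C} (reach-image p) (reach-image p′)
  reach-image (_⊡_ {B} {C} p p′) = image-∘ {B} {C} (reach-image p) (reach-image p′)
  reach-image (resp {B} {C} e p) = image-resp {B} {C} e (reach-image p)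

-- Spanning words of the Temperley-Lieb algebra

module MonoidFacts {c ℓ} (M : Monoid c ℓ) where
  open Monoid M renaming (_∙_ to _*_)
  open MonoidSolver M using (solve; _⊕_; _⊜_)
  open import Relation.Binary.Reasoning.Setoid setoid

  commute-* : ∀ {x y z} → x * z ≈ z * x → y * z ≈ z * y → (x * y) * z ≈ z * (x * y)
  commute-* {x} {y} {z} p p′ = begin
    (x * y) * z  ≈⟨ assoc x y z ⟩
    x * (y * z)  ≈⟨ ∙-congˡ p′ ⟩
    x * (z * y)  ≈⟨ assoc x z y ⟨
    (x * z) * y  ≈⟨ ∙-congʳ p ⟩
    (z * x) * y  ≈⟨ assoc z x y ⟩
    z * (x * y)  ∎

  absorb-right : ∀ {x y z} → x * z ≈ z * x → (x * y) * x ≈ x → (x * (y * z)) * x ≈ z * x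
  absorb-right {x} {y} {z} p p′ = begin
    (x * (y * z)) * x  ≈⟨ solve 3 (λ x y z → (x ⊕ (y ⊕ z)) ⊕ x ⊜ (x ⊕ y) ⊕ (z ⊕ x)) refl x y z ⟩
    (x * y) * (z * x)  ≈⟨ ∙-congˡ p ⟨
    (x * y) * (x * z)  ≈⟨ assoc (x * y) x z ⟨
    ((x * y) * x) * z  ≈⟨ ∙-congʳ p′ ⟩
    x * z              ≈⟨ p ⟩
    z * x              ∎

  absorb-left : ∀ {x y z} → (y * x) * y ≈ y → y * (x * (y * z)) ≈ y * z
  absorb-left {x} {y} {z} p = trans (solve 3 (λ x y z → y ⊕ (x ⊕ (y ⊕ z)) ⊜ ((y ⊕ x) ⊕ y) ⊕ z) refl x y z) (∙-congʳ p)

  exchange : ∀ {x y a b a′ b′} → x * a ≈ a * x → x * a′ ≈ a′ * x → a * b ≈ a′ * b′ →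
             (y * a) * (x * b) ≈ (y * a′) * (x * b′)
  exchange {x} {y} {a} {b} {a′} {b′} p p′ e = begin
    (y * a) * (x * b)    ≈⟨ regroup a b ⟩
    y * (a * x) * b      ≈⟨ ∙-congʳ (∙-congˡ p) ⟨
    y * (x * a) * b      ≈⟨ regroup′ a b ⟩
    (y * x) * (a * b)    ≈⟨ ∙-congˡ e ⟩
    (y * x) * (a′ * b′)  ≈⟨ regroup′ a′ b′ ⟨
    y * (x * a′) * b′    ≈⟨ ∙-congʳ (∙-congˡ p′) ⟩
    y * (a′ * x) * b′    ≈⟨ regroup a′ b′ ⟨
    (y * a′) * (x * b′)  ∎
    where
    regroup : ∀ a b → (y * a) * (x * b) ≈ y * (a * x) * b
    regroup a b = solve 4 (λ x y a b → (y ⊕ a) ⊕ (x ⊕ b) ⊜ (y ⊕ (a ⊕ x)) ⊕ b) refl x y a b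
    regroup′ : ∀ a b → y * (x * a) * b ≈ (y * x) * (a * b)
    regroup′ a b = solve 4 (λ x y a b → (y ⊕ (x ⊕ a)) ⊕ b ⊜ (y ⊕ x) ⊕ (a ⊕ b)) refl x y a b

module NormalForms {c ℓ} (R : CommutativeRing c ℓ) (δ ε : CommutativeRing.Carrier R)
  (ε*ε≈1 : CommutativeRing._≈_ R (CommutativeRing._*_ R ε ε) (CommutativeRing.1# R))
  where
  private
    module R = CommutativeRing R
  open Presentation R using (Term; gen; con; _+_; _*_)
  open Presentation using (relation; con-cong; con-*; con-central)

  TL : ∀ N → Algebra R c (c ⊔ ℓ)
  TL N = TemperleyLieb.TL R δ N

  T : ℕ → Set c
  T N = Term (Fin (N ∸ 1))

  module A (N : ℕ) = Algebra (TL N)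
  private
    module M (N : ℕ) = MonoidFacts (A.*-monoid N)
    module Reasoning (N : ℕ) where
      open import Relation.Binary.Reasoning.Setoid (A.setoid N) public
      open A N public using (sym; refl; trans; *-cong; *-congˡ; *-congʳ; *-assoc; *-identityˡ; *-identityʳ; zeroˡ; zeroʳ; +-cong; distribˡ; distribʳ)

    shift-gen : ∀ N → Fin (N ∸ 1) → T (suc N)
    shift-gen (suc N) i = gen (suc i)

  shift : ∀ N → AlgebraHom (TL N) (TL (suc N))
  shift N = Presentation.extend R (TemperleyLieb.Relation R δ N) (TL (suc N)) (shift-gen N) (shift-relation N)
    where
    shift-relation : ∀ N {a b} → TemperleyLieb.Relation R δ N a b → A._≈_ (suc N)
      (Presentation.evaluate R (TemperleyLieb.Relation R δ N) (TL (suc N)) (shift-gen N) a)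
      (Presentation.evaluate R (TemperleyLieb.Relation R δ N) (TL (suc N)) (shift-gen N) b)
    shift-relation (suc N) (TemperleyLieb.square i)       = relation (TemperleyLieb.square (suc i))
    shift-relation (suc N) (TemperleyLieb.adjacent i j d) = relation (TemperleyLieb.adjacent (suc i) (suc j) d)
    shift-relation (suc N) (TemperleyLieb.distant i j d)  = relation (TemperleyLieb.distant (suc i) (suc j) d)

  module _ (N : ℕ) where
    open AlgebraHom (shift N) public using () renaming (⟦_⟧ to sh; ⟦⟧-cong to sh-cong)

  -- The sign ε makes ê act as 𝐮 for either sign of δ. Indices out of range give 0, which keeps `p`
  -- total and lets its relations be stated without bounds.
  ê : ∀ N → ℕ → T N
  ê zero          i       = con R.0#
  ê (suc zero)    i       = con R.0#
  ê (suc (suc N)) zero    = con ε * gen zero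
  ê (suc (suc N)) (suc i) = sh (suc N) (ê (suc N) i)

  -- e₀ e₁ ⋯ e_{b-1}
  p : ∀ N → ℕ → T N
  p N       zero    = con R.1#
  p zero    (suc b) = con R.0#
  p (suc N) (suc b) = ê (suc N) 0 * sh N (p N b)

  ê-suc : ∀ N i → A._≈_ (suc N) (ê (suc N) (suc i)) (sh N (ê N i))
  ê-suc zero    i = A.refl 1
  ê-suc (suc N) i = A.refl (2 ℕ.+ N)

  ê-out : ∀ N i → N ∸ 1 ℕ.≤ i → A._≈_ N (ê N i) (con R.0#)
  ê-out zero          i       _       = A.refl 0
  ê-out (suc zero)    i       _       = A.refl 1
  ê-out (suc (suc N)) (suc i) (s≤s q) = sh-cong (suc N) (ê-out (suc N) i q)

  private
    ε-move : ∀ N (x y : T N) → A._≈_ N ((con ε * x) * (con ε * y)) (x * y)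
    ε-move N x y = begin
      (con ε * x) * (con ε * y)  ≈⟨ *-assoc _ _ _ ⟩
      con ε * (x * (con ε * y))  ≈⟨ *-congˡ (*-assoc _ _ _) ⟨
      con ε * ((x * con ε) * y)  ≈⟨ *-congˡ (*-congʳ (con-central ε x)) ⟨
      con ε * ((con ε * x) * y)  ≈⟨ *-congˡ (*-assoc _ _ _) ⟩
      con ε * (con ε * (x * y))  ≈⟨ *-assoc _ _ _ ⟨
      (con ε * con ε) * (x * y)  ≈⟨ *-congʳ (trans (sym (con-* ε ε)) (con-cong ε*ε≈1)) ⟩
      con R.1# * (x * y)         ≈⟨ *-identityˡ _ ⟩
      x * y                      ∎
      where open Reasoning N

    ε-triple : ∀ N (x y : T N) → A._≈_ N ((x * y) * x) x → A._≈_ N (((con ε * x) * (con ε * y)) * (con ε * x)) (con ε * x)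
    ε-triple N x y e = begin
      ((con ε * x) * (con ε * y)) * (con ε * x)  ≈⟨ *-congʳ (ε-move N x y) ⟩
      (x * y) * (con ε * x)                      ≈⟨ *-assoc _ _ _ ⟨
      ((x * y) * con ε) * x                      ≈⟨ *-congʳ (con-central ε (x * y)) ⟨
      (con ε * (x * y)) * x                      ≈⟨ *-assoc _ _ _ ⟩
      con ε * ((x * y) * x)                      ≈⟨ *-congˡ e ⟩
      con ε * x                                  ∎
      where open Reasoning N

    con-0 : ∀ N x y → A._≈_ N ((con R.0# * x) * y) (con R.0#)
    con-0 N x y = A.trans N (A.*-congʳ N (A.zeroˡ N x)) (A.zeroˡ N y)

  δ′ : R.Carrier
  δ′ = ε R.* δ

  ê-square : ∀ N → A._≈_ N (ê N 0 * ê N 0) (con δ′ * ê N 0)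
  ê-square zero          = A.trans 0 (A.zeroˡ 0 _) (A.sym 0 (A.zeroʳ 0 _))
  ê-square (suc zero)    = A.trans 1 (A.zeroˡ 1 _) (A.sym 1 (A.zeroʳ 1 _))
  ê-square (suc (suc N)) = begin
    (con ε * gen zero) * (con ε * gen zero)  ≈⟨ ε-move _ _ _ ⟩
    gen zero * gen zero                      ≈⟨ relation (TemperleyLieb.square zero) ⟩
    con δ * gen zero                         ≈⟨ *-congʳ (con-cong (R.trans (R.*-congʳ ε*ε≈1) (R.*-identityˡ δ))) ⟨
    con ((ε R.* ε) R.* δ) * gen zero         ≈⟨ *-congʳ (con-cong (R.trans (R.*-assoc ε ε δ) (R.*-comm ε δ′))) ⟩
    con (δ′ R.* ε) * gen zero                ≈⟨ *-congʳ (con-* δ′ ε) ⟩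
    (con δ′ * con ε) * gen zero              ≈⟨ *-assoc _ _ _ ⟩
    con δ′ * (con ε * gen zero)              ∎
    where open Reasoning (2 ℕ.+ N)

  ê-101 : ∀ N → A._≈_ (2 ℕ.+ N) ((ê (2 ℕ.+ N) 1 * ê (2 ℕ.+ N) 0) * ê (2 ℕ.+ N) 1) (ê (2 ℕ.+ N) 1)
  ê-101 zero    = con-0 2 _ _
  ê-101 (suc N) = ε-triple _ _ _ (relation (TemperleyLieb.adjacent (suc zero) zero ≡.refl))

  ê-010 : ∀ N → A._≈_ (3 ℕ.+ N) ((ê (3 ℕ.+ N) 0 * ê (3 ℕ.+ N) 1) * ê (3 ℕ.+ N) 0) (ê (3 ℕ.+ N) 0)
  ê-010 N = ε-triple _ _ _ (relation (TemperleyLieb.adjacent zero (suc zero) ≡.refl))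

  ê₀-commutes : ∀ N (x : T N) → A._≈_ (2 ℕ.+ N) (ê (2 ℕ.+ N) 0 * sh (suc N) (sh N x)) (sh (suc N) (sh N x) * ê (2 ℕ.+ N) 0)
  ê₀-commutes (suc N) (gen i) = M.commute-* (3 ℕ.+ N) (con-central ε _)
    (relation (TemperleyLieb.distant zero (suc (suc i)) (s≤s (s≤s z≤n))))
  ê₀-commutes N (con r) = A.sym (2 ℕ.+ N) (con-central r _)
  ê₀-commutes N (x + y) = trans (distribˡ _ _ _) (trans (+-cong (ê₀-commutes N x) (ê₀-commutes N y)) (sym (distribʳ _ _ _)))
    where open Reasoning (2 ℕ.+ N)
  ê₀-commutes N (x * y) = sym (M.commute-* (2 ℕ.+ N) (sym (ê₀-commutes N x)) (sym (ê₀-commutes N y)))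
    where open Reasoning (2 ℕ.+ N)

  p-last : ∀ N b → A._≈_ N (p N b * ê N b) (p N (suc b))
  p-last zero    b       = A.zeroʳ 0 _
  p-last (suc N) zero    = A.trans (suc N) (A.*-identityˡ (suc N) _) (A.sym (suc N) (A.*-identityʳ (suc N) _))
  p-last (suc N) (suc b) = begin
    (ê (suc N) 0 * sh N (p N b)) * ê (suc N) (suc b)  ≈⟨ *-assoc _ _ _ ⟩
    ê (suc N) 0 * (sh N (p N b) * ê (suc N) (suc b))  ≈⟨ *-congˡ (*-congˡ (ê-suc N b)) ⟩
    ê (suc N) 0 * sh N (p N b * ê N b)                ≈⟨ *-congˡ (sh-cong N (p-last N b)) ⟩
    ê (suc N) 0 * sh N (p N (suc b))                  ∎
    where open Reasoning (suc N)

  p-square : ∀ N b → A._≈_ N (p N (suc b) * ê N b) (con δ′ * p N (suc b))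
  p-square zero    b       = A.trans 0 (A.zeroˡ 0 _) (A.sym 0 (A.zeroʳ 0 _))
  p-square (suc N) zero    = begin
    (ê (suc N) 0 * con R.1#) * ê (suc N) 0  ≈⟨ *-congʳ (*-identityʳ _) ⟩
    ê (suc N) 0 * ê (suc N) 0               ≈⟨ ê-square (suc N) ⟩
    con δ′ * ê (suc N) 0                    ≈⟨ *-congˡ (*-identityʳ _) ⟨
    con δ′ * (ê (suc N) 0 * con R.1#)       ∎
    where open Reasoning (suc N)
  p-square (suc N) (suc b) = begin
    (ê (suc N) 0 * sh N (p N (suc b))) * ê (suc N) (suc b)  ≈⟨ *-assoc _ _ _ ⟩
    ê (suc N) 0 * (sh N (p N (suc b)) * ê (suc N) (suc b))  ≈⟨ *-congˡ (*-congˡ (ê-suc N b)) ⟩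
    ê (suc N) 0 * sh N (p N (suc b) * ê N b)                ≈⟨ *-congˡ (sh-cong N (p-square N b)) ⟩
    ê (suc N) 0 * (con δ′ * sh N (p N (suc b)))             ≈⟨ *-assoc _ _ _ ⟨
    (ê (suc N) 0 * con δ′) * sh N (p N (suc b))             ≈⟨ *-congʳ (con-central δ′ _) ⟨
    (con δ′ * ê (suc N) 0) * sh N (p N (suc b))             ≈⟨ *-assoc _ _ _ ⟩
    con δ′ * (ê (suc N) 0 * sh N (p N (suc b)))             ∎
    where open Reasoning (suc N)

  p-commutes : ∀ N b i → b ℕ.≤ i → A._≈_ (suc N) (p (suc N) b * ê (suc N) (suc i)) (sh N (ê N i) * p (suc N) b)
  p-commutes N zero i _ = trans (*-identityˡ _) (trans (ê-suc N i) (sym (*-identityʳ _)))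
    where open Reasoning (suc N)
  p-commutes zero    (suc b) (suc i) (s≤s q) = A.trans 1 (A.zeroʳ 1 _) (A.sym 1 (A.zeroˡ 1 _))
  p-commutes (suc N) (suc b) (suc i) (s≤s q) = M.commute-* (2 ℕ.+ N)
    (begin
      ê (2 ℕ.+ N) 0 * sh (suc N) (ê (suc N) (suc i))  ≈⟨ *-congˡ (sh-cong (suc N) (ê-suc N i)) ⟩
      ê (2 ℕ.+ N) 0 * sh (suc N) (sh N (ê N i))       ≈⟨ ê₀-commutes N (ê N i) ⟩
      sh (suc N) (sh N (ê N i)) * ê (2 ℕ.+ N) 0       ≈⟨ *-congʳ (sh-cong (suc N) (ê-suc N i)) ⟨
      sh (suc N) (ê (suc N) (suc i)) * ê (2 ℕ.+ N) 0  ∎)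
    (trans (sh-cong (suc N) (p-commutes N b i q)) (*-congʳ (sh-cong (suc N) (sym′ (ê-suc N i)))))
    where
    open Reasoning (2 ℕ.+ N)
    sym′ = A.sym (suc N)

  -- By eᵢeᵢ₊₁eᵢ = eᵢ the factor eᵢ₊₁ disappears; the rest eᵢ₊₂⋯e_{b-1} then commutes with e₀⋯eᵢ and
  -- moves to the left.
  p-absorb : ∀ N b i → suc i ℕ.< b → b ℕ.≤ N →
             Σ (T N) λ y → A._≈_ (suc N) (p (suc N) b * ê (suc N) i) (sh N y * p (suc N) (suc i))
  p-absorb (suc (suc N)) (suc (suc b)) zero _ _ = sh (suc N) (p (suc N) b) ,
    trans (M.absorb-right (3 ℕ.+ N) (ê₀-commutes (suc N) (p (suc N) b)) (ê-010 N)) (*-congˡ (sym (*-identityʳ _)))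
    where open Reasoning (3 ℕ.+ N)
  p-absorb (suc zero) (suc (suc b)) _ _ (s≤s ())
  p-absorb (suc N) (suc b) (suc i) (s≤s q) (s≤s q′) with y , e ← p-absorb N b i q q′ = sh N y , (begin
    (ê (2 ℕ.+ N) 0 * sh (suc N) (p (suc N) b)) * sh (suc N) (ê (suc N) i)  ≈⟨ *-assoc _ _ _ ⟩
    ê (2 ℕ.+ N) 0 * sh (suc N) (p (suc N) b * ê (suc N) i)                 ≈⟨ *-congˡ (sh-cong (suc N) e) ⟩
    ê (2 ℕ.+ N) 0 * (sh (suc N) (sh N y) * sh (suc N) (p (suc N) (suc i)))  ≈⟨ *-assoc _ _ _ ⟨
    (ê (2 ℕ.+ N) 0 * sh (suc N) (sh N y)) * sh (suc N) (p (suc N) (suc i))  ≈⟨ *-congʳ (ê₀-commutes N y) ⟩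
    (sh (suc N) (sh N y) * ê (2 ℕ.+ N) 0) * sh (suc N) (p (suc N) (suc i))  ≈⟨ *-assoc _ _ _ ⟩
    sh (suc N) (sh N y) * p (2 ℕ.+ N) (2 ℕ.+ i)                            ∎)
    where open Reasoning (2 ℕ.+ N)

  -- That is, (e₁⋯e_{b+1})(e₀⋯e_c) = (e₁⋯e_c)(e₀⋯e_{b-1}). For b = 0 it is e₁e₀e₁ = e₁; in general
  -- e₀ commutes with the twice shifted factors, and the case b - 1 applies to these.
  p-exchange : ∀ N b c → b ℕ.< c → A._≈_ (suc N) (sh N (p N (suc b)) * p (suc N) (suc c)) (sh N (p N c) * p (suc N) b)
  p-exchange zero b (suc c) _ = A.trans 1 (A.zeroˡ 1 _) (A.sym 1 (A.zeroˡ 1 _))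
  p-exchange (suc N) zero (suc c) _ = begin
    (ê (2 ℕ.+ N) 1 * con R.1#) * (ê (2 ℕ.+ N) 0 * (ê (2 ℕ.+ N) 1 * sh (suc N) (sh N (p N c))))
      ≈⟨ *-congʳ (*-identityʳ _) ⟩
    ê (2 ℕ.+ N) 1 * (ê (2 ℕ.+ N) 0 * (ê (2 ℕ.+ N) 1 * sh (suc N) (sh N (p N c))))
      ≈⟨ M.absorb-left (2 ℕ.+ N) (ê-101 N) ⟩
    ê (2 ℕ.+ N) 1 * sh (suc N) (sh N (p N c))
      ≈⟨ *-identityʳ _ ⟨
    (ê (2 ℕ.+ N) 1 * sh (suc N) (sh N (p N c))) * con R.1# ∎
    where open Reasoning (2 ℕ.+ N)
  p-exchange (suc N) (suc b) (suc c) (s≤s q) =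
    M.exchange (2 ℕ.+ N) (ê₀-commutes N (p N (suc b))) (ê₀-commutes N (p N c)) (sh-cong (suc N) (p-exchange N b c q))

  -- The elements sh^{N-1}(p c₁) ⋯ sh(p c_{N-1}) p c_N, with c_m ≤ min(c_{m+1}, m - 1), span TL_N:
  -- they correspond to the Dyck paths, hence to the noncrossing diagrams.
  data Span : ∀ N → ℕ → T N → Set (c ⊔ ℓ) where
    base  : ∀ {b} r → Span 0 b (con r)
    step  : ∀ {N b k x} → k ℕ.≤ b → k ℕ.≤ N → Span N k x → Span (suc N) b (sh N x * p (suc N) k)
    add   : ∀ {N b x y} → Span N b x → Span N b y → Span N b (x + y)
    scale : ∀ {N b x} r → Span N b x → Span N b (con r * x)
    resp  : ∀ {N b x y} → A._≈_ N x y → Span N b x → Span N b y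

  span-weaken : ∀ {N b b′ x} → b ℕ.≤ b′ → Span N b x → Span N b′ x
  span-weaken q (base r)      = base r
  span-weaken q (step q′ k s) = step (ℕ.≤-trans q′ q) k s
  span-weaken q (add s s′)    = add (span-weaken q s) (span-weaken q s′)
  span-weaken q (scale r s)   = scale r (span-weaken q s)
  span-weaken q (resp e s)    = resp e (span-weaken q s)

  span-full : ∀ {N b x} → Span N b x → Span N N x
  span-full (base r)     = base r
  span-full (step _ k s) = step (ℕ.m≤n⇒m≤1+n k) k s
  span-full (add s s′)   = add (span-full s) (span-full s′)
  span-full (scale r s)  = scale r (span-full s)
  span-full (resp e s)   = resp e (span-full s)

  span-1 : ∀ N b → Span N b (con R.1#)
  span-1 zero    b = base R.1#
  span-1 (suc N) b = resp (A.*-identityʳ (suc N) _) (step z≤n z≤n (span-1 N 0))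

  span-0 : ∀ N b → Span N b (con R.0#)
  span-0 N b = resp (A.zeroˡ N _) (scale R.0# (span-1 N b))

  -- If y ends in p_k with k > b, the order is wrong. By `p-exchange` from right to left, the
  -- lengths (k, b) become (b + 1, k + 1), which are in order, and the recursion continues one level
  -- down.
  span-step : ∀ {N d y} b → b ℕ.≤ suc d → b ℕ.≤ N → Span N d y → Span (suc N) (suc d) (sh N y * p (suc N) b)
  span-step b b≤ b≤N (base r) = step b≤ b≤N (base r)
  span-step {suc N} {d} b b≤ b≤N (step {k = k} {x} k≤d k≤N s) with k ℕ.≤? b
  ... | yes k≤b = step b≤ b≤N (step k≤b k≤N s)
  ... | no k≰b  = resp (begin
      (sh (suc N) (sh N x) * sh (suc N) (p (suc N) (suc b))) * p (2 ℕ.+ N) (suc k)  ≈⟨ *-assoc _ _ _ ⟩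
      sh (suc N) (sh N x) * (sh (suc N) (p (suc N) (suc b)) * p (2 ℕ.+ N) (suc k))  ≈⟨ *-congˡ (p-exchange (suc N) b k b<k) ⟩
      sh (suc N) (sh N x) * (sh (suc N) (p (suc N) k) * p (2 ℕ.+ N) b)              ≈⟨ *-assoc _ _ _ ⟨
      (sh (suc N) (sh N x) * sh (suc N) (p (suc N) k)) * p (2 ℕ.+ N) b              ∎)
    (step (s≤s k≤d) (s≤s k≤N) (span-step (suc b) (ℕ.m≤n⇒m≤1+n b<k) (ℕ.≤-trans b<k k≤N) s))
    where
    open Reasoning (2 ℕ.+ N)
    b<k = ℕ.≰⇒> k≰b
  span-step {N} b b≤ b≤N (add s s′) = resp (A.sym (suc N) (A.distribʳ (suc N) _ _ _))
    (add (span-step b b≤ b≤N s) (span-step b b≤ b≤N s′))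
  span-step {N} b b≤ b≤N (scale r s) = resp (A.sym (suc N) (A.*-assoc (suc N) _ _ _)) (scale r (span-step b b≤ b≤N s))
  span-step {N} b b≤ b≤N (resp e s) = resp (A.*-congʳ (suc N) (sh-cong N e)) (span-step b b≤ b≤N s)

  private
    scalar-0 : (x : T 0) → Σ R.Carrier λ r → A._≈_ 0 x (con r)
    scalar-0 (con r) = r , A.refl 0
    scalar-0 (x + y) = let r , e = scalar-0 x ; s , e′ = scalar-0 y in
      r R.+ s , A.trans 0 (A.+-cong 0 e e′) (A.sym 0 (Presentation.con-+ r s))
    scalar-0 (x * y) = let r , e = scalar-0 x ; s , e′ = scalar-0 y in
      r R.* s , A.trans 0 (A.*-cong 0 e e′) (A.sym 0 (con-* r s))

    gen-ê : ∀ N (i : Fin (N ∸ 1)) → A._≈_ N (gen i) (con ε * ê N (toℕ i))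
    gen-ê (suc (suc N)) zero = begin
      gen zero                  ≈⟨ *-identityˡ _ ⟨
      con R.1# * gen zero       ≈⟨ *-congʳ (trans (sym (con-* ε ε)) (con-cong ε*ε≈1)) ⟨
      (con ε * con ε) * gen zero ≈⟨ *-assoc _ _ _ ⟩
      con ε * (con ε * gen zero) ∎
      where open Reasoning (2 ℕ.+ N)
    gen-ê (suc (suc N)) (suc i) = sh-cong (suc N) (gen-ê (suc N) i)

    module _ N (closed-ê : ∀ {x} → Span N N x → ∀ i → Span N N (x * ê N i)) where
      open Reasoning N

      closed-from-ê : ∀ {x} → Span N N x → ∀ a → Span N N (x * a)
      closed-from-ê {x} s (gen i) = resp (begin
          con ε * (x * ê N (toℕ i))  ≈⟨ *-assoc _ _ _ ⟨
          (con ε * x) * ê N (toℕ i)  ≈⟨ *-congʳ (con-central ε x) ⟩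
          (x * con ε) * ê N (toℕ i)  ≈⟨ *-assoc _ _ _ ⟩
          x * (con ε * ê N (toℕ i))  ≈⟨ *-congˡ (gen-ê N i) ⟨
          x * gen i                  ∎)
        (scale ε (closed-ê s (toℕ i)))
      closed-from-ê s (con r) = resp (con-central r _) (scale r s)
      closed-from-ê s (a + b) = resp (sym (distribˡ _ _ _)) (add (closed-from-ê s a) (closed-from-ê s b))
      closed-from-ê s (a * b) = resp (*-assoc _ _ _) (closed-from-ê (closed-from-ê s a) b)

  -- A factor ê_i after p_k is moved into the left factor if i > k, lengthens p if i = k, gives the
  -- scalar `δ′` if i = k - 1, and shortens p if i < k - 1.
  span-closed : ∀ N {x} → Span N N x → ∀ a → Span N N (x * a)
  span-closed zero {x} s a = let r , e = scalar-0 (x * a) in resp (A.sym 0 e) (base r)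
  span-closed (suc N) = closed-from-ê (suc N) closed-ê
    where
    open Reasoning (suc N)
    closed-ê : ∀ {b x} → Span (suc N) b x → ∀ i → Span (suc N) (suc N) (x * ê (suc N) i)
    closed-ê (add s s′) i = resp (sym (distribʳ _ _ _)) (add (closed-ê s i) (closed-ê s′ i))
    closed-ê (scale r s) i = resp (sym (*-assoc _ _ _)) (scale r (closed-ê s i))
    closed-ê (resp e s) i = resp (*-congʳ e) (closed-ê s i)
    closed-ê (step {k = k} {x} _ k≤N s) i with ℕ.<-cmp i k
    closed-ê (step {k = k} {x} _ k≤N s) (suc i) | tri> _ _ (s≤s k≤i) = resp (begin
        sh N (x * ê N i) * p (suc N) k               ≈⟨ *-assoc _ _ _ ⟩
        sh N x * (sh N (ê N i) * p (suc N) k)        ≈⟨ *-congˡ (p-commutes N k i k≤i) ⟨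
        sh N x * (p (suc N) k * ê (suc N) (suc i))   ≈⟨ *-assoc _ _ _ ⟨
        (sh N x * p (suc N) k) * ê (suc N) (suc i)   ∎)
      (span-step k (ℕ.m≤n⇒m≤1+n k≤N) k≤N (span-closed N (span-full s) (ê N i)))
    ... | tri≈ _ ≡.refl _ with suc k ℕ.≤? N
    ...   | yes k<N = resp (trans (*-congˡ (sym (p-last (suc N) k))) (sym (*-assoc _ _ _)))
      (step (ℕ.m≤n⇒m≤1+n k<N) k<N (span-weaken (ℕ.n≤1+n k) s))
    -- For k = N the index is out of range and ê is 0.
    ...   | no k≮N  = resp (sym (trans (*-congˡ (ê-out (suc N) k (ℕ.≮⇒≥ k≮N))) (zeroʳ _))) (span-0 (suc N) (suc N))
    closed-ê (step {k = k} {x} _ k≤N s) i | tri< i<k _ _ with ℕ.m≤n⇒m<n∨m≡n i<k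
    ... | inj₁ i+1<k with y , e ← p-absorb N k i i+1<k k≤N = resp (begin
        sh N (x * y) * p (suc N) (suc i)         ≈⟨ *-assoc _ _ _ ⟩
        sh N x * (sh N y * p (suc N) (suc i))    ≈⟨ *-congˡ e ⟨
        sh N x * (p (suc N) k * ê (suc N) i)     ≈⟨ *-assoc _ _ _ ⟨
        (sh N x * p (suc N) k) * ê (suc N) i     ∎)
      (span-step (suc i) (ℕ.m≤n⇒m≤1+n (ℕ.≤-trans i<k k≤N)) (ℕ.≤-trans i<k k≤N) (span-closed N (span-full s) y))
    ... | inj₂ ≡.refl = resp (begin
        con δ′ * (sh N x * p (suc N) k)          ≈⟨ *-assoc _ _ _ ⟨
        (con δ′ * sh N x) * p (suc N) k          ≈⟨ *-congʳ (con-central δ′ _) ⟩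
        (sh N x * con δ′) * p (suc N) k          ≈⟨ *-assoc _ _ _ ⟩
        sh N x * (con δ′ * p (suc N) k)          ≈⟨ *-congˡ (p-square (suc N) i) ⟨
        sh N x * (p (suc N) k * ê (suc N) i)     ≈⟨ *-assoc _ _ _ ⟨
        (sh N x * p (suc N) k) * ê (suc N) i     ∎)
      (scale δ′ (step (ℕ.m≤n⇒m≤1+n k≤N) k≤N s))

  spans : ∀ N a → Span N N a
  spans N a = resp (A.*-identityˡ N a) (span-closed N (span-1 N N) a)

-- Words are padded with 0 on the right.
toVec : ∀ n → List (Fin 2) → Vec (Fin 2) n
toVec zero    l       = []
toVec (suc n) []      = 0F ∷ toVec n []
toVec (suc n) (i ∷ l) = i ∷ toVec n l

toVec-toList : ∀ {n} (w : Vec (Fin 2) n) → toVec n (toList w) ≡ w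
toVec-toList []      = ≡.refl
toVec-toList (i ∷ w) = ≡.cong (i ∷_) (toVec-toList w)

toVec-∷ʳ-0 : ∀ n l → toVec n (l List.++ 0F ∷ []) ≡ toVec n l
toVec-∷ʳ-0 zero    l       = ≡.refl
toVec-∷ʳ-0 (suc n) []      = ≡.refl
toVec-∷ʳ-0 (suc n) (i ∷ l) = ≡.cong (i ∷_) (toVec-∷ʳ-0 n l)

-- The action on tensor space and the bending of inputs

module Action {c ℓ} (R : CommutativeRing c ℓ) (q q⁻¹ : CommutativeRing.Carrier R)
  (q*q⁻¹≈1 : CommutativeRing._≈_ R (CommutativeRing._*_ R q q⁻¹) (CommutativeRing.1# R))
  (q⁻¹*q≈1 : CommutativeRing._≈_ R (CommutativeRing._*_ R q⁻¹ q) (CommutativeRing.1# R))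
  (s : Sign)
  where
  open CommutativeRing R hiding (zero)
  open FromℤR.Solver R using (solve; _:=_; _:+_; _:*_; _:-_; :-_; con)
  open import Algebra.Properties.Ring ring using (-1*x≈-x; -0#≈0#)
  open TensorPower R
  open Coordinates R
  open Ladder R q q⁻¹ q*q⁻¹≈1 q⁻¹*q≈1
  open WeightSpaces R q q⁻¹ q*q⁻¹≈1 q⁻¹*q≈1 using (𝐮; 1⊗-at)
  open WeightProjections R q q⁻¹ q*q⁻¹≈1 q⁻¹*q≈1 using (cup; cup-cong)
  open TemperleyLiebOperators R q q⁻¹ q*q⁻¹≈1
  open import Relation.Binary.Reasoning.Setoid setoid

  private
    sgn : Sign → Carrier
    sgn Sign.+ = - 1#
    sgn Sign.- = 1#

    sgn-square : ∀ s → sgn s * sgn s ≈ 1#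
    sgn-square Sign.+ = solve 0 ((:- con 1ℤ) :* (:- con 1ℤ) := con 1ℤ) refl
    sgn-square Sign.- = *-identityˡ 1#

    sgn-±ᵒ : ∀ s (B : Endomorphism {n}) f w → sgn s * ⟦ ±ᵒ s B ⟧ f w ≈ - ⟦ B ⟧ f w
    sgn-±ᵒ Sign.+ B f w = -1*x≈-x _
    sgn-±ᵒ Sign.- B f w = *-identityˡ _

  ε : Carrier
  ε = sgn s

  ε*ε≈1 : ε * ε ≈ 1#
  ε*ε≈1 = sgn-square s

  open NormalForms R (± s (q + q⁻¹)) ε ε*ε≈1 public
  private module P = Presentation R
  open P using () renaming (_*_ to infixl 7 _⊛_; _+_ to infixl 6 _⊹_)

  𝐞-sign : ∀ n i → ε • 𝐞 s n i ≋ 𝐮 n i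
  𝐞-sign (suc (suc n)) zero f w = sgn-±ᵒ s (ξ n) f w
  𝐞-sign (suc (suc n)) (suc i) f (j ∷ w) = begin
    ε * ⟦ 1-matrix ⊗ᵒ 𝐞 s (suc n) i ⟧ f (j ∷ w)  ≈⟨ *-congˡ (1⊗-at (𝐞 s (suc n) i) f j w) ⟩
    ε * ⟦ 𝐞 s (suc n) i ⟧ (f ↾ j) w              ≈⟨ 𝐞-sign (suc n) i (f ↾ j) w ⟩
    ⟦ 𝐮 (suc n) i ⟧ (f ↾ j) w                    ≈⟨ 1⊗-at (𝐮 (suc n) i) f j w ⟨
    _                                            ∎

  representation : ∀ n → AlgebraHom (TL n) (End n)
  representation n = P.extend (TemperleyLieb.Relation R (± s (q + q⁻¹)) n) (End n) (𝐞 s n)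
    (λ { (TemperleyLieb.square i)       → 𝐞-square s n i
       ; (TemperleyLieb.adjacent i j d) → 𝐞-adjacent s n i j d
       ; (TemperleyLieb.distant i j d)  → 𝐞-distant s n i j d })

  τ : ∀ n → T n → Endomorphism {n}
  τ n = AlgebraHom.⟦_⟧ (representation n)

  τ-cong : ∀ n {a b} → A._≈_ n a b → τ n a ≋ τ n b
  τ-cong n = AlgebraHom.⟦⟧-cong (representation n)

  τ-shift : ∀ n a → τ (suc n) (sh n a) ≋ 1-matrix ⊗ᵒ τ n a
  τ-shift (suc (suc n)) (P.gen i) f w = refl
  τ-shift n (P.con r) f (j ∷ w) = sym (1⊗-at (End.ι n r) f j w)
  τ-shift n (a ⊹ b) f (j ∷ w) = begin
    _ ≈⟨ +-cong (trans (τ-shift n a f (j ∷ w)) (1⊗-at (τ n a) f j w)) (trans (τ-shift n b f (j ∷ w)) (1⊗-at (τ n b) f j w)) ⟩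
    _ ≈⟨ 1⊗-at (τ n a ⊕ τ n b) f j w ⟨
    _ ∎
  τ-shift n (a ⊛ b) f (j ∷ w) = begin
    _ ≈⟨ τ-shift n a (⟦ τ (suc n) (sh n b) ⟧ f) (j ∷ w) ⟩
    _ ≈⟨ 1⊗-at (τ n a) (⟦ τ (suc n) (sh n b) ⟧ f) j w ⟩
    _ ≈⟨ ⟦⟧-cong (τ n a) (λ w → trans (τ-shift n b f (j ∷ w)) (1⊗-at (τ n b) f j w)) w ⟩
    _ ≈⟨ 1⊗-at (τ n a ∘ τ n b) f j w ⟨
    _ ∎

  -- The counterpart of `cup`: 𝐮 is `cup` after `cap` (`τ-ê₀`), and the two straighten each other by
  -- `zigzag`.
  cap : Vector (2 ℕ.+ n) → Vector n
  cap f w = f (0F ∷ 1F ∷ w) - q * f (1F ∷ 0F ∷ w)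

  cap-cong : {f g : Vector (2 ℕ.+ n)} → (∀ w → f w ≈ g w) → ∀ w → cap f w ≈ cap g w
  cap-cong e w = +-cong (e _) (-‿cong (*-congˡ (e _)))

  τ-ê₀ : ∀ n (f : Vector (2 ℕ.+ n)) w → ⟦ τ (2 ℕ.+ n) (ê (2 ℕ.+ n) 0) ⟧ f w ≈ cup (cap f) w
  τ-ê₀ n f w = trans (𝐞-sign (2 ℕ.+ n) zero f w) (at w)
    where
    at : ∀ w → ⟦ 𝐮 (2 ℕ.+ n) zero ⟧ f w ≈ cup (cap f) w
    at (0F ∷ 0F ∷ w) = -0#≈0#
    at (0F ∷ 1F ∷ w) = begin
      - (q⁻¹ * x - y)                          ≈⟨ -‿cong (+-congˡ (-‿cong (cancel-q⁻¹ y))) ⟨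
      - (q⁻¹ * x - q⁻¹ * (q * y))              ≈⟨ solve 4 (λ q p x y → :- (p :* x :- p :* (q :* y)) := (:- p) :* (x :- q :* y)) refl q q⁻¹ x y ⟩
      - q⁻¹ * (x - q * y)                      ∎
      where
      x = f (0F ∷ 1F ∷ w)
      y = f (1F ∷ 0F ∷ w)
    at (1F ∷ 0F ∷ w) = solve 3 (λ q x y → :- (:- x :+ q :* y) := x :- q :* y) refl q _ _
    at (1F ∷ 1F ∷ w) = -0#≈0#

  zigzag : ∀ i (g : Vector n) w → cap (i ◁ cup g) w ≈ (i ◁ g) w
  zigzag 0F g (0F ∷ w) = solve 2 (λ q x → x :- q :* con 0ℤ := x) refl q _
  zigzag 0F g (1F ∷ w) = solve 1 (λ q → con 0ℤ :- q :* con 0ℤ := con 0ℤ) refl q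
  zigzag 1F g (0F ∷ w) = solve 1 (λ q → con 0ℤ :- q :* con 0ℤ := con 0ℤ) refl q
  zigzag 1F g (1F ∷ w) = trans (solve 3 (λ q p x → con 0ℤ :- q :* ((:- p) :* x) := q :* (p :* x)) refl q q⁻¹ _) (cancel-q _)

  private
    τ-p-suc : ∀ n b (f : Vector (2 ℕ.+ n)) w → ⟦ τ (2 ℕ.+ n) (p (2 ℕ.+ n) (suc b)) ⟧ f w ≈
              cup (cap (⟦ 1-matrix ⊗ᵒ τ (suc n) (p (suc n) b) ⟧ f)) w
    τ-p-suc n b f w = trans (⟦⟧-cong (τ (2 ℕ.+ n) (ê (2 ℕ.+ n) 0)) (τ-shift (suc n) (p (suc n) b) f) w)
      (τ-ê₀ n (⟦ 1-matrix ⊗ᵒ τ (suc n) (p (suc n) b) ⟧ f) w)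

    cup-* : ∀ r (f : Vector n) w → cup (λ w → r * f w) w ≈ r * cup f w
    cup-* r f (0F ∷ 0F ∷ w) = sym (zeroʳ r)
    cup-* r f (0F ∷ 1F ∷ w) = solve 3 (λ p r x → (:- p) :* (r :* x) := r :* ((:- p) :* x)) refl q⁻¹ r _
    cup-* r f (1F ∷ 0F ∷ w) = refl
    cup-* r f (1F ∷ 1F ∷ w) = sym (zeroʳ r)

    cap-* : ∀ r (f : Vector (2 ℕ.+ n)) w → cap (λ w → r * f w) w ≈ r * cap f w
    cap-* r f w = solve 4 (λ q r x y → r :* x :- q :* (r :* y) := r :* (x :- q :* y)) refl q r _ _

    1⊗-◁ : ∀ (B : Endomorphism {n}) i f w → ⟦ 1-matrix ⊗ᵒ B ⟧ (i ◁ f) w ≈ (i ◁ ⟦ B ⟧ f) w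
    1⊗-◁ B 0F f (0F ∷ w) = 1⊗-at B (0F ◁ f) 0F w
    1⊗-◁ B 0F f (1F ∷ w) = trans (1⊗-at B (0F ◁ f) 1F w) (⟦⟧-0 B w)
    1⊗-◁ B 1F f (0F ∷ w) = trans (1⊗-at B (1F ◁ f) 0F w) (⟦⟧-0 B w)
    1⊗-◁ B 1F f (1F ∷ w) = 1⊗-at B (1F ◁ f) 1F w

  -- p_{b+1} caps off the letters b+1, b+2 and puts a cup in front; letter b+2 is a padding 0.
  private
    κ : Fin 2 → Carrier
    κ 0F = 0#
    κ 1F = - q

  p-cap : ∀ j l m → length l ℕ.≤ m → ∀ w →
          ⟦ τ (2 ℕ.+ m) (p (2 ℕ.+ m) (suc (length l))) ⟧ (basis (toVec (2 ℕ.+ m) (l List.++ j ∷ []))) w ≈ κ j * cup (basis (toVec m l)) w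
  p-cap j [] m _ w = begin
    _ ≈⟨ τ-p-suc m 0 f w ⟩
    _ ≈⟨ cup-cong (cap-cong {f = ⟦ 1-matrix ⊗ᵒ τ (suc m) (p (suc m) 0) ⟧ f} {f} (λ { (i ∷ w) → trans (1⊗-at (τ (suc m) (p (suc m) 0)) f i w) (*-identityˡ _) })) w ⟩
    _ ≈⟨ cup-cong (at j) w ⟩
    _ ≈⟨ cup-* (κ j) (basis (toVec m [])) w ⟩
    _ ∎
    where
    f = basis (toVec (2 ℕ.+ m) (j ∷ []))
    at : ∀ j w → cap (basis (toVec (2 ℕ.+ m) (j ∷ []))) w ≈ κ j * basis (toVec m []) w
    at 0F w = solve 2 (λ q x → con 0ℤ :- q :* con 0ℤ := con 0ℤ :* x) refl q _
    at 1F w = solve 2 (λ q x → con 0ℤ :- q :* x := (:- q) :* x) refl q _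
  p-cap j (i ∷ l) (suc m) (s≤s l≤m) w = begin
    _ ≈⟨ τ-p-suc (suc m) (suc (length l)) (i ◁ f) w ⟩
    _ ≈⟨ cup-cong (cap-cong (1⊗-◁ P i f)) w ⟩
    _ ≈⟨ cup-cong (cap-cong (◁-cong i (p-cap j l m l≤m))) w ⟩
    _ ≈⟨ cup-cong (cap-cong (◁-* i (κ j) (cup g))) w ⟩
    _ ≈⟨ cup-cong (cap-* (κ j) (i ◁ cup g)) w ⟩
    _ ≈⟨ cup-* (κ j) (cap (i ◁ cup g)) w ⟩
    -- The shifted word has left a cup behind the letter i; e₀ caps i with it, which returns i, and
    -- makes a new cup in front.
    _ ≈⟨ *-congˡ (cup-cong (zigzag i g) w) ⟩
    _ ∎
    where
    f = basis (toVec (2 ℕ.+ m) (l List.++ j ∷ []))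
    g = basis (toVec m l)
    P = τ (2 ℕ.+ m) (p (2 ℕ.+ m) (suc (length l)))

  -- Bending: the last letter of the input becomes the first letter of the output through the cup.
  γ : Fin 2 → Carrier
  γ 0F = - q⁻¹
  γ 1F = 1#

  Entries : Set c
  Entries = List (Fin 2) → List (Fin 2) → Carrier

  entries : Endomorphism {n} → Entries
  entries {n} B u w = ⟦ B ⟧ (basis (toVec n u)) (toVec n w)

  bend : Entries → Entries
  bend h u []      = γ 0F * h (1F ∷ u) []
  bend h u (i ∷ w) = γ i * h (opp i ∷ u) w

  bends : ℕ → Entries → Entries
  bends zero    h = h
  bends (suc b) h = bend (bends b h)

  bends-cong : ∀ b {h h′ : Entries} → (∀ u w → h u w ≈ h′ u w) → ∀ u w → bends b h u w ≈ bends b h′ u w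
  bends-cong zero    e u w       = e u w
  bends-cong (suc b) e u []      = *-congˡ (bends-cong b e _ _)
  bends-cong (suc b) e u (i ∷ w) = *-congˡ (bends-cong b e _ _)

  bends-+ : ∀ b (h h′ : Entries) u w → bends b (λ u w → h u w + h′ u w) u w ≈ bends b h u w + bends b h′ u w
  bends-+ zero    h h′ u w       = refl
  bends-+ (suc b) h h′ u []      = trans (*-congˡ (bends-+ b h h′ _ _)) (distribˡ _ _ _)
  bends-+ (suc b) h h′ u (i ∷ w) = trans (*-congˡ (bends-+ b h h′ _ _)) (distribˡ _ _ _)

  bends-* : ∀ b r (h : Entries) u w → bends b (λ u w → r * h u w) u w ≈ r * bends b h u w
  bends-* zero    r h u w       = refl
  bends-* (suc b) r h u []      = trans (*-congˡ (bends-* b r h _ _)) (solve 3 (λ r x y → x :* (r :* y) := r :* (x :* y)) refl r _ _)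
  bends-* (suc b) r h u (i ∷ w) = trans (*-congˡ (bends-* b r h _ _)) (solve 3 (λ r x y → x :* (r :* y) := r :* (x :* y)) refl r _ _)

  -- The coordinates of the vector of V^{⊗(b+n)} obtained by bending the first b inputs of B,
  -- the others being fed with x₀.
  X : ∀ b → Endomorphism {n} → List (Fin 2) → Carrier
  X b B = bends b (entries B) []

  X-cong : ∀ b {B C : Endomorphism {n}} → B ≋ C → ∀ w → X b B w ≈ X b C w
  X-cong b {B} {C} e = bends-cong b {entries B} {entries C} (λ u w → e _ _) []

  -- An output letter 1 feeds in x₀ with factor γ 1F = 1, and x₀ is also the padding. So restriction
  -- to 1... undoes the outermost bend.
  X-1 : ∀ b (B : Endomorphism {n}) w → X (suc b) B (1F ∷ w) ≈ X b B w
  X-1 {n} b B w = trans (*-identityˡ _) (pad b [] w)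
    where
    pad : ∀ b u w → bends b (entries B) (u List.++ 0F ∷ []) w ≈ bends b (entries B) u w
    pad zero    u w       = reflexive (≡.cong (λ u → ⟦ B ⟧ (basis u) (toVec n w)) (toVec-∷ʳ-0 n u))
    pad (suc b) u []      = *-congˡ (pad b (1F ∷ u) [])
    pad (suc b) u (i ∷ w) = *-congˡ (pad b (opp i ∷ u) w)

  private
    cup-↾ : ∀ i (g : Vector n) w → (cup g ↾ i) w ≈ γ i * (opp i ◁ g) w
    cup-↾ 0F g (0F ∷ w) = sym (zeroʳ _)
    cup-↾ 0F g (1F ∷ w) = refl
    cup-↾ 1F g (0F ∷ w) = sym (*-identityˡ _)
    cup-↾ 1F g (1F ∷ w) = sym (*-identityˡ _)

    τ-step : ∀ n (a : T n) k f i w → ⟦ τ (suc n) (sh n a ⊛ p (suc n) k) ⟧ f (i ∷ w) ≈ ⟦ τ n a ⟧ (⟦ τ (suc n) (p (suc n) k) ⟧ f ↾ i) w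
    τ-step n a k f i w = trans (τ-shift n a (⟦ τ (suc n) (p (suc n) k) ⟧ f) (i ∷ w)) (1⊗-at (τ n a) (⟦ τ (suc n) (p (suc n) k) ⟧ f) i w)

  -- Composing with p_b inserts a cup.
  X-p-zero-0 : ∀ (a : T n) w → X 0 (τ (suc n) (sh n a ⊛ p (suc n) 0)) (0F ∷ w) ≈ X 0 (τ n a) w
  X-p-zero-0 {n} a w = trans (τ-step n a 0 (0F ◁ basis (toVec n [])) 0F (toVec n w)) (⟦⟧-cong (τ n a) (λ w → *-identityˡ _) (toVec n w))

  X-p-zero-1 : ∀ (a : T n) w → X 0 (τ (suc n) (sh n a ⊛ p (suc n) 0)) (1F ∷ w) ≈ 0#
  X-p-zero-1 {n} a w = trans (τ-step n a 0 (0F ◁ basis (toVec n [])) 1F (toVec n w)) (⟦⟧-zero (τ n a) (λ w → *-identityˡ _) (toVec n w))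

  module _ {m : ℕ} (a : T (suc m)) {b : ℕ} (b≤m : b ℕ.≤ m) where
    private
      B = τ (2 ℕ.+ m) (sh (suc m) a ⊛ p (2 ℕ.+ m) (suc b))

      entry : ∀ j u i w → length u ≡ b → entries B (u List.++ j ∷ []) (i ∷ w) ≈ κ j * (γ i * entries (τ (suc m) a) (opp i ∷ u) w)
      entry j u i w ≡.refl = begin
        _ ≈⟨ τ-step (suc m) a (suc b) (basis (toVec (2 ℕ.+ m) (u List.++ j ∷ []))) i (toVec (suc m) w) ⟩
        _ ≈⟨ ⟦⟧-cong (τ (suc m) a) (λ w → trans (p-cap j u m b≤m (i ∷ w)) (*-congˡ (cup-↾ i (basis (toVec m u)) w))) (toVec (suc m) w) ⟩
        _ ≈⟨ *ₗ-homo (τ (suc m) a) (κ j) (λ w → γ i * (opp i ◁ basis (toVec m u)) w) (toVec (suc m) w) ⟩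
        _ ≈⟨ *-congˡ (*ₗ-homo (τ (suc m) a) (γ i) (opp i ◁ basis (toVec m u)) (toVec (suc m) w)) ⟩
        _ ∎

      -- While d letters are still to be bent in front of u, j stays at the end, as input b + 1,
      -- where `p-cap` absorbs it. The cup made by p accounts for the extra bend on the right side.
      bent : ∀ j d u w → length u ℕ.+ d ≡ b → bends d (entries B) (u List.++ j ∷ []) w ≈ κ j * bends (suc d) (entries (τ (suc m) a)) u w
      bent j zero    u []      e = entry j u 0F [] (≡.trans (≡.sym (ℕ.+-identityʳ _)) e)
      bent j zero    u (i ∷ w) e = entry j u i w (≡.trans (≡.sym (ℕ.+-identityʳ _)) e)
      bent j (suc d) u []      e = trans (*-congˡ (bent j d (1F ∷ u) [] (≡.trans (≡.sym (ℕ.+-suc _ d)) e)))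
        (solve 3 (λ r x y → x :* (r :* y) := r :* (x :* y)) refl (κ j) _ _)
      bent j (suc d) u (i ∷ w) e = trans (*-congˡ (bent j d (opp i ∷ u) w (≡.trans (≡.sym (ℕ.+-suc _ d)) e)))
        (solve 3 (λ r x y → x :* (r :* y) := r :* (x :* y)) refl (κ j) _ _)

    -- An output letter 0 feeds in x₁, and κ 1F = -q cancels γ 0F = -q⁻¹. An output letter 1 feeds
    -- in x₀, for which κ is 0.
    X-p-suc-0 : ∀ w → X (suc b) B (0F ∷ w) ≈ X (suc b) (τ (suc m) a) w
    X-p-suc-0 w = begin
      - q⁻¹ * bends b (entries B) (1F ∷ []) w  ≈⟨ *-congˡ (bent 1F b [] w ≡.refl) ⟩
      - q⁻¹ * (- q * x)                        ≈⟨ solve 3 (λ q p x → (:- p) :* ((:- q) :* x) := q :* (p :* x)) refl q q⁻¹ x ⟩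
      q * (q⁻¹ * x)                            ≈⟨ cancel-q x ⟩
      x                                        ∎
      where x = X (suc b) (τ (suc m) a) w

    X-p-suc-1 : ∀ w → X (suc b) B (1F ∷ w) ≈ 0#
    X-p-suc-1 w = trans (*-congˡ (trans (bent 0F b [] w ≡.refl) (zeroˡ _))) (zeroʳ _)

  X-+ : ∀ b (B C : Endomorphism {n}) w → X b (B ⊕ C) w ≈ X b B w + X b C w
  X-+ b B C = bends-+ b (entries B) (entries C) []

  X-* : ∀ b r (B : Endomorphism {n}) w → X b (r • B) w ≈ r * X b B w
  X-* b r B = bends-* b r (entries B) []

-- Expansion of a vector in the spanning words

module Lifting {c ℓ} (R : CommutativeRing c ℓ) (q q⁻¹ : CommutativeRing.Carrier R)
  (q*q⁻¹≈1 : CommutativeRing._≈_ R (CommutativeRing._*_ R q q⁻¹) (CommutativeRing.1# R))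
  (q⁻¹*q≈1 : CommutativeRing._≈_ R (CommutativeRing._*_ R q⁻¹ q) (CommutativeRing.1# R))
  (s : Sign)
  where
  open CommutativeRing R hiding (zero)
  open FromℤR.Solver R using (solve; _:=_; _:+_; _:*_; _:-_; :-_; con)
  open import Algebra.Properties.Ring ring using (-0#≈0#)
  open TensorPower R
  open Action R q q⁻¹ q*q⁻¹≈1 q⁻¹*q≈1 s
  private module P = Presentation R
  open P using () renaming (_*_ to infixl 7 _⊛_; _+_ to infixl 6 _⊹_)

  -- Writes a vector in terms of the vectors X b of the spanning elements of TL_n. Those with
  -- last factor p_b vanish on words 1…, where X b restricts to X (b-1): the system is triangular.
  lift : ∀ n → ℕ → (List (Fin 2) → Carrier) → T n
  remainder : ∀ n → ℕ → (List (Fin 2) → Carrier) → List (Fin 2) → Carrier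
  lift zero    b       f = P.con (f [])
  lift (suc n) zero    f = sh n (lift n 0 (λ w → f (0F ∷ w))) ⊛ p (suc n) 0
  lift (suc n) (suc b) f with suc b ℕ.≤? n
  ... | yes _ = lift (suc n) b (λ w → f (1F ∷ w)) ⊹ sh n (lift n (suc b) (remainder n b f)) ⊛ p (suc n) (suc b)
  ... | no _  = lift (suc n) b (λ w → f (1F ∷ w))
  remainder n b f w = f (0F ∷ w) - X (suc b) (τ (suc n) (lift (suc n) b (λ w → f (1F ∷ w)))) (0F ∷ w)

  private
    module Reasoning (n : ℕ) where
      open import Relation.Binary.Reasoning.Setoid (A.setoid n) public
      open import Algebra.Properties.CommutativeSemigroup
        (CommutativeMonoid.commutativeSemigroup (A.+-commutativeMonoid n)) public using (interchange)

    lift-yes : ∀ n b f → suc b ℕ.≤ n → lift (suc n) (suc b) f ≡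
               lift (suc n) b (λ w → f (1F ∷ w)) ⊹ sh n (lift n (suc b) (remainder n b f)) ⊛ p (suc n) (suc b)
    lift-yes n b f b<n with suc b ℕ.≤? n
    ... | yes _  = ≡.refl
    ... | no b≮n = contradiction b<n b≮n

  lift-cong : ∀ n b {f g} → (∀ w → f w ≈ g w) → A._≈_ n (lift n b f) (lift n b g)
  remainder-cong : ∀ n b {f g} → (∀ w → f w ≈ g w) → ∀ w → remainder n b f w ≈ remainder n b g w
  lift-cong zero    b       e = P.con-cong (e [])
  lift-cong (suc n) zero    e = A.*-congʳ (suc n) (sh-cong n (lift-cong n 0 (λ w → e (0F ∷ w))))
  lift-cong (suc n) (suc b) e with suc b ℕ.≤? n
  ... | yes _ = A.+-cong (suc n) (lift-cong (suc n) b (λ w → e (1F ∷ w)))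
                  (A.*-congʳ (suc n) (sh-cong n (lift-cong n (suc b) (remainder-cong n b e))))
  ... | no _  = lift-cong (suc n) b (λ w → e (1F ∷ w))
  remainder-cong n b {f} {g} e w = +-cong (e _) (-‿cong (X-cong (suc b) {τ (suc n) (lift (suc n) b (λ w → f (1F ∷ w)))}
    {τ (suc n) (lift (suc n) b (λ w → g (1F ∷ w)))} (τ-cong (suc n) (lift-cong (suc n) b (λ w → e (1F ∷ w)))) (0F ∷ w)))

  lift-+ : ∀ n b f g → A._≈_ n (lift n b (λ w → f w + g w)) (lift n b f ⊹ lift n b g)
  lift-+ zero    b       f g = P.con-+ _ _
  lift-+ (suc n) zero    f g = A.trans (suc n) (A.*-congʳ (suc n) (sh-cong n (lift-+ n 0 _ _))) (A.distribʳ (suc n) _ _ _)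
  lift-+ (suc n) (suc b) f g with suc b ℕ.≤? n
  ... | no _  = lift-+ (suc n) b _ _
  ... | yes _ = begin
      lift (suc n) b (λ w → f (1F ∷ w) + g (1F ∷ w)) ⊹ sh n (lift n (suc b) (remainder n b (λ w → f w + g w))) ⊛ P
        ≈⟨ A.+-cong (suc n) top (A.*-congʳ (suc n) (sh-cong n (A.trans n (lift-cong n (suc b) rem) (lift-+ n (suc b) _ _)))) ⟩
      (F ⊹ G) ⊹ (sh n (lift n (suc b) (remainder n b f)) ⊹ sh n (lift n (suc b) (remainder n b g))) ⊛ P
        ≈⟨ A.+-congˡ (suc n) (A.distribʳ (suc n) _ _ _) ⟩
      (F ⊹ G) ⊹ (sh n (lift n (suc b) (remainder n b f)) ⊛ P ⊹ sh n (lift n (suc b) (remainder n b g)) ⊛ P)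
        ≈⟨ interchange F G _ _ ⟩
      _ ∎
    where
    open Reasoning (suc n)
    P = p (suc n) (suc b)
    F = lift (suc n) b (λ w → f (1F ∷ w))
    G = lift (suc n) b (λ w → g (1F ∷ w))
    top : A._≈_ (suc n) (lift (suc n) b (λ w → f (1F ∷ w) + g (1F ∷ w))) (F ⊹ G)
    top = lift-+ (suc n) b _ _
    rem : ∀ w → remainder n b (λ w → f w + g w) w ≈ remainder n b f w + remainder n b g w
    rem w = trans (+-congˡ (-‿cong (trans
        (X-cong (suc b) {τ (suc n) (lift (suc n) b (λ w → f (1F ∷ w) + g (1F ∷ w)))} {τ (suc n) (F ⊹ G)} (τ-cong (suc n) top) (0F ∷ w))
        (X-+ (suc b) (τ (suc n) F) (τ (suc n) G) (0F ∷ w)))))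
      (solve 4 (λ x y z t → (x :+ y) :- (z :+ t) := (x :- z) :+ (y :- t)) refl _ _ _ _)

  lift-* : ∀ n b r f → A._≈_ n (lift n b (λ w → r * f w)) (P.con r ⊛ lift n b f)
  lift-* zero    b       r f = P.con-* _ _
  lift-* (suc n) zero    r f = A.trans (suc n) (A.*-congʳ (suc n) (sh-cong n (lift-* n 0 r _))) (A.*-assoc (suc n) _ _ _)
  lift-* (suc n) (suc b) r f with suc b ℕ.≤? n
  ... | no _  = lift-* (suc n) b r _
  ... | yes _ = begin
      lift (suc n) b (λ w → r * f (1F ∷ w)) ⊹ sh n (lift n (suc b) (remainder n b (λ w → r * f w))) ⊛ P
        ≈⟨ A.+-cong (suc n) top (A.*-congʳ (suc n) (sh-cong n (A.trans n (lift-cong n (suc b) rem) (lift-* n (suc b) r _)))) ⟩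
      P.con r ⊛ F ⊹ (P.con r ⊛ sh n (lift n (suc b) (remainder n b f))) ⊛ P
        ≈⟨ A.+-congˡ (suc n) (A.*-assoc (suc n) _ _ _) ⟩
      P.con r ⊛ F ⊹ P.con r ⊛ (sh n (lift n (suc b) (remainder n b f)) ⊛ P)
        ≈⟨ A.distribˡ (suc n) _ _ _ ⟨
      _ ∎
    where
    open Reasoning (suc n)
    P = p (suc n) (suc b)
    F = lift (suc n) b (λ w → f (1F ∷ w))
    top : A._≈_ (suc n) (lift (suc n) b (λ w → r * f (1F ∷ w))) (P.con r ⊛ F)
    top = lift-* (suc n) b r _
    rem : ∀ w → remainder n b (λ w → r * f w) w ≈ r * remainder n b f w
    rem w = trans (+-congˡ (-‿cong (trans
        (X-cong (suc b) {τ (suc n) (lift (suc n) b (λ w → r * f (1F ∷ w)))} {τ (suc n) (P.con r ⊛ F)} (τ-cong (suc n) top) (0F ∷ w))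
        (X-* (suc b) r (τ (suc n) F) (0F ∷ w)))))
      (solve 3 (λ r x y → r :* x :- r :* y := r :* (x :- y)) refl r _ _)

  lift-0 : ∀ n b {f} → (∀ w → f w ≈ 0#) → A._≈_ n (lift n b f) (P.con 0#)
  lift-0 n b {f} e = A.trans n (lift-cong n b (λ w → trans (e w) (sym (zeroˡ (f w))))) (A.trans n (lift-* n b 0# f) (A.zeroˡ n _))

  private
    vanishing-remainder : ∀ n b y f → A._≈_ (suc n) (lift (suc n) b (λ w → f (1F ∷ w))) y →
                          (∀ w → remainder n b f w ≈ 0#) → A._≈_ (suc n) (lift (suc n) (suc b) f) y
    vanishing-remainder n b y f e e′ with suc b ℕ.≤? n
    ... | no _  = e
    ... | yes _ = A.trans (suc n) (A.+-cong (suc n) e (A.trans (suc n) (A.*-congʳ (suc n) (sh-cong n (lift-0 n (suc b) e′))) (A.zeroˡ (suc n) _)))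
                    (A.+-identityʳ (suc n) y)

  -- Sums and scalars are handled by linearity of `lift`. For a last factor p_k with k ≤ b, the
  -- restriction to 1... already gives the element and the remainder is 0; for k = b + 1 that
  -- restriction is 0 and the remainder is the vector of the left factor.
  lift-X : ∀ n b → b ℕ.≤ n → ∀ {y} → Span n b y → A._≈_ n (lift n b (X b (τ n y))) y
  lift-X n b b≤n (add {x = x} {y} s s′) = A.trans n (lift-cong n b (X-+ b (τ n x) (τ n y)))
    (A.trans n (lift-+ n b _ _) (A.+-cong n (lift-X n b b≤n s) (lift-X n b b≤n s′)))
  lift-X n b b≤n (scale {x = x} r s) = A.trans n (lift-cong n b (X-* b r (τ n x)))
    (A.trans n (lift-* n b r _) (A.*-congˡ n (lift-X n b b≤n s)))
  lift-X n b b≤n (resp {x = x} {y} e s) = A.trans n (lift-cong n b (X-cong b {τ n y} {τ n x} (τ-cong n (A.sym n e))))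
    (A.trans n (lift-X n b b≤n s) e)
  lift-X zero zero b≤n (base r) = P.con-cong (*-identityʳ r)
  lift-X (suc n) zero b≤n (step {x = x} z≤n _ s) =
    A.*-congʳ (suc n) (sh-cong n (A.trans n (lift-cong n 0 (X-p-zero-0 {n} x)) (lift-X n 0 z≤n s)))
  lift-X (suc n) (suc b) b≤n (step {k = k} {x} k≤b k≤n s) with ℕ.m≤n⇒m<n∨m≡n k≤b
  ... | inj₁ (s≤s k≤b) = vanishing-remainder n b y (X (suc b) (τ (suc n) y)) top (λ w →
      trans (+-congˡ (-‿cong (X-cong (suc b) {τ (suc n) (lift (suc n) b (λ w → X (suc b) (τ (suc n) y) (1F ∷ w)))} {τ (suc n) y} (τ-cong (suc n) top) (0F ∷ w))))
        (-‿inverseʳ _))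
    where
    y = sh n x ⊛ p (suc n) k
    top : A._≈_ (suc n) (lift (suc n) b (λ w → X (suc b) (τ (suc n) y) (1F ∷ w))) y
    top = A.trans (suc n) (lift-cong (suc n) b (X-1 b (τ (suc n) y))) (lift-X (suc n) b (ℕ.≤-trans (ℕ.n≤1+n b) b≤n) (step k≤b k≤n s))
  lift-X (suc (suc n)) (suc b) b≤n (step {x = x} k≤b (s≤s k≤n) s) | inj₂ ≡.refl =
      A.trans N (A.reflexive N (lift-yes (suc n) b _ (s≤s k≤n)))
      (A.trans N (A.+-cong N top (A.*-congʳ N (sh-cong (suc n) (A.trans (suc n) (lift-cong (suc n) (suc b) bottom)
        (lift-X (suc n) (suc b) (s≤s k≤n) s))))) (A.+-identityˡ N _))
    where
    N = 2 ℕ.+ n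
    y = sh (suc n) x ⊛ p N (suc b)
    f = X (suc b) (τ N y)
    top : A._≈_ N (lift N b (λ w → f (1F ∷ w))) (P.con 0#)
    top = lift-0 N b (X-p-suc-1 x k≤n)
    X-zero : ∀ w → X (suc b) (τ N (P.con 0#)) w ≈ 0#
    X-zero w = trans (X-cong (suc b) {τ N (P.con 0#)} {0# • 1ᵒ N} (λ f w → refl) w) (trans (X-* (suc b) 0# (1ᵒ N) w) (zeroˡ _))
    bottom : ∀ w → remainder (suc n) b f w ≈ X (suc b) (τ (suc n) x) w
    bottom w = trans (+-cong (X-p-suc-0 x k≤n w) (-‿cong (trans
        (X-cong (suc b) {τ N (lift N b (λ w → f (1F ∷ w)))} {τ N (P.con 0#)} (τ-cong N top) (0F ∷ w)) (X-zero (0F ∷ w)))))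
      (trans (+-congˡ -0#≈0#) (+-identityʳ _))

  lift-τ : ∀ n a → A._≈_ n (lift n n (X n (τ n a))) a
  lift-τ n a = lift-X n n ℕ.≤-refl (spans n a)

-- Equivariant maps and invariant vectors

module Invariants {c ℓ} (R : CommutativeRing c ℓ) (q q⁻¹ : CommutativeRing.Carrier R)
  (q*q⁻¹≈1 : CommutativeRing._≈_ R (CommutativeRing._*_ R q q⁻¹) (CommutativeRing.1# R))
  (q⁻¹*q≈1 : CommutativeRing._≈_ R (CommutativeRing._*_ R q⁻¹ q) (CommutativeRing.1# R))
  (s : Sign)
  where
  open CommutativeRing R hiding (zero)
  open FromℤR.Solver R using (solve; _:=_; _:+_; _:*_; _:-_; :-_; con)
  open TensorPower R
  open Coordinates R
  open Ladder R q q⁻¹ q*q⁻¹≈1 q⁻¹*q≈1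
  open WeightProjections R q q⁻¹ q*q⁻¹≈1 q⁻¹*q≈1 using (at)
  open DoubleCentralizer R q q⁻¹ q*q⁻¹≈1 q⁻¹*q≈1 using (at-reachable)
  open TemperleyLiebOperators R q q⁻¹ q*q⁻¹≈1 using (𝐞)
  open Action R q q⁻¹ q*q⁻¹≈1 q⁻¹*q≈1 s
  open Lifting R q q⁻¹ q*q⁻¹≈1 q⁻¹*q≈1 s
  open import Algebra.Properties.Semiring.Exp semiring using (_^_)
  open import Relation.Binary.Reasoning.Setoid setoid
  private module P = Presentation R
  open P using () renaming (_*_ to infixl 7 _⊛_; _+_ to infixl 6 _⊹_)

  -- Stated with `Reach` in place of U, so that nothing here depends on 𝔤; `reach-image` connects
  -- the two.
  Equivariant : Endomorphism {n} → Set (c ⊔ ℓ)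
  Equivariant {n} B = ∀ {C : Endomorphism {n}} → Reach C → B ∘ C ≋ C ∘ B

  private
    unit-cancel : ∀ {x y} → IsUnit x → x * y ≈ 0# → y ≈ 0#
    unit-cancel {x} {y} (z , e) e′ = begin
      y            ≈⟨ *-identityˡ y ⟨
      1# * y       ≈⟨ *-congʳ e ⟨
      (x * z) * y  ≈⟨ solve 3 (λ x y z → (x :* z) :* y := z :* (x :* y)) refl x y z ⟩
      z * (x * y)  ≈⟨ *-congˡ e′ ⟩
      z * 0#       ≈⟨ zeroʳ z ⟩
      0#           ∎

  𝐞-equivariant : ∀ n i → Equivariant (𝐞 s n i)
  𝐞-equivariant n i {C} C-reach f w = begin
    ⟦ 𝐞 s n i ⟧ (⟦ C ⟧ f) w                    ≈⟨ recover (⟦ C ⟧ f) w ⟩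
    ε * ⟦ 𝐞 Sign.- n i ⟧ (⟦ C ⟧ f) w           ≈⟨ *-congˡ (reach-commutes C-reach i f w) ⟨
    ε * ⟦ C ⟧ (⟦ 𝐞 Sign.- n i ⟧ f) w           ≈⟨ *ₗ-homo C ε (⟦ 𝐞 Sign.- n i ⟧ f) w ⟨
    ⟦ C ⟧ (λ w → ε * ⟦ 𝐞 Sign.- n i ⟧ f w) w   ≈⟨ ⟦⟧-cong C (recover f) w ⟨
    ⟦ C ⟧ (⟦ 𝐞 s n i ⟧ f) w                    ∎
    where
    recover : ∀ f w → ⟦ 𝐞 s n i ⟧ f w ≈ ε * ⟦ 𝐞 Sign.- n i ⟧ f w
    recover f w = begin
      ⟦ 𝐞 s n i ⟧ f w              ≈⟨ *-identityˡ _ ⟨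
      1# * ⟦ 𝐞 s n i ⟧ f w         ≈⟨ *-congʳ ε*ε≈1 ⟨
      (ε * ε) * ⟦ 𝐞 s n i ⟧ f w    ≈⟨ *-assoc _ _ _ ⟩
      ε * (ε * ⟦ 𝐞 s n i ⟧ f w)    ≈⟨ *-congˡ (𝐞-sign n i f w) ⟩
      ε * ⟦ 𝐞 Sign.- n i ⟧ f w     ∎

  τ-equivariant : ∀ n a → Equivariant (τ n a)
  τ-equivariant n (P.gen i) {C} C-reach = 𝐞-equivariant n i {C} C-reach
  τ-equivariant n (P.con r) {C} C-reach = End.ι-central n r C
  τ-equivariant n (a ⊹ b) {C} C-reach f w = trans (+-cong (τ-equivariant n a {C} C-reach f w) (τ-equivariant n b {C} C-reach f w))
    (sym (+ᴹ-homo C (⟦ τ n a ⟧ f) (⟦ τ n b ⟧ f) w))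
  τ-equivariant n (a ⊛ b) {C} C-reach f w = trans (⟦⟧-cong (τ n a) (τ-equivariant n b {C} C-reach f) w)
    (τ-equivariant n a {C} C-reach (⟦ τ n b ⟧ f) w)

  on : ∀ n → (List (Fin 2) → Carrier) → Vector n
  on n f w = f (toList w)

  -- f ↦ (w ↦ Σᵤ f u · h u w) is the linear map V^{⊗a} → V^{⊗m} with entries h.
  Intertwines : ℕ → ℕ → Entries → Set (c ⊔ ℓ)
  Intertwines a m h = ∀ j (f : Vector a) w →
    ⟦ 𝐄⁽ j ⁾ m ⟧ (λ w → dot a f (λ u → h (toList u) (toList w))) w ≈ dot a (⟦ 𝐄⁽ j ⁾ a ⟧ f) (λ u → h (toList u) (toList w))

  entries-intertwine : (B : Endomorphism {n}) → Equivariant B → Intertwines n n (entries B)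
  entries-intertwine {n} B B-eq j f w = begin
    _ ≈⟨ ⟦⟧-cong (𝐄⁽ j ⁾ n) (λ w → to f w) w ⟩
    _ ≈⟨ B-eq {𝐄⁽ j ⁾ n} (raise j) f w ⟨
    _ ≈⟨ to (⟦ 𝐄⁽ j ⁾ n ⟧ f) w ⟨
    _ ∎
    where
    to : ∀ f w → dot n f (λ u → entries B (toList u) (toList w)) ≈ ⟦ B ⟧ f w
    to f w = trans (dot-cong n {f} (λ _ → refl) (λ u → reflexive (≡.cong₂ (λ u w → ⟦ B ⟧ (basis u) w) (toVec-toList u) (toVec-toList w))))
      (sym (expand B f w))

  private
    dot-◁-0 : ∀ n (f : Vector n) (g : Vector (suc n)) → dot (suc n) (0F ◁ f) g ≈ dot n f (g ↾ 0F)
    dot-◁-0 n f g = trans (+-congˡ (dot-0ˡ n (g ↾ 1F))) (+-identityʳ _)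

    dot-◁-1 : ∀ n (f : Vector n) (g : Vector (suc n)) → dot (suc n) (1F ◁ f) g ≈ dot n f (g ↾ 1F)
    dot-◁-1 n f g = trans (+-congʳ (dot-0ˡ n (g ↾ 0F))) (+-identityˡ _)

    E-0◁ : ∀ j (f : Vector n) (g : Vector (suc n)) → dot (suc n) (⟦ 𝐄⁽ j ⁾ (suc n) ⟧ (0F ◁ f)) g ≈ q ^ j * dot n (⟦ 𝐄⁽ j ⁾ n ⟧ f) (g ↾ 0F)
    E-0◁ {n} j f g = begin
      _ ≈⟨ +-cong
             (dot-cong n (λ w → trans (E-0 j (0F ◁ f) w) (trans (+-congˡ (⟦⟧-0 (E↓ j n) w)) (+-identityʳ _))) (λ _ → refl))
             (trans (dot-cong n {g = g ↾ 1F} (λ w → trans (E-1 j (0F ◁ f) w) (trans (*-congˡ (⟦⟧-0 (𝐄⁽ j ⁾ n) w)) (zeroʳ _))) (λ _ → refl)) (dot-0ˡ n (g ↾ 1F))) ⟩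
      _ ≈⟨ +-identityʳ _ ⟩
      _ ≈⟨ dot-*ˡ n (q ^ j) (⟦ 𝐄⁽ j ⁾ n ⟧ f) (g ↾ 0F) ⟩
      _ ∎

    E-1◁ : ∀ j (f : Vector n) (g : Vector (suc n)) → dot (suc n) (⟦ 𝐄⁽ j ⁾ (suc n) ⟧ (1F ◁ f)) g ≈
           dot n (⟦ E↓ j n ⟧ f) (g ↾ 0F) + q⁻¹ ^ j * dot n (⟦ 𝐄⁽ j ⁾ n ⟧ f) (g ↾ 1F)
    E-1◁ {n} j f g = +-cong
      (dot-cong n (λ w → trans (E-0 j (1F ◁ f) w) (trans (+-congʳ (trans (*-congˡ (⟦⟧-0 (𝐄⁽ j ⁾ n) w)) (zeroʳ _))) (+-identityˡ _))) (λ _ → refl))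
      (trans (dot-cong n {g = g ↾ 1F} (λ w → E-1 j (1F ◁ f) w) (λ _ → refl)) (dot-*ˡ n (q⁻¹ ^ j) (⟦ 𝐄⁽ j ⁾ n ⟧ f) (g ↾ 1F)))

  -- Invariance of the cup. The intertwining property of h is tested on x₁ ⊗ f and x₀ ⊗ f, which
  -- give the parts of the bent map with output 0 and 1.
  bend-intertwines : ∀ a m h → Intertwines (suc a) m h → Intertwines a (suc m) (bend h)
  bend-intertwines a m h e j f = result
    where
    F : Vector (suc m)
    F w = dot a f (λ u → bend h (toList u) (toList w))
    H : Vec (Fin 2) m → Vector (suc a)
    H w u = h (toList u) (toList w)
    G₀ G₁ : Vector m
    G₀ w = dot (suc a) (1F ◁ f) (H w)
    G₁ w = dot (suc a) (0F ◁ f) (H w)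

    F-0 : ∀ w → F (0F ∷ w) ≈ - q⁻¹ * G₀ w
    F-0 w = trans (dot-*ʳ a (- q⁻¹) f (H w ↾ 1F)) (*-congˡ (sym (dot-◁-1 a f (H w))))
    F-1 : ∀ w → F (1F ∷ w) ≈ G₁ w
    F-1 w = trans (dot-*ʳ a 1# f (H w ↾ 0F)) (trans (*-identityˡ _) (sym (dot-◁-0 a f (H w))))

    E-G₀ : ∀ w → ⟦ 𝐄⁽ j ⁾ m ⟧ G₀ w ≈ dot a (⟦ E↓ j a ⟧ f) (H w ↾ 0F) + q⁻¹ ^ j * dot a (⟦ 𝐄⁽ j ⁾ a ⟧ f) (H w ↾ 1F)
    E-G₀ w = trans (e j (1F ◁ f) w) (E-1◁ j f (H w))
    E-G₁ : ∀ j w → ⟦ 𝐄⁽ j ⁾ m ⟧ G₁ w ≈ q ^ j * dot a (⟦ 𝐄⁽ j ⁾ a ⟧ f) (H w ↾ 0F)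
    E-G₁ j w = trans (e j (0F ◁ f) w) (E-0◁ j f (H w))

    -- E acting on the bent input letter and E acting on the new output letter contribute opposite
    -- terms.
    cancel : ∀ j w → q ^ j * (- q⁻¹ * dot a (⟦ E↓ j a ⟧ f) (H w ↾ 0F)) + ⟦ E↓ j m ⟧ G₁ w ≈ 0#
    cancel zero w = trans (+-congʳ (trans (*-congˡ (trans (*-congˡ (dot-0ˡ a (H w ↾ 0F))) (zeroʳ _))) (zeroʳ _))) (+-identityˡ 0#)
    cancel (suc j) w = begin
      (q * Q) * (- q⁻¹ * x) + ⟦ 𝐄⁽ j ⁾ m ⟧ G₁ w  ≈⟨ +-congˡ (E-G₁ j w) ⟩
      (q * Q) * (- q⁻¹ * x) + Q * x              ≈⟨ solve 4 (λ q p Q x → (q :* Q) :* ((:- p) :* x) :+ Q :* x := Q :* x :- q :* (p :* (Q :* x))) refl q q⁻¹ Q x ⟩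
      Q * x - q * (q⁻¹ * (Q * x))                ≈⟨ +-congˡ (-‿cong (cancel-q _)) ⟩
      Q * x - Q * x                              ≈⟨ -‿inverseʳ _ ⟩
      0#                                         ∎
      where
      Q = q ^ j
      x = dot a (⟦ 𝐄⁽ j ⁾ a ⟧ f) (H w ↾ 0F)

    result : ∀ w → ⟦ 𝐄⁽ j ⁾ (suc m) ⟧ F w ≈ dot a (⟦ 𝐄⁽ j ⁾ a ⟧ f) (λ u → bend h (toList u) (toList w))
    result (1F ∷ w) = begin
      _ ≈⟨ E-1 j F w ⟩
      _ ≈⟨ *-congˡ (trans (⟦⟧-cong (𝐄⁽ j ⁾ m) F-1 w) (E-G₁ j w)) ⟩
      q⁻¹ ^ j * (q ^ j * x)   ≈⟨ *-assoc _ _ _ ⟨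
      (q⁻¹ ^ j * q ^ j) * x   ≈⟨ *-congʳ (trans (*-comm _ _) (q^*q⁻¹^ j)) ⟩
      1# * x                  ≈⟨ dot-*ʳ a 1# (⟦ 𝐄⁽ j ⁾ a ⟧ f) (H w ↾ 0F) ⟨
      _ ∎
      where x = dot a (⟦ 𝐄⁽ j ⁾ a ⟧ f) (H w ↾ 0F)
    result (0F ∷ w) = begin
      _ ≈⟨ E-0 j F w ⟩
      _ ≈⟨ +-cong (*-congˡ (trans (⟦⟧-cong (𝐄⁽ j ⁾ m) F-0 w) (trans (*ₗ-homo (𝐄⁽ j ⁾ m) (- q⁻¹) G₀ w) (*-congˡ (E-G₀ w)))))
                  (⟦⟧-cong (E↓ j m) F-1 w) ⟩
      q ^ j * (- q⁻¹ * (x + q⁻¹ ^ j * y)) + z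
        ≈⟨ solve 6 (λ Q P p x y z → Q :* ((:- p) :* (x :+ P :* y)) :+ z := (Q :* ((:- p) :* x) :+ z) :+ (Q :* P) :* ((:- p) :* y)) refl (q ^ j) (q⁻¹ ^ j) q⁻¹ x y z ⟩
      (q ^ j * (- q⁻¹ * x) + z) + (q ^ j * q⁻¹ ^ j) * (- q⁻¹ * y)
        ≈⟨ +-cong (cancel j w) (trans (*-congʳ (q^*q⁻¹^ j)) (*-identityˡ _)) ⟩
      0# + - q⁻¹ * y
        ≈⟨ +-identityˡ _ ⟩
      - q⁻¹ * y
        ≈⟨ dot-*ʳ a (- q⁻¹) (⟦ 𝐄⁽ j ⁾ a ⟧ f) (H w ↾ 1F) ⟨
      _ ∎
      where
      x = dot a (⟦ E↓ j a ⟧ f) (H w ↾ 0F)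
      y = dot a (⟦ 𝐄⁽ j ⁾ a ⟧ f) (H w ↾ 1F)
      z = ⟦ E↓ j m ⟧ G₁ w

  bends-intertwine : ∀ b a m h → Intertwines (b ℕ.+ a) m h → Intertwines a (b ℕ.+ m) (bends b h)
  bends-intertwine zero    a m h e = e
  bends-intertwine (suc b) a m h e = bend-intertwines a (b ℕ.+ m) (bends b h)
    (bends-intertwine b (suc a) m h (≡.subst (λ k → Intertwines k m h) (≡.sym (ℕ.+-suc b a)) e))

  -- Preservation of weight, written without subtraction: bending moves a letter to the other side
  -- and inverts it, which shifts both sums equally.
  Balanced : ℕ → ℕ → Entries → Set ℓ
  Balanced a m h = ∀ (u : Vec (Fin 2) a) (w : Vec (Fin 2) m) → zeros u ℕ.+ ones w ≢ ones u ℕ.+ zeros w → h (toList u) (toList w) ≈ 0#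

  bends-balanced : ∀ b a m h → Balanced (b ℕ.+ a) m h → Balanced a (b ℕ.+ m) (bends b h)
  bends-balanced zero    a m h e = e
  bends-balanced (suc b) a m h e = at′
    where
    rec : Balanced (suc a) (b ℕ.+ m) (bends b h)
    rec = bends-balanced b (suc a) m h (≡.subst (λ k → Balanced k m h) (≡.sym (ℕ.+-suc b a)) e)
    at′ : Balanced a (suc (b ℕ.+ m)) (bends (suc b) h)
    at′ u (0F ∷ w) p = trans (*-congˡ (rec (1F ∷ u) w (λ e → p (≡.trans e (≡.sym (ℕ.+-suc _ _)))))) (zeroʳ _)
    at′ u (1F ∷ w) p = trans (*-congˡ (rec (0F ∷ u) w (λ e → p (≡.trans (ℕ.+-suc _ _) e)))) (zeroʳ _)

  -- Equivariance is applied to the weight projections themselves, since K alone may fail to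
  -- separate the weights.
  entries-balanced : (B : Endomorphism {n}) → Equivariant B → Balanced n n (entries B)
  entries-balanced {n} B B-eq u w p = begin
    _ ≡⟨ ≡.cong₂ (λ u w → ⟦ B ⟧ (basis u) w) (toVec-toList u) (toVec-toList w) ⟩
    ⟦ B ⟧ (basis u) w                       ≈⟨ ⟦⟧-cong B (at-fixes (zeros u) (basis-homogeneous u)) w ⟨
    ⟦ B ⟧ (⟦ at (zeros u) ⟧ (basis u)) w    ≈⟨ B-eq {at (zeros u)} (at-reachable n (zeros u) (zeros≤n u)) (basis u) w ⟩
    ⟦ at (zeros u) ⟧ (⟦ B ⟧ (basis u)) w    ≈⟨ at-homogeneous (zeros u) (⟦ B ⟧ (basis u)) w (λ e → p (cross e)) ⟩
    0#                                      ∎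
    where
    open WeightProjections R q q⁻¹ q*q⁻¹≈1 q⁻¹*q≈1 using (at-fixes; at-homogeneous)
    basis-homogeneous : ∀ {n} (u : Vec (Fin 2) n) w → zeros w ≢ zeros u → basis u w ≈ 0#
    basis-homogeneous []       []       p = contradiction ≡.refl p
    basis-homogeneous (0F ∷ u) (0F ∷ w) p = basis-homogeneous u w (λ e → p (≡.cong suc e))
    basis-homogeneous (0F ∷ u) (1F ∷ w) p = refl
    basis-homogeneous (1F ∷ u) (0F ∷ w) p = refl
    basis-homogeneous (1F ∷ u) (1F ∷ w) p = basis-homogeneous u w p
    cross : zeros w ≡ zeros u → zeros u ℕ.+ ones w ≡ ones u ℕ.+ zeros w
    cross e = ≡.trans (≡.cong₂ ℕ._+_ (≡.sym e) (≡.trans (ones≡n∸zeros w) (≡.trans (≡.cong (n ∸_) e) (≡.sym (ones≡n∸zeros u)))))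
      (ℕ.+-comm (zeros w) (ones u))

  -- The restrictions to the words with prefix 1^k of invariant vectors.
  record Invariant (k m : ℕ) (f : List (Fin 2) → Carrier) : Set ℓ where
    field
      weight  : ∀ (w : Vec (Fin 2) m) → zeros w ≢ k ℕ.+ ones w → f (toList w) ≈ 0#
      E-kills : ∀ j w → ⟦ 𝐄⁽ suc j ⁾ m ⟧ (on m f) w ≈ 0#
  open Invariant

  -- The coordinates of E⁽ʲ⁾ f at 1... involve only the restriction to 1..., with the unit factor
  -- q⁻ʲ.
  restrict-1 : ∀ {k m f} → Invariant k (suc m) f → Invariant (suc k) m (λ w → f (1F ∷ w))
  restrict-1 {k} {m} {f} f-inv = record
    { weight  = λ w p → weight f-inv (1F ∷ w) (λ e → p (≡.trans e (ℕ.+-suc k (ones w))))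
    ; E-kills = λ j w → unit-cancel (unit-q⁻¹^ (suc j)) (trans (sym (E-1 (suc j) (on (suc m) f) w)) (E-kills f-inv j (1F ∷ w))) }

  private
    E-bottom : ∀ {m} (f : Vector (suc m)) j w → ⟦ E↓ j m ⟧ (f ↾ 1F) w ≈ 0# → ⟦ 𝐄⁽ j ⁾ (suc m) ⟧ f (0F ∷ w) ≈ 0# →
               ⟦ 𝐄⁽ j ⁾ m ⟧ (f ↾ 0F) w ≈ 0#
    E-bottom f j w e e′ = unit-cancel (unit-q^ j) (trans (sym (trans (+-congˡ e) (+-identityʳ _))) (trans (sym (E-0 j f w)) e′))

  restrict-0 : ∀ {k m f} → Invariant (suc k) (suc m) f → (∀ (w : Vec (Fin 2) m) → f (1F ∷ toList w) ≈ 0#) →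
               Invariant k m (λ w → f (0F ∷ w))
  restrict-0 {k} {m} {f} f-inv e = record
    { weight  = λ w p → weight f-inv (0F ∷ w) (λ e → p (ℕ.suc-injective e))
    ; E-kills = λ j w → E-bottom (on (suc m) f) (suc j) w (⟦⟧-zero (𝐄⁽ j ⁾ m) e w) (E-kills f-inv j (0F ∷ w)) }

  -- E⁽ʲ⁾ is injective on the space of weight -j.
  negative-weight-vanish : ∀ m d (f : Vector m) → (∀ w → ones w ≢ suc d ℕ.+ zeros w → f w ≈ 0#) →
                           (∀ j → suc d ℕ.≤ j → ∀ w → ⟦ 𝐄⁽ j ⁾ m ⟧ f w ≈ 0#) → ∀ w → f w ≈ 0#
  negative-weight-vanish zero    d f f-weight f-E [] = f-weight [] (λ ())
  negative-weight-vanish (suc m) d f f-weight f-E = result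
    where
    E-f₁ : ∀ j → suc d ℕ.≤ j → ∀ w → ⟦ 𝐄⁽ j ⁾ m ⟧ (f ↾ 1F) w ≈ 0#
    E-f₁ j d<j w = unit-cancel (unit-q⁻¹^ j) (trans (sym (E-1 j f w)) (f-E j d<j (1F ∷ w)))
    -- Splitting off a 0 makes the weight more negative, so the recursion is on the length with d +
    -- 1.
    f₀≈0 : ∀ w → f (0F ∷ w) ≈ 0#
    f₀≈0 = negative-weight-vanish m (suc d) (f ↾ 0F)
      (λ w p → f-weight (0F ∷ w) (λ e → p (≡.trans e (≡.cong suc (ℕ.+-suc d (zeros w))))))
      (λ { (suc j) (s≤s d<j) w → E-bottom f (suc j) w (E-f₁ j d<j w) (f-E (suc j) (ℕ.m≤n⇒m≤1+n d<j) (0F ∷ w)) })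
    -- With the part at 0... gone, E⁽ʲ⁺¹⁾ f at 0... is E⁽ʲ⁾ of the part at 1...: the bound on j
    -- drops by one, as the weight of that part requires. For d = 0 this includes E⁽⁰⁾ = 1.
    E-f₁′ : ∀ j → d ℕ.≤ j → ∀ w → ⟦ 𝐄⁽ j ⁾ m ⟧ (f ↾ 1F) w ≈ 0#
    E-f₁′ j d≤j w = begin
      ⟦ 𝐄⁽ j ⁾ m ⟧ (f ↾ 1F) w                                              ≈⟨ +-identityˡ _ ⟨
      0# + ⟦ 𝐄⁽ j ⁾ m ⟧ (f ↾ 1F) w
        ≈⟨ +-congʳ (trans (*-congˡ (⟦⟧-zero (𝐄⁽ suc j ⁾ m) f₀≈0 w)) (zeroʳ _)) ⟨
      q ^ suc j * ⟦ 𝐄⁽ suc j ⁾ m ⟧ (f ↾ 0F) w + ⟦ 𝐄⁽ j ⁾ m ⟧ (f ↾ 1F) w    ≈⟨ E-0 (suc j) f w ⟨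
      ⟦ 𝐄⁽ suc j ⁾ (suc m) ⟧ f (0F ∷ w)                                    ≈⟨ f-E (suc j) (s≤s d≤j) (0F ∷ w) ⟩
      0#                                                                   ∎
    f₁≈0 : ∀ d → (∀ w → ones w ≢ d ℕ.+ zeros w → f (1F ∷ w) ≈ 0#) → (∀ j → d ℕ.≤ j → ∀ w → ⟦ 𝐄⁽ j ⁾ m ⟧ (f ↾ 1F) w ≈ 0#) → ∀ w → f (1F ∷ w) ≈ 0#
    f₁≈0 zero    _ e = e 0 z≤n
    f₁≈0 (suc d) p e = negative-weight-vanish m d (f ↾ 1F) p e
    result : ∀ w → f w ≈ 0#
    result (0F ∷ w) = f₀≈0 w
    result (1F ∷ w) = f₁≈0 d (λ w p → f-weight (1F ∷ w) (λ e → p (ℕ.suc-injective e))) E-f₁′ w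

  -- The end of the recursion: the restriction to 0... has weight -1, and a vector of negative
  -- weight killed by all E⁽ʲ⁾ with j ≥ 1 is zero.
  restrict-0-vanish : ∀ {m f} → Invariant 0 (suc m) f → (∀ (w : Vec (Fin 2) m) → f (1F ∷ toList w) ≈ 0#) →
                      ∀ (w : Vec (Fin 2) m) → f (0F ∷ toList w) ≈ 0#
  restrict-0-vanish {m} {f} f-inv e = negative-weight-vanish m 0 (on (suc m) f ↾ 0F)
    (λ w p → weight f-inv (0F ∷ w) (λ e → p (≡.sym e)))
    (λ { (suc j) _ w → E-bottom (on (suc m) f) (suc j) w (⟦⟧-zero (𝐄⁽ j ⁾ m) e w) (E-kills f-inv j (0F ∷ w)) })

  invariant-resp : ∀ {k m f g} → (∀ w → f w ≈ g w) → Invariant k m f → Invariant k m g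
  invariant-resp {m = m} e f-inv = record
    { weight  = λ w p → trans (sym (e _)) (weight f-inv w p)
    ; E-kills = λ j w → trans (⟦⟧-cong (𝐄⁽ suc j ⁾ m) (λ w → sym (e _)) w) (E-kills f-inv j w) }

  invariant-minus : ∀ {k m f g} → Invariant k m f → Invariant k m g → Invariant k m (λ w → f w - g w)
  invariant-minus {m = m} f-inv g-inv = record
    { weight  = λ w p → trans (+-cong (weight f-inv w p) (-‿cong (weight g-inv w p))) (-‿inverseʳ 0#)
    ; E-kills = λ j w → trans (⟦⟧-minus (𝐄⁽ suc j ⁾ m) _ _ w) (trans (+-cong (E-kills f-inv j w) (-‿cong (E-kills g-inv j w))) (-‿inverseʳ 0#)) }

  -- Only the fully bent vector, k = 0, is treated directly. By `X-1`, bending fewer inputs amounts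
  -- to restricting it to words that start with 1^k.
  X-invariant : ∀ k b {n} → k ℕ.+ b ≡ n → (B : Endomorphism {n}) → Equivariant B → Invariant k (b ℕ.+ n) (X b B)
  X-invariant zero n ≡.refl B B-eq = record
    { weight  = λ w p → bends-balanced n 0 n (entries B) (≡.subst (λ k → Balanced k n (entries B)) (≡.sym (ℕ.+-identityʳ n)) (entries-balanced B B-eq))
        [] w (λ e → p (≡.sym e))
    ; E-kills = λ j w → trans
        (⟦⟧-cong (𝐄⁽ suc j ⁾ (n ℕ.+ n)) (λ w → sym (*-identityˡ _)) w)
        (trans (bends-intertwine n 0 n (entries B) (≡.subst (λ k → Intertwines k n (entries B)) (≡.sym (ℕ.+-identityʳ n)) (entries-intertwine B B-eq))
          (suc j) (λ _ → 1#) w) (zeroˡ _)) }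
  X-invariant (suc k) b {n} e B B-eq = invariant-resp (X-1 b B)
    (restrict-1 (X-invariant k (suc b) (≡.trans (ℕ.+-suc k b) e) B B-eq))

  private
    X-Lifts : ℕ → ℕ → Set (c ⊔ ℓ)
    X-Lifts n b = ∀ k → k ℕ.+ b ≡ n → ∀ f → Invariant k (b ℕ.+ n) f →
      ∀ (w : Vec (Fin 2) (b ℕ.+ n)) → X b (τ n (lift n b f)) (toList w) ≈ f (toList w)

    X-lift-suc : ∀ n b → X-Lifts (suc n) b → X-Lifts n (suc b) → X-Lifts (suc n) (suc b)
    X-lift-suc n b top-lifts bottom-lifts k e f f-inv with suc b ℕ.≤? n
    ... | no b≮n = result
      where
      a = lift (suc n) b (λ w → f (1F ∷ w))
      -- `lift` adds no cup here: b has reached n, so k = 0 and the difference g is zero by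
      -- `restrict-0-vanish`.
      k≡0 : k ≡ 0
      k≡0 = ℕ.n≤0⇒n≡0 (ℕ.+-cancelʳ-≤ (suc b) k 0 (≡.subst (ℕ._≤ suc b) (≡.sym e) (ℕ.≰⇒> b≮n)))
      top : ∀ (w : Vec (Fin 2) (b ℕ.+ suc n)) → X b (τ (suc n) a) (toList w) ≈ f (1F ∷ toList w)
      top = top-lifts (suc k) (≡.trans (≡.sym (ℕ.+-suc k b)) e) (λ w → f (1F ∷ w)) (restrict-1 f-inv)
      g : List (Fin 2) → Carrier
      g w = f w - X (suc b) (τ (suc n) a) w
      g-inv : Invariant 0 (suc b ℕ.+ suc n) g
      g-inv = ≡.subst (λ k → Invariant k (suc b ℕ.+ suc n) g) k≡0
        (invariant-minus f-inv (X-invariant k (suc b) e (τ (suc n) a) (λ {C} → τ-equivariant (suc n) a {C})))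
      g₁≈0 : ∀ (w : Vec (Fin 2) (b ℕ.+ suc n)) → g (1F ∷ toList w) ≈ 0#
      g₁≈0 w = trans (+-congˡ (-‿cong (trans (X-1 b (τ (suc n) a) (toList w)) (top w)))) (-‿inverseʳ _)
      from-g : ∀ w → g w ≈ 0# → X (suc b) (τ (suc n) a) w ≈ f w
      from-g w e = sym (trans (solve 2 (λ x y → x := (x :- y) :+ y) refl (f w) (X (suc b) (τ (suc n) a) w)) (trans (+-congʳ e) (+-identityˡ _)))
      result : ∀ (w : Vec (Fin 2) (suc b ℕ.+ suc n)) → X (suc b) (τ (suc n) a) (toList w) ≈ f (toList w)
      result (0F ∷ w) = from-g (0F ∷ toList w) (restrict-0-vanish g-inv g₁≈0 w)
      result (1F ∷ w) = from-g (1F ∷ toList w) (g₁≈0 w)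
    X-lift-suc zero    b _ _ k e f f-inv | yes ()
    X-lift-suc (suc n) b _ _ zero e f f-inv | yes b<n = contradiction (ℕ.suc-injective e) (ℕ.<⇒≢ b<n)
    X-lift-suc (suc n) b top-lifts bottom-lifts (suc k) e f f-inv | yes (s≤s b≤n) = result
      where
      N = 2 ℕ.+ n
      a = lift N b (λ w → f (1F ∷ w))
      top : ∀ (w : Vec (Fin 2) (b ℕ.+ N)) → X b (τ N a) (toList w) ≈ f (1F ∷ toList w)
      top = top-lifts (2 ℕ.+ k) (≡.trans (≡.sym (ℕ.+-suc (suc k) b)) e) (λ w → f (1F ∷ w)) (restrict-1 f-inv)
      g : List (Fin 2) → Carrier
      g w = f w - X (suc b) (τ N a) w
      g-inv : Invariant (suc k) (suc b ℕ.+ N) g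
      g-inv = invariant-minus f-inv (X-invariant (suc k) (suc b) e (τ N a) (λ {C} → τ-equivariant N a {C}))
      g₁≈0 : ∀ (w : Vec (Fin 2) (b ℕ.+ N)) → g (1F ∷ toList w) ≈ 0#
      g₁≈0 w = trans (+-congˡ (-‿cong (trans (X-1 b (τ N a) (toList w)) (top w)))) (-‿inverseʳ _)
      a′ = lift (suc n) (suc b) (remainder (suc n) b f)
      bottom : ∀ (w : Vec (Fin 2) (b ℕ.+ N)) → X (suc b) (τ (suc n) a′) (toList w) ≈ g (0F ∷ toList w)
      bottom = ≡.subst (λ m → ∀ (w : Vec (Fin 2) m) → X (suc b) (τ (suc n) a′) (toList w) ≈ g (0F ∷ toList w)) (≡.sym (ℕ.+-suc b (suc n)))
        (bottom-lifts k (ℕ.suc-injective e) (λ w → g (0F ∷ w))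
          (≡.subst (λ m → Invariant k m (λ w → g (0F ∷ w))) (ℕ.+-suc b (suc n)) (restrict-0 g-inv g₁≈0)))
      B = sh (suc n) a′ ⊛ p N (suc b)
      from-g : ∀ w {x} → x ≈ g w → X (suc b) (τ N a) w + x ≈ f w
      from-g w e = trans (+-congˡ e) (solve 2 (λ x y → y :+ (x :- y) := x) refl (f w) (X (suc b) (τ N a) w))
      result : ∀ (w : Vec (Fin 2) (suc b ℕ.+ N)) → X (suc b) (τ N (a ⊹ B)) (toList w) ≈ f (toList w)
      result (0F ∷ w) = trans (X-+ (suc b) (τ N a) (τ N B) (0F ∷ toList w))
        (from-g (0F ∷ toList w) (trans (X-p-suc-0 {n} a′ b≤n (toList w)) (bottom w)))
      result (1F ∷ w) = trans (X-+ (suc b) (τ N a) (τ N B) (1F ∷ toList w))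
        (from-g (1F ∷ toList w) (trans (X-p-suc-1 {n} a′ b≤n (toList w)) (sym (g₁≈0 w))))

  X-lift : ∀ n b → X-Lifts n b
  X-lift zero    zero    k e f f-inv [] = *-identityʳ _
  X-lift zero    (suc b) k e f f-inv w with () ← ≡.trans (≡.sym (ℕ.+-suc k b)) e
  X-lift (suc n) zero    k e f f-inv = at′ (≡.trans (≡.sym (ℕ.+-identityʳ k)) e) f-inv
    where
    at′ : ∀ {k} → k ≡ suc n → Invariant k (suc n) f → ∀ w → X 0 (τ (suc n) (lift (suc n) 0 f)) (toList w) ≈ f (toList w)
    at′ ≡.refl f-inv = result
      where
      f₁≈0 : ∀ (w : Vec (Fin 2) n) → f (1F ∷ toList w) ≈ 0#
      -- For b = 0 the weight asks for n + 1 more zeros than ones in a word of length n + 1, so only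
      -- the word of zeros survives.
      f₁≈0 w = weight f-inv (1F ∷ w) (ℕ.<⇒≢ (ℕ.≤-trans (s≤s (zeros≤n w)) (ℕ.m≤m+n (suc n) (suc (ones w)))))
      result : ∀ w → X 0 (τ (suc n) (lift (suc n) 0 f)) (toList w) ≈ f (toList w)
      result (0F ∷ w) = trans (X-p-zero-0 {n} (lift n 0 (λ w → f (0F ∷ w))) (toList w))
        (X-lift n 0 n (ℕ.+-identityʳ n) (λ w → f (0F ∷ w)) (restrict-0 f-inv f₁≈0) w)
      result (1F ∷ w) = trans (X-p-zero-1 {n} (lift n 0 (λ w → f (0F ∷ w))) (toList w)) (sym (f₁≈0 w))
  X-lift (suc n) (suc b) = X-lift-suc n b (X-lift (suc n) b) (X-lift n (suc b))

  private
    Agree : ℕ → List (Fin 2) → Entries → Entries → ℕ → Set ℓ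
    Agree b u h h′ m = ∀ (w : Vec (Fin 2) (b ℕ.+ m)) → bends b h u (toList w) ≈ bends b h′ u (toList w)

    γ-unit : ∀ i → IsUnit (γ i)
    γ-unit 0F = - q , trans (solve 2 (λ q p → (:- p) :* (:- q) := p :* q) refl q q⁻¹) q⁻¹*q≈1
    γ-unit 1F = unit-1

    unit-cancelˡ : ∀ {x y z} → IsUnit x → x * y ≈ x * z → y ≈ z
    unit-cancelˡ {x} {y} {z} (t , e) e′ = begin
      y            ≈⟨ *-identityˡ y ⟨
      1# * y       ≈⟨ *-congʳ e ⟨
      (x * t) * y  ≈⟨ solve 3 (λ x t y → (x :* t) :* y := t :* (x :* y)) refl x t y ⟩
      t * (x * y)  ≈⟨ *-congˡ e′ ⟩
      t * (x * z)  ≈⟨ solve 3 (λ x t y → (x :* t) :* y := t :* (x :* y)) refl x t z ⟨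
      (x * t) * z  ≈⟨ *-congʳ e ⟩
      1# * z       ≈⟨ *-identityˡ z ⟩
      z            ∎

    unbend : ∀ b u i {h h′ m} → Agree (suc b) u h h′ m → Agree b (i ∷ u) h h′ m
    unbend b u 0F e w = unit-cancelˡ (γ-unit 1F) (e (1F ∷ w))
    unbend b u 1F e w = unit-cancelˡ (γ-unit 0F) (e (0F ∷ w))

    unbends : ∀ {a} b (u : Vec (Fin 2) a) {h h′ m} → Agree (a ℕ.+ b) [] h h′ m → Agree b (toList u) h h′ m
    unbends b []      e = e
    unbends {suc a} b (i ∷ u) {h} {h′} {m} e = unbend b (toList u) i
      (unbends (suc b) u (≡.subst (λ k → Agree k [] h h′ m) (≡.sym (ℕ.+-suc a b)) e))

  -- Each bend multiplies entries by `γ`, whose values are units, so it can be undone letter by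
  -- letter.
  X-injective : (B C : Endomorphism {n}) → (∀ (w : Vec (Fin 2) (n ℕ.+ n)) → X n B (toList w) ≈ X n C (toList w)) → B ≋ C
  X-injective {n} B C e = ≋-from-basis B C λ u w → begin
    ⟦ B ⟧ (basis u) w                   ≡⟨ ≡.cong₂ (λ u w → ⟦ B ⟧ (basis u) w) (toVec-toList u) (toVec-toList w) ⟨
    entries B (toList u) (toList w)     ≈⟨ unbends 0 u {entries B} {entries C} {n} (≡.subst (λ k → Agree k [] (entries B) (entries C) n) (≡.sym (ℕ.+-identityʳ n)) e) w ⟩
    entries C (toList u) (toList w)     ≡⟨ ≡.cong₂ (λ u w → ⟦ C ⟧ (basis u) w) (toVec-toList u) (toVec-toList w) ⟩
    ⟦ C ⟧ (basis u) w                   ∎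

  τ-injective : ∀ n {a b} → τ n a ≋ τ n b → A._≈_ n a b
  τ-injective n {a} {b} e = A.trans n (A.sym n (lift-τ n a))
    (A.trans n (lift-cong n n (X-cong n {τ n a} {τ n b} e)) (lift-τ n b))

  τ-surjective : (B : Endomorphism {n}) → Equivariant B → Σ (T n) λ a → τ n a ≋ B
  τ-surjective {n} B B-eq = lift n n (X n B) , X-injective (τ n (lift n n (X n B))) B
    (X-lift n n 0 ≡.refl (X n B) (X-invariant 0 n ≡.refl B B-eq))

-- Translation into the duality statements

module Duality {c ℓ} (𝕜 : Field c ℓ) (v : Field.Carrier 𝕜) (v≉0 : ¬ Field._≈_ 𝕜 v (Field.0# 𝕜))
  (s : Sign) (𝔤 : LieAlgebra) (n : ℕ) where
  private
    module 𝕜 = Field 𝕜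
    R = 𝕜.commutativeRing
  open SchurWeyl 𝕜 v v≉0 s 𝔤 n hiding (τ)

  private
    v*v⁻¹≈1 : v 𝕜.* v⁻¹ 𝕜.≈ 𝕜.1#
    v*v⁻¹≈1 = proj₂ (𝕜.inverse v v≉0)

    v⁻¹*v≈1 : v⁻¹ 𝕜.* v 𝕜.≈ 𝕜.1#
    v⁻¹*v≈1 = 𝕜.trans (𝕜.*-comm v⁻¹ v) v*v⁻¹≈1

  open TensorPower R
  open Ladder R v v⁻¹ v*v⁻¹≈1 v⁻¹*v≈1 using (Commutes-TL)
  open DoubleCentralizer R v v⁻¹ v*v⁻¹≈1 v⁻¹*v≈1 using (reachable)
  open ReachImage R v v⁻¹ v*v⁻¹≈1 v⁻¹*v≈1 𝔤 n using (reach-image)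
  open Action R v v⁻¹ v*v⁻¹≈1 v⁻¹*v≈1 s using (τ; 𝐞-sign; ε)
  open Invariants R v v⁻¹ v*v⁻¹≈1 v⁻¹*v≈1 s using (Equivariant; τ-injective; τ-surjective)
  private
    module P = Presentation R
    module ρ = AlgebraHom (QuantumGroup.representation R v v⁻¹ v*v⁻¹≈1 𝔤 n)
    module τ = AlgebraHom representationTL

  𝐔-surjective : IsSurjective 𝐔→End-TL
  𝐔-surjective (f , f-commutes) =
    let u , e = reach-image (reachable f commutes) in u , λ {z} z≈u x w → 𝕜.trans (ρ.⟦⟧-cong {z} {u} z≈u x w) (e x w)
    where
    commutes : Commutes-TL f
    commutes i x w = 𝕜.trans (⟦⟧-cong f (λ w → 𝕜.sym (𝐞-sign n i x w)) w)
      -- Commutation with TL is used for the element ε eᵢ, which acts as the generator of the sign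
      -- fixed in `Commutes-TL`.
      (𝕜.trans (f-commutes (P.con ε P.* P.gen i) x w) (𝐞-sign n i (⟦ f ⟧ x) w))

  TL-surjective : IsSurjective TL→End-𝐔
  TL-surjective (f , f-commutes) =
    let a , e = τ-surjective f (λ {C} → equivariant {C}) in a , λ {z} z≈a x w → 𝕜.trans (τ.⟦⟧-cong {z} {a} z≈a x w) (e x w)
    where
    equivariant : Equivariant f
    equivariant {C} C-reach x w = let u , e = reach-image C-reach in 𝕜.trans (⟦⟧-cong f (λ w → 𝕜.sym (e x w)) w)
      (𝕜.trans (f-commutes u x w) (e (⟦ f ⟧ x) w))

  TL-isomorphism : IsIsomorphism TL→End-𝐔
  TL-isomorphism = record
    { isRingMonomorphism = record
      { isRingHomomorphism = AlgebraHom.isRingHomomorphism TL→End-𝐔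
      ; injective = τ-injective n }
    ; surjective = TL-surjective }

theorem9p8 : ∀ {c ℓ} (𝕜 : Field c ℓ) (v : Field.Carrier 𝕜)
    (v≉0 : ¬ Field._≈_ 𝕜 v (Field.0# 𝕜))
    (s : Sign) (𝔤 : LieAlgebra) (n : ℕ) →
    IsSurjective (SchurWeyl.𝐔→End-TL 𝕜 v v≉0 s 𝔤 n) ×
    IsSurjective (SchurWeyl.TL→End-𝐔 𝕜 v v≉0 s 𝔤 n) ×
    IsIsomorphism (SchurWeyl.TL→End-𝐔 𝕜 v v≉0 s 𝔤 n)
theorem9p8 𝕜 v v≉0 s 𝔤 n = 𝐔-surjective , TL-surjective , TL-isomorphism
  where open Duality 𝕜 v v≉0 s 𝔤 n
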